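{- Every forcing set of permutations (whose elements may have arbitrary, possibly different, orders) has at least four elements.
   Context: For $n\in\mathbb{N}$, an $n$-permutation (permutation of order $n$) is a bijection $\Pi:\{1,\dots,n\}\to\{1,\dots,n\}$; its order is denoted $|\Pi|$. If $A=\{a_1<\dots<a_k\}\subseteq\{1,\dots,n\}$, the subpermutation of $\Pi$ induced by $A$ is the unique $k$-permutation $\pi$ with $\pi(i)<\pi(j)$ iff $\Pi(a_i)<\Pi(a_j)$. The density $d(\pi,\Pi)$ of a $k$-permutation $\pi$ in an $n$-permutation $\Pi$ is the probability that a uniformly random $k$-element subset of $\{1,\dots,n\}$ induces $\pi$ (and $d(\pi,\Pi)=0$ if $k>n$). A sequence $\{\Pi_i\}_{i\in\mathbb{N}}$ of permutations is quasirandom if for every permutation $\pi$ the limit $\lim_{i\to\infty} d(\pi,\Pi_i)$ exists and equals $1/|\pi|!$. A set $S$ of permutations is forcing if every sequence $\{\Pi_i\}_{i\in\mathbb{N}}$ of permutations with $\lim_{i\to\infty} d(\pi,\Pi_i)=1/|\pi|!$ for all $\pi\in S$ is quasirandom. -}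

module Defs where

open import Data.Nat as ℕ using (ℕ; zero; suc; _≤_; _<ᵇ_; _!)
open import Data.Nat.Combinatorics using (_C_)
open import Data.Fin using (Fin; toℕ; zero; suc)
open import Data.Bool using (Bool; true; false; _∧_; if_then_else_)
open import Data.Bool.Properties using () renaming (_≟_ to _≟ᵇ_)
open import Data.List using (List; []; _∷_; map; concatMap; allFin; length; filter)
open import Data.Bool.ListAction using (and)
open import Data.Vec using (Vec; []; _∷_; lookup)
open import Data.Integer using (+_)
open import Data.Rational using (ℚ; _/_; 0ℚ; _-_; ∣_∣; _<_)
open import Data.Product using (Σ; ∃; _×_; _,_)
open import Function.Definitions using (Bijective)
open import Relation.Binary.PropositionalEquality using (_≡_)
open import Relation.Nullary.Decidable using (⌊_⌋)

record Perm : Set where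
  constructor perm
  field
    order : ℕ
    σ     : Fin order → Fin order
    bij   : Bijective {A = Fin order} _≡_ _≡_ σ
open Perm public

-- Strictly increasing k-tuples (a₁ < … < a_k) of elements of Fin n,
-- i.e. the k-element subsets of {1..n}, each listed once.
subsets : (n k : ℕ) → List (Vec (Fin n) k)
subsets n       zero    = [] ∷ []
subsets zero    (suc k) = []
subsets (suc n) (suc k) =
  map (λ v → zero ∷ Data.Vec.map suc v) (subsets n k)
  Data.List.++ map (Data.Vec.map suc) (subsets n (suc k))

induces : {k n : ℕ} → (Fin k → Fin k) → (Fin n → Fin n) → Vec (Fin n) k → Bool
induces {k} π Π a =
  and (concatMap (λ i → map (λ j →
         ⌊ (toℕ (π i) <ᵇ toℕ (π j)) ≟ᵇ (toℕ (Π (lookup a i)) <ᵇ toℕ (Π (lookup a j))) ⌋)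
       (allFin k)) (allFin k))

count : Perm → Perm → ℕ
count p P = length (filter (λ a → induces (σ p) (σ P) a Data.Bool.≟ true)
                           (subsets (order P) (order p)))

-- density d(π, Π) = count / (n choose k); 0 when k > n (then n C k = 0).
density : Perm → Perm → ℚ
density p P with order P C order p
... | zero  = 0ℚ
... | suc m = + count p P / suc m

inv! : ℕ → ℚ
inv! m with m !
... | zero  = 0ℚ
... | suc r = + 1 / suc r

ConvergesTo : (ℕ → ℚ) → ℚ → Set
ConvergesTo f q = ∀ (ε : ℚ) → 0ℚ < ε → ∃ λ N → ∀ i → N ≤ i → ∣ f i - q ∣ < ε

Quasirandom : (ℕ → Perm) → Set
Quasirandom Πs = ∀ (π : Perm) → ConvergesTo (λ i → density π (Πs i)) (inv! (order π))

Forcing : (Perm → Set) → Set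
Forcing S = ∀ (Πs : ℕ → Perm) →
  (∀ (π : Perm) → S π → ConvergesTo (λ i → density π (Πs i)) (inv! (order π))) →
  Quasirandom Πs

module Submission where

-- Words over a linearly ordered alphabet of columns are read as permutations, ranking positions by
-- letter and then from left to right. The subsequence counts of a word made of long runs are the
-- coefficients of a product of exponentials exp(a J), J a set of columns. Start from the uniform
-- product and insert three gadgets, of length δ at the places x g: gadget g moves an amount y g of
-- one thin set of columns past another, the first having a proportion u g of all columns to its
-- left and the second a proportion w g to its right. A final stretch of length δ² runs through the
-- columns in increasing order. The densities of three patterns π i then change, to order δ², by
-- the linear map with matrix T (π i) (x g) (u g) (w g). For three distinct patterns of order at
-- least two, none of them 21, the places can be chosen to make this matrix invertible, because a
-- vanishing combination of the polynomials T determines the patterns. A contraction argument then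
-- gives y for which the three densities are the random ones, while the increasing stretch forces
-- the identity of order K to have density about δ²ᴷ, more than 1/K! for large K. The general case
-- follows since the densities of 12 and 21 add up to 1, patterns of order at most one have density
-- 1, and long identities can be added to reach three patterns.

-- Three densities are three equations, so three amounts `y` can satisfy them as long as the linear
-- part of the system dominates everything else. The obstacle is that the columns are finite in
-- number: a thin set takes a proportion `η` of them, so the linear response has size `η² δ²`,
-- against a remainder of order δ³. Hence `η` is fixed first and δ after it, and the bounds on the
-- remainder are kept independent of the number of columns, which must still grow at the end to make
-- ties between equal letters negligible. The increasing stretch is as short as δ² because it then
-- changes coefficients only at order δ⁴ and drops out of the linear system; yet its share of
-- identities is a power of a fixed number, while `1 / K!` decays faster than any such power. The
-- rationals are not complete, so the equations are solved only up to an arbitrary error, which is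
-- enough because forcing speaks of limits.

module Rationals where
  open import Data.Nat as ℕ using (ℕ; zero; suc; z≤n; s≤s)
  import Data.Nat.Properties as ℕ
  open import Data.Integer as ℤ using (ℤ)
  import Data.Integer.Properties as ℤ
  open import Data.Rational as D using (ℚ; 0ℚ; 1ℚ; ½; _≤_; _<_; positive; nonNegative) public
  import Data.Rational.Properties as D
  open import Data.Rational.Properties using (≤-refl; ≤-trans; ≤-reflexive; ≤-antisym; ≤-total; <⇒≤; <-≤-trans; ≤-<-trans; <-trans; <-irrefl; _≟_; 1≢0) public
  open import Data.Unit using (⊤; tt)
  import Data.Rational.Unnormalised as ℚᵘ
  import Data.Rational.Unnormalised.Properties as ℚᵘ
  open import Data.List as List using (List; []; _∷_; _++_; map)
  open import Data.Product using (∃; _×_; _,_; proj₁; proj₂)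
  open import Data.Sum using (_⊎_; inj₁; inj₂)
  open import Relation.Nullary.Decidable.Core using (dec⇒maybe)
  open import Relation.Binary.PropositionalEquality
  open import Tactic.RingSolver.Core.AlmostCommutativeRing using (AlmostCommutativeRing; fromCommutativeRing)
  open import Tactic.RingSolver using (solve-∀)

  -- Rational arithmetic, finite sums and divided powers.

  R : AlmostCommutativeRing _ _
  R = fromCommutativeRing D.+-*-commutativeRing (λ x → dec⇒maybe (0ℚ ≟ x))

  infixl 6 _+_ _-_
  infixl 7 _*_
  infix 8 -_

  -- Opaque copies of the operations: the library's ones compute by matching on
  -- normalised fractions, which blocks unification.
  opaque
    _+_ _*_ : ℚ → ℚ → ℚ
    _+_ = D._+_
    _*_ = D._*_

    -_ ∣_∣ : ℚ → ℚ
    -_ = D.-_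
    ∣_∣ = D.∣_∣

  _-_ : ℚ → ℚ → ℚ
  a - b = a + - b

  opaque
    unfolding _+_ _*_ -_

    arith : ⊤
    arith = tt

  opaque
    unfolding arith ∣_∣

    +-assoc : ∀ a b c → (a + b) + c ≡ a + (b + c)
    +-assoc = D.+-assoc
    +-comm : ∀ a b → a + b ≡ b + a
    +-comm = D.+-comm
    +-identityˡ : ∀ a → 0ℚ + a ≡ a
    +-identityˡ = D.+-identityˡ
    +-identityʳ : ∀ a → a + 0ℚ ≡ a
    +-identityʳ = D.+-identityʳ
    +-inverseʳ : ∀ a → a - a ≡ 0ℚ
    +-inverseʳ = D.+-inverseʳ
    *-assoc : ∀ a b c → (a * b) * c ≡ a * (b * c)
    *-assoc = D.*-assoc
    *-comm : ∀ a b → a * b ≡ b * a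
    *-comm = D.*-comm
    *-identityˡ : ∀ a → 1ℚ * a ≡ a
    *-identityˡ = D.*-identityˡ
    *-identityʳ : ∀ a → a * 1ℚ ≡ a
    *-identityʳ = D.*-identityʳ
    *-zeroˡ : ∀ a → 0ℚ * a ≡ 0ℚ
    *-zeroˡ = D.*-zeroˡ
    *-zeroʳ : ∀ a → a * 0ℚ ≡ 0ℚ
    *-zeroʳ = D.*-zeroʳ
    *-distribˡ-+ : ∀ a b c → a * (b + c) ≡ a * b + a * c
    *-distribˡ-+ = D.*-distribˡ-+
    *-distribʳ-+ : ∀ a b c → (b + c) * a ≡ b * a + c * a
    *-distribʳ-+ = D.*-distribʳ-+
    +-mono-≤ : ∀ {a b c d} → a ≤ b → c ≤ d → a + c ≤ b + d
    +-mono-≤ = D.+-mono-≤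
    +-mono-<-≤ : ∀ {a b c d} → a < b → c ≤ d → a + c < b + d
    +-mono-<-≤ = D.+-mono-<-≤
    +-monoʳ-≤ : ∀ a {b c} → b ≤ c → a + b ≤ a + c
    +-monoʳ-≤ a = D.+-monoʳ-≤ a
    +-monoʳ-< : ∀ a {b c} → b < c → a + b < a + c
    +-monoʳ-< a = D.+-monoʳ-< a
    +-monoˡ-≤ : ∀ a {b c} → b ≤ c → b + a ≤ c + a
    +-monoˡ-≤ a = D.+-monoˡ-≤ a
    +-monoˡ-< : ∀ a {b c} → b < c → b + a < c + a
    +-monoˡ-< a = D.+-monoˡ-< a
    infixl 7 _⊛_
    _⊛_ : ∀ {a b} → 0ℚ ≤ a → 0ℚ ≤ b → 0ℚ ≤ a * b
    _⊛_ {a} {b} p q = D.nonNegative⁻¹ (a D.* b) {{D.nonNeg*nonNeg⇒nonNeg a {{nonNegative p}} b {{nonNegative q}}}}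
    0<* : ∀ {a b} → 0ℚ < a → 0ℚ < b → 0ℚ < a * b
    0<* {a} {b} p q = D.positive⁻¹ (a D.* b) {{D.pos*pos⇒pos a {{positive p}} b {{positive q}}}}
    *-monoˡ : ∀ {a b} c → 0ℚ ≤ c → a ≤ b → c * a ≤ c * b
    *-monoˡ c p q = D.*-monoˡ-≤-nonNeg c {{nonNegative p}} q
    *-monoʳ : ∀ {a b} c → 0ℚ ≤ c → a ≤ b → a * c ≤ b * c
    *-monoʳ c p q = D.*-monoʳ-≤-nonNeg c {{nonNegative p}} q
    inverse : ∀ a → a ≢ 0ℚ → ∃ λ b → b * a ≡ 1ℚ
    inverse a n = (D.1/ a) {{D.≢-nonZero n}} , D.*-inverseˡ a {{D.≢-nonZero n}}
    inverse⁺ : ∀ a → 0ℚ < a → ∃ λ b → 0ℚ < b × b * a ≡ 1ℚ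
    inverse⁺ a p = (D.1/ a) {{nz}} , D.positive⁻¹ _ {{D.1/pos⇒pos a {{positive p}}}} , D.*-inverseˡ a {{nz}}
      where
      nz : D.NonZero a
      nz = D.pos⇒nonZero a {{positive p}}
    ∣x∣≡x∨-x : ∀ x → ∣ x ∣ ≡ x ⊎ ∣ x ∣ ≡ - x
    ∣x∣≡x∨-x = D.∣p∣≡p∨∣p∣≡-p
    0≤∣x∣ : ∀ x → 0ℚ ≤ ∣ x ∣
    0≤∣x∣ = D.0≤∣p∣
    ∣∣-nn : ∀ {x} → 0ℚ ≤ x → ∣ x ∣ ≡ x
    ∣∣-nn = D.0≤p⇒∣p∣≡p
    ∣-x∣ : ∀ x → ∣ - x ∣ ≡ ∣ x ∣
    ∣-x∣ = D.∣-p∣≡∣p∣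
    ∣x+y∣ : ∀ x y → ∣ x + y ∣ ≤ ∣ x ∣ + ∣ y ∣
    ∣x+y∣ = D.∣p+q∣≤∣p∣+∣q∣
    ∣x*y∣ : ∀ x y → ∣ x * y ∣ ≡ ∣ x ∣ * ∣ y ∣
    ∣x*y∣ = D.∣p*q∣≡∣p∣*∣q∣

  infixl 6 _⊹_
  _⊹_ : ∀ {a b} → 0ℚ ≤ a → 0ℚ ≤ b → 0ℚ ≤ a + b
  _⊹_ {a} {b} p q = subst (_≤ a + b) (+-identityˡ 0ℚ) (+-mono-≤ p q)

  gap : ∀ {a b} → a ≤ b → 0ℚ ≤ b - a
  gap {a} {b} p = subst (_≤ b - a) (+-inverseʳ a) (+-monoˡ-≤ (- a) p)

  -- The working form of linear inequalities: the slack `t` is written out, the ring solver checks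
  -- the identity, and nonnegativity of the slack is assembled with `_⊹_` and `_⊛_`.
  lin : ∀ {a b t} → 0ℚ ≤ t → b ≡ a + t → a ≤ b
  lin {a} {b} {t} p e = subst (_≤ b) (+-identityʳ a) (subst (a + 0ℚ ≤_) (sym e) (+-monoʳ-≤ a p))

  0<+ : ∀ {a b} → 0ℚ < a → 0ℚ ≤ b → 0ℚ < a + b
  0<+ {a} {b} p q = subst (_< a + b) (+-identityˡ 0ℚ) (+-mono-<-≤ p q)

  gap< : ∀ {a b} → a < b → 0ℚ < b - a
  gap< {a} {b} p = subst (_< b - a) (+-inverseʳ a) (+-monoˡ-< (- a) p)

  lin< : ∀ {a b t} → 0ℚ < t → b ≡ a + t → a < b
  lin< {a} {b} {t} p e = subst (_< b) (+-identityʳ a) (subst (a + 0ℚ <_) (sym e) (+-monoʳ-< a p))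

  *-mono : ∀ {a b c d} → 0ℚ ≤ a → 0ℚ ≤ d → a ≤ b → c ≤ d → a * c ≤ b * d
  *-mono {a} {b} {c} {d} p q r s = ≤-trans (*-monoˡ a p s) (*-monoʳ d q r)

  *≤1 : ∀ {a b} → 0ℚ ≤ a → a ≤ 1ℚ → b ≤ 1ℚ → a * b ≤ 1ℚ
  *≤1 {a} {b} h p q = ≤-trans (*-monoˡ a h q) (subst (_≤ 1ℚ) (sym (*-identityʳ a)) p)

  0≤1 : 0ℚ ≤ 1ℚ
  0≤1 = D.nonNegative⁻¹ 1ℚ

  0<1 : 0ℚ < 1ℚ
  0<1 = D.positive⁻¹ 1ℚ

  0≤½ : 0ℚ ≤ ½
  0≤½ = D.nonNegative⁻¹ ½

  *-zero⁻ : ∀ a b → a * b ≡ 0ℚ → a ≢ 0ℚ → b ≡ 0ℚ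
  *-zero⁻ a b e a≢0 with inverse a a≢0
  ... | c , h = trans (sym (*-identityˡ b)) (trans (cong (_* b) (sym h)) (trans (*-assoc c a b) (trans (cong (c *_) e) (*-zeroʳ c))))

  -‿≢0 : ∀ {a b} → a ≢ b → a - b ≢ 0ℚ
  -‿≢0 {a} {b} n e = n (trans (lem a b) (trans (cong (_+ b) e) (+-identityˡ b)))
    where
    opaque
      unfolding arith
      lem : ∀ a b → a ≡ (a - b) + b
      lem = solve-∀ R

  ι : ℕ → ℚ
  ι zero = 0ℚ
  ι (suc n) = 1ℚ + ι n

  ι-+ : ∀ m n → ι (m ℕ.+ n) ≡ ι m + ι n
  ι-+ zero n = sym (+-identityˡ (ι n))
  ι-+ (suc m) n = trans (cong (1ℚ +_) (ι-+ m n)) (sym (+-assoc 1ℚ (ι m) (ι n)))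

  ι-* : ∀ m n → ι (m ℕ.* n) ≡ ι m * ι n
  ι-* zero n = sym (*-zeroˡ (ι n))
  ι-* (suc m) n = trans (ι-+ n (m ℕ.* n)) (trans (cong (ι n +_) (ι-* m n)) (lem (ι m) (ι n)))
    where
    opaque
      unfolding arith
      lem : ∀ a b → b + a * b ≡ (1ℚ + a) * b
      lem = solve-∀ R

  0≤ι : ∀ n → 0ℚ ≤ ι n
  0≤ι zero = ≤-refl
  0≤ι (suc n) = 0≤1 ⊹ 0≤ι n

  0<ι : ∀ n → 0ℚ < ι (suc n)
  0<ι n = 0<+ 0<1 (0≤ι n)

  ι-mono : ∀ {m n} → m ℕ.≤ n → ι m ≤ ι n
  ι-mono {n = n} z≤n = 0≤ι n
  ι-mono (s≤s p) = +-monoʳ-≤ 1ℚ (ι-mono p)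

  ι-∸ : ∀ {m n} → m ℕ.≤ n → ι (n ℕ.∸ m) ≡ ι n - ι m
  ι-∸ {m} {n} p = trans (lem (ι (n ℕ.∸ m)) (ι m)) (cong (_- ι m) (trans (sym (ι-+ (n ℕ.∸ m) m)) (cong ι (ℕ.m∸n+n≡m p))))
    where
    opaque
      unfolding arith
      lem : ∀ a b → a ≡ (a + b) - b
      lem = solve-∀ R

  opaque
    -- Reciprocal of `n + 1` rather than of `n`: no positivity condition arises, and `rec` serves
    -- throughout as a sequence tending to 0.
    rec : ℕ → ℚ
    rec n = proj₁ (inverse⁺ (ι (suc n)) (0<ι n))

    rec-ι : ∀ n → rec n * ι (suc n) ≡ 1ℚ
    rec-ι n = proj₂ (proj₂ (inverse⁺ (ι (suc n)) (0<ι n)))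

    0<rec : ∀ n → 0ℚ < rec n
    0<rec n = proj₁ (proj₂ (inverse⁺ (ι (suc n)) (0<ι n)))

  0≤rec : ∀ n → 0ℚ ≤ rec n
  0≤rec n = <⇒≤ (0<rec n)

  opaque
    unfolding arith

    ι≡/ : ∀ n → ι n ≡ ℤ.+ n D./ 1
    ι≡/ zero = refl
    ι≡/ (suc n) = trans (cong (1ℚ D.+_) (ι≡/ n)) (D.toℚᵘ-injective (ℚᵘ.≃-trans (D.toℚᵘ-homo-+ 1ℚ (ℤ.+ n D./ 1))
       (ℚᵘ.≃-trans (ℚᵘ.+-cong {D.toℚᵘ 1ℚ} {D.toℚᵘ 1ℚ} ℚᵘ.≃-refl (D.toℚᵘ-fromℚᵘ (ℚᵘ.mkℚᵘ (ℤ.+ n) 0)))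
       (ℚᵘ.≃-trans (ℚᵘ.*≡* lem) (ℚᵘ.≃-sym (D.toℚᵘ-fromℚᵘ (ℚᵘ.mkℚᵘ (ℤ.+ suc n) 0)))))))
      where
      lem : (ℤ.1ℤ ℤ.* ℤ.1ℤ ℤ.+ ℤ.+ n ℤ.* ℤ.1ℤ) ℤ.* ℤ.1ℤ ≡ ℤ.+ suc n ℤ.* (ℤ.1ℤ ℤ.* ℤ.1ℤ)
      lem = cong (ℤ._* ℤ.1ℤ) (cong (ℤ._+_ ℤ.1ℤ) (ℤ.*-identityʳ (ℤ.+ n)))

    /-ι : ∀ a m → (ℤ.+ a D./ suc m) * ι (suc m) ≡ ι a
    /-ι a m = trans (cong₂ D._*_ {ℤ.+ a D./ suc m} refl (ι≡/ (suc m))) (trans (D.toℚᵘ-injective (ℚᵘ.≃-trans (D.toℚᵘ-homo-* (ℤ.+ a D./ suc m) (ℤ.+ suc m D./ 1))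
       (ℚᵘ.≃-trans (ℚᵘ.*-cong (D.toℚᵘ-fromℚᵘ (ℚᵘ.mkℚᵘ (ℤ.+ a) m)) (D.toℚᵘ-fromℚᵘ (ℚᵘ.mkℚᵘ (ℤ.+ suc m) 0)))
       (ℚᵘ.≃-trans (ℚᵘ.*≡* lem) (ℚᵘ.≃-sym (D.toℚᵘ-fromℚᵘ (ℚᵘ.mkℚᵘ (ℤ.+ a) 0))))))) (sym (ι≡/ a)))
      where
      lem : (ℤ.+ a ℤ.* ℤ.+ suc m) ℤ.* ℤ.1ℤ ≡ ℤ.+ a ℤ.* (ℤ.+ suc m ℤ.* ℤ.1ℤ)
      lem = ℤ.*-assoc (ℤ.+ a) (ℤ.+ suc m) ℤ.1ℤ

  ∣∣-intro : ∀ {x c} → x ≤ c → - x ≤ c → ∣ x ∣ ≤ c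
  ∣∣-intro {x} {c} p q with ∣x∣≡x∨-x x
  ... | inj₁ e = subst (_≤ c) (sym e) p
  ... | inj₂ e = subst (_≤ c) (sym e) q

  x≤∣x∣ : ∀ x → x ≤ ∣ x ∣
  x≤∣x∣ x with ≤-total 0ℚ x
  ... | inj₁ p = subst (x ≤_) (sym (∣∣-nn p)) ≤-refl
  ... | inj₂ p = ≤-trans p (0≤∣x∣ x)

  -x≤∣x∣ : ∀ x → - x ≤ ∣ x ∣
  -x≤∣x∣ x = subst (- x ≤_) (∣-x∣ x) (x≤∣x∣ (- x))

  ∣∣-elim : ∀ {x c} → ∣ x ∣ ≤ c → x ≤ c × - x ≤ c
  ∣∣-elim {x} p = ≤-trans (x≤∣x∣ x) p , ≤-trans (-x≤∣x∣ x) p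

  ∣∣-sym : ∀ a b → ∣ a - b ∣ ≡ ∣ b - a ∣
  ∣∣-sym a b = trans (sym (∣-x∣ (a - b))) (cong ∣_∣ (lem a b))
    where
    opaque
      unfolding arith
      lem : ∀ a b → - (a - b) ≡ b - a
      lem = solve-∀ R

  ∣+∣≤ : ∀ {a b c d} → ∣ a ∣ ≤ c → ∣ b ∣ ≤ d → ∣ a + b ∣ ≤ c + d
  ∣+∣≤ {a} {b} p q = ≤-trans (∣x+y∣ a b) (+-mono-≤ p q)

  ∣*∣≤ : ∀ {a b c d} → ∣ a ∣ ≤ c → ∣ b ∣ ≤ d → ∣ a * b ∣ ≤ c * d
  ∣*∣≤ {a} {b} {c} {d} p q = subst (_≤ c * d) (sym (∣x*y∣ a b)) (*-mono (0≤∣x∣ a) (≤-trans (0≤∣x∣ b) q) p q)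

  ∣0∣≤ : ∀ {c} → 0ℚ ≤ c → ∣ 0ℚ ∣ ≤ c
  ∣0∣≤ {c} p = subst (_≤ c) (sym (∣∣-nn ≤-refl)) p

  ∣-∣-tri : ∀ {a b c s t} → ∣ a - b ∣ ≤ s → ∣ b - c ∣ ≤ t → ∣ a - c ∣ ≤ s + t
  ∣-∣-tri {a} {b} {c} {s} {t} p q = subst (λ z → ∣ z ∣ ≤ s + t) (lem a b c) (∣+∣≤ p q)
    where
    opaque
      unfolding arith
      lem : ∀ a b c → (a - b) + (b - c) ≡ a - c
      lem = solve-∀ R

  0≤of∣∣ : ∀ {x c} → ∣ x ∣ ≤ c → 0ℚ ≤ c
  0≤of∣∣ {x} p = ≤-trans (0≤∣x∣ x) p

  ≤+ : ∀ {a} b → 0ℚ ≤ b → a ≤ a + b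
  ≤+ b p = lin p refl

  ≤+ˡ : ∀ {a} b → 0ℚ ≤ b → a ≤ b + a
  ≤+ˡ {a} b p = lin p (+-comm b a)

  module _ {A : Set} where
    ∑ : List A → (A → ℚ) → ℚ
    ∑ [] f = 0ℚ
    ∑ (x ∷ xs) f = f x + ∑ xs f

    ∑-cong : ∀ xs {f g : A → ℚ} → (∀ x → f x ≡ g x) → ∑ xs f ≡ ∑ xs g
    ∑-cong [] e = refl
    ∑-cong (x ∷ xs) e = cong₂ _+_ (e x) (∑-cong xs e)

    ∑-++ : ∀ xs ys (f : A → ℚ) → ∑ (xs ++ ys) f ≡ ∑ xs f + ∑ ys f
    ∑-++ [] ys f = sym (+-identityˡ _)
    ∑-++ (x ∷ xs) ys f = trans (cong (f x +_) (∑-++ xs ys f)) (sym (+-assoc (f x) _ _))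

    ∑-+ : ∀ xs (f g : A → ℚ) → ∑ xs (λ x → f x + g x) ≡ ∑ xs f + ∑ xs g
    ∑-+ [] f g = sym (+-identityˡ 0ℚ)
    ∑-+ (x ∷ xs) f g = trans (cong (f x + g x +_) (∑-+ xs f g)) (lem (f x) (g x) (∑ xs f) (∑ xs g))
      where
      opaque
        unfolding arith
        lem : ∀ a b c d → a + b + (c + d) ≡ a + c + (b + d)
        lem = solve-∀ R

    ∑-*ˡ : ∀ xs c (f : A → ℚ) → ∑ xs (λ x → c * f x) ≡ c * ∑ xs f
    ∑-*ˡ [] c f = sym (*-zeroʳ c)
    ∑-*ˡ (x ∷ xs) c f = trans (cong (c * f x +_) (∑-*ˡ xs c f)) (sym (*-distribˡ-+ c (f x) _))

    ∑-mono : ∀ xs {f g : A → ℚ} → (∀ x → f x ≤ g x) → ∑ xs f ≤ ∑ xs g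
    ∑-mono [] e = ≤-refl
    ∑-mono (x ∷ xs) e = +-mono-≤ (e x) (∑-mono xs e)

    ∑-∣∣ : ∀ xs (f : A → ℚ) → ∣ ∑ xs f ∣ ≤ ∑ xs (λ x → ∣ f x ∣)
    ∑-∣∣ [] f = ≤-reflexive (∣∣-nn ≤-refl)
    ∑-∣∣ (x ∷ xs) f = ∣+∣≤ {f x} ≤-refl (∑-∣∣ xs f)

    ∑-const : ∀ xs c → ∑ xs (λ _ → c) ≡ ι (List.length xs) * c
    ∑-const [] c = sym (*-zeroˡ c)
    ∑-const (x ∷ xs) c = trans (cong (c +_) (∑-const xs c)) (lem c (ι (List.length xs)))
      where
      opaque
        unfolding arith
        lem : ∀ c n → c + n * c ≡ (1ℚ + n) * c
        lem = solve-∀ R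

    ∑-bound : ∀ xs {f : A → ℚ} c → (∀ x → ∣ f x ∣ ≤ c) → ∣ ∑ xs f ∣ ≤ ι (List.length xs) * c
    ∑-bound xs {f} c e = ≤-trans (∑-∣∣ xs f) (≤-trans (∑-mono xs e) (≤-reflexive (∑-const xs c)))

    ∑-zero : ∀ xs {f : A → ℚ} → (∀ x → f x ≡ 0ℚ) → ∑ xs f ≡ 0ℚ
    ∑-zero [] e = refl
    ∑-zero (x ∷ xs) e = trans (cong₂ _+_ (e x) (∑-zero xs e)) (+-identityˡ 0ℚ)

  ∑-map : ∀ {A B : Set} (h : A → B) xs (f : B → ℚ) → ∑ (map h xs) f ≡ ∑ xs (λ x → f (h x))
  ∑-map h [] f = refl
  ∑-map h (x ∷ xs) f = cong (f (h x) +_) (∑-map h xs f)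

  ∑-swap : ∀ {A B : Set} xs ys (f : A → B → ℚ) → ∑ xs (λ x → ∑ ys (f x)) ≡ ∑ ys (λ y → ∑ xs (λ x → f x y))
  ∑-swap [] ys f = sym (∑-zero ys (λ _ → refl))
  ∑-swap (x ∷ xs) ys f = trans (cong (∑ ys (f x) +_) (∑-swap xs ys f)) (sym (∑-+ ys (f x) _))

  -- Divided power `t ^ n / n!`: the coefficient of an exponential, and at `t = 1` the random
  -- density of a pattern of order n.
  p : ℕ → ℚ → ℚ
  p zero t = 1ℚ
  p (suc n) t = p n t * (t * rec n)

  p-suc : ∀ n t → ι (suc n) * p (suc n) t ≡ t * p n t
  p-suc n t = trans (lem (ι (suc n)) (p n t) t (rec n)) (trans (cong (_* (t * p n t)) (rec-ι n)) (*-identityˡ _))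
    where
    opaque
      unfolding arith
      lem : ∀ a b c d → a * (b * (c * d)) ≡ (d * a) * (c * b)
      lem = solve-∀ R

  0≤p : ∀ n {t} → 0ℚ ≤ t → 0ℚ ≤ p n t
  0≤p zero h = 0≤1
  0≤p (suc n) h = 0≤p n h ⊛ (h ⊛ 0≤rec n)

  0<p : ∀ n {t} → 0ℚ < t → 0ℚ < p n t
  0<p zero h = 0<1
  0<p (suc n) h = 0<* (0<p n h) (0<* h (0<rec n))

  rec≤1 : ∀ n → rec n ≤ 1ℚ
  rec≤1 n = lin (0≤rec n ⊛ 0≤ι n) (trans (sym (rec-ι n)) (lem (rec n) (ι n)))
    where
    opaque
      unfolding arith
      lem : ∀ a b → a * (1ℚ + b) ≡ a + a * b
      lem = solve-∀ R

  p≤1 : ∀ n {t} → 0ℚ ≤ t → t ≤ 1ℚ → p n t ≤ 1ℚ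
  p≤1 zero h k = ≤-refl
  p≤1 (suc n) h k = *≤1 (0≤p n h) (p≤1 n h k) (*≤1 h k (rec≤1 n))

-- Noncommutative power series and products of exponentials.

module Series where
  open import Data.Nat as ℕ using (ℕ; zero; suc)
  import Data.Nat.Properties as ℕ
  open import Data.Bool using (Bool; true; false; _∧_)
  open import Data.List using (List; []; _∷_; _++_; map; length)
  open import Data.Product using (_×_; _,_)
  open import Relation.Binary.PropositionalEquality hiding (_≗_)
  open import Tactic.RingSolver using (solve-∀)
  open Rationals

  -- A formal power series in noncommuting variables, one for each column: the argument is a word of
  -- columns, the value its coefficient.
  Ser : Set
  Ser = List ℕ → ℚ

  infix 4 _≗_
  _≗_ : Ser → Ser → Set
  F ≗ G = ∀ c → F c ≡ G c

  infixr 7 _⋆_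
  infixl 6 _⊞_
  infixr 8 _⊡_
  -- Product of noncommuting series: a sum over all cuts of the word into a prefix and a suffix. The
  -- recursion moves the first letter into the left factor.
  _⋆_ : Ser → Ser → Ser
  (F ⋆ G) [] = F [] * G []
  (F ⋆ G) (x ∷ c) = F [] * G (x ∷ c) + ((λ l → F (x ∷ l)) ⋆ G) c

  _⊞_ : Ser → Ser → Ser
  (F ⊞ G) c = F c + G c

  _⊡_ : ℚ → Ser → Ser
  (a ⊡ F) c = a * F c

  𝟘 : Ser
  𝟘 _ = 0ℚ

  one : Ser
  one [] = 1ℚ
  one (_ ∷ _) = 0ℚ

  ⋆-cong : ∀ {F F′ G G′} → F ≗ F′ → G ≗ G′ → F ⋆ G ≗ F′ ⋆ G′
  ⋆-cong e h [] = cong₂ _*_ (e []) (h [])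
  ⋆-cong e h (x ∷ c) = cong₂ _+_ (cong₂ _*_ (e []) (h (x ∷ c))) (⋆-cong (λ l → e (x ∷ l)) h c)

  ⋆-congˡ : ∀ {F G G′} → G ≗ G′ → F ⋆ G ≗ F ⋆ G′
  ⋆-congˡ = ⋆-cong (λ _ → refl)

  ⋆-congʳ : ∀ {F F′ G} → F ≗ F′ → F ⋆ G ≗ F′ ⋆ G
  ⋆-congʳ e = ⋆-cong e (λ _ → refl)

  ⋆-distribˡ : ∀ F G H → F ⋆ (G ⊞ H) ≗ (F ⋆ G) ⊞ (F ⋆ H)
  ⋆-distribˡ F G H [] = *-distribˡ-+ (F []) _ _
  ⋆-distribˡ F G H (x ∷ c) = trans (cong₂ _+_ refl (⋆-distribˡ (λ l → F (x ∷ l)) G H c)) (lem (F []) _ _ _ _)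
    where
    opaque
      unfolding arith
      lem : ∀ f g h a b → f * (g + h) + (a + b) ≡ (f * g + a) + (f * h + b)
      lem = solve-∀ R

  ⋆-distribʳ : ∀ F G H → (F ⊞ G) ⋆ H ≗ (F ⋆ H) ⊞ (G ⋆ H)
  ⋆-distribʳ F G H [] = *-distribʳ-+ (H []) _ _
  ⋆-distribʳ F G H (x ∷ c) = trans (cong₂ _+_ refl (⋆-distribʳ (λ l → F (x ∷ l)) (λ l → G (x ∷ l)) H c)) (lem (F []) (G []) _ _ _)
    where
    opaque
      unfolding arith
      lem : ∀ f g h a b → (f + g) * h + (a + b) ≡ (f * h + a) + (g * h + b)
      lem = solve-∀ R

  ⋆-scaleˡ : ∀ a F G → (a ⊡ F) ⋆ G ≗ a ⊡ (F ⋆ G)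
  ⋆-scaleˡ a F G [] = *-assoc a _ _
  ⋆-scaleˡ a F G (x ∷ c) = trans (cong₂ _+_ refl (⋆-scaleˡ a (λ l → F (x ∷ l)) G c)) (lem a _ _ _)
    where
    opaque
      unfolding arith
      lem : ∀ a f g b → a * f * g + a * b ≡ a * (f * g + b)
      lem = solve-∀ R

  ⋆-scaleʳ : ∀ a F G → F ⋆ (a ⊡ G) ≗ a ⊡ (F ⋆ G)
  ⋆-scaleʳ a F G [] = lem a (F []) (G [])
    where
    opaque
      unfolding arith
      lem : ∀ a f g → f * (a * g) ≡ a * (f * g)
      lem = solve-∀ R
  ⋆-scaleʳ a F G (x ∷ c) = trans (cong₂ _+_ refl (⋆-scaleʳ a (λ l → F (x ∷ l)) G c)) (lem a _ _ _)
    where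
    opaque
      unfolding arith
      lem : ∀ a f g b → f * (a * g) + a * b ≡ a * (f * g + b)
      lem = solve-∀ R

  ⋆-zeroˡ : ∀ G → 𝟘 ⋆ G ≗ 𝟘
  ⋆-zeroˡ G [] = *-zeroˡ _
  ⋆-zeroˡ G (x ∷ c) = trans (cong₂ _+_ (*-zeroˡ (G (x ∷ c))) (⋆-zeroˡ G c)) (+-identityˡ 0ℚ)

  ⋆-zeroʳ : ∀ F → F ⋆ 𝟘 ≗ 𝟘
  ⋆-zeroʳ F [] = *-zeroʳ _
  ⋆-zeroʳ F (x ∷ c) = trans (cong₂ _+_ (*-zeroʳ (F [])) (⋆-zeroʳ (λ l → F (x ∷ l)) c)) (+-identityˡ 0ℚ)

  ⋆-oneˡ : ∀ G → one ⋆ G ≗ G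
  ⋆-oneˡ G [] = *-identityˡ _
  ⋆-oneˡ G (x ∷ c) = trans (cong₂ _+_ (*-identityˡ (G (x ∷ c))) (⋆-zeroˡ G c)) (+-identityʳ _)

  ⋆-assoc : ∀ F G H → (F ⋆ G) ⋆ H ≗ F ⋆ (G ⋆ H)
  ⋆-assoc F G H [] = *-assoc (F []) _ _
  ⋆-assoc F G H (x ∷ c) = trans (cong (F [] * G [] * H (x ∷ c) +_) step) (lem (F []) (G []) _ _ _)
    where
    Fx Gx : Ser
    Fx l = F (x ∷ l)
    Gx l = G (x ∷ l)
    step : ((λ l → (F ⋆ G) (x ∷ l)) ⋆ H) c ≡ F [] * (Gx ⋆ H) c + (Fx ⋆ (G ⋆ H)) c
    step = trans (⋆-distribʳ (F [] ⊡ Gx) (Fx ⋆ G) H c) (cong₂ _+_ (⋆-scaleˡ (F []) Gx H c) (⋆-assoc Fx G H c))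
    opaque
      unfolding arith
      lem : ∀ f g h a b → f * g * h + (f * a + b) ≡ f * (g * h + a) + b
      lem = solve-∀ R

  prod : (ℕ → ℚ) → List ℕ → ℚ
  prod φ [] = 1ℚ
  prod φ (x ∷ c) = φ x * prod φ c

  0≤prod : ∀ {φ} → (∀ x → 0ℚ ≤ φ x) → ∀ c → 0ℚ ≤ prod φ c
  0≤prod h [] = 0≤1
  0≤prod h (x ∷ c) = h x ⊛ 0≤prod h c

  prod-≤1 : ∀ {φ} → (∀ x → 0ℚ ≤ φ x) → (∀ x → φ x ≤ 1ℚ) → ∀ c → prod φ c ≤ 1ℚ
  prod-≤1 h k [] = ≤-refl
  prod-≤1 h k (x ∷ c) = *≤1 (h x) (k x) (prod-≤1 h k c)

  0≤⋆ : ∀ {F G} → (∀ c → 0ℚ ≤ F c) → (∀ c → 0ℚ ≤ G c) → ∀ c → 0ℚ ≤ (F ⋆ G) c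
  0≤⋆ f g [] = f [] ⊛ g []
  0≤⋆ f g (x ∷ c) = f [] ⊛ g (x ∷ c) ⊹ 0≤⋆ (λ l → f (x ∷ l)) g c

  -- A cut contributes at most the product of `φ` over the prefix and of `γ` over the suffix, which
  -- is one term of the expanded product of sums. The factor `κ` serves the induction: it absorbs
  -- `φ x` when a letter moves to the left factor.
  ⋆-bound : ∀ {F G} (φ γ : ℕ → ℚ) (κ : ℚ) → 0ℚ ≤ κ → (∀ x → 0ℚ ≤ φ x) → (∀ x → 0ℚ ≤ γ x) →
    (∀ c → 0ℚ ≤ G c) →
    (∀ c → F c ≤ κ * prod φ c) → (∀ c → G c ≤ prod γ c) → ∀ c → (F ⋆ G) c ≤ κ * prod (λ x → φ x + γ x) c
  ⋆-bound {F} {G} φ γ κ k hφ hγ g₀ f g [] = *-mono′ (g₀ []) (f []) (g [])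
    where
    *-mono′ : ∀ {a b} → 0ℚ ≤ b → a ≤ κ * 1ℚ → b ≤ 1ℚ → a * b ≤ κ * 1ℚ
    *-mono′ {a} {b} h p q = ≤-trans (*-monoʳ b h p) (subst (κ * 1ℚ * b ≤_) (*-identityʳ (κ * 1ℚ)) (*-monoˡ (κ * 1ℚ) (k ⊛ 0≤1) q))
  ⋆-bound {F} {G} φ γ κ k hφ hγ g₀ f g (x ∷ c) = ≤-trans (+-mono-≤ s₁ s₂) (≤-reflexive (lem κ (φ x) (γ x) _))
    where
    P : ℚ
    P = prod (λ x → φ x + γ x) c
    mono : ∀ c → prod γ c ≤ prod (λ x → φ x + γ x) c
    mono [] = ≤-refl
    mono (x ∷ c) = *-mono (hγ x) (0≤prod (λ x → hφ x ⊹ hγ x) c) (≤+ˡ (φ x) (hφ x)) (mono c)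
    s₁ : F [] * G (x ∷ c) ≤ κ * (γ x * P)
    s₁ = ≤-trans (*-monoʳ _ (g₀ (x ∷ c)) (≤-trans (f []) (≤-reflexive (*-identityʳ κ))))
          (*-monoˡ κ k (≤-trans (g (x ∷ c)) (*-monoˡ (γ x) (hγ x) (mono c))))
    s₂ : ((λ l → F (x ∷ l)) ⋆ G) c ≤ (κ * φ x) * P
    s₂ = ⋆-bound φ γ (κ * φ x) (k ⊛ hφ x) hφ hγ g₀ (λ l → ≤-trans (f (x ∷ l)) (≤-reflexive (sym (*-assoc κ _ _)))) g c
    opaque
      unfolding arith
      lem : ∀ k a b q → k * (b * q) + (k * a) * q ≡ k * ((a + b) * q)
      lem = solve-∀ R

  -- This is exp(a J) with J the set of all columns, a uniform stretch of length `a`.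
  eS : ℚ → Ser
  eS a c = p (length c) a

  pow : ℚ → ℕ → ℚ
  pow a zero = 1ℚ
  pow a (suc n) = a * pow a n

  0≤pow : ∀ {a} n → 0ℚ ≤ a → 0ℚ ≤ pow a n
  0≤pow zero h = 0≤1
  0≤pow (suc n) h = h ⊛ 0≤pow n h

  p-pow : ∀ n s t → p n (s * t) ≡ pow s n * p n t
  p-pow zero s t = sym (*-identityˡ 1ℚ)
  p-pow (suc n) s t = trans (cong (_* (s * t * rec n)) (p-pow n s t)) (lem (pow s n) (p n t) s t (rec n))
    where
    opaque
      unfolding arith
      lem : ∀ a b s t r → a * b * (s * t * r) ≡ s * a * (b * (t * r))
      lem = solve-∀ R

  -- binom j n a b = Σ_{i ≤ n} p_{j+i}(a) p_{n-i}(b)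
  binom : ℕ → ℕ → ℚ → ℚ → ℚ
  binom j zero a b = p j a
  binom j (suc n) a b = p j a * p (suc n) b + binom (suc j) n a b

  eS⋆eS-binom : ∀ j c a b → ((λ l → p (j ℕ.+ length l) a) ⋆ eS b) c ≡ binom j (length c) a b
  eS⋆eS-binom j [] a b = trans (*-identityʳ _) (cong (λ z → p z a) (ℕ.+-identityʳ j))
  eS⋆eS-binom j (x ∷ c) a b = cong₂ _+_ (cong (λ z → p z a * p (suc (length c)) b) (ℕ.+-identityʳ j))
    (trans (⋆-congʳ (λ l → cong (λ z → p z a) (ℕ.+-suc j (length l))) c) (eS⋆eS-binom (suc j) c a b))

  p-one : ∀ t → p 1 t ≡ t
  p-one t = trans (*-identityˡ _) (trans (cong (t *_) (trans (sym (lem (rec 0))) (rec-ι 0))) (*-identityʳ t))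
    where
    opaque
      unfolding arith
      lem : ∀ r → r * (1ℚ + 0ℚ) ≡ r
      lem = solve-∀ R

  -- Multiply a term `p i a * p l b` by `i + l`. By `p-suc` the summand `i` lowers the first index
  -- at the price of `a`, and `l` lowers the second at the price of `b`. Regrouped, this is `a + b`
  -- times the shorter sum, except for the part with `ι j` of the first term, which has no partner.
  binom-Δ : ∀ j n a b → ι (j ℕ.+ suc n) * binom j (suc n) a b ≡ ι j * p j a * p (suc n) b + (a + b) * binom j n a b
  binom-Δ j zero a b = begin
    ι (j ℕ.+ 1) * (p j a * p 1 b + p (suc j) a)       ≡⟨ cong (λ n → ι n * (p j a * p 1 b + p (suc j) a)) (ℕ.+-comm j 1) ⟩
    (1ℚ + ι j) * (p j a * p 1 b + p (suc j) a)        ≡⟨ lem₁ (ι j) (p j a * p 1 b) (p (suc j) a) ⟩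
    ι j * (p j a * p 1 b) + (p j a * p 1 b + ι (suc j) * p (suc j) a) ≡⟨ cong₂ (λ u v → ι j * (p j a * p 1 b) + (p j a * u + v)) (p-one b) (p-suc j a) ⟩
    ι j * (p j a * p 1 b) + (p j a * b + a * p j a)   ≡⟨ lem₂ (ι j) (p j a) (p 1 b) a b ⟩
    ι j * p j a * p 1 b + (a + b) * p j a             ∎
    where
    open ≡-Reasoning
    opaque
      unfolding arith
      lem₁ : ∀ i u v → (1ℚ + i) * (u + v) ≡ i * u + (u + (1ℚ + i) * v)
      lem₁ = solve-∀ R
      lem₂ : ∀ i q u a b → i * (q * u) + (q * b + a * q) ≡ i * q * u + (a + b) * q
      lem₂ = solve-∀ R
  binom-Δ j (suc m) a b = begin
    ι (j ℕ.+ suc (suc m)) * (p j a * p (suc (suc m)) b + binom (suc j) (suc m) a b)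
      ≡⟨ *-distribˡ-+ (ι (j ℕ.+ suc (suc m))) _ _ ⟩
    ι (j ℕ.+ suc (suc m)) * (p j a * p (suc (suc m)) b) + ι (j ℕ.+ suc (suc m)) * binom (suc j) (suc m) a b
      ≡⟨ cong₂ _+_ (cong₂ _*_ (ι-+ j (suc (suc m))) refl) (trans (cong (λ z → ι z * binom (suc j) (suc m) a b) (ℕ.+-suc j (suc m))) (binom-Δ (suc j) m a b)) ⟩
    (ι j + ι (suc (suc m))) * (p j a * p (suc (suc m)) b) + (ι (suc j) * p (suc j) a * p (suc m) b + (a + b) * B)
      ≡⟨ lem₁ (ι j) (ι (suc (suc m))) (p j a) (p (suc (suc m)) b) _ ⟩
    ι j * p j a * p (suc (suc m)) b + (p j a * (ι (suc (suc m)) * p (suc (suc m)) b) + (ι (suc j) * p (suc j) a * p (suc m) b + (a + b) * B))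
      ≡⟨ cong₂ (λ u v → ι j * p j a * p (suc (suc m)) b + (p j a * u + (v * p (suc m) b + (a + b) * B))) (p-suc (suc m) b) (p-suc j a) ⟩
    ι j * p j a * p (suc (suc m)) b + (p j a * (b * p (suc m) b) + (a * p j a * p (suc m) b + (a + b) * B))
      ≡⟨ lem₂ (ι j * p j a * p (suc (suc m)) b) (p j a) a b (p (suc m) b) B ⟩
    ι j * p j a * p (suc (suc m)) b + (a + b) * (p j a * p (suc m) b + B) ∎
    where
    open ≡-Reasoning
    B : ℚ
    B = binom (suc j) m a b
    opaque
      unfolding arith
      lem₁ : ∀ i k q u w → (i + k) * (q * u) + w ≡ i * q * u + (q * (k * u) + w)
      lem₁ = solve-∀ R
    opaque
      unfolding arith
      lem₂ : ∀ t q a b r s → t + (q * (b * r) + (a * q * r + (a + b) * s)) ≡ t + (a + b) * (q * r + s)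
      lem₂ = solve-∀ R

  ι-cancel : ∀ n {a b} → ι (suc n) * a ≡ ι (suc n) * b → a ≡ b
  ι-cancel n {a} {b} e = trans (lem a) (trans (cong (rec n *_) e) (sym (lem b)))
    where
    lem : ∀ a → a ≡ rec n * (ι (suc n) * a)
    lem a = sym (trans (sym (*-assoc (rec n) (ι (suc n)) a)) (trans (cong (_* a) (rec-ι n)) (*-identityˡ a)))

  -- For `j = 0` the boundary term of `binom-Δ` vanishes, so both sides satisfy the recurrence
  -- `p-suc`.
  binomial : ∀ n a b → binom 0 n a b ≡ p n (a + b)
  binomial zero a b = refl
  binomial (suc n) a b = ι-cancel n (trans (binom-Δ 0 n a b) (trans (lem (p (suc n) b) ((a + b) * binom 0 n a b)) (trans (cong ((a + b) *_) (binomial n a b)) (sym (p-suc n (a + b))))))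
    where
    opaque
      unfolding arith
      lem : ∀ u v → 0ℚ * 1ℚ * u + v ≡ v
      lem = solve-∀ R

  eS-+ : ∀ a b → eS a ⋆ eS b ≗ eS (a + b)
  eS-+ a b c = trans (eS⋆eS-binom 0 c a b) (binomial (length c) a b)

  𝟙 : Bool → ℚ
  𝟙 true = 1ℚ
  𝟙 false = 0ℚ

  0≤𝟙 : ∀ b → 0ℚ ≤ 𝟙 b
  0≤𝟙 true = 0≤1
  0≤𝟙 false = ≤-refl

  𝟙≤1 : ∀ b → 𝟙 b ≤ 1ℚ
  𝟙≤1 true = ≤-refl
  𝟙≤1 false = 0≤1

  all : (ℕ → Bool) → List ℕ → Bool
  all J [] = true
  all J (x ∷ c) = J x ∧ all J c

  eJ : (ℕ → Bool) → ℚ → Ser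
  eJ J a c = 𝟙 (all J c) * p (length c) a

  every : ℕ → Bool
  every _ = true

  all-every : ∀ c → all every c ≡ true
  all-every [] = refl
  all-every (x ∷ c) = all-every c

  eJ-every : ∀ a → eJ every a ≗ eS a
  eJ-every a c = trans (cong (λ z → 𝟙 z * p (length c) a) (all-every c)) (*-identityˡ _)

  -- Two-letter insertions: sw a b h j c = Σ_r p_{j+r}(a) h(c_r,c_{r+1}) p_{|c|-r-2}(b).

  sw : ℚ → ℚ → (ℕ → ℕ → ℚ) → ℕ → List ℕ → ℚ
  sw a b h j [] = 0ℚ
  sw a b h j (x ∷ []) = 0ℚ
  sw a b h j (x ∷ y ∷ c) = p j a * (h x y * p (length c) b) + sw a b h (suc j) (y ∷ c)

  two : (ℕ → ℕ → ℚ) → Ser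
  two h [] = 0ℚ
  two h (x ∷ []) = 0ℚ
  two h (x ∷ y ∷ []) = h x y
  two h (x ∷ y ∷ z ∷ c) = 0ℚ

  two⋆ : ∀ h b x y c → (two h ⋆ eS b) (x ∷ y ∷ c) ≡ h x y * p (length c) b
  two⋆ h b x y [] = lem (p 2 b) (p 1 b) (h x y)
    where
    opaque
      unfolding arith
      lem : ∀ u v w → 0ℚ * u + (0ℚ * v + w * 1ℚ) ≡ w * 1ℚ
      lem = solve-∀ R
  two⋆ h b x y (z ∷ c) = trans (cong (λ t → 0ℚ * p (suc (suc (suc (length c)))) b + (0ℚ * p (suc (suc (length c))) b + (h x y * p (suc (length c)) b + t))) (⋆-zeroˡ (eS b) c)) (lem (p (suc (suc (suc (length c)))) b) (p (suc (suc (length c))) b) (h x y * p (suc (length c)) b))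
    where
    opaque
      unfolding arith
      lem : ∀ u v w → 0ℚ * u + (0ℚ * v + (w + 0ℚ)) ≡ w
      lem = solve-∀ R

  sandwich′ : ∀ a b h j c → ((λ l → p (j ℕ.+ length l) a) ⋆ (two h ⋆ eS b)) c ≡ sw a b h j c
  sandwich′ a b h j [] = trans (cong (p (j ℕ.+ 0) a *_) (*-zeroˡ 1ℚ)) (*-zeroʳ (p (j ℕ.+ 0) a))
  sandwich′ a b h j (x ∷ []) = lem (p (j ℕ.+ 0) a) (p 1 b) (p (j ℕ.+ 1) a)
    where
    opaque
      unfolding arith
      lem : ∀ u v w → u * (0ℚ * v + 0ℚ * 1ℚ) + w * (0ℚ * 1ℚ) ≡ 0ℚ
      lem = solve-∀ R
  sandwich′ a b h j (x ∷ y ∷ c) = cong₂ _+_ (cong₂ _*_ (cong (λ z → p z a) (ℕ.+-identityʳ j)) (two⋆ h b x y c))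
    (trans (⋆-congʳ (λ l → cong (λ z → p z a) (ℕ.+-suc j (length l))) (y ∷ c)) (sandwich′ a b h (suc j) (y ∷ c)))

  sandwich : ∀ a b h → eS a ⋆ (two h ⋆ eS b) ≗ sw a b h 0
  sandwich a b h = sandwich′ a b h 0

  -- An entry `(a , J)` stands for the factor exp(a J); `coef` takes the ordered product of the
  -- factors.
  Path : Set
  Path = List (ℚ × (ℕ → Bool))

  coef : Path → Ser
  coef [] = one
  coef ((a , J) ∷ P) = eJ J a ⋆ coef P

  coef-++ : ∀ P Q → coef (P ++ Q) ≗ coef P ⋆ coef Q
  coef-++ [] Q c = sym (⋆-oneˡ (coef Q) c)
  coef-++ ((a , J) ∷ P) Q c = trans (⋆-congˡ (coef-++ P Q) c) (sym (⋆-assoc (eJ J a) (coef P) (coef Q) c))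

  scale : ℚ → Path → Path
  scale s = map (λ { (a , J) → s * a , J })

  -- Substitution of `s` times each variable; on a product of exponentials it multiplies all lengths
  -- by `s`.
  homog : ℚ → Ser → Ser
  homog s F c = pow s (length c) * F c

  ⋆-homog : ∀ s F G → homog s F ⋆ homog s G ≗ homog s (F ⋆ G)
  ⋆-homog s F G [] = lem (F []) (G [])
    where
    opaque
      unfolding arith
      lem : ∀ a b → 1ℚ * a * (1ℚ * b) ≡ 1ℚ * (a * b)
      lem = solve-∀ R
  ⋆-homog s F G (x ∷ c) = trans (cong (1ℚ * F [] * (s * pow s (length c) * G (x ∷ c)) +_)
     (trans (⋆-congʳ (λ l → *-assoc s (pow s (length l)) (F (x ∷ l))) c) (trans (⋆-scaleˡ s (homog s (λ l → F (x ∷ l))) (homog s G) c) (cong (s *_) (⋆-homog s (λ l → F (x ∷ l)) G c)))))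
     (lem (F []) s (pow s (length c)) (G (x ∷ c)) _)
    where
    opaque
      unfolding arith
      lem : ∀ f s q g u → 1ℚ * f * (s * q * g) + s * (q * u) ≡ s * q * (f * g + u)
      lem = solve-∀ R

  coef-scale : ∀ s P → coef (scale s P) ≗ homog s (coef P)
  coef-scale s [] [] = sym (*-identityˡ 1ℚ)
  coef-scale s [] (x ∷ c) = sym (*-zeroʳ _)
  coef-scale s ((a , J) ∷ P) c = trans (⋆-cong (λ l → trans (cong (𝟙 (all J l) *_) (p-pow (length l) s a)) (lem (𝟙 (all J l)) (pow s (length l)) (p (length l) a))) (coef-scale s P) c) (⋆-homog s (eJ J a) (coef P) c)
    where
    opaque
      unfolding arith
      lem : ∀ a b c → a * (b * c) ≡ b * (a * c)
      lem = solve-∀ R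

-- Polynomials in one variable, tested for zero by sampling.

module Polynomials where
  open import Data.Nat as ℕ using (ℕ; zero; suc; s≤s)
  import Data.Nat.Properties as ℕ
  open import Data.List using (List; []; _∷_; map; length)
  open import Data.List.Relation.Unary.All using (All; []; _∷_)
  open import Data.Product using (∃; _×_; _,_)
  open import Data.Sum using (_⊎_; inj₁; inj₂)
  open import Data.Empty using (⊥-elim)
  open import Relation.Nullary using (yes; no)
  open import Relation.Binary.PropositionalEquality hiding (_≗_)
  open import Tactic.RingSolver using (solve-∀)
  open Rationals
  open Series

  eval : List ℚ → ℚ → ℚ
  eval [] t = 0ℚ
  eval (c ∷ cs) t = c + t * eval cs t

  -- Any coefficient list will do; a degree enters only as the length of the list, which bounds the
  -- number of roots.
  IsPoly : (ℚ → ℚ) → Set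
  IsPoly f = ∃ λ cs → ∀ t → f t ≡ eval cs t

  addP : List ℚ → List ℚ → List ℚ
  addP [] ds = ds
  addP (c ∷ cs) [] = c ∷ cs
  addP (c ∷ cs) (d ∷ ds) = c + d ∷ addP cs ds

  eval-add : ∀ cs ds t → eval (addP cs ds) t ≡ eval cs t + eval ds t
  eval-add [] ds t = sym (+-identityˡ _)
  eval-add (c ∷ cs) [] t = sym (+-identityʳ _)
  eval-add (c ∷ cs) (d ∷ ds) t = trans (cong (λ z → c + d + t * z) (eval-add cs ds t)) (lem c d t (eval cs t) (eval ds t))
    where
    opaque
      unfolding arith
      lem : ∀ c d t a b → c + d + t * (a + b) ≡ (c + t * a) + (d + t * b)
      lem = solve-∀ R

  eval-scale : ∀ a cs t → eval (map (a *_) cs) t ≡ a * eval cs t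
  eval-scale a [] t = sym (*-zeroʳ a)
  eval-scale a (c ∷ cs) t = trans (cong (λ z → a * c + t * z) (eval-scale a cs t)) (lem a c t (eval cs t))
    where
    opaque
      unfolding arith
      lem : ∀ a c t b → a * c + t * (a * b) ≡ a * (c + t * b)
      lem = solve-∀ R

  mulP : List ℚ → List ℚ → List ℚ
  mulP [] ds = []
  mulP (c ∷ cs) ds = addP (map (c *_) ds) (0ℚ ∷ mulP cs ds)

  eval-mul : ∀ cs ds t → eval (mulP cs ds) t ≡ eval cs t * eval ds t
  eval-mul [] ds t = sym (*-zeroˡ _)
  eval-mul (c ∷ cs) ds t = trans (eval-add (map (c *_) ds) (0ℚ ∷ mulP cs ds) t)
    (trans (cong₂ (λ y z → y + (0ℚ + t * z)) (eval-scale c ds t) (eval-mul cs ds t)) (lem c t (eval cs t) (eval ds t)))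
    where
    opaque
      unfolding arith
      lem : ∀ c t a b → c * b + (0ℚ + t * (a * b)) ≡ (c + t * a) * b
      lem = solve-∀ R

  poly-const : ∀ c → IsPoly (λ _ → c)
  poly-const c = c ∷ [] , λ t → sym (trans (cong (c +_) (*-zeroʳ t)) (+-identityʳ c))

  poly-id : IsPoly (λ t → t)
  poly-id = 0ℚ ∷ 1ℚ ∷ [] , lem
    where
    opaque
      unfolding arith
      lem : ∀ t → t ≡ 0ℚ + t * (1ℚ + t * 0ℚ)
      lem = solve-∀ R

  poly-+ : ∀ {f g} → IsPoly f → IsPoly g → IsPoly (λ t → f t + g t)
  poly-+ (cs , e) (ds , h) = addP cs ds , λ t → trans (cong₂ _+_ (e t) (h t)) (sym (eval-add cs ds t))

  poly-* : ∀ {f g} → IsPoly f → IsPoly g → IsPoly (λ t → f t * g t)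
  poly-* (cs , e) (ds , h) = mulP cs ds , λ t → trans (cong₂ _*_ (e t) (h t)) (sym (eval-mul cs ds t))

  poly-neg : ∀ {f} → IsPoly f → IsPoly (λ t → - f t)
  poly-neg {f} h with poly-* (poly-const (- 1ℚ)) h
  ... | cs , e = cs , λ t → trans (lem (f t)) (e t)
    where
    opaque
      unfolding arith
      lem : ∀ a → - a ≡ - 1ℚ * a
      lem = solve-∀ R

  poly-p : ∀ n {f} → IsPoly f → IsPoly (λ t → p n (f t))
  poly-p zero h = poly-const 1ℚ
  poly-p (suc n) h = poly-* (poly-p n h) (poly-* h (poly-const (rec n)))

  poly-sw : ∀ {a b : ℚ → ℚ} {h : ℚ → ℕ → ℕ → ℚ} → IsPoly a → IsPoly b → (∀ x y → IsPoly (λ t → h t x y)) →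
    ∀ j c → IsPoly (λ t → sw (a t) (b t) (h t) j c)
  poly-sw ha hb hh j [] = poly-const 0ℚ
  poly-sw ha hb hh j (x ∷ []) = poly-const 0ℚ
  poly-sw ha hb hh j (x ∷ y ∷ c) = poly-+ (poly-* (poly-p j ha) (poly-* (hh x y) (poly-p (length c) hb))) (poly-sw ha hb hh (suc j) (y ∷ c))

  -- Synthetic division by `t - a`, the remainder being the value at `a`.
  quot : List ℚ → ℚ → List ℚ
  quot [] a = []
  quot (c ∷ []) a = []
  quot (c ∷ d ∷ cs) a = eval (d ∷ cs) a ∷ quot (d ∷ cs) a

  length-quot : ∀ c cs a → length (quot (c ∷ cs) a) ≡ length cs
  length-quot c [] a = refl
  length-quot c (d ∷ cs) a = cong suc (length-quot d cs a)

  eval-quot : ∀ cs a t → eval cs t ≡ eval cs a + (t - a) * eval (quot cs a) t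
  eval-quot [] a t = lem t a
    where
    opaque
      unfolding arith
      lem : ∀ t a → 0ℚ ≡ 0ℚ + (t - a) * 0ℚ
      lem = solve-∀ R
  eval-quot (c ∷ []) a t = lem c t a
    where
    opaque
      unfolding arith
      lem : ∀ c t a → c + t * 0ℚ ≡ c + a * 0ℚ + (t - a) * 0ℚ
      lem = solve-∀ R
  eval-quot (c ∷ d ∷ cs) a t = trans (cong (λ z → c + t * z) (eval-quot (d ∷ cs) a t)) (lem c t a (eval (d ∷ cs) a) (eval (quot (d ∷ cs) a) t))
    where
    opaque
      unfolding arith
      lem : ∀ c t a e q → c + t * (e + (t - a) * q) ≡ c + a * e + (t - a) * (e + t * q)
      lem = solve-∀ R

  Inj : (ℕ → ℚ) → Set
  Inj r = ∀ {i j} → i ℕ.< j → r i ≢ r j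

  -- Divide by the last root: the other roots remain roots of the quotient, whose list is one
  -- shorter.
  roots⇒zero : ∀ {r} → Inj r → ∀ n cs → length cs ≡ n → (∀ i → i ℕ.< n → eval cs (r i) ≡ 0ℚ) → ∀ t → eval cs t ≡ 0ℚ
  roots⇒zero inj zero [] e h t = refl
  roots⇒zero {r} inj (suc n) (c ∷ cs) e h t = trans (eval-quot (c ∷ cs) (r n) t)
    (trans (cong₂ (λ y z → y + (t - r n) * z) (h n ℕ.≤-refl) (roots⇒zero inj n q (trans (length-quot c cs (r n)) (ℕ.suc-injective e)) root t)) (lem (t - r n)))
    where
    q : List ℚ
    q = quot (c ∷ cs) (r n)
    opaque
      unfolding arith
      lem : ∀ a → 0ℚ + a * 0ℚ ≡ 0ℚ
      lem = solve-∀ R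
    root : ∀ i → i ℕ.< n → eval q (r i) ≡ 0ℚ
    root i i<n = *-zero⁻ _ _ (trans (sym (+-identityˡ _)) (trans (cong (_+ (r i - r n) * eval q (r i)) (sym (h n ℕ.≤-refl)))
      (trans (sym (eval-quot (c ∷ cs) (r n) (r i))) (h i (ℕ.m<n⇒m<1+n i<n))))) (-‿≢0 (inj i<n))

  find : ∀ n (f : ℕ → ℚ) → (∃ λ i → f i ≢ 0ℚ) ⊎ (∀ i → i ℕ.< n → f i ≡ 0ℚ)
  find zero f = inj₂ λ i ()
  find (suc n) f with f n ≟ 0ℚ | find n f
  ... | no h | _ = inj₁ (n , h)
  ... | yes h | inj₁ g = inj₁ g
  ... | yes h | inj₂ g = inj₂ λ i i<n → case i i<n
    where
    case : ∀ i → i ℕ.< suc n → f i ≡ 0ℚ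
    case i i<n with i ℕ.≟ n
    ... | yes refl = h
    ... | no i≢n = g i (ℕ.≤∧≢⇒< (ℕ.≤-pred i<n) i≢n)

  ι-< : ∀ {m n} → m ℕ.< n → ι m < ι n
  ι-< {m} h = <-≤-trans (lin< 0<1 (+-comm 1ℚ (ι m))) (ι-mono h)

  ι-inj : Inj (λ i → ι (suc i))
  ι-inj h e = <-irrefl e (ι-< (s≤s h))

  rec-inj : ∀ {i j} → i ℕ.< j → rec i ≢ rec j
  rec-inj {i} {j} h e = ι-inj h (trans (lem (ι (suc i)) (ι (suc j)) (rec i) (rec j) (trans (*-comm _ _) (rec-ι j)) (rec-ι i) e) refl)
    where
    lem : ∀ a b x y → b * y ≡ 1ℚ → x * a ≡ 1ℚ → x ≡ y → a ≡ b
    lem a b x y p q refl = trans (sym (*-identityˡ a)) (trans (cong (_* a) (sym p)) (trans (*-assoc b x a) (trans (cong (b *_) q) (*-identityʳ b))))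

  -- As many samples as there are coefficients decide the matter. This keeps the later case
  -- distinctions constructive and yields an explicit point with a nonzero value.
  poly-dec : ∀ {f r} → IsPoly f → Inj r → (∃ λ i → f (r i) ≢ 0ℚ) ⊎ (∀ t → f t ≡ 0ℚ)
  poly-dec {f} {r} (cs , e) inj with find (length cs) (λ i → f (r i))
  ... | inj₁ g = inj₁ g
  ... | inj₂ g = inj₂ λ t → trans (e t) (roots⇒zero inj (length cs) cs refl (λ i h → trans (sym (e (r i))) (g i h)) t)

  rec<1 : ∀ i → rec (suc i) < 1ℚ
  rec<1 i = lin< (0<* (0<rec (suc i)) (0<+ 0<1 (0≤ι i))) (trans (sym (rec-ι (suc i))) (lem (rec (suc i)) (ι i)))
    where
    opaque
      unfolding arith
      lem : ∀ a b → a * (1ℚ + (1ℚ + b)) ≡ a + a * (1ℚ + b)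
      lem = solve-∀ R

  -- The samples `ξ / (i + 2)` all lie in the interval, and they cannot all be zeros because `f t₀`
  -- is nonzero.
  poly-small : ∀ {f} → IsPoly f → ∀ t₀ → f t₀ ≢ 0ℚ → ∀ ξ → 0ℚ < ξ → ∃ λ t → 0ℚ < t × t < ξ × f t ≢ 0ℚ
  poly-small {f} h t₀ n ξ 0<ξ with poly-dec {r = λ i → ξ * rec (suc i)} h inj
    where
    inj : Inj (λ i → ξ * rec (suc i))
    inj {i} {j} i<j e = rec-inj (s≤s i<j) (cancel e)
      where
      cancel : ∀ {a b} → ξ * a ≡ ξ * b → a ≡ b
      cancel {a} {b} e with inverse⁺ ξ 0<ξ
      ... | c , _ , g = trans (sym (lem a)) (trans (cong (c *_) e) (lem b))
        where
        lem : ∀ a → c * (ξ * a) ≡ a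
        lem a = trans (sym (*-assoc c ξ a)) (trans (cong (_* a) g) (*-identityˡ a))
  ... | inj₁ (i , g) = ξ * rec (suc i) , 0<* 0<ξ (0<rec (suc i)) , lin< (0<* 0<ξ (gap< (rec<1 i))) (lem ξ (rec (suc i))) , g
    where
    opaque
      unfolding arith
      lem : ∀ x r → x ≡ x * r + x * (1ℚ - r)
      lem = solve-∀ R
  ... | inj₂ g = ⊥-elim (n (g t₀))

  coefs-zero : ∀ cs → (∀ t → t ≢ 0ℚ → eval cs t ≡ 0ℚ) → All (_≡ 0ℚ) cs
  coefs-zero [] h = []
  coefs-zero (c ∷ cs) h = c0 ∷ coefs-zero cs (λ t n → *-zero⁻ t (eval cs t) (trans (sym (+-identityˡ _)) (trans (cong (_+ t * eval cs t) (sym c0)) (h t n))) n)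
    where
    c0 : c ≡ 0ℚ
    c0 = trans (lem c (eval cs 0ℚ)) (roots⇒zero ι-inj (suc (length cs)) (c ∷ cs) refl (λ i _ → h (ι (suc i)) (λ e → <-irrefl (sym e) (0<ι i))) 0ℚ)
      where
      opaque
        unfolding arith
        lem : ∀ c d → c ≡ c + 0ℚ * d
        lem = solve-∀ R

  -- Bernstein form with coefficients `gs`. The functional `sw` has this shape, with one coefficient
  -- for each pair of neighbouring letters.
  bern : ℚ → ℚ → ℕ → List ℚ → ℚ
  bern a b j [] = 0ℚ
  bern a b j (g ∷ gs) = p j a * (g * p (length gs) b) + bern a b (suc j) gs

  p-1≢0 : ∀ n → p n 1ℚ ≢ 0ℚ
  p-1≢0 n e = <-irrefl (sym e) (0<p n 0<1)

  bernC : ℕ → List ℚ → List ℚ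
  bernC j [] = []
  bernC j (g ∷ gs) = p j 1ℚ * (g * p (length gs) 1ℚ) ∷ bernC (suc j) gs

  bern-eval : ∀ t j gs → bern t 1ℚ j gs ≡ pow t j * eval (bernC j gs) t
  bern-eval t j [] = sym (*-zeroʳ _)
  bern-eval t j (g ∷ gs) = trans (cong₂ (λ y z → y * (g * p (length gs) 1ℚ) + z) (trans (cong (p j) (sym (*-identityʳ t))) (p-pow j t 1ℚ)) (bern-eval t (suc j) gs))
     (lem (pow t j) (p j 1ℚ) (g * p (length gs) 1ℚ) t (eval (bernC (suc j) gs) t))
    where
    opaque
      unfolding arith
      lem : ∀ q x y t e → q * x * y + t * q * e ≡ q * (x * y + t * e)
      lem = solve-∀ R

  bernC-zero : ∀ j gs → All (_≡ 0ℚ) (bernC j gs) → All (_≡ 0ℚ) gs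
  bernC-zero j [] [] = []
  bernC-zero j (g ∷ gs) (e ∷ es) = *-zero⁻ (p (length gs) 1ℚ) g (trans (*-comm _ g) (*-zero⁻ (p j 1ℚ) _ e (p-1≢0 j))) (p-1≢0 (length gs)) ∷ bernC-zero (suc j) gs es

  -- The degree is `j + n - 1`; the extra factor `s` on the left avoids the subtraction.
  bern-homog : ∀ s a b n j gs → n ≡ length gs → s * bern (s * a) (s * b) j gs ≡ pow s (j ℕ.+ n) * bern a b j gs
  bern-homog s a b n j [] refl = trans (*-zeroʳ s) (sym (*-zeroʳ _))
  bern-homog s a b (suc n) j (g ∷ gs) refl = trans (*-distribˡ-+ s _ _) (trans (cong₂ _+_
      (trans (cong₂ (λ y z → s * (y * (g * z))) (p-pow j s a) (p-pow n s b)) (trans (lem s (pow s j) (p j a) g (pow s n) (p n b)) (cong (_* (p j a * (g * p n b))) (sym (pow-+ j n)))))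
      (trans (bern-homog s a b n (suc j) gs refl) (cong (λ z → pow s z * bern a b (suc j) gs) (sym (ℕ.+-suc j n)))))
      (sym (*-distribˡ-+ (pow s (j ℕ.+ suc n)) _ _)))
    where
    opaque
      unfolding arith
      lem : ∀ s x y g z w → s * (x * y * (g * (z * w))) ≡ s * (x * z) * (y * (g * w))
      lem = solve-∀ R
      lem₂ : ∀ s x y → s * (s * x * y) ≡ s * (s * (x * y))
      lem₂ = solve-∀ R
    pow-+ : ∀ j n → pow s (j ℕ.+ suc n) ≡ s * (pow s j * pow s n)
    pow-+ zero n = cong (s *_) (sym (*-identityˡ _))
    pow-+ (suc j) n = trans (cong (s *_) (pow-+ j n)) (sym (lem₂ s (pow s j) (pow s n)))

  -- With `x = t / (1 + t)`, homogeneity turns the Bernstein form into an ordinary polynomial in `t`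
  -- whose coefficients are nonzero multiples of the entries of `gs`; it vanishes at all positive
  -- integers.
  bern-zero : ∀ gs → (∀ x → bern x (1ℚ - x) 0 gs ≡ 0ℚ) → All (_≡ 0ℚ) gs
  bern-zero gs h = bernC-zero 0 gs (coefs-zero (bernC 0 gs) λ t _ → van t)
    where
    eq : ∀ i → eval (bernC 0 gs) (ι (suc i)) ≡ 0ℚ
    eq i with inverse⁺ (1ℚ + ι (suc i)) (0<+ 0<1 (0≤ι (suc i)))
    ... | s , 0<s , e = trans (sym (*-identityˡ _)) (trans (sym (bern-eval t 0 gs)) (*-zero⁻ (pow s (length gs)) (bern t 1ℚ 0 gs)
        (trans (sym (bern-homog s t 1ℚ (length gs) 0 gs refl)) (trans (cong (s *_) (trans (cong (λ z → bern (s * t) z 0 gs) e₁) (h (s * t)))) (*-zeroʳ s))) (pow≢0 (length gs))))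
      where
      t : ℚ
      t = ι (suc i)
      opaque
        unfolding arith
        lem : ∀ s t → s * 1ℚ ≡ s * (1ℚ + t) - s * t
        lem = solve-∀ R
      e₁ : s * 1ℚ ≡ 1ℚ - s * t
      e₁ = trans (lem s t) (cong (_- s * t) e)
      0<pow : ∀ n → 0ℚ < pow s n
      0<pow zero = 0<1
      0<pow (suc n) = 0<* 0<s (0<pow n)
      pow≢0 : ∀ n → pow s n ≢ 0ℚ
      pow≢0 n e = <-irrefl (sym e) (0<pow n)
    van : ∀ t → eval (bernC 0 gs) t ≡ 0ℚ
    van = roots⇒zero ι-inj (length (bernC 0 gs)) (bernC 0 gs) refl (λ i _ → eq i)

-- Response polynomials and the separation of their monomials.

module Moments where
  open import Data.Nat as ℕ using (ℕ; zero; suc; s≤s; _⊓_; _⊔_; _∸_; _<ᵇ_)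
  import Data.Nat.Properties as ℕ
  open import Data.Bool using (true; false)
  open import Data.Fin using (Fin; zero; suc)
  open import Data.Vec using (Vec; toList)
  open import Data.Product using (_×_; _,_; proj₁; proj₂)
  open import Data.Sum using (_⊎_; inj₁; inj₂)
  open import Data.Empty using (⊥; ⊥-elim)
  open import Relation.Nullary using (¬_; yes; no)
  open import Relation.Binary.PropositionalEquality hiding (_≗_)
  open import Tactic.RingSolver using (solve-∀)
  open Rationals
  open Series
  open Polynomials

  sgn : ℕ → ℕ → ℚ
  sgn P Q with P <ᵇ Q
  ... | true = 1ℚ
  ... | false = - 1ℚ

  mon : ℕ → ℕ → ℕ → ℚ → ℚ → ℚ → ℚ
  mon P B Γ u v w = p P u * (p B v * p Γ w)

  -- The numbers of values of a pattern of order `k` below, between and above the two values `P` and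
  -- `Q`.
  lo mid hi : ℕ → ℕ → ℕ → ℕ
  lo k P Q = P ⊓ Q
  mid k P Q = P ⊔ Q ∸ suc (P ⊓ Q)
  hi k P Q = k ∸ suc (P ⊔ Q)

  opaque
    -- Limiting weight of the increasing column tuples whose entries of ranks `P` and `Q` lie in the
    -- two thin sets, when proportions `u`, `v`, `w` of the columns come before, between and after
    -- these. The sign says whether the smaller value stands first in the pattern.
    τ : ℕ → ℚ → ℚ → ℚ → ℕ → ℕ → ℚ
    τ k u v w P Q = sgn P Q * mon (lo k P Q) (mid k P Q) (hi k P Q) u v w

  -- Response of the density of `π` to a gadget at place `x`: the gadget acts on two neighbouring
  -- entries, the earlier entries being read before it and the later ones after it.
  T : ∀ {n} → Vec ℕ n → ℚ → ℚ → ℚ → ℚ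
  T {n} π x u w = sw x (1ℚ - x) (τ n u (1ℚ - u - w) w) 0 (toList π)

  -1≢0 : - 1ℚ ≢ 0ℚ
  -1≢0 e = 1≢0 (trans (lem 1ℚ) (trans (cong -_ e) lem₀))
    where
    opaque
      unfolding arith
      lem : ∀ a → a ≡ - (- a)
      lem = solve-∀ R
      lem₀ : - 0ℚ ≡ 0ℚ
      lem₀ = refl

  *≢0 : ∀ {a b} → a ≢ 0ℚ → b ≢ 0ℚ → a * b ≢ 0ℚ
  *≢0 {a} {b} p q e = q (*-zero⁻ a b e p)

  sgn≢0 : ∀ P Q → sgn P Q ≢ 0ℚ
  sgn≢0 P Q with P <ᵇ Q
  ... | true = 1≢0
  ... | false = -1≢0

  p-neg≢0 : ∀ n → p n (- 1ℚ) ≢ 0ℚ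
  p-neg≢0 zero = 1≢0
  p-neg≢0 (suc n) = *≢0 (p-neg≢0 n) (*≢0 -1≢0 (λ e → <-irrefl (sym e) (0<rec n)))

  2q : ℚ
  2q = 1ℚ + 1ℚ

  -- Powers of 2 separate exponents: at these points a monomial takes the values 1, `A` and `A * A`,
  -- where `A` determines the exponent, and three values suffice for three monomials.
  lam : Fin 3 → ℚ
  lam zero = 1ℚ
  lam (suc zero) = 2q
  lam (suc (suc zero)) = 2q * 2q

  pow-1 : ∀ n → pow 1ℚ n ≡ 1ℚ
  pow-1 zero = refl
  pow-1 (suc n) = trans (*-identityˡ _) (pow-1 n)

  pow-* : ∀ a b n → pow (a * b) n ≡ pow a n * pow b n
  pow-* a b zero = sym (*-identityˡ 1ℚ)
  pow-* a b (suc n) = trans (cong (a * b *_) (pow-* a b n)) (lem a b (pow a n) (pow b n))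
    where
    opaque
      unfolding arith
      lem : ∀ a b c d → a * b * (c * d) ≡ a * c * (b * d)
      lem = solve-∀ R

  pow-+ : ∀ a m n → pow a (m ℕ.+ n) ≡ pow a m * pow a n
  pow-+ a zero n = sym (*-identityˡ _)
  pow-+ a (suc m) n = trans (cong (a *_) (pow-+ a m n)) (sym (*-assoc a _ _))

  0<pow : ∀ {a} → 0ℚ < a → ∀ n → 0ℚ < pow a n
  0<pow h zero = 0<1
  0<pow h (suc n) = 0<* h (0<pow h n)

  0<2 : 0ℚ < 2q
  0<2 = 0<+ 0<1 0≤1

  pow2-< : ∀ {m n} → m ℕ.< n → pow 2q m < pow 2q n
  pow2-< {m} {suc n} (s≤s h) with ℕ.m≤n⇒m<n∨m≡n h
  ... | inj₁ h′ = <-trans (pow2-< h′) (step n)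
    where
    step : ∀ n → pow 2q n < 2q * pow 2q n
    step n = lin< (0<pow 0<2 n) (lem (pow 2q n))
      where
      opaque
        unfolding arith
        lem : ∀ a → (1ℚ + 1ℚ) * a ≡ a + a
        lem = solve-∀ R
  ... | inj₂ refl = lin< (0<pow 0<2 n) (lem (pow 2q n))
    where
    opaque
      unfolding arith
      lem : ∀ a → (1ℚ + 1ℚ) * a ≡ a + a
      lem = solve-∀ R

  pow2-inj : ∀ {m n} → m ≢ n → pow 2q m - pow 2q n ≢ 0ℚ
  pow2-inj {m} {n} h = -‿≢0 λ e → case e (ℕ.<-cmp m n)
    where
    open import Relation.Binary.Definitions using (Tri; tri<; tri≈; tri>)
    case : pow 2q m ≡ pow 2q n → Tri (m ℕ.< n) (m ≡ n) (n ℕ.< m) → ⊥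
    case e (tri< a _ _) = <-irrefl e (pow2-< a)
    case e (tri≈ _ b _) = h b
    case e (tri> _ _ c) = <-irrefl (sym e) (pow2-< c)

  -- Three monomials cancelling at λ = 1, 2, 4: the nonzero ones have equal degrees.
  module Level (β₁ β₂ β₃ : ℚ) (a b c : ℕ)
    (h : ∀ i → β₁ * pow (lam i) a + β₂ * pow (lam i) b + β₃ * pow (lam i) c ≡ 0ℚ) where

    private
      A B C : ℚ
      A = pow 2q a
      B = pow 2q b
      C = pow 2q c

      h₀ : β₁ + β₂ + β₃ ≡ 0ℚ
      h₀ = trans (sym (cong₂ _+_ (cong₂ _+_ (e β₁ a) (e β₂ b)) (e β₃ c))) (h zero)
        where
        e : ∀ β n → β * pow 1ℚ n ≡ β
        e β n = trans (cong (β *_) (pow-1 n)) (*-identityʳ β)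
      h₁ : β₁ * A + β₂ * B + β₃ * C ≡ 0ℚ
      h₁ = h (suc zero)
      h₂ : β₁ * (A * A) + β₂ * (B * B) + β₃ * (C * C) ≡ 0ℚ
      h₂ = trans (sym (cong₂ _+_ (cong₂ _+_ (e β₁ a) (e β₂ b)) (e β₃ c))) (h (suc (suc zero)))
        where
        e : ∀ β n → β * pow (2q * 2q) n ≡ β * (pow 2q n * pow 2q n)
        e β n = cong (β *_) (pow-* 2q 2q n)

      -- Combining the three equations with the coefficients of the polynomial `(X - B) * (X - C)`
      -- eliminates the second and the third term.
      cancel : β₁ * ((A - B) * (A - C)) ≡ 0ℚ
      cancel = trans (lem β₁ β₂ β₃ A B C) (trans (cong₂ _+_ (cong₂ _-_ h₂ (cong ((B + C) *_) h₁)) (cong (B * C *_) h₀)) (lem₀ (B + C) (B * C)))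
        where
        opaque
          unfolding arith
          lem : ∀ x y z A B C → x * ((A - B) * (A - C)) ≡ x * (A * A) + y * (B * B) + z * (C * C) - (B + C) * (x * A + y * B + z * C) + B * C * (x + y + z)
          lem = solve-∀ R
          lem₀ : ∀ u v → 0ℚ - u * 0ℚ + v * 0ℚ ≡ 0ℚ
          lem₀ = solve-∀ R

    near : β₁ ≢ 0ℚ → (a ≡ b) ⊎ (a ≡ c)
    near n with a ℕ.≟ b | a ℕ.≟ c
    ... | yes e | _ = inj₁ e
    ... | no _ | yes e = inj₂ e
    ... | no p | no q = ⊥-elim (*≢0 n (*≢0 (pow2-inj p) (pow2-inj q)) cancel)

    pair₁₂ : β₁ ≢ 0ℚ → β₃ ≡ 0ℚ → a ≡ b
    pair₁₂ n z with a ℕ.≟ b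
    ... | yes e = e
    ... | no p = ⊥-elim (*≢0 n (pow2-inj p) (trans (lem β₁ β₂ β₃ A B C) (trans (cong₂ _+_ (cong₂ _-_ h₁ (cong (B *_) h₀)) (cong (λ t → - (t * (C - B))) z)) (lem₀ B (C - B)))))
      where
      opaque
        unfolding arith
        lem : ∀ x y z A B C → x * (A - B) ≡ x * A + y * B + z * C - B * (x + y + z) + - (z * (C - B))
        lem = solve-∀ R
        lem₀ : ∀ u v → 0ℚ - u * 0ℚ + - (0ℚ * v) ≡ 0ℚ
        lem₀ = solve-∀ R

    alone : β₂ ≡ 0ℚ → β₃ ≡ 0ℚ → β₁ ≡ 0ℚ
    alone y z = trans (lem β₁ β₂ β₃) (trans (cong₂ _-_ h₀ (cong₂ _+_ y z)) lem₀)
      where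
      opaque
        unfolding arith
        lem : ∀ x y z → x ≡ x + y + z - (y + z)
        lem = solve-∀ R
        lem₀ : 0ℚ - (0ℚ + 0ℚ) ≡ 0ℚ
        lem₀ = refl

  -- If all coefficients are nonzero, `near` gives each exponent an equal partner among the other
  -- two, and for three exponents this forces all to agree. With a vanishing coefficient only two
  -- monomials remain.
  level : ∀ β₁ β₂ β₃ a b c → (∀ i → β₁ * pow (lam i) a + β₂ * pow (lam i) b + β₃ * pow (lam i) c ≡ 0ℚ) →
    β₁ ≢ 0ℚ → (β₂ ≢ 0ℚ → a ≡ b) × (β₃ ≢ 0ℚ → a ≡ c) × ¬ (β₂ ≡ 0ℚ × β₃ ≡ 0ℚ)
  level β₁ β₂ β₃ a b c h n₁ = two₂ , two₃ , λ (y , z) → n₁ (Level.alone β₁ β₂ β₃ a b c h y z)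
    where
    opaque
      unfolding arith
      s₁₃ : ∀ x y z → x + z + y ≡ x + y + z
      s₁₃ = solve-∀ R
      s₂ : ∀ x y z → y + x + z ≡ x + y + z
      s₂ = solve-∀ R
      s₃ : ∀ x y z → z + x + y ≡ x + y + z
      s₃ = solve-∀ R
    h₁₃ : ∀ i → β₁ * pow (lam i) a + β₃ * pow (lam i) c + β₂ * pow (lam i) b ≡ 0ℚ
    h₁₃ i = trans (s₁₃ _ _ _) (h i)
    h₂ : ∀ i → β₂ * pow (lam i) b + β₁ * pow (lam i) a + β₃ * pow (lam i) c ≡ 0ℚ
    h₂ i = trans (s₂ _ _ _) (h i)
    h₃ : ∀ i → β₃ * pow (lam i) c + β₁ * pow (lam i) a + β₂ * pow (lam i) b ≡ 0ℚ
    h₃ i = trans (s₃ _ _ _) (h i)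
    two₂ : β₂ ≢ 0ℚ → a ≡ b
    two₂ n₂ with β₃ ≟ 0ℚ
    ... | yes z = Level.pair₁₂ β₁ β₂ β₃ a b c h n₁ z
    ... | no n₃ with Level.near β₁ β₂ β₃ a b c h n₁ | Level.near β₂ β₁ β₃ b a c h₂ n₂ | Level.near β₃ β₁ β₂ c a b h₃ n₃
    ...   | inj₁ e | _ | _ = e
    ...   | inj₂ e | inj₁ f | _ = sym f
    ...   | inj₂ e | inj₂ f | _ = trans e (sym f)
    two₃ : β₃ ≢ 0ℚ → a ≡ c
    two₃ n₃ with β₂ ≟ 0ℚ
    ... | yes z = Level.pair₁₂ β₁ β₃ β₂ a c b h₁₃ n₁ z
    ... | no n₂ with Level.near β₁ β₂ β₃ a b c h n₁ | Level.near β₂ β₁ β₃ b a c h₂ n₂ | Level.near β₃ β₁ β₂ c a b h₃ n₃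
    ...   | inj₂ e | _ | _ = e
    ...   | inj₁ e | _ | inj₁ f = sym f
    ...   | inj₁ e | _ | inj₂ f = trans e (sym f)

  -- With `v = 1 - u - w`, on each of the three families two of `u`, `v`, `w` are the parameter up
  -- to sign and the third is 1. A monomial thus becomes a power of the parameter whose exponent is
  -- the sum of two of its three exponents.
  Nine : (ℚ → ℚ → ℚ) → Set
  Nine f = ∀ i → f (lam i) 1ℚ ≡ 0ℚ × f (lam i) (- lam i) ≡ 0ℚ × f 1ℚ (lam i) ≡ 0ℚ

  Exps : Set
  Exps = ℕ × ℕ × ℕ

  opaque
    tm : ℚ → Exps → ℚ → ℚ → ℚ
    tm α (P , B , Γ) u w = α * mon P B Γ u (1ℚ - u - w) w

  private
    v₁ : ∀ l → 1ℚ - l - 1ℚ ≡ l * - 1ℚ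
    v₁ = solve′
      where
      opaque
        unfolding arith
        solve′ : ∀ l → 1ℚ - l - 1ℚ ≡ l * - 1ℚ
        solve′ = solve-∀ R
    v₂ : ∀ l → 1ℚ - l - (- l) ≡ 1ℚ
    v₂ = solve′
      where
      opaque
        unfolding arith
        solve′ : ∀ l → 1ℚ - l - (- l) ≡ 1ℚ
        solve′ = solve-∀ R
    v₃ : ∀ l → 1ℚ - 1ℚ - l ≡ l * - 1ℚ
    v₃ = solve′
      where
      opaque
        unfolding arith
        solve′ : ∀ l → 1ℚ - 1ℚ - l ≡ l * - 1ℚ
        solve′ = solve-∀ R
    neg : ∀ l → - l ≡ l * - 1ℚ
    neg = solve′
      where
      opaque
        unfolding arith
        solve′ : ∀ l → - l ≡ l * - 1ℚ
        solve′ = solve-∀ R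
    opaque
      unfolding arith
      r₁ : ∀ α x y z s t → α * (s * x * (t * y * z)) ≡ α * (x * (y * z)) * (s * t)
      r₁ = solve-∀ R
      r₂ : ∀ α x y z s t → α * (s * x * (y * (t * z))) ≡ α * (x * (y * z)) * (s * t)
      r₂ = solve-∀ R
      r₃ : ∀ α x y z s t → α * (x * (s * y * (t * z))) ≡ α * (x * (y * z)) * (s * t)
      r₃ = solve-∀ R

  p1 : ∀ n l → p n l ≡ pow l n * p n 1ℚ
  p1 n l = trans (cong (p n) (sym (*-identityʳ l))) (p-pow n l 1ℚ)

  κ₁ κ₂ : Exps → ℚ
  κ₁ (P , B , Γ) = p P 1ℚ * (p B (- 1ℚ) * p Γ 1ℚ)
  κ₂ (P , B , Γ) = p P 1ℚ * (p B 1ℚ * p Γ (- 1ℚ))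

  opaque
    unfolding tm

    tm₁ : ∀ α e l → tm α e l 1ℚ ≡ α * κ₁ e * pow l (proj₁ e ℕ.+ proj₁ (proj₂ e))
    tm₁ α (P , B , Γ) l = trans (cong (α *_) (cong₂ _*_ (p1 P l) (cong (_* p Γ 1ℚ) (trans (cong (p B) (v₁ l)) (p-pow B l (- 1ℚ))))))
      (trans (r₁ α (p P 1ℚ) (p B (- 1ℚ)) (p Γ 1ℚ) (pow l P) (pow l B)) (cong (α * κ₁ (P , B , Γ) *_) (sym (pow-+ l P B))))

    tm₂ : ∀ α e l → tm α e l (- l) ≡ α * κ₂ e * pow l (proj₁ e ℕ.+ proj₂ (proj₂ e))
    tm₂ α (P , B , Γ) l = trans (cong (α *_) (cong₂ _*_ (p1 P l) (cong₂ _*_ (cong (p B) (v₂ l)) (trans (cong (p Γ) (neg l)) (p-pow Γ l (- 1ℚ))))))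
      (trans (r₂ α (p P 1ℚ) (p B 1ℚ) (p Γ (- 1ℚ)) (pow l P) (pow l Γ)) (cong (α * κ₂ (P , B , Γ) *_) (sym (pow-+ l P Γ))))

    tm₃ : ∀ α e l → tm α e 1ℚ l ≡ α * κ₁ e * pow l (proj₁ (proj₂ e) ℕ.+ proj₂ (proj₂ e))
    tm₃ α (P , B , Γ) l = trans (cong (α *_) (cong (p P 1ℚ *_) (cong₂ _*_ (trans (cong (p B) (v₃ l)) (p-pow B l (- 1ℚ))) (p1 Γ l))))
      (trans (r₃ α (p P 1ℚ) (p B (- 1ℚ)) (p Γ 1ℚ) (pow l B) (pow l Γ)) (cong (α * κ₁ (P , B , Γ) *_) (sym (pow-+ l B Γ))))

  κ₁≢0 : ∀ e → κ₁ e ≢ 0ℚ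
  κ₁≢0 (P , B , Γ) = *≢0 (p-1≢0 P) (*≢0 (p-neg≢0 B) (p-1≢0 Γ))

  κ₂≢0 : ∀ e → κ₂ e ≢ 0ℚ
  κ₂≢0 (P , B , Γ) = *≢0 (p-1≢0 P) (*≢0 (p-1≢0 B) (p-neg≢0 Γ))

  -- The first two sums add up to twice the first exponent plus the third sum.
  exps≡ : ∀ {P B Γ P′ B′ Γ′} → P ℕ.+ B ≡ P′ ℕ.+ B′ → P ℕ.+ Γ ≡ P′ ℕ.+ Γ′ → B ℕ.+ Γ ≡ B′ ℕ.+ Γ′ → (P , B , Γ) ≡ (P′ , B′ , Γ′)
  exps≡ {P} {B} {Γ} {P′} {B′} {Γ′} x y z = go (half (trans (sym (arr P B Γ)) (trans (cong₂ ℕ._+_ (cong₂ ℕ._+_ x y) refl) (trans (step P′ B′ Γ′ (B ℕ.+ Γ) z) refl))))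
    where
    open import Data.Nat.Tactic.RingSolver renaming (solve-∀ to solveℕ)
    arr : ∀ P B Γ → (P ℕ.+ B) ℕ.+ (P ℕ.+ Γ) ℕ.+ 0 ≡ (P ℕ.+ P) ℕ.+ (B ℕ.+ Γ)
    arr = solveℕ
    step : ∀ P B Γ t → t ≡ B ℕ.+ Γ → (P ℕ.+ B) ℕ.+ (P ℕ.+ Γ) ℕ.+ 0 ≡ (P ℕ.+ P) ℕ.+ t
    step P B Γ t refl = arr P B Γ
    dbl : ∀ m n → m ℕ.+ m ≡ n ℕ.+ n → m ≡ n
    dbl zero zero e = refl
    dbl (suc m) (suc n) e = cong suc (dbl m n (ℕ.suc-injective (trans (sym (ℕ.+-suc m m)) (trans (ℕ.suc-injective e) (ℕ.+-suc n n)))))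
    half : (P ℕ.+ P) ℕ.+ (B ℕ.+ Γ) ≡ (P′ ℕ.+ P′) ℕ.+ (B ℕ.+ Γ) → P ≡ P′
    half e = dbl P P′ (ℕ.+-cancelʳ-≡ (B ℕ.+ Γ) (P ℕ.+ P) (P′ ℕ.+ P′) e)
    go : P ≡ P′ → (P , B , Γ) ≡ (P′ , B′ , Γ′)
    go refl = cong₂ (λ b g → P , b , g) (ℕ.+-cancelˡ-≡ P B B′ x) (ℕ.+-cancelˡ-≡ P Γ Γ′ y)

  -- `level`, applied to each of the three families, compares all pairwise sums of exponents; the
  -- constants `κ₁` and `κ₂` picked up on the way are nonzero.
  row : ∀ α₁ α₂ α₃ e₁ e₂ e₃ → Nine (λ u w → tm α₁ e₁ u w + tm α₂ e₂ u w + tm α₃ e₃ u w) →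
    α₁ ≢ 0ℚ → (α₂ ≢ 0ℚ → e₁ ≡ e₂) × (α₃ ≢ 0ℚ → e₁ ≡ e₃) × ¬ (α₂ ≡ 0ℚ × α₃ ≡ 0ℚ)
  row α₁ α₂ α₃ e₁ e₂ e₃ h n₁ =
      (λ n₂ → exps≡ (proj₁ L₁ (*≢0 n₂ (κ₁≢0 e₂))) (proj₁ L₂ (*≢0 n₂ (κ₂≢0 e₂))) (proj₁ L₃ (*≢0 n₂ (κ₁≢0 e₂))))
    , (λ n₃ → exps≡ (proj₁ (proj₂ L₁) (*≢0 n₃ (κ₁≢0 e₃))) (proj₁ (proj₂ L₂) (*≢0 n₃ (κ₂≢0 e₃))) (proj₁ (proj₂ L₃) (*≢0 n₃ (κ₁≢0 e₃))))
    , λ (y , z) → proj₂ (proj₂ L₁) (trans (cong (_* κ₁ e₂) y) (*-zeroˡ _) , trans (cong (_* κ₁ e₃) z) (*-zeroˡ _))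
    where
    L₁ = level (α₁ * κ₁ e₁) (α₂ * κ₁ e₂) (α₃ * κ₁ e₃) _ _ _ (λ i → trans (sym (cong₂ _+_ (cong₂ _+_ (tm₁ α₁ e₁ (lam i)) (tm₁ α₂ e₂ (lam i))) (tm₁ α₃ e₃ (lam i)))) (proj₁ (h i))) (*≢0 n₁ (κ₁≢0 e₁))
    L₂ = level (α₁ * κ₂ e₁) (α₂ * κ₂ e₂) (α₃ * κ₂ e₃) _ _ _ (λ i → trans (sym (cong₂ _+_ (cong₂ _+_ (tm₂ α₁ e₁ (lam i)) (tm₂ α₂ e₂ (lam i))) (tm₂ α₃ e₃ (lam i)))) (proj₁ (proj₂ (h i)))) (*≢0 n₁ (κ₂≢0 e₁))
    L₃ = level (α₁ * κ₁ e₁) (α₂ * κ₁ e₂) (α₃ * κ₁ e₃) _ _ _ (λ i → trans (sym (cong₂ _+_ (cong₂ _+_ (tm₃ α₁ e₁ (lam i)) (tm₃ α₂ e₂ (lam i))) (tm₃ α₃ e₃ (lam i)))) (proj₂ (proj₂ (h i)))) (*≢0 n₁ (κ₁≢0 e₁))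

-- Combinations of the responses of distinct patterns do not vanish.

module Nonvanishing where
  open import Data.Nat as ℕ using (ℕ; zero; suc; _⊓_; _⊔_)
  import Data.Nat.Properties as ℕ
  open import Data.Fin using (zero; suc)
  open import Data.List using (List; []; _∷_; length)
  open import Data.List.Relation.Unary.All using (All; []; _∷_)
  open import Data.Vec using (Vec; []; _∷_; toList)
  open import Data.Vec.Relation.Unary.All as VA using ([]; _∷_)
  open import Data.Vec.Relation.Unary.AllPairs as VP using ([]; _∷_)
  open import Data.Product using (∃; _×_; _,_; proj₁; proj₂)
  open import Data.Sum using (_⊎_; inj₁; inj₂)
  open import Data.Empty using (⊥-elim)
  open import Data.Unit using (⊤; tt)
  open import Relation.Nullary using (¬_; Dec; yes; no)
  open import Relation.Binary.PropositionalEquality hiding (_≗_)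
  open import Tactic.RingSolver using (solve-∀)
  open Rationals
  open Series
  open Polynomials
  open Moments

  Unique : ∀ {n} → Vec ℕ n → Set
  Unique = VP.AllPairs _≢_

  Ascending₂ : ∀ {n} → Vec ℕ n → Set
  Ascending₂ (a ∷ b ∷ []) = a ℕ.< b
  Ascending₂ _ = ⊤

  record Good {n} (π : Vec ℕ n) : Set where
    field
      bounded : VA.All (ℕ._< n) π
      unique : Unique π
      asc : Ascending₂ π

  opaque
    exps : ℕ → ℕ → ℕ → Exps
    exps k P Q = lo k P Q , mid k P Q , hi k P Q

  Pair : ℕ → ℕ → ℕ → ℕ → Set
  Pair a b c d = (a ≡ c × b ≡ d) ⊎ (a ≡ d × b ≡ c)

  ⊓<⊔ : ∀ {a b} → a ≢ b → a ⊓ b ℕ.< a ⊔ b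
  ⊓<⊔ {a} {b} n with ℕ.≤-total a b
  ... | inj₁ p = subst₂ ℕ._<_ (sym (ℕ.m≤n⇒m⊓n≡m p)) (sym (ℕ.m≤n⇒m⊔n≡n p)) (ℕ.≤∧≢⇒< p n)
  ... | inj₂ p = subst₂ ℕ._<_ (sym (ℕ.m≥n⇒m⊓n≡n p)) (sym (ℕ.m≥n⇒m⊔n≡m p)) (ℕ.≤∧≢⇒< p (λ e → n (sym e)))

  hi-bound : ∀ {a b k} → a ℕ.< k → b ℕ.< k → a ⊔ b ℕ.< k
  hi-bound = ℕ.⊔-lub

  opaque
    unfolding exps

    exps⇒max : ∀ {k k′ a b c d} → a ≢ b → c ≢ d → exps k a b ≡ exps k′ c d → a ⊔ b ≡ c ⊔ d
    exps⇒max {k} {k′} {a} {b} {c} {d} n m e = trans (sym (ℕ.m+[n∸m]≡n (⊓<⊔ n))) (trans (cong₂ (λ x y → suc x ℕ.+ y) (cong proj₁ e) (cong (λ t → proj₁ (proj₂ t)) e)) (ℕ.m+[n∸m]≡n (⊓<⊔ m)))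

    -- The three exponents and the two marked values account for all `k` values, so monomials of
    -- patterns of different orders cannot cancel.
    exps⇒k : ∀ {k k′ a b c d} → a ≢ b → c ≢ d → a ⊔ b ℕ.< k → c ⊔ d ℕ.< k′ → exps k a b ≡ exps k′ c d → k ≡ k′
    exps⇒k {k} {k′} n m p q e = trans (sym (ℕ.m+[n∸m]≡n p)) (trans (cong₂ (λ x y → suc x ℕ.+ y) (exps⇒max {k} {k′} n m e) (cong (λ t → proj₂ (proj₂ t)) e)) (ℕ.m+[n∸m]≡n q))

    exps⇒Pair : ∀ {k k′ a b c d} → a ≢ b → c ≢ d → exps k a b ≡ exps k′ c d → Pair a b c d
    exps⇒Pair {k} {k′} {a} {b} {c} {d} n m e = case (ℕ.≤-total a b) (ℕ.≤-total c d)
      where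
      l : a ⊓ b ≡ c ⊓ d
      l = cong proj₁ e
      h : a ⊔ b ≡ c ⊔ d
      h = exps⇒max {k} {k′} n m e
      case : (a ℕ.≤ b) ⊎ (b ℕ.≤ a) → (c ℕ.≤ d) ⊎ (d ℕ.≤ c) → Pair a b c d
      case (inj₁ p) (inj₁ q) = inj₁ (trans (sym (ℕ.m≤n⇒m⊓n≡m p)) (trans l (ℕ.m≤n⇒m⊓n≡m q)) , trans (sym (ℕ.m≤n⇒m⊔n≡n p)) (trans h (ℕ.m≤n⇒m⊔n≡n q)))
      case (inj₁ p) (inj₂ q) = inj₂ (trans (sym (ℕ.m≤n⇒m⊓n≡m p)) (trans l (ℕ.m≥n⇒m⊓n≡n q)) , trans (sym (ℕ.m≤n⇒m⊔n≡n p)) (trans h (ℕ.m≥n⇒m⊔n≡m q)))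
      case (inj₂ p) (inj₁ q) = inj₂ (trans (sym (ℕ.m≥n⇒m⊔n≡m p)) (trans h (ℕ.m≤n⇒m⊔n≡n q)) , trans (sym (ℕ.m≥n⇒m⊓n≡n p)) (trans l (ℕ.m≤n⇒m⊓n≡m q)))
      case (inj₂ p) (inj₂ q) = inj₁ (trans (sym (ℕ.m≥n⇒m⊔n≡m p)) (trans h (ℕ.m≥n⇒m⊔n≡m q)) , trans (sym (ℕ.m≥n⇒m⊓n≡n p)) (trans l (ℕ.m≥n⇒m⊓n≡n q)))

  -- What the exponents reveal of a pattern: the unordered pair of values at each two neighbouring
  -- positions. The order within a pair shows only in a sign, which the arbitrary coefficients of a
  -- combination can hide.
  SamePairs : ∀ {n} → Vec ℕ n → Vec ℕ n → Set
  SamePairs (a ∷ b ∷ v) (c ∷ d ∷ w) = Pair a b c d × SamePairs (b ∷ v) (d ∷ w)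
  SamePairs _ _ = ⊤

  same-head : ∀ {n a c} {v w : Vec ℕ n} → a ≡ c → Unique (a ∷ v) → Unique (c ∷ w) → SamePairs (a ∷ v) (c ∷ w) → v ≡ w
  same-head {v = []} {[]} e u u′ s = refl
  same-head {v = b ∷ v} {d ∷ w} e (_ ∷ u) (_ ∷ u′) (inj₁ (_ , f) , s) = cong₂ _∷_ f (same-head f u u′ s)
  same-head {v = b ∷ v} {d ∷ w} e ((a≢b ∷ _) ∷ _) u′ (inj₂ (_ , g) , s) = ⊥-elim (a≢b (trans e (sym g)))

  -- With three or more entries, the second entry is the common element of the first two pairs, so
  -- the first pair cannot be crossed; with two entries `Ascending₂` fixes the order. Once the first
  -- entry is known the rest is forced.
  same : ∀ {n} {v w : Vec ℕ (suc (suc n))} → Good v → Good w → SamePairs v w → v ≡ w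
  same {v = a ∷ b ∷ v} {c ∷ d ∷ w} g h (inj₁ (e , f) , s) = cong₂ _∷_ e (same-head {v = b ∷ v} {d ∷ w} e (Good.unique g) (Good.unique h) (inj₁ (e , f) , s))
  same {zero} {a ∷ b ∷ []} {c ∷ d ∷ []} g h (inj₂ (refl , refl) , s) = ⊥-elim (ℕ.<-asym (Good.asc g) (Good.asc h))
  same {suc n} {a ∷ b ∷ x ∷ v} {c ∷ d ∷ y ∷ w} g h (inj₂ (refl , refl) , (inj₁ (e , _) , _)) with Good.unique g
  ... | (a≢b ∷ _) ∷ _ = ⊥-elim (a≢b (sym e))
  same {suc n} {a ∷ b ∷ x ∷ v} {c ∷ d ∷ y ∷ w} g h (inj₂ (refl , refl) , (inj₂ (_ , e) , _)) with Good.unique g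
  ... | (_ ∷ a≢x ∷ _) ∷ _ = ⊥-elim (a≢x (sym e))

  rows : ∀ {n} → ℚ → ℚ → ℚ → (ℕ → ℕ → ℚ) → Vec ℕ n → Vec ℕ n → Vec ℕ n → List ℚ
  rows α β γ h (a ∷ b ∷ u) (c ∷ d ∷ v) (e ∷ f ∷ w) = (α * h a b + β * h c d + γ * h e f) ∷ rows α β γ h (b ∷ u) (d ∷ v) (f ∷ w)
  rows α β γ h _ _ _ = []

  length-rows : ∀ {n} α β γ h a b c (u v w : Vec ℕ n) → length (rows α β γ h (a ∷ u) (b ∷ v) (c ∷ w)) ≡ n
  length-rows α β γ h a b c [] [] [] = refl
  length-rows α β γ h a b c (a′ ∷ u) (b′ ∷ v) (c′ ∷ w) = cong suc (length-rows α β γ h a′ b′ c′ u v w)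

  length-toList : ∀ {n} (v : Vec ℕ n) → length (toList v) ≡ n
  length-toList [] = refl
  length-toList (x ∷ v) = cong suc (length-toList v)

  -- Patterns of one length share the Bernstein basis, so a combination of their responses is again
  -- in Bernstein form.
  sw-rows : ∀ {n} α β γ x y h j (u v w : Vec ℕ n) →
    α * sw x y h j (toList u) + β * sw x y h j (toList v) + γ * sw x y h j (toList w) ≡ bern x y j (rows α β γ h u v w)
  sw-rows α β γ x y h j [] [] [] = lem α β γ
    where
    opaque
      unfolding arith
      lem : ∀ a b c → a * 0ℚ + b * 0ℚ + c * 0ℚ ≡ 0ℚ
      lem = solve-∀ R
  sw-rows α β γ x y h j (_ ∷ []) (_ ∷ []) (_ ∷ []) = lem α β γ
    where
    opaque
      unfolding arith
      lem : ∀ a b c → a * 0ℚ + b * 0ℚ + c * 0ℚ ≡ 0ℚ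
      lem = solve-∀ R
  sw-rows {suc (suc n)} α β γ x y h j (a ∷ b ∷ u) (c ∷ d ∷ v) (e ∷ f ∷ w) = trans
    (cong₂ _+_ (cong₂ _+_ (eq α a b u) (eq β c d v)) (eq γ e f w))
    (trans (lem α β γ (p j x) (h a b) (h c d) (h e f) (p n y) _ _ _)
      (cong₂ _+_ (cong (λ m → p j x * ((α * h a b + β * h c d + γ * h e f) * p m y)) (sym (length-rows α β γ h b d f u v w)))
         (sw-rows α β γ x y h (suc j) (b ∷ u) (d ∷ v) (f ∷ w))))
    where
    eq : ∀ α a b (u : Vec ℕ n) → α * sw x y h j (a ∷ b ∷ toList u) ≡ α * (p j x * (h a b * p n y) + sw x y h (suc j) (b ∷ toList u))
    eq α a b u = cong (λ m → α * (p j x * (h a b * p m y) + sw x y h (suc j) (b ∷ toList u))) (length-toList u)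
    opaque
      unfolding arith
      lem : ∀ α β γ q f g h y s t r → α * (q * (f * y) + s) + β * (q * (g * y) + t) + γ * (q * (h * y) + r) ≡ q * ((α * f + β * g + γ * h) * y) + (α * s + β * t + γ * r)
      lem = solve-∀ R

  alt : ∀ {A B C : Set} → A ⊎ B → A ⊎ C → A ⊎ (B × C)
  alt (inj₁ a) _ = inj₁ a
  alt (inj₂ _) (inj₁ a) = inj₁ a
  alt (inj₂ b) (inj₂ c) = inj₂ (b , c)

  module _ {f : ℚ → ℚ → ℚ → ℚ} (px : ∀ u w → IsPoly (λ x → f x u w)) where
    Somewhere : Set
    Somewhere = ∃ λ x → ∃ λ u → ∃ λ w → f x u w ≢ 0ℚ

    at : ∀ u w → Somewhere ⊎ (∀ x → f x u w ≡ 0ℚ)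
    at u w with poly-dec (px u w) ι-inj
    ... | inj₁ (i , n) = inj₁ (ι (suc i) , u , w , n)
    ... | inj₂ z = inj₂ z

    -- A full identity test in three variables is avoided: by `row`, nine pairs `(u , w)` carry
    -- enough information, and for each of them only a polynomial in `x` has to be tested.
    at-nine : Somewhere ⊎ (∀ x → Nine (f x))
    at-nine with alt (alt (three zero) (three (suc zero))) (three (suc (suc zero)))
      where
      three : ∀ i → Somewhere ⊎ ((∀ x → f x (lam i) 1ℚ ≡ 0ℚ) × ((∀ x → f x (lam i) (- lam i) ≡ 0ℚ) × (∀ x → f x 1ℚ (lam i) ≡ 0ℚ)))
      three i = alt (at (lam i) 1ℚ) (alt (at (lam i) (- lam i)) (at 1ℚ (lam i)))
    ... | inj₁ s = inj₁ s
    ... | inj₂ ((z₀ , z₁) , z₂) = inj₂ λ where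
        x zero → proj₁ z₀ x , proj₁ (proj₂ z₀) x , proj₂ (proj₂ z₀) x
        x (suc zero) → proj₁ z₁ x , proj₁ (proj₂ z₁) x , proj₂ (proj₂ z₁) x
        x (suc (suc zero)) → proj₁ z₂ x , proj₁ (proj₂ z₂) x , proj₂ (proj₂ z₂) x

  opaque
    unfolding τ tm exps

    poly-T : ∀ {n} (π : Vec ℕ n) {x u w : ℚ → ℚ} → IsPoly x → IsPoly u → IsPoly w → IsPoly (λ t → T π (x t) (u t) (w t))
    poly-T {n} π {x} {u} {w} hx hu hw = poly-sw hx (minus (poly-const 1ℚ) hx) (λ P Q → poly-* (poly-const _) (poly-* (poly-p (lo n P Q) hu) (poly-* (poly-p (mid n P Q) (minus (minus (poly-const 1ℚ) hu) hw)) (poly-p (hi n P Q) hw)))) 0 (toList π)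
      where
      minus : ∀ {f g} → IsPoly f → IsPoly g → IsPoly (λ t → f t - g t)
      minus a b = poly-+ a (poly-neg b)

    tm-scale : ∀ α q e u w → tm α e u w * q ≡ tm (α * q) e u w
    tm-scale α q (P , B , Γ) u w = lem α (mon P B Γ u (1ℚ - u - w) w) q
      where
      opaque
        unfolding arith
        lem : ∀ a b c → a * b * c ≡ a * c * b
        lem = solve-∀ R

    τ-tm : ∀ α k P Q u w → α * τ k u (1ℚ - u - w) w P Q ≡ tm (α * sgn P Q) (exps k P Q) u w
    τ-tm α k P Q u w = sym (*-assoc α _ _)

  -- The case of equal orders: `bern-zero` reduces the vanishing to each position separately, and
  -- there `row` equates the exponents, hence the unordered pairs.
  module Core {n} (u v w : Vec ℕ (suc (suc n))) (gu : Good u) (gv : Good v) (gw : Good w) (α β γ : ℚ)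
    (h : ∀ x → Nine (λ y z → α * T u x y z + β * T v x y z + γ * T w x y z)) (α≢0 : α ≢ 0ℚ) where

    private
      K : ℕ
      K = suc (suc n)

      all-rows : ∀ y z → (∀ x → α * T u x y z + β * T v x y z + γ * T w x y z ≡ 0ℚ) → All (_≡ 0ℚ) (rows α β γ (τ K y (1ℚ - y - z) z) u v w)
      all-rows y z e = bern-zero _ λ x → trans (sym (sw-rows α β γ x (1ℚ - x) (τ K y (1ℚ - y - z) z) 0 u v w)) (e x)

      NineRows : ∀ {m} → Vec ℕ m → Vec ℕ m → Vec ℕ m → Set
      NineRows u v w = ∀ i → (All (_≡ 0ℚ) (rows α β γ (τ K (lam i) (1ℚ - lam i - 1ℚ) 1ℚ) u v w))
                           × (All (_≡ 0ℚ) (rows α β γ (τ K (lam i) (1ℚ - lam i - (- lam i)) (- lam i)) u v w))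
                           × (All (_≡ 0ℚ) (rows α β γ (τ K 1ℚ (1ℚ - 1ℚ - lam i) (lam i)) u v w))

      tl : ∀ {x xs} → All (_≡ 0ℚ) (x ∷ xs) → All (_≡ 0ℚ) xs
      tl (_ ∷ a) = a

      hd : ∀ {x xs} → All (_≡ 0ℚ) (x ∷ xs) → x ≡ 0ℚ
      hd (a ∷ _) = a

      step : ∀ {m} a b c d e f (u v w : Vec ℕ m) → NineRows (a ∷ b ∷ u) (c ∷ d ∷ v) (e ∷ f ∷ w) →
        (β ≢ 0ℚ → exps K a b ≡ exps K c d) × (γ ≢ 0ℚ → exps K a b ≡ exps K e f)
      step a b c d e f u v w N = (λ z → proj₁ r (*≢0 z (sgn≢0 c d))) , (λ z → proj₁ (proj₂ r) (*≢0 z (sgn≢0 e f)))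
        where
        eq : ∀ y z → α * τ K y (1ℚ - y - z) z a b + β * τ K y (1ℚ - y - z) z c d + γ * τ K y (1ℚ - y - z) z e f
                   ≡ tm (α * sgn a b) (exps K a b) y z + tm (β * sgn c d) (exps K c d) y z + tm (γ * sgn e f) (exps K e f) y z
        eq y z = cong₂ _+_ (cong₂ _+_ (τ-tm α K a b y z) (τ-tm β K c d y z)) (τ-tm γ K e f y z)
        r = row (α * sgn a b) (β * sgn c d) (γ * sgn e f) (exps K a b) (exps K c d) (exps K e f)
              (λ i → trans (sym (eq (lam i) 1ℚ)) (hd (proj₁ (N i))) , trans (sym (eq (lam i) (- lam i))) (hd (proj₁ (proj₂ (N i)))) , trans (sym (eq 1ℚ (lam i))) (hd (proj₂ (proj₂ (N i)))))
              (*≢0 α≢0 (sgn≢0 a b))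

      fst-≢ : ∀ {m a b} {u : Vec ℕ m} → Unique (a ∷ b ∷ u) → a ≢ b
      fst-≢ ((n ∷ _) ∷ _) = n

      sv : β ≢ 0ℚ → ∀ {m} (u v w : Vec ℕ m) → Unique u → Unique v → NineRows u v w → SamePairs u v
      sv z [] [] w _ _ N = tt
      sv z (_ ∷ []) (_ ∷ []) w _ _ N = tt
      sv z (a ∷ b ∷ u) (c ∷ d ∷ v) (e ∷ f ∷ w) (p ∷ ps) (q ∷ qs) N =
        exps⇒Pair {K} {K} (fst-≢ (p ∷ ps)) (fst-≢ (q ∷ qs)) (proj₁ (step a b c d e f u v w N) z) ,
        sv z (b ∷ u) (d ∷ v) (f ∷ w) ps qs (λ i → tl (proj₁ (N i)) , tl (proj₁ (proj₂ (N i))) , tl (proj₂ (proj₂ (N i))))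

      sw′ : γ ≢ 0ℚ → ∀ {m} (u v w : Vec ℕ m) → Unique u → Unique w → NineRows u v w → SamePairs u w
      sw′ z [] v [] _ _ N = tt
      sw′ z (_ ∷ []) v (_ ∷ []) _ _ N = tt
      sw′ z (a ∷ b ∷ u) (c ∷ d ∷ v) (e ∷ f ∷ w) (p ∷ ps) (q ∷ qs) N =
        exps⇒Pair {K} {K} (fst-≢ (p ∷ ps)) (fst-≢ (q ∷ qs)) (proj₂ (step a b c d e f u v w N) z) ,
        sw′ z (b ∷ u) (d ∷ v) (f ∷ w) ps qs (λ i → tl (proj₁ (N i)) , tl (proj₁ (proj₂ (N i))) , tl (proj₂ (proj₂ (N i))))

      N₀ : NineRows u v w
      N₀ i = all-rows (lam i) 1ℚ (λ x → proj₁ (h x i)) , all-rows (lam i) (- lam i) (λ x → proj₁ (proj₂ (h x i))) , all-rows 1ℚ (lam i) (λ x → proj₂ (proj₂ (h x i)))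

    u≡v : β ≢ 0ℚ → u ≡ v
    u≡v z = same gu gv (sv z u v w (Good.unique gu) (Good.unique gv) N₀)

    u≡w : γ ≢ 0ℚ → u ≡ w
    u≡w z = same gu gw (sw′ z u v w (Good.unique gu) (Good.unique gw) N₀)

  sw-at-0 : ∀ b h j c → sw 0ℚ b h (suc j) c ≡ 0ℚ
  sw-at-0 b h j [] = refl
  sw-at-0 b h j (x ∷ []) = refl
  sw-at-0 b h j (x ∷ y ∷ c) = trans (cong₂ _+_ (trans (cong (_* (h x y * p (length c) b)) (trans (cong (p j 0ℚ *_) (*-zeroˡ _)) (*-zeroʳ _))) (*-zeroˡ _)) (sw-at-0 b h (suc j) (y ∷ c))) (+-identityˡ 0ℚ)

  T-at-0 : ∀ {n} a b (v : Vec ℕ n) u w → T (a ∷ b ∷ v) 0ℚ u w ≡ τ (suc (suc n)) u (1ℚ - u - w) w a b * p n 1ℚ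
  T-at-0 {n} a b v u w = trans (cong₂ _+_ refl (sw-at-0 _ _ 0 (b ∷ toList v))) (trans (+-identityʳ _) (trans (*-identityˡ _)
    (cong₂ (λ m t → τ (suc (suc n)) u (1ℚ - u - w) w a b * p m t) (length-toList v) lem)))
    where
    opaque
      unfolding arith
      lem : 1ℚ - 0ℚ ≡ 1ℚ
      lem = refl

  private
    bd : ∀ {n a b} {v : Vec ℕ n} → Good (a ∷ b ∷ v) → a ⊔ b ℕ.< suc (suc n)
    bd g with Good.bounded g
    ... | p ∷ q ∷ _ = hi-bound p q
    ne : ∀ {n a b} {v : Vec ℕ n} → Good (a ∷ b ∷ v) → a ≢ b
    ne g with Good.unique g
    ... | (p ∷ _) ∷ _ = p

  -- At `x = 0` only the first pair of each pattern contributes, whatever its order. This leaves one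
  -- monomial per pattern, and its exponents reveal the order.
  first-rows : ∀ {l m n} (u : Vec ℕ (suc (suc l))) (v : Vec ℕ (suc (suc m))) (w : Vec ℕ (suc (suc n))) → Good u → Good v → Good w → ∀ α β γ →
    Nine (λ y z → α * T u 0ℚ y z + β * T v 0ℚ y z + γ * T w 0ℚ y z) → α ≢ 0ℚ →
    (β ≢ 0ℚ → l ≡ m) × (γ ≢ 0ℚ → l ≡ n) × ¬ (β ≡ 0ℚ × γ ≡ 0ℚ)
  first-rows {l} {m} {n} (a ∷ b ∷ u) (c ∷ d ∷ v) (e ∷ f ∷ w) gu gv gw α β γ h z =
    (λ y → sz (exps⇒k {suc (suc l)} {suc (suc m)} (ne gu) (ne gv) (bd gu) (bd gv) (proj₁ r (*≢0 (*≢0 y (sgn≢0 c d)) (p-1≢0 m))))) ,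
    (λ y → sz (exps⇒k {suc (suc l)} {suc (suc n)} (ne gu) (ne gw) (bd gu) (bd gw) (proj₁ (proj₂ r) (*≢0 (*≢0 y (sgn≢0 e f)) (p-1≢0 n))))) ,
    λ (y , x) → proj₂ (proj₂ r) (van y , van x)
    where
    sz : ∀ {x y} → suc (suc x) ≡ suc (suc y) → x ≡ y
    sz refl = refl
    van : ∀ {x s t} → x ≡ 0ℚ → x * s * t ≡ 0ℚ
    van {s = s} {t} refl = trans (cong (_* t) (*-zeroˡ s)) (*-zeroˡ t)
    one′ : ∀ {n} α a b (v : Vec ℕ n) y z → α * T (a ∷ b ∷ v) 0ℚ y z ≡ tm (α * sgn a b * p n 1ℚ) (exps (suc (suc n)) a b) y z
    one′ {n} α a b v y z = trans (cong (α *_) (T-at-0 a b v y z)) (trans (sym (*-assoc α _ _)) (trans (cong (_* p n 1ℚ) (τ-tm α (suc (suc n)) a b y z)) (tm-scale (α * sgn a b) (p n 1ℚ) (exps (suc (suc n)) a b) y z)))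
    eq : ∀ y z → α * T (a ∷ b ∷ u) 0ℚ y z + β * T (c ∷ d ∷ v) 0ℚ y z + γ * T (e ∷ f ∷ w) 0ℚ y z
               ≡ tm (α * sgn a b * p l 1ℚ) (exps (suc (suc l)) a b) y z + tm (β * sgn c d * p m 1ℚ) (exps (suc (suc m)) c d) y z + tm (γ * sgn e f * p n 1ℚ) (exps (suc (suc n)) e f) y z
    eq y z = cong₂ _+_ (cong₂ _+_ (one′ α a b u y z) (one′ β c d v y z)) (one′ γ e f w y z)
    r = row (α * sgn a b * p l 1ℚ) (β * sgn c d * p m 1ℚ) (γ * sgn e f * p n 1ℚ) (exps (suc (suc l)) a b) (exps (suc (suc m)) c d) (exps (suc (suc n)) e f)
          (λ i → trans (sym (eq (lam i) 1ℚ)) (proj₁ (h i)) , trans (sym (eq (lam i) (- lam i))) (proj₁ (proj₂ (h i))) , trans (sym (eq 1ℚ (lam i))) (proj₂ (proj₂ (h i))))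
          (*≢0 (*≢0 z (sgn≢0 a b)) (p-1≢0 l))

  opaque
    combo : ∀ {l m n} → Vec ℕ l → Vec ℕ m → Vec ℕ n → ℚ → ℚ → ℚ → ℚ → ℚ → ℚ → ℚ
    combo u v w α β γ x y z = α * T u x y z + β * T v x y z + γ * T w x y z

  opaque
    unfolding combo

    combo≡ : ∀ {l m n} (u : Vec ℕ l) (v : Vec ℕ m) (w : Vec ℕ n) α β γ x y z →
      combo u v w α β γ x y z ≡ α * T u x y z + β * T v x y z + γ * T w x y z
    combo≡ u v w α β γ x y z = refl

    poly-combo : ∀ {l m n} (u : Vec ℕ l) (v : Vec ℕ m) (w : Vec ℕ n) α β γ {x y z} → IsPoly x → IsPoly y → IsPoly z →
      IsPoly (λ t → combo u v w α β γ (x t) (y t) (z t))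
    poly-combo u v w α β γ hx hy hz = poly-+ (poly-+ (poly-* (poly-const α) (poly-T u hx hy hz)) (poly-* (poly-const β) (poly-T v hx hy hz))) (poly-* (poly-const γ) (poly-T w hx hy hz))

    -- The third pattern may have another order, but its coefficient is 0: `u` is put in its place,
    -- so that `Core` applies.
    clash₁₂ : ∀ {l m n} → l ≡ m → (u : Vec ℕ (suc (suc l))) (v : Vec ℕ (suc (suc m))) (w : Vec ℕ (suc (suc n))) → Good u → Good v →
      ∀ {α β γ} → (∀ x → Nine (combo u v w α β γ x)) → α ≢ 0ℚ → β ≢ 0ℚ → γ ≡ 0ℚ → toList u ≡ toList v
    clash₁₂ refl u v w gu gv {α} {β} {γ} h a b c = cong toList (Core.u≡v u v u gu gv gu α β γ h′ a b)
      where
      fix : ∀ {a s t} → a + γ * s ≡ 0ℚ → a + γ * t ≡ 0ℚ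
      fix {a} {s} {t} e = trans (cong (a +_) (trans (cong (_* t) c) (trans (*-zeroˡ t) (sym (trans (cong (_* s) c) (*-zeroˡ s)))))) e
      h′ : ∀ x → Nine (λ y z → α * T u x y z + β * T v x y z + γ * T u x y z)
      h′ x i = fix (proj₁ (h x i)) , fix (proj₁ (proj₂ (h x i))) , fix (proj₂ (proj₂ (h x i)))

    clash₁₃ : ∀ {l m n} → l ≡ n → (u : Vec ℕ (suc (suc l))) (v : Vec ℕ (suc (suc m))) (w : Vec ℕ (suc (suc n))) → Good u → Good w →
      ∀ {α β γ} → (∀ x → Nine (combo u v w α β γ x)) → α ≢ 0ℚ → γ ≢ 0ℚ → β ≡ 0ℚ → toList u ≡ toList w
    clash₁₃ refl u v w gu gw {α} {β} {γ} h a c b = cong toList (Core.u≡w u u w gu gu gw α β γ h′ a c)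
      where
      fix : ∀ {a s t d} → a + β * s + d ≡ 0ℚ → a + β * t + d ≡ 0ℚ
      fix {a} {s} {t} {d} e = trans (cong (λ z → a + z + d) (trans (cong (_* t) b) (trans (*-zeroˡ t) (sym (trans (cong (_* s) b) (*-zeroˡ s)))))) e
      h′ : ∀ x → Nine (λ y z → α * T u x y z + β * T u x y z + γ * T w x y z)
      h′ x i = fix (proj₁ (h x i)) , fix (proj₁ (proj₂ (h x i))) , fix (proj₂ (proj₂ (h x i)))

    clash₁₂₃ : ∀ {l m n} → l ≡ m → l ≡ n → (u : Vec ℕ (suc (suc l))) (v : Vec ℕ (suc (suc m))) (w : Vec ℕ (suc (suc n))) → Good u → Good v → Good w →
      ∀ {α β γ} → (∀ x → Nine (combo u v w α β γ x)) → α ≢ 0ℚ → β ≢ 0ℚ → toList u ≡ toList v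
    clash₁₂₃ refl refl u v w gu gv gw {α} {β} {γ} h a b = cong toList (Core.u≡v u v w gu gv gw α β γ h a b)

    some-clash : ∀ {l m n} (u : Vec ℕ (suc (suc l))) (v : Vec ℕ (suc (suc m))) (w : Vec ℕ (suc (suc n))) → Good u → Good v → Good w →
      ∀ {α β γ} → (∀ x → Nine (combo u v w α β γ x)) → α ≢ 0ℚ → toList u ≡ toList v ⊎ toList u ≡ toList w
    some-clash {l} {m} {n} u v w gu gv gw {α} {β} {γ} h a = case (β ≟ 0ℚ) (γ ≟ 0ℚ) (first-rows u v w gu gv gw α β γ (h 0ℚ) a)
      where
      case : Dec (β ≡ 0ℚ) → Dec (γ ≡ 0ℚ) → (β ≢ 0ℚ → l ≡ m) × (γ ≢ 0ℚ → l ≡ n) × ¬ (β ≡ 0ℚ × γ ≡ 0ℚ) → toList u ≡ toList v ⊎ toList u ≡ toList w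
      case (yes b) (yes c) (_ , _ , r) = ⊥-elim (r (b , c))
      case (no b) (yes c) (r , _) = inj₁ (clash₁₂ (r b) u v w gu gv h a b c)
      case (yes b) (no c) (_ , r , _) = inj₂ (clash₁₃ (r c) u v w gu gw h a c b)
      case (no b) (no c) (r , r′ , _) = inj₁ (clash₁₂₃ (r b) (r′ c) u v w gu gv gw h a b)

  -- A nonzero value found anywhere is moved into the box by changing one variable at a time with
  -- `poly-small`.
  nonvanishing : ∀ {l m n} (u : Vec ℕ (suc (suc l))) (v : Vec ℕ (suc (suc m))) (w : Vec ℕ (suc (suc n))) →
    Good u → Good v → Good w → toList u ≢ toList v → toList u ≢ toList w →
    ∀ α β γ → α ≢ 0ℚ → ∀ ξ → 0ℚ < ξ →
    ∃ λ x → ∃ λ y → ∃ λ z → (0ℚ < x × x < ξ) × (0ℚ < y × y < ξ) × (0ℚ < z × z < ξ) × combo u v w α β γ x y z ≢ 0ℚ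
  nonvanishing u v w gu gv gw u≢v u≢w α β γ α≢0 ξ 0<ξ = go (at-nine {f} (λ y z → poly-combo u v w α β γ poly-id (poly-const y) (poly-const z)))
    where
    f : ℚ → ℚ → ℚ → ℚ
    f = combo u v w α β γ
    Goal : Set
    Goal = ∃ λ x → ∃ λ y → ∃ λ z → (0ℚ < x × x < ξ) × (0ℚ < y × y < ξ) × (0ℚ < z × z < ξ) × f x y z ≢ 0ℚ
    no-clash : ¬ (toList u ≡ toList v ⊎ toList u ≡ toList w)
    no-clash (inj₁ e) = u≢v e
    no-clash (inj₂ e) = u≢w e
    go : (∃ λ x → ∃ λ y → ∃ λ z → f x y z ≢ 0ℚ) ⊎ (∀ x → Nine (f x)) → Goal
    go (inj₂ h) = ⊥-elim (no-clash (some-clash u v w gu gv gw h α≢0))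
    go (inj₁ (x₀ , y₀ , z₀ , n₀)) =
      let x , 0<x , x<ξ , n₁ = poly-small {λ t → f t y₀ z₀} (poly-combo u v w α β γ poly-id (poly-const y₀) (poly-const z₀)) x₀ n₀ ξ 0<ξ
          y , 0<y , y<ξ , n₂ = poly-small {λ t → f x t z₀} (poly-combo u v w α β γ (poly-const x) poly-id (poly-const z₀)) y₀ n₁ ξ 0<ξ
          z , 0<z , z<ξ , n₃ = poly-small {λ t → f x y t} (poly-combo u v w α β γ (poly-const x) (poly-const y) poly-id) z₀ n₂ ξ 0<ξ
      in x , y , z , (0<x , x<ξ) , (0<y , y<ξ) , (0<z , z<ξ) , n₃

-- Gadgets and the increasing stretch.

module Gadgets where
  open import Data.Nat using (ℕ; zero; suc; _≤ᵇ_; _≡ᵇ_)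
  open import Data.Bool using (Bool; true; false; _∧_)
  open import Data.List using ([]; _∷_; length)
  open import Data.Product using (_,_)
  open import Relation.Binary.PropositionalEquality hiding (_≗_)
  open import Tactic.RingSolver using (solve-∀)
  open Rationals
  open Series

  data Class : Set where
    first second other : Class

  is₁ is₂ is₃ : Class → Bool
  is₁ first = true
  is₁ _ = false
  is₂ second = true
  is₂ _ = false
  is₃ other = true
  is₃ _ = false

  Δ : Class → Class → ℚ
  Δ first second = 1ℚ
  Δ second first = - 1ℚ
  Δ _ _ = 0ℚ

  -- Every column gets total length 1, as in a uniform stretch. The other columns are split evenly
  -- around the two sets, so that they meet these equally often in both orders; the first set is
  -- split around the second with imbalance `y`.
  gadget : (ℕ → Class) → ℚ → Path
  gadget cl y = (½ , λ c → is₃ (cl c)) ∷ (½ + y , λ c → is₁ (cl c)) ∷ (1ℚ , λ c → is₂ (cl c)) ∷ (½ - y , λ c → is₁ (cl c)) ∷ (½ , λ c → is₃ (cl c)) ∷ []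

  rec1 : rec 1 ≡ ½
  rec1 = trans (lem (rec 1)) (trans (cong (_* ½) (rec-ι 1)) (*-identityˡ ½))
    where
    opaque
      unfolding arith
      lem : ∀ r → r ≡ r * (1ℚ + (1ℚ + 0ℚ)) * ½
      lem = solve-∀ R

  p-two : ∀ a → p 2 a ≡ ½ * (a * a)
  p-two a = trans (cong₂ _*_ (p-one a) (cong (a *_) rec1)) (lem a ½)
    where
    opaque
      unfolding arith
      lem : ∀ a h → a * (a * h) ≡ h * (a * a)
      lem = solve-∀ R

  coef-[] : ∀ P → coef P [] ≡ 1ℚ
  coef-[] [] = refl
  coef-[] ((a , J) ∷ P) = trans (cong₂ _*_ (*-identityˡ 1ℚ) (coef-[] P)) (*-identityˡ 1ℚ)

  𝟙-∧ : ∀ a b → 𝟙 (a ∧ b) ≡ 𝟙 a * 𝟙 b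
  𝟙-∧ true b = sym (*-identityˡ _)
  𝟙-∧ false b = sym (*-zeroˡ _)

  coef-one : ∀ a J P x → coef ((a , J) ∷ P) (x ∷ []) ≡ coef P (x ∷ []) + 𝟙 (J x) * a
  coef-one a J P x = trans (cong₂ (λ s t → 1ℚ * 1ℚ * coef P (x ∷ []) + s * t) (cong₂ _*_ (trans (𝟙-∧ (J x) true) (*-identityʳ _)) (p-one a)) (coef-[] P)) (lem (coef P (x ∷ [])) (𝟙 (J x) * a))
    where
    opaque
      unfolding arith
      lem : ∀ u v → 1ℚ * 1ℚ * u + v * 1ℚ ≡ u + v
      lem = solve-∀ R

  coef-two : ∀ a J P x y → coef ((a , J) ∷ P) (x ∷ y ∷ []) ≡ coef P (x ∷ y ∷ []) + 𝟙 (J x) * a * coef P (y ∷ []) + 𝟙 (J x) * 𝟙 (J y) * (½ * (a * a))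
  coef-two a J P x y = trans (cong₂ (λ s t → 1ℚ * 1ℚ * coef P (x ∷ y ∷ []) + (s * coef P (y ∷ []) + t)) (cong₂ _*_ (trans (𝟙-∧ (J x) true) (*-identityʳ _)) (p-one a))
     (cong₂ _*_ (cong₂ _*_ (trans (𝟙-∧ (J x) (J y ∧ true)) (cong (𝟙 (J x) *_) (trans (𝟙-∧ (J y) true) (*-identityʳ _)))) (p-two a)) (coef-[] P)))
     (lem (coef P (x ∷ y ∷ [])) (𝟙 (J x) * a * coef P (y ∷ [])) (𝟙 (J x) * 𝟙 (J y) * (½ * (a * a))))
    where
    opaque
      unfolding arith
      lem : ∀ u v w → 1ℚ * 1ℚ * u + (v + w * 1ℚ) ≡ u + v + w
      lem = solve-∀ R

  gadget-one : ∀ cl y x → coef (gadget cl y) (x ∷ []) ≡ 1ℚ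
  gadget-one cl y x = trans (coef-one ½ J₃ P₄ x) (trans (cong (_+ 𝟙 (is₃ (cl x)) * ½) (trans (coef-one (½ + y) J₁ P₃ x) (cong (_+ 𝟙 (is₁ (cl x)) * (½ + y)) (trans (coef-one 1ℚ J₂ P₂ x) (cong (_+ 𝟙 (is₂ (cl x)) * 1ℚ) (trans (coef-one (½ - y) J₁ P₁ x) (cong (_+ 𝟙 (is₁ (cl x)) * (½ - y)) (coef-one ½ J₃ [] x)))))))) (num (cl x) y))
    where
    J₁ J₂ J₃ : ℕ → Bool
    J₁ c = is₁ (cl c)
    J₂ c = is₂ (cl c)
    J₃ c = is₃ (cl c)
    P₁ P₂ P₃ P₄ : Path
    P₁ = (½ , J₃) ∷ []
    P₂ = (½ - y , J₁) ∷ P₁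
    P₃ = (1ℚ , J₂) ∷ P₂
    P₄ = (½ + y , J₁) ∷ P₃
    opaque
      unfolding arith
      n₁ : ∀ y → 0ℚ + 0ℚ * ½ + 1ℚ * (½ - y) + 0ℚ * 1ℚ + 1ℚ * (½ + y) + 0ℚ * ½ ≡ 1ℚ
      n₁ = solve-∀ R
      n₂ : ∀ y → 0ℚ + 0ℚ * ½ + 0ℚ * (½ - y) + 1ℚ * 1ℚ + 0ℚ * (½ + y) + 0ℚ * ½ ≡ 1ℚ
      n₂ = solve-∀ R
      n₃ : ∀ y → 0ℚ + 1ℚ * ½ + 0ℚ * (½ - y) + 0ℚ * 1ℚ + 0ℚ * (½ + y) + 1ℚ * ½ ≡ 1ℚ
      n₃ = solve-∀ R
    num : ∀ k y → 0ℚ + 𝟙 (is₃ k) * ½ + 𝟙 (is₁ k) * (½ - y) + 𝟙 (is₂ k) * 1ℚ + 𝟙 (is₁ k) * (½ + y) + 𝟙 (is₃ k) * ½ ≡ 1ℚ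
    num first = n₁
    num second = n₂
    num other = n₃

  -- A uniform stretch of length 1 has the coefficient 1/2 here, so to second order the gadget
  -- deviates from it only by the antisymmetric term between the two sets.
  gadget-two : ∀ cl y x z → coef (gadget cl y) (x ∷ z ∷ []) ≡ ½ + y * Δ (cl x) (cl z)
  gadget-two cl y x z = trans (coef-two ½ J₃ P₄ x z) (trans (cong₂ (λ s t → s + i₃ * ½ * t + i₃ * j₃ * (½ * (½ * ½)))
      (trans (coef-two (½ + y) J₁ P₃ x z) (cong₂ (λ s t → s + i₁ * (½ + y) * t + i₁ * j₁ * (½ * ((½ + y) * (½ + y))))
        (trans (coef-two 1ℚ J₂ P₂ x z) (cong₂ (λ s t → s + i₂ * 1ℚ * t + i₂ * j₂ * (½ * (1ℚ * 1ℚ)))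
          (trans (coef-two (½ - y) J₁ P₁ x z) (cong₂ (λ s t → s + i₁ * (½ - y) * t + i₁ * j₁ * (½ * ((½ - y) * (½ - y))))
            (coef-two ½ J₃ [] x z) o₁)) o₂)) o₃)) o₄) (num (cl x) (cl z) y))
    where
    J₁ J₂ J₃ : ℕ → Bool
    J₁ c = is₁ (cl c)
    J₂ c = is₂ (cl c)
    J₃ c = is₃ (cl c)
    P₁ P₂ P₃ P₄ : Path
    P₁ = (½ , J₃) ∷ []
    P₂ = (½ - y , J₁) ∷ P₁
    P₃ = (1ℚ , J₂) ∷ P₂
    P₄ = (½ + y , J₁) ∷ P₃
    i₁ i₂ i₃ j₁ j₂ j₃ : ℚ
    i₁ = 𝟙 (is₁ (cl x))
    i₂ = 𝟙 (is₂ (cl x))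
    i₃ = 𝟙 (is₃ (cl x))
    j₁ = 𝟙 (is₁ (cl z))
    j₂ = 𝟙 (is₂ (cl z))
    j₃ = 𝟙 (is₃ (cl z))
    o₁ : coef P₁ (z ∷ []) ≡ 0ℚ + j₃ * ½
    o₁ = coef-one ½ J₃ [] z
    o₂ : coef P₂ (z ∷ []) ≡ 0ℚ + j₃ * ½ + j₁ * (½ - y)
    o₂ = trans (coef-one (½ - y) J₁ P₁ z) (cong (_+ j₁ * (½ - y)) o₁)
    o₃ : coef P₃ (z ∷ []) ≡ 0ℚ + j₃ * ½ + j₁ * (½ - y) + j₂ * 1ℚ
    o₃ = trans (coef-one 1ℚ J₂ P₂ z) (cong (_+ j₂ * 1ℚ) o₂)
    o₄ : coef P₄ (z ∷ []) ≡ 0ℚ + j₃ * ½ + j₁ * (½ - y) + j₂ * 1ℚ + j₁ * (½ + y)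
    o₄ = trans (coef-one (½ + y) J₁ P₃ z) (cong (_+ j₁ * (½ + y)) o₃)
    W : ℚ → ℚ → ℚ → ℚ → ℚ → ℚ → ℚ → ℚ
    W i₁ i₂ i₃ j₁ j₂ j₃ y =
      0ℚ + i₃ * ½ * 0ℚ + i₃ * j₃ * (½ * (½ * ½))
      + i₁ * (½ - y) * (0ℚ + j₃ * ½) + i₁ * j₁ * (½ * ((½ - y) * (½ - y)))
      + i₂ * 1ℚ * (0ℚ + j₃ * ½ + j₁ * (½ - y)) + i₂ * j₂ * (½ * (1ℚ * 1ℚ))
      + i₁ * (½ + y) * (0ℚ + j₃ * ½ + j₁ * (½ - y) + j₂ * 1ℚ) + i₁ * j₁ * (½ * ((½ + y) * (½ + y)))
      + i₃ * ½ * (0ℚ + j₃ * ½ + j₁ * (½ - y) + j₂ * 1ℚ + j₁ * (½ + y)) + i₃ * j₃ * (½ * (½ * ½))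
    opaque
      unfolding arith
      -- An identity in free variables; that the indicators of the three classes add up to 1, and
      -- that the last bracket is `Δ`, is put in afterwards.
      quad : ∀ i₁ i₂ i₃ j₁ j₂ j₃ y →
        0ℚ + i₃ * ½ * 0ℚ + i₃ * j₃ * (½ * (½ * ½))
        + i₁ * (½ - y) * (0ℚ + j₃ * ½) + i₁ * j₁ * (½ * ((½ - y) * (½ - y)))
        + i₂ * 1ℚ * (0ℚ + j₃ * ½ + j₁ * (½ - y)) + i₂ * j₂ * (½ * (1ℚ * 1ℚ))
        + i₁ * (½ + y) * (0ℚ + j₃ * ½ + j₁ * (½ - y) + j₂ * 1ℚ) + i₁ * j₁ * (½ * ((½ + y) * (½ + y)))
        + i₃ * ½ * (0ℚ + j₃ * ½ + j₁ * (½ - y) + j₂ * 1ℚ + j₁ * (½ + y)) + i₃ * j₃ * (½ * (½ * ½))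
        ≡ ½ * ((i₁ + i₂ + i₃) * (j₁ + j₂ + j₃)) + y * (i₁ * j₂ - i₂ * j₁)
      quad = solve-∀ R
      d₁ : (1ℚ + 0ℚ + 0ℚ) ≡ 1ℚ
      d₁ = refl
      d₂ : (0ℚ + 1ℚ + 0ℚ) ≡ 1ℚ
      d₂ = refl
      d₃ : (0ℚ + 0ℚ + 1ℚ) ≡ 1ℚ
      d₃ = refl
      e₀₀ : 0ℚ * 0ℚ - 0ℚ * 0ℚ ≡ 0ℚ
      e₀₀ = refl
      e₁₁ : 1ℚ * 0ℚ - 0ℚ * 1ℚ ≡ 0ℚ
      e₁₁ = refl
      e₂₂ : 0ℚ * 1ℚ - 1ℚ * 0ℚ ≡ 0ℚ
      e₂₂ = refl
      e₁₀ : 1ℚ * 0ℚ - 0ℚ * 0ℚ ≡ 0ℚ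
      e₁₀ = refl
      e₂₀ : 0ℚ * 0ℚ - 1ℚ * 0ℚ ≡ 0ℚ
      e₂₀ = refl
      e₀₁ : 0ℚ * 0ℚ - 0ℚ * 1ℚ ≡ 0ℚ
      e₀₁ = refl
      e₀₂ : 0ℚ * 1ℚ - 0ℚ * 0ℚ ≡ 0ℚ
      e₀₂ = refl
      e₁₂ : 1ℚ * 1ℚ - 0ℚ * 0ℚ ≡ 1ℚ
      e₁₂ = refl
      e₂₁ : 0ℚ * 0ℚ - 1ℚ * 1ℚ ≡ - 1ℚ
      e₂₁ = refl
    tot : ∀ k → 𝟙 (is₁ k) + 𝟙 (is₂ k) + 𝟙 (is₃ k) ≡ 1ℚ
    tot first = d₁
    tot second = d₂
    tot other = d₃
    det : ∀ k l → 𝟙 (is₁ k) * 𝟙 (is₂ l) - 𝟙 (is₂ k) * 𝟙 (is₁ l) ≡ Δ k l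
    det first first = e₁₁
    det first second = e₁₂
    det first other = e₁₀
    det second first = e₂₁
    det second second = e₂₂
    det second other = e₂₀
    det other first = e₀₁
    det other second = e₀₂
    det other other = e₀₀
    num : ∀ k l y → W (𝟙 (is₁ k)) (𝟙 (is₂ k)) (𝟙 (is₃ k)) (𝟙 (is₁ l)) (𝟙 (is₂ l)) (𝟙 (is₃ l)) y ≡ ½ + y * Δ k l
    num k l y = trans (quad _ _ _ _ _ _ y) (cong₂ (λ s t → s + y * t) (trans (cong (½ *_) (trans (cong₂ _*_ (tot k) (tot l)) (*-identityˡ 1ℚ))) (*-identityʳ ½)) (det k l))

  -- The last step takes all letters ≥ k, so that every letter gets mass one.
  stairs : ℕ → ℕ → Path
  stairs k zero = (1ℚ , λ c → k ≤ᵇ c) ∷ []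
  stairs k (suc m) = (1ℚ , λ c → k ≡ᵇ c) ∷ stairs (suc k) m

  mass : Path → ℕ → ℚ
  mass [] x = 0ℚ
  mass ((a , J) ∷ P) x = 𝟙 (J x) * a + mass P x

  coef-mass : ∀ P x → coef P (x ∷ []) ≡ mass P x
  coef-mass [] x = refl
  coef-mass ((a , J) ∷ P) x = trans (coef-one a J P x) (trans (cong (_+ 𝟙 (J x) * a) (coef-mass P x)) (+-comm _ _))

  stairs-mass : ∀ k m x → mass (stairs k m) x ≡ 𝟙 (k ≤ᵇ x)
  stairs-mass k zero x = trans (+-identityʳ _) (*-identityʳ _)
  stairs-mass k (suc m) x = trans (cong₂ _+_ (*-identityʳ (𝟙 (k ≡ᵇ x))) (stairs-mass (suc k) m x)) (split k x)
    where
    split : ∀ k x → 𝟙 (k ≡ᵇ x) + 𝟙 (suc k ≤ᵇ x) ≡ 𝟙 (k ≤ᵇ x)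
    split zero zero = +-identityʳ 1ℚ
    split zero (suc x) = +-identityˡ 1ℚ
    split (suc k) zero = +-identityˡ 0ℚ
    split (suc zero) (suc x) = split zero x
    split (suc (suc k)) (suc x) = split (suc k) x

  data All≥0 : Path → Set where
    [] : All≥0 []
    _∷_ : ∀ {a J P} → 0ℚ ≤ a → All≥0 P → All≥0 ((a , J) ∷ P)

  0≤eJ : ∀ J {a} → 0ℚ ≤ a → ∀ c → 0ℚ ≤ eJ J a c
  0≤eJ J h c = 0≤𝟙 (all J c) ⊛ 0≤p (length c) h

  0≤coef : ∀ {P} → All≥0 P → ∀ c → 0ℚ ≤ coef P c
  0≤coef [] [] = 0≤1
  0≤coef [] (x ∷ c) = ≤-refl
  0≤coef {(a , J) ∷ P} (h ∷ hs) c = 0≤⋆ (0≤eJ J h) (0≤coef hs) c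

  0≤mass : ∀ {P} → All≥0 P → ∀ x → 0ℚ ≤ mass P x
  0≤mass [] x = ≤-refl
  0≤mass {(a , J) ∷ P} (h ∷ hs) x = 0≤𝟙 (J x) ⊛ h ⊹ 0≤mass hs x

  p-step≤ : ∀ n {t} → 0ℚ ≤ t → p (suc n) t ≤ p n t * t
  p-step≤ n {t} h = *-monoˡ (p n t) (0≤p n h) (subst (t * rec n ≤_) (*-identityʳ t) (*-monoˡ t h (rec≤1 n)))

  eJ≤ : ∀ J {a} → 0ℚ ≤ a → ∀ c → eJ J a c ≤ 1ℚ * prod (λ x → 𝟙 (J x) * a) c
  eJ≤ J h [] = ≤-refl
  eJ≤ J {a} h (x ∷ c) = ≤-trans (≤-reflexive (trans (cong (_* p (suc (length c)) a) (𝟙-∧ (J x) (all J c))) refl))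
    (≤-trans (*-monoˡ (𝟙 (J x) * 𝟙 (all J c)) (0≤𝟙 (J x) ⊛ 0≤𝟙 (all J c)) (p-step≤ (length c) h))
    (≤-trans (≤-reflexive (lem (𝟙 (J x)) (𝟙 (all J c)) (p (length c) a) a)) (≤-trans (*-monoˡ (𝟙 (J x) * a) (0≤𝟙 (J x) ⊛ h) (eJ≤ J h c)) (≤-reflexive (lem₂ (𝟙 (J x) * a) _)))))
    where
    opaque
      unfolding arith
      lem : ∀ i j q a → i * j * (q * a) ≡ i * a * (j * q)
      lem = solve-∀ R
      lem₂ : ∀ u v → u * (1ℚ * v) ≡ 1ℚ * (u * v)
      lem₂ = solve-∀ R

  -- A single stretch is dominated by a product of letter masses because `p (suc n) a` is at most
  -- `p n a * a`; under products the masses add by `⋆-bound`.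
  coef≤ : ∀ {P} → All≥0 P → ∀ c → coef P c ≤ prod (mass P) c
  coef≤ [] [] = ≤-refl
  coef≤ [] (x ∷ c) = ≤-reflexive (sym (*-zeroˡ _))
  coef≤ {(a , J) ∷ P} (h ∷ hs) c = ≤-trans (⋆-bound (λ x → 𝟙 (J x) * a) (mass P) 1ℚ 0≤1 (λ x → 0≤𝟙 (J x) ⊛ h) (0≤mass hs) (0≤coef hs) (eJ≤ J h) (coef≤ hs) c) (≤-reflexive (*-identityˡ _))

  stairs≥0 : ∀ k m → All≥0 (stairs k m)
  stairs≥0 k zero = 0≤1 ∷ []
  stairs≥0 k (suc m) = 0≤1 ∷ stairs≥0 (suc k) m

  stairs≤1 : ∀ m c → coef (stairs 0 m) c ≤ 1ℚ
  stairs≤1 m c = ≤-trans (coef≤ (stairs≥0 0 m) c) (prod-≤1 (0≤mass (stairs≥0 0 m)) (λ x → ≤-trans (≤-reflexive (stairs-mass 0 m x)) ≤-refl) c)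

-- Expansions in δ with uniform bounds.

module Expansions where
  open import Data.Nat as ℕ using (ℕ; zero; suc)
  import Data.Nat.Properties as ℕ
  open import Data.Bool using (Bool)
  open import Data.Fin using (Fin; zero; suc)
  open import Data.List using ([]; _∷_; length)
  open import Data.Product using (_×_; _,_; proj₁; proj₂)
  open import Relation.Binary.PropositionalEquality hiding (_≗_)
  open import Tactic.RingSolver using (solve-∀)
  open Rationals
  open Series
  open Gadgets

  Y : Set
  Y = Fin 3 → ℚ

  -- Keeps the lengths `½ + y` and `½ - y` of a gadget nonnegative.
  Box : Y → Set
  Box y = ∀ g → ∣ y g ∣ ≤ ½

  dist : Y → Y → ℚ
  dist y z = ∣ y zero - z zero ∣ + ∣ y (suc zero) - z (suc zero) ∣ + ∣ y (suc (suc zero)) - z (suc (suc zero)) ∣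

  0≤dist : ∀ y z → 0ℚ ≤ dist y z
  0≤dist y z = 0≤∣x∣ _ ⊹ 0≤∣x∣ _ ⊹ 0≤∣x∣ _

  coord≤dist : ∀ y z g → ∣ y g - z g ∣ ≤ dist y z
  coord≤dist y z zero = ≤-trans (≤+ _ (0≤∣x∣ (y (suc zero) - z (suc zero)))) (≤+ _ (0≤∣x∣ _))
  coord≤dist y z (suc zero) = ≤-trans (≤+ˡ _ (0≤∣x∣ (y zero - z zero))) (≤+ _ (0≤∣x∣ _))
  coord≤dist y z (suc (suc zero)) = ≤+ˡ _ (0≤∣x∣ _ ⊹ 0≤∣x∣ _)

  -- A single constant bounds both the values and the difference quotients, which keeps the
  -- constants of sums and products simple.
  record LipB (C : ℚ) (f : Y → ℚ) : Set where
    field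
      bd : ∀ {y} → Box y → ∣ f y ∣ ≤ C
      lp : ∀ {y z} → Box y → Box z → ∣ f y - f z ∣ ≤ C * dist y z

  open LipB public

  0-Y : Y
  0-Y _ = 0ℚ

  0-Box : Box 0-Y
  0-Box g = ∣0∣≤ 0≤½

  LipB-0≤ : ∀ {C f} → LipB C f → 0ℚ ≤ C
  LipB-0≤ h = 0≤of∣∣ (bd h {0-Y} 0-Box)

  LipB-cong : ∀ {C f g} → (∀ y → f y ≡ g y) → LipB C f → LipB C g
  LipB-cong {C} e h = record
    { bd = λ {y} b → subst (λ t → ∣ t ∣ ≤ C) (e y) (bd h b)
    ; lp = λ {y} {z} b c → subst₂ (λ s t → ∣ s - t ∣ ≤ C * dist y z) (e y) (e z) (lp h b c) }

  LipB-mono : ∀ {C D f} → C ≤ D → LipB C f → LipB D f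
  LipB-mono k h = record
    { bd = λ b → ≤-trans (bd h b) k
    ; lp = λ {y} {z} b c → ≤-trans (lp h b c) (*-monoʳ (dist y z) (0≤dist y z) k) }

  LipB-const : ∀ {C} c → ∣ c ∣ ≤ C → LipB C (λ _ → c)
  LipB-const {C} c h = record
    { bd = λ _ → h
    ; lp = λ {y} {z} _ _ → subst (λ t → ∣ t ∣ ≤ C * dist y z) (sym (+-inverseʳ c)) (∣0∣≤ (0≤of∣∣ h ⊛ 0≤dist y z)) }

  LipB-+ : ∀ {C D f g} → LipB C f → LipB D g → LipB (C + D) (λ y → f y + g y)
  LipB-+ {C} {D} {f} {g} h k = record
    { bd = λ b → ∣+∣≤ (bd h b) (bd k b)
    ; lp = λ {y} {z} b c → subst₂ (λ s t → ∣ s ∣ ≤ t) (lem (f y) (g y) (f z) (g z)) (sym (*-distribʳ-+ (dist y z) C D)) (∣+∣≤ (lp h b c) (lp k b c)) }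
    where
    opaque
      unfolding arith
      lem : ∀ a b c d → a - c + (b - d) ≡ a + b - (c + d)
      lem = solve-∀ R

  LipB-* : ∀ {C D f g} → LipB C f → LipB D g → LipB (C * D + C * D) (λ y → f y * g y)
  LipB-* {C} {D} {f} {g} h k = record
    { bd = λ b → ≤-trans (∣*∣≤ (bd h b) (bd k b)) (≤+ _ (LipB-0≤ h ⊛ LipB-0≤ k))
    ; lp = λ {y} {z} b c → subst₂ (λ s t → ∣ s ∣ ≤ t) (lem (f y) (g y) (f z) (g z)) (lem₂ C D (dist y z)) (∣+∣≤ (∣*∣≤ (lp h b c) (bd k b)) (∣*∣≤ (bd h c) (lp k b c))) }
    where
    opaque
      unfolding arith
      lem : ∀ a b c d → (a - c) * b + c * (b - d) ≡ a * b - c * d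
      lem = solve-∀ R
      lem₂ : ∀ C D e → C * e * D + C * (D * e) ≡ (C * D + C * D) * e
      lem₂ = solve-∀ R

  LipB-scale : ∀ {C f} a → ∣ a ∣ ≤ 1ℚ → LipB C f → LipB C (λ y → a * f y)
  LipB-scale {C} {f} a ha h = record
    { bd = λ b → subst (∣ _ ∣ ≤_) (*-identityˡ C) (∣*∣≤ ha (bd h b))
    ; lp = λ {y} {z} b c → subst₂ (λ s t → ∣ s ∣ ≤ t) (lem a (f y) (f z)) (*-identityˡ _) (∣*∣≤ ha (lp h b c)) }
    where
    opaque
      unfolding arith
      lem : ∀ a x y → a * (x - y) ≡ a * x - a * y
      lem = solve-∀ R

  LipB-coord : ∀ g → LipB 1ℚ (λ y → y g)
  LipB-coord g = record
    { bd = λ b → ≤-trans (b g) ½≤1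
    ; lp = λ {y} {z} b c → subst (∣ y g - z g ∣ ≤_) (sym (*-identityˡ _)) (coord≤dist y z g) }
    where
    ½≤1 : ½ ≤ 1ℚ
    ½≤1 = lin 0≤½ lem
      where
      opaque
        unfolding arith
        lem : 1ℚ ≡ ½ + ½
        lem = refl

  ∣1∣≤1 : ∣ 1ℚ ∣ ≤ 1ℚ
  ∣1∣≤1 = ≤-reflexive (∣∣-nn 0≤1)

  ∣𝟙∣≤1 : ∀ b → ∣ 𝟙 b ∣ ≤ 1ℚ
  ∣𝟙∣≤1 b = ≤-trans (≤-reflexive (∣∣-nn (0≤𝟙 b))) (𝟙≤1 b)

  powerBound : ℚ → ℕ → ℚ
  powerBound C zero = 1ℚ
  powerBound C (suc n) = powerBound C n * C + powerBound C n * C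

  LipB-p : ∀ {C f} → LipB C f → ∀ n → LipB (powerBound C n) (λ y → p n (f y))
  LipB-p h zero = LipB-const 1ℚ ∣1∣≤1
  LipB-p {f = f} h (suc n) = LipB-* (LipB-p h n) (LipB-cong (λ y → *-comm (rec n) (f y)) (LipB-scale (rec n) (≤-trans (≤-reflexive (∣∣-nn (0≤rec n))) (rec≤1 n)) h))

  -- The data on which no constant may depend: the scale of the gadgets, the number `suc top` of
  -- columns and the position of the thin sets.
  record Par : Set where
    constructor par
    field
      δ : ℚ
      top : ℕ
      cl : Fin 3 → ℕ → Class

  open Par public

  -- Three gadgets and the final stretch then take at most 4/8 of the path, which together with
  -- places up to 1/4 stays within total length 1.
  ⅛ : ℚ
  ⅛ = ½ * (½ * ½)

  record Ok (ω : Par) : Set where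
    field
      0≤δ : 0ℚ ≤ δ ω
      δ≤⅛ : δ ω ≤ ⅛

  open Ok public

  Fam : Set
  Fam = Par → Y → Ser

  infix 4 _≐_
  _≐_ : Fam → Fam → Set
  F ≐ G = ∀ ω y → F ω y ≗ G ω y

  -- `K` sees only the length of the word and nothing of `Par`, so the number of columns can be
  -- raised later without touching any estimate.
  record Bdd (F : Fam) : Set where
    constructor bdd
    field
      K : ℕ → ℚ
      ok : ∀ {ω} → Ok ω → ∀ c → LipB (K (length c)) (λ y → F ω y c)

  Bdd-cong : ∀ {F G} → F ≐ G → Bdd F → Bdd G
  Bdd-cong e (bdd K h) = bdd K λ {ω} o c → LipB-cong (λ y → e ω y c) (h o c)

  infixr 7 _✶_
  _✶_ : Fam → Fam → Fam
  (F ✶ G) ω y = F ω y ⋆ G ω y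

  infixl 6 _✚_
  _✚_ : Fam → Fam → Fam
  (F ✚ G) ω y = F ω y ⊞ G ω y

  infixr 8 _·_
  _·_ : (Par → ℚ) → Fam → Fam
  (s · F) ω y = s ω ⊡ F ω y

  Bdd-+ : ∀ {F G} → Bdd F → Bdd G → Bdd (F ✚ G)
  Bdd-+ (bdd K h) (bdd L k) = bdd (λ n → K n + L n) λ o c → LipB-+ (h o c) (k o c)

  Bdd-· : ∀ {F} s → (∀ {ω} → Ok ω → ∣ s ω ∣ ≤ 1ℚ) → Bdd F → Bdd (s · F)
  Bdd-· s b (bdd K h) = bdd K λ {ω} o c → LipB-scale (s ω) (b o) (h o c)

  Bdd-0 : Bdd (λ _ _ → 𝟘)
  Bdd-0 = bdd (λ _ → 0ℚ) λ o c → LipB-const 0ℚ (∣0∣≤ ≤-refl)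

  convBound : (ℕ → ℚ) → (ℕ → ℚ) → ℕ → ℚ
  convBound K L zero = K 0 * L 0 + K 0 * L 0
  convBound K L (suc n) = (K 0 * L (suc n) + K 0 * L (suc n)) + convBound (λ m → K (suc m)) L n

  LipB-⋆ : ∀ {F G : Y → Ser} K L → (∀ c → LipB (K (length c)) (λ y → F y c)) → (∀ c → LipB (L (length c)) (λ y → G y c)) →
    ∀ c → LipB (convBound K L (length c)) (λ y → (F y ⋆ G y) c)
  LipB-⋆ K L h k [] = LipB-* (h []) (k [])
  LipB-⋆ K L h k (x ∷ c) = LipB-+ (LipB-* (h []) (k (x ∷ c))) (LipB-⋆ (λ m → K (suc m)) L (λ l → h (x ∷ l)) k c)

  Bdd-⋆ : ∀ {F G} → Bdd F → Bdd G → Bdd (F ✶ G)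
  Bdd-⋆ (bdd K h) (bdd L k) = bdd (convBound K L) λ o → LipB-⋆ K L (h o) (k o)

  Bdd-eS : ∀ (a : Par → ℚ) → (∀ {ω} → Ok ω → 0ℚ ≤ a ω × a ω ≤ 1ℚ) → Bdd (λ ω _ → eS (a ω))
  Bdd-eS a h = bdd (λ _ → 1ℚ) λ {ω} o c → LipB-const (p (length c) (a ω)) (≤-trans (≤-reflexive (∣∣-nn (0≤p (length c) (proj₁ (h o))))) (p≤1 (length c) (proj₁ (h o)) (proj₂ (h o))))

  -- A deviation of order δ is absent because gadgets leave the coefficients of single letters
  -- unchanged.
  record Exp (A Λ X : Fam) : Set where
    constructor exp
    field
      E : Fam
      eq : ∀ ω y c → X ω y c ≡ A ω y c + δ ω * δ ω * Λ ω y c + δ ω * δ ω * δ ω * E ω y c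
      bA : Bdd A
      bΛ : Bdd Λ
      bE : Bdd E

  Exp-cong : ∀ {A A′ Λ Λ′ X X′} → A ≐ A′ → Λ ≐ Λ′ → X ≐ X′ → Exp A Λ X → Exp A′ Λ′ X′
  Exp-cong a l x (exp E eq bA bΛ bE) = exp E (λ ω y c → trans (sym (x ω y c)) (trans (eq ω y c) (cong₂ (λ s t → s + δ ω * δ ω * t + δ ω * δ ω * δ ω * E ω y c) (a ω y c) (l ω y c)))) (Bdd-cong a bA) (Bdd-cong l bΛ) bE

  opaque
    unfolding arith
    ½*½≤ : ½ * (½ * ½) ≤ 1ℚ
    ½*½≤ = D.≤ᵇ⇒≤ _
      where
      import Data.Rational.Properties as D
    0≤⅛ : 0ℚ ≤ ½ * (½ * ½)
    0≤⅛ = D.≤ᵇ⇒≤ _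
      where
      import Data.Rational.Properties as D

  δ≤1 : ∀ {ω} → Ok ω → δ ω ≤ 1ℚ
  δ≤1 o = ≤-trans (δ≤⅛ o) ½*½≤

  ∣δ∣≤1 : ∀ {ω} → Ok ω → ∣ δ ω ∣ ≤ 1ℚ
  ∣δ∣≤1 o = ≤-trans (≤-reflexive (∣∣-nn (0≤δ o))) (δ≤1 o)

  trilinˡ : ∀ s t (A L E G : Ser) → (A ⊞ s ⊡ L ⊞ t ⊡ E) ⋆ G ≗ (A ⋆ G) ⊞ s ⊡ (L ⋆ G) ⊞ t ⊡ (E ⋆ G)
  trilinˡ s t A L E G c = trans (⋆-distribʳ (A ⊞ s ⊡ L) (t ⊡ E) G c) (cong₂ _+_ (trans (⋆-distribʳ A (s ⊡ L) G c) (cong₂ _+_ refl (⋆-scaleˡ s L G c))) (⋆-scaleˡ t E G c))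

  trilinʳ : ∀ s t (A L E G : Ser) → G ⋆ (A ⊞ s ⊡ L ⊞ t ⊡ E) ≗ (G ⋆ A) ⊞ s ⊡ (G ⋆ L) ⊞ t ⊡ (G ⋆ E)
  trilinʳ s t A L E G c = trans (⋆-distribˡ G (A ⊞ s ⊡ L) (t ⊡ E) c) (cong₂ _+_ (trans (⋆-distribˡ G A (s ⊡ L) c) (cong₂ _+_ refl (⋆-scaleʳ s G L c))) (⋆-scaleʳ t G E c))

  -- The leading terms multiply and the δ² terms obey the product rule; every other product carries
  -- at least δ³ and is collected in `E″`.
  Exp-⋆ : ∀ {A Λ X A′ Λ′ X′} → Exp A Λ X → Exp A′ Λ′ X′ → Exp (A ✶ A′) (A ✶ Λ′ ✚ Λ ✶ A′) (X ✶ X′)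
  Exp-⋆ {A} {Λ} {X} {A′} {Λ′} {X′} (exp E eq bA bΛ bE) (exp E′ eq′ bA′ bΛ′ bE′) = exp E″ eq″ (Bdd-⋆ bA bA′) (Bdd-+ (Bdd-⋆ bA bΛ′) (Bdd-⋆ bΛ bA′))
    (Bdd-+ (Bdd-+ (Bdd-⋆ bA bE′) (Bdd-⋆ bE bA′)) (Bdd-· δ ∣δ∣≤1 (Bdd-+ (Bdd-⋆ bΛ bΛ′) (Bdd-· δ ∣δ∣≤1 (Bdd-+ (Bdd-+ (Bdd-⋆ bΛ bE′) (Bdd-⋆ bE bΛ′)) (Bdd-· δ ∣δ∣≤1 (Bdd-⋆ bE bE′)))))))
    where
    E″ : Fam
    E″ = A ✶ E′ ✚ E ✶ A′ ✚ δ · (Λ ✶ Λ′ ✚ δ · (Λ ✶ E′ ✚ E ✶ Λ′ ✚ δ · (E ✶ E′)))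
    opaque
      unfolding arith
      lem : ∀ δ aa al ae la ll le ea el ee →
        (aa + δ * δ * al + δ * δ * δ * ae) + δ * δ * (la + δ * δ * ll + δ * δ * δ * le) + δ * δ * δ * (ea + δ * δ * el + δ * δ * δ * ee)
        ≡ aa + δ * δ * (al + la) + δ * δ * δ * (ae + ea + δ * (ll + δ * (le + el + δ * ee)))
      lem = solve-∀ R
    eq″ : ∀ ω y c → (X ✶ X′) ω y c ≡ (A ✶ A′) ω y c + δ ω * δ ω * (A ✶ Λ′ ✚ Λ ✶ A′) ω y c + δ ω * δ ω * δ ω * E″ ω y c
    eq″ ω y c = trans (⋆-cong (eq ω y) (eq′ ω y) c) (trans (trilinˡ d² d³ (A ω y) (Λ ω y) (E ω y) G c)
      (trans (cong₂ _+_ (cong₂ (λ s t → s + d² * t) (tr (A ω y)) (tr (Λ ω y))) (cong (d³ *_) (tr (E ω y)))) (lem (δ ω) _ _ _ _ _ _ _ _ _)))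
      where
      d² d³ : ℚ
      d² = δ ω * δ ω
      d³ = δ ω * δ ω * δ ω
      G : Ser
      G = A′ ω y ⊞ d² ⊡ Λ′ ω y ⊞ d³ ⊡ E′ ω y
      tr : ∀ H → (H ⋆ G) c ≡ (H ⋆ A′ ω y) c + d² * (H ⋆ Λ′ ω y) c + d³ * (H ⋆ E′ ω y) c
      tr H = trilinʳ d² d³ (A′ ω y) (Λ′ ω y) (E′ ω y) H c

  0F : Fam
  0F _ _ = 𝟘

  Exp-eS : ∀ (a : Par → ℚ) → (∀ {ω} → Ok ω → 0ℚ ≤ a ω × a ω ≤ 1ℚ) → Exp (λ ω _ → eS (a ω)) 0F (λ ω _ → eS (a ω))
  Exp-eS a h = exp 0F (λ ω y c → lem (p (length c) (a ω)) (δ ω * δ ω) (δ ω * δ ω * δ ω)) (Bdd-eS a h) Bdd-0 Bdd-0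
    where
    opaque
      unfolding arith
      lem : ∀ u s t → u ≡ u + s * 0ℚ + t * 0ℚ
      lem = solve-∀ R

  pow≤1 : ∀ {a} → 0ℚ ≤ a → a ≤ 1ℚ → ∀ n → 0ℚ ≤ pow a n × pow a n ≤ 1ℚ
  pow≤1 h k zero = 0≤1 , ≤-refl
  pow≤1 h k (suc n) = let u , v = pow≤1 h k n in h ⊛ u , *≤1 h k v

  gadgetFam : Fin 3 → Fam
  gadgetFam g ω y = coef (gadget (cl ω g) (y g))

  stairsFam : Fam
  stairsFam ω y = coef (stairs 0 (top ω))

  ΔFam : Fin 3 → Fam
  ΔFam g ω y = y g ⊡ two (λ a b → Δ (cl ω g a) (cl ω g b))

  Bdd-eJ : ∀ (J : Par → ℕ → Bool) {C} (f : Y → ℚ) → LipB C f → Bdd (λ ω y → eJ (J ω) (f y))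
  Bdd-eJ J {C} f h = bdd (powerBound C) λ {ω} o c → LipB-scale (𝟙 (all (J ω) c)) (∣𝟙∣≤1 (all (J ω) c)) (LipB-p h (length c))

  Bdd-one : Bdd (λ _ _ → one)
  Bdd-one = bdd (λ _ → 1ℚ) λ { o [] → LipB-const 1ℚ ∣1∣≤1 ; o (x ∷ c) → LipB-const 0ℚ (∣0∣≤ 0≤1) }

  Bdd-gadget : ∀ g → Bdd (gadgetFam g)
  Bdd-gadget g = Bdd-⋆ (Bdd-eJ (ind is₃) (λ _ → ½) half) (Bdd-⋆ (Bdd-eJ (ind is₁) (λ y → ½ + y g) (LipB-+ half (LipB-coord g)))
    (Bdd-⋆ (Bdd-eJ (ind is₂) (λ _ → 1ℚ) (LipB-const 1ℚ ∣1∣≤1)) (Bdd-⋆ (Bdd-eJ (ind is₁) (λ y → ½ - y g) (LipB-+ half (LipB-neg (LipB-coord g)))) (Bdd-⋆ (Bdd-eJ (ind is₃) (λ _ → ½) half) Bdd-one))))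
    where
    ind : (Class → Bool) → Par → ℕ → Bool
    ind i ω c = i (cl ω g c)
    half : LipB ½ (λ _ → ½)
    half = LipB-const ½ (≤-reflexive (∣∣-nn 0≤½))
    LipB-neg : ∀ {C f} → LipB C f → LipB C (λ y → - f y)
    LipB-neg {f = f} h = LipB-cong (λ y → lem (f y)) (LipB-scale (- 1ℚ) (≤-reflexive (trans (∣-x∣ 1ℚ) (∣∣-nn 0≤1))) h)
      where
      opaque
        unfolding arith
        lem : ∀ a → - 1ℚ * a ≡ - a
        lem = solve-∀ R

  Bdd-stairs : Bdd stairsFam
  Bdd-stairs = bdd (λ _ → 1ℚ) λ {ω} o c → LipB-const _ (≤-trans (≤-reflexive (∣∣-nn (0≤coef (stairs≥0 0 (top ω)) c))) (stairs≤1 (top ω) c))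

  Bdd-Δ : ∀ g → Bdd (ΔFam g)
  Bdd-Δ g = bdd (λ _ → 1ℚ) λ {ω} o c → LipB-cong (λ y → *-comm _ (y g)) (LipB-scale (two (h ω) c) (bound (h ω) (λ a b → ∣Δ∣≤1 (cl ω g a) (cl ω g b)) c) (LipB-coord g))
    where
    h : Par → ℕ → ℕ → ℚ
    h ω a b = Δ (cl ω g a) (cl ω g b)
    ∣Δ∣≤1 : ∀ k l → ∣ Δ k l ∣ ≤ 1ℚ
    ∣Δ∣≤1 first first = ∣0∣≤ 0≤1
    ∣Δ∣≤1 first second = ∣1∣≤1
    ∣Δ∣≤1 first other = ∣0∣≤ 0≤1
    ∣Δ∣≤1 second first = ≤-reflexive (trans (∣-x∣ 1ℚ) (∣∣-nn 0≤1))
    ∣Δ∣≤1 second second = ∣0∣≤ 0≤1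
    ∣Δ∣≤1 second other = ∣0∣≤ 0≤1
    ∣Δ∣≤1 other first = ∣0∣≤ 0≤1
    ∣Δ∣≤1 other second = ∣0∣≤ 0≤1
    ∣Δ∣≤1 other other = ∣0∣≤ 0≤1
    bound : ∀ h → (∀ a b → ∣ h a b ∣ ≤ 1ℚ) → ∀ c → ∣ two h c ∣ ≤ 1ℚ
    bound h k [] = ∣0∣≤ 0≤1
    bound h k (x ∷ []) = ∣0∣≤ 0≤1
    bound h k (x ∷ y ∷ []) = k x y
    bound h k (x ∷ y ∷ z ∷ c) = ∣0∣≤ 0≤1

  homogFam : (Par → ℚ) → Fam → Fam
  homogFam s F ω y = homog (s ω) (F ω y)

  -- A rescaled series divided by the third power of the scale, with words of fewer than three
  -- letters removed.
  tail₃ : (Par → ℚ) → Fam → Fam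
  tail₃ s F ω y (x ∷ z ∷ t ∷ c) = pow (s ω) (length c) * F ω y (x ∷ z ∷ t ∷ c)
  tail₃ s F ω y _ = 0ℚ

  tail₂ : (Par → ℚ) → Fam → Fam
  tail₂ s F ω y (x ∷ z ∷ c) = pow (s ω) (length c) * F ω y (x ∷ z ∷ c)
  tail₂ s F ω y _ = 0ℚ

  module _ {F : Fam} (s : Par → ℚ) (hs : ∀ {ω} → Ok ω → 0ℚ ≤ s ω × s ω ≤ 1ℚ) where
    private
      ∣pow∣≤1 : ∀ {ω} → Ok ω → ∀ n → ∣ pow (s ω) n ∣ ≤ 1ℚ
      ∣pow∣≤1 o n = let u , v = pow≤1 (proj₁ (hs o)) (proj₂ (hs o)) n in ≤-trans (≤-reflexive (∣∣-nn u)) v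

    Bdd-tail₃ : Bdd F → Bdd (tail₃ s F)
    Bdd-tail₃ (bdd K h) = bdd K λ where
      o [] → LipB-const 0ℚ (∣0∣≤ (LipB-0≤ (h o [])))
      o (x ∷ []) → LipB-const 0ℚ (∣0∣≤ (LipB-0≤ (h o (x ∷ []))))
      o (x ∷ z ∷ []) → LipB-const 0ℚ (∣0∣≤ (LipB-0≤ (h o (x ∷ z ∷ []))))
      o (x ∷ z ∷ t ∷ c) → LipB-scale _ (∣pow∣≤1 o (length c)) (h o (x ∷ z ∷ t ∷ c))

    Bdd-tail₂ : Bdd F → Bdd (tail₂ s F)
    Bdd-tail₂ (bdd K h) = bdd K λ where
      o [] → LipB-const 0ℚ (∣0∣≤ (LipB-0≤ (h o [])))
      o (x ∷ []) → LipB-const 0ℚ (∣0∣≤ (LipB-0≤ (h o (x ∷ []))))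
      o (x ∷ z ∷ c) → LipB-scale _ (∣pow∣≤1 o (length c)) (h o (x ∷ z ∷ c))

  minus-p : Fam → Fam
  minus-p F ω y c = F ω y c - p (length c) 1ℚ

  Bdd-minus-p : ∀ {F} → Bdd F → Bdd (minus-p F)
  Bdd-minus-p {F} (bdd K h) = bdd (λ n → K n + 1ℚ) λ {ω} o c → LipB-+ (h o c) (LipB-const _ (subst (_≤ 1ℚ) (sym (trans (∣-x∣ _) (∣∣-nn (0≤p (length c) 0≤1)))) (p≤1 (length c) 0≤1 ≤-refl)))

  0≤δ≤1 : ∀ {ω} → Ok ω → 0ℚ ≤ δ ω × δ ω ≤ 1ℚ
  0≤δ≤1 o = 0≤δ o , δ≤1 o

  δ² : Par → ℚ
  δ² ω = δ ω * δ ω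

  0≤δ²≤1 : ∀ {ω} → Ok ω → 0ℚ ≤ δ² ω × δ² ω ≤ 1ℚ
  0≤δ²≤1 o = 0≤δ o ⊛ 0≤δ o , *≤1 (0≤δ o) (δ≤1 o) (δ≤1 o)

  p-homog : ∀ n s → p n s ≡ pow s n * p n 1ℚ
  p-homog n s = trans (cong (p n) (sym (*-identityʳ s))) (p-pow n s 1ℚ)

  -- At scale δ a word of n letters carries the factor `δ ^ n`: up to one letter the gadget agrees
  -- with a uniform stretch, two letters give the deviation, and longer words go into the remainder.
  Exp-gadget : ∀ g → Exp (λ ω _ → eS (δ ω)) (ΔFam g) (homogFam δ (gadgetFam g))
  Exp-gadget g = exp (tail₃ δ (minus-p (gadgetFam g))) eq (Bdd-eS δ 0≤δ≤1) (Bdd-Δ g) (Bdd-tail₃ δ 0≤δ≤1 (Bdd-minus-p (Bdd-gadget g)))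
    where
    opaque
      unfolding arith
      e₀ : ∀ s t u → 1ℚ * 1ℚ ≡ 1ℚ + s * (u * 0ℚ) + t * 0ℚ
      e₀ = solve-∀ R
      e₁ : ∀ d s t u → d * 1ℚ * 1ℚ ≡ d + s * (u * 0ℚ) + t * 0ℚ
      e₁ = solve-∀ R
      e₂ : ∀ d y D t → d * (d * 1ℚ) * (½ + y * D) ≡ ½ * (d * d) + d * d * (y * D) + t * 0ℚ
      e₂ = solve-∀ R
      e₃ : ∀ d q b r u → d * (d * (d * q)) * b ≡ d * (d * (d * q)) * r + d * d * (u * 0ℚ) + d * d * d * (q * (b - r))
      e₃ = solve-∀ R
    eq : ∀ ω y c → homogFam δ (gadgetFam g) ω y c ≡ eS (δ ω) c + δ ω * δ ω * ΔFam g ω y c + δ ω * δ ω * δ ω * tail₃ δ (minus-p (gadgetFam g)) ω y c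
    eq ω y [] = trans (cong (1ℚ *_) (coef-[] (gadget (cl ω g) (y g)))) (e₀ _ _ (y g))
    eq ω y (x ∷ []) = trans (cong (δ ω * 1ℚ *_) (gadget-one (cl ω g) (y g) x)) (trans (e₁ (δ ω) (δ ω * δ ω) (δ ω * δ ω * δ ω) (y g)) (cong (λ t → t + δ ω * δ ω * (y g * 0ℚ) + δ ω * δ ω * δ ω * 0ℚ) (sym (p-one (δ ω)))))
    eq ω y (x ∷ z ∷ []) = trans (cong (δ ω * (δ ω * 1ℚ) *_) (gadget-two (cl ω g) (y g) x z)) (trans (e₂ (δ ω) (y g) _ (δ ω * δ ω * δ ω)) (cong (λ t → t + δ ω * δ ω * (y g * Δ (cl ω g x) (cl ω g z)) + δ ω * δ ω * δ ω * 0ℚ) (sym (p-two (δ ω)))))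
    eq ω y (x ∷ z ∷ t ∷ c) = trans (e₃ (δ ω) (pow (δ ω) (length c)) (gadgetFam g ω y (x ∷ z ∷ t ∷ c)) (p (3 ℕ.+ length c) 1ℚ) (y g))
      (cong (λ t′ → t′ + δ ω * δ ω * (y g * 0ℚ) + δ ω * δ ω * δ ω * (pow (δ ω) (length c) * minus-p (gadgetFam g) ω y (x ∷ z ∷ t ∷ c))) (sym (p-homog (3 ℕ.+ length c) (δ ω))))

  -- At scale δ² agreement on words of at most one letter is enough, since two letters already carry
  -- δ⁴.
  Exp-stairs : Exp (λ ω _ → eS (δ² ω)) 0F (homogFam δ² stairsFam)
  Exp-stairs = exp (δ · tail₂ δ² (minus-p stairsFam)) eq (Bdd-eS δ² 0≤δ²≤1) Bdd-0 (Bdd-· δ ∣δ∣≤1 (Bdd-tail₂ δ² 0≤δ²≤1 (Bdd-minus-p Bdd-stairs)))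
    where
    opaque
      unfolding arith
      e₀ : ∀ s t u → 1ℚ * 1ℚ ≡ 1ℚ + s * 0ℚ + t * (u * 0ℚ)
      e₀ = solve-∀ R
      e₁ : ∀ d s t u → d * 1ℚ * 1ℚ ≡ d + s * 0ℚ + t * (u * 0ℚ)
      e₁ = solve-∀ R
      e₂ : ∀ d q b r → d * d * (d * d * q) * b ≡ d * d * (d * d * q) * r + d * d * 0ℚ + d * d * d * (d * (q * (b - r)))
      e₂ = solve-∀ R
    eq : ∀ ω y c → homogFam δ² stairsFam ω y c ≡ eS (δ² ω) c + δ ω * δ ω * 0ℚ + δ ω * δ ω * δ ω * (δ · tail₂ δ² (minus-p stairsFam)) ω y c
    eq ω y [] = trans (cong (1ℚ *_) (coef-[] (stairs 0 (top ω)))) (e₀ _ _ (δ ω))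
    eq ω y (x ∷ []) = trans (cong (δ² ω * 1ℚ *_) (trans (coef-mass (stairs 0 (top ω)) x) (stairs-mass 0 (top ω) x))) (trans (e₁ (δ² ω) (δ ω * δ ω) (δ ω * δ ω * δ ω) (δ ω)) (cong (λ t → t + δ ω * δ ω * 0ℚ + δ ω * δ ω * δ ω * (δ ω * 0ℚ)) (sym (p-one (δ² ω)))))
    eq ω y (x ∷ z ∷ c) = trans (e₂ (δ ω) (pow (δ² ω) (length c)) (stairsFam ω y (x ∷ z ∷ c)) (p (2 ℕ.+ length c) 1ℚ))
      (cong (λ t′ → t′ + δ ω * δ ω * 0ℚ + δ ω * δ ω * δ ω * (δ ω * (pow (δ² ω) (length c) * minus-p stairsFam ω y (x ∷ z ∷ c)))) (sym (p-homog (2 ℕ.+ length c) (δ² ω))))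

-- The perturbed path and its expansion.

module TestPaths where
  open import Data.Nat using (ℕ; zero; suc)
  open import Data.Fin using (Fin; zero; suc)
  open import Data.List using ([]; _∷_; _++_; length)
  open import Data.Product using (_×_; _,_; proj₁; proj₂)
  open import Relation.Binary.PropositionalEquality hiding (_≗_)
  open import Tactic.RingSolver using (solve-∀)
  open Rationals
  open Series
  open Gadgets
  open Expansions

  h-of : Par → Fin 3 → ℕ → ℕ → ℚ
  h-of ω g a b = Δ (cl ω g a) (cl ω g b)

  eS-shift : ∀ a a′ b h → eS a ⋆ sw a′ b h 0 ≗ sw (a + a′) b h 0
  eS-shift a a′ b h c = trans (⋆-congˡ (λ l → sym (sandwich a′ b h l)) c) (trans (sym (⋆-assoc (eS a) (eS a′) (two h ⋆ eS b) c))
    (trans (⋆-congʳ (eS-+ a a′) c) (sandwich (a + a′) b h c)))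

  eS-pull : ∀ a b s h → eS a ⋆ ((s ⊡ two h) ⋆ eS b) ≗ s ⊡ sw a b h 0
  eS-pull a b s h c = trans (⋆-congˡ (⋆-scaleˡ s (two h) (eS b)) c) (trans (⋆-scaleʳ s (eS a) (two h ⋆ eS b) c) (cong (s *_) (sandwich a b h c)))

  swF : (Par → ℚ) → (Par → ℚ) → Fin 3 → Fam
  swF a b g ω y = y g ⊡ sw (a ω) (b ω) (h-of ω g) 0

  seg : (Par → ℚ) → Fam
  seg a ω _ = eS (a ω)

  InUnit : (Par → ℚ) → Set
  InUnit a = ∀ {ω} → Ok ω → 0ℚ ≤ a ω × a ω ≤ 1ℚ

  -- Paths are expanded from their end: prepending a stretch and a gadget adds one new response and
  -- shifts those already present by `a + δ`.
  Exp-step : ∀ {b Λ X} (a : Par → ℚ) g → InUnit a → Exp (seg b) Λ X →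
    Exp (seg (λ ω → a ω + (δ ω + b ω))) (swF a b g ✚ seg (λ ω → a ω + δ ω) ✶ Λ) (seg a ✶ (homogFam δ (gadgetFam g) ✶ X))
  Exp-step {b} {Λ} a g ha e = Exp-cong eA eΛ (λ _ _ _ → refl) (Exp-⋆ (Exp-eS a ha) (Exp-⋆ (Exp-gadget g) e))
    where
    eA : seg a ✶ (seg δ ✶ seg b) ≐ seg (λ ω → a ω + (δ ω + b ω))
    eA ω y c = trans (⋆-congˡ (eS-+ (δ ω) (b ω)) c) (eS-+ (a ω) (δ ω + b ω) c)
    eΛ : seg a ✶ (seg δ ✶ Λ ✚ ΔFam g ✶ seg b) ✚ 0F ✶ (seg δ ✶ seg b) ≐ swF a b g ✚ seg (λ ω → a ω + δ ω) ✶ Λ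
    eΛ ω y c = trans (cong₂ _+_ (trans (⋆-distribˡ (eS (a ω)) (eS (δ ω) ⋆ Λ ω y) (ΔFam g ω y ⋆ eS (b ω)) c)
        (cong₂ _+_ (trans (sym (⋆-assoc (eS (a ω)) (eS (δ ω)) (Λ ω y) c)) (⋆-congʳ (eS-+ (a ω) (δ ω)) c)) (eS-pull (a ω) (b ω) (y g) (h-of ω g) c)))
        (⋆-zeroˡ (eS (δ ω) ⋆ eS (b ω)) c)) (trans (+-identityʳ _) (+-comm _ _))

  -- The gadgets come in the order 2, 1, 0 along the path, so the places decrease with the index;
  -- `locate` finds them in this way, each below the preceding one.
  module Total (x : Fin 3 → ℚ) (0≤x₂ : 0ℚ ≤ x (suc (suc zero))) (x₂≤x₁ : x (suc (suc zero)) ≤ x (suc zero)) (x₁≤x₀ : x (suc zero) ≤ x zero) (x₀≤ : x zero ≤ ½ * ½) where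

    a₀ a₁ a₂ rest : ℚ
    a₂ = x (suc (suc zero))
    a₁ = x (suc zero) - x (suc (suc zero))
    a₀ = x zero - x (suc zero)
    rest = 1ℚ - x zero

    -- The last uniform stretch is shortened by the three gadgets and the final stretch, so that
    -- every column has total length exactly 1.
    restδ : Par → ℚ
    restδ ω = rest - (δ ω + δ ω + δ ω + δ² ω)

    private
      opaque
        unfolding arith
        ¼≤1 : ½ * ½ ≤ 1ℚ
        ¼≤1 = D.≤ᵇ⇒≤ _
          where
          import Data.Rational.Properties as D
        num : 0ℚ ≤ 1ℚ - ½ * ½ - (⅛ + ⅛ + ⅛ + ⅛)
        num = D.≤ᵇ⇒≤ _
          where
          import Data.Rational.Properties as D
        lem₁ : ∀ a b → b ≡ b - a + a
        lem₁ = solve-∀ R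
        lem₂ : ∀ x a b d → 1ℚ - x - (d + d + d + d * d) ≡ (1ℚ - b - (a + a + a + a)) + ((b - x) + ((a - d) + (a - d) + (a - d) + (a - d) + d * (1ℚ - d)))
        lem₂ = solve-∀ R
        lem₃ : ∀ x d → 1ℚ ≡ 1ℚ - x - (d + d + d + d * d) + (x + (d + d + d + d * d))
        lem₃ = solve-∀ R
      x₁≤ : x (suc zero) ≤ ½ * ½
      x₁≤ = ≤-trans x₁≤x₀ x₀≤
      unit₂ : InUnit (λ _ → a₂)
      unit₂ _ = 0≤x₂ , ≤-trans x₂≤x₁ (≤-trans x₁≤ ¼≤1)
      unit₁ : InUnit (λ _ → a₁)
      unit₁ _ = gap x₂≤x₁ , ≤-trans (lin {t = a₂} 0≤x₂ (lem₁ a₂ (x (suc zero)))) (≤-trans x₁≤ ¼≤1)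
      unit₀ : InUnit (λ _ → a₀)
      unit₀ _ = gap x₁≤x₀ , ≤-trans (lin {t = x (suc zero)} (≤-trans 0≤x₂ x₂≤x₁) (lem₁ (x (suc zero)) (x zero))) (≤-trans x₀≤ ¼≤1)
      0≤x₀ : 0ℚ ≤ x zero
      0≤x₀ = ≤-trans 0≤x₂ (≤-trans x₂≤x₁ x₁≤x₀)
      unitδ : InUnit restδ
      unitδ {ω} o = subst (0ℚ ≤_) (sym (lem₂ (x zero) ⅛ (½ * ½) (δ ω))) (num ⊹ (gap x₀≤ ⊹ (g ⊹ g ⊹ g ⊹ g ⊹ 0≤δ o ⊛ gap (δ≤1 o))))
                  , lin (0≤x₀ ⊹ (0≤δ o ⊹ 0≤δ o ⊹ 0≤δ o ⊹ 0≤δ o ⊛ 0≤δ o)) (lem₃ (x zero) (δ ω))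
        where
        g : 0ℚ ≤ ⅛ - δ ω
        g = gap (δ≤⅛ o)

    total : Fam
    total = seg (λ _ → a₂) ✶ (homogFam δ (gadgetFam (suc (suc zero))) ✶ (seg (λ _ → a₁) ✶ (homogFam δ (gadgetFam (suc zero)) ✶
            (seg (λ _ → a₀) ✶ (homogFam δ (gadgetFam zero) ✶ (seg restδ ✶ homogFam δ² stairsFam))))))

    -- Lengths of the path before and after gadget `g`; they differ from `x g` and `1 - x g` by at
    -- most 3δ.
    pre post : Fin 3 → Par → ℚ
    pre zero ω = x zero + (δ ω + δ ω)
    pre (suc zero) ω = x (suc zero) + δ ω
    pre (suc (suc zero)) ω = x (suc (suc zero))
    post zero ω = 1ℚ - x zero - (δ ω + δ ω + δ ω)
    post (suc zero) ω = 1ℚ - x (suc zero) - (δ ω + δ ω)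
    post (suc (suc zero)) ω = 1ℚ - x (suc (suc zero)) - δ ω

    ΛF : Fam
    ΛF = swF (pre zero) (post zero) zero ✚ swF (pre (suc zero)) (post (suc zero)) (suc zero) ✚ swF (pre (suc (suc zero))) (post (suc (suc zero))) (suc (suc zero))

    private
      b₁ b₂ b₃ : Par → ℚ
      b₁ ω = restδ ω + δ² ω
      b₂ ω = a₀ + (δ ω + b₁ ω)
      b₃ ω = a₁ + (δ ω + b₂ ω)
      e₀ : Exp (seg b₁) 0F (seg restδ ✶ homogFam δ² stairsFam)
      e₀ = Exp-cong (λ ω y → eS-+ (restδ ω) (δ² ω)) eΛ (λ _ _ _ → refl) (Exp-⋆ (Exp-eS restδ unitδ) Exp-stairs)
        where
        eΛ : seg restδ ✶ 0F ✚ 0F ✶ seg δ² ≐ 0F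
        eΛ ω y c = trans (cong₂ _+_ (⋆-zeroʳ (eS (restδ ω)) c) (⋆-zeroˡ (eS (δ² ω)) c)) (+-identityˡ 0ℚ)
      e₁ = Exp-step (λ _ → a₀) zero unit₀ e₀
      e₂ = Exp-step (λ _ → a₁) (suc zero) unit₁ e₁
      e₃ = Exp-step (λ _ → a₂) (suc (suc zero)) unit₂ e₂

      opaque
        unfolding arith
        q₀ : ∀ x₀ d → 1ℚ - x₀ - (d + d + d + d * d) + d * d ≡ 1ℚ - x₀ - (d + d + d)
        q₀ = solve-∀ R
        q₁ : ∀ x₀ x₁ d → x₀ - x₁ + (d + (1ℚ - x₀ - (d + d + d + d * d) + d * d)) ≡ 1ℚ - x₁ - (d + d)
        q₁ = solve-∀ R
        q₂ : ∀ x₀ x₁ x₂ d → x₁ - x₂ + (d + (x₀ - x₁ + (d + (1ℚ - x₀ - (d + d + d + d * d) + d * d)))) ≡ 1ℚ - x₂ - d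
        q₂ = solve-∀ R
        q₃ : ∀ x₀ x₁ x₂ d → x₂ + (d + (x₁ - x₂ + (d + (x₀ - x₁ + (d + (1ℚ - x₀ - (d + d + d + d * d) + d * d)))))) ≡ 1ℚ
        q₃ = solve-∀ R
        r₁ : ∀ x₁ x₂ d → (x₂ + d) + (x₁ - x₂) ≡ x₁ + d
        r₁ = solve-∀ R
        r₀ : ∀ x₀ x₁ x₂ d → (x₂ + d) + ((x₁ - x₂ + d) + (x₀ - x₁)) ≡ x₀ + (d + d)
        r₀ = solve-∀ R
        fin : ∀ u v w → u + (v + (w + 0ℚ)) ≡ w + v + u
        fin = solve-∀ R

    expansion : Exp (seg (λ _ → 1ℚ)) ΛF total
    expansion = Exp-cong (λ ω y c → cong (p (length c)) (q₃ (x zero) (x (suc zero)) a₂ (δ ω))) eΛ (λ _ _ _ → refl) e₃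
      where
      shift : ∀ a a′ b s h c → (eS a ⋆ (s ⊡ sw a′ b h 0)) c ≡ s * sw (a + a′) b h 0 c
      shift a a′ b s h c = trans (⋆-scaleʳ s (eS a) (sw a′ b h 0) c) (cong (s *_) (eS-shift a a′ b h c))
      eΛ : swF (λ _ → a₂) b₃ (suc (suc zero)) ✚ seg (λ ω → a₂ + δ ω) ✶ (swF (λ _ → a₁) b₂ (suc zero) ✚ seg (λ ω → a₁ + δ ω) ✶ (swF (λ _ → a₀) b₁ zero ✚ seg (λ ω → a₀ + δ ω) ✶ 0F)) ≐ ΛF
      eΛ ω y c = trans (cong₂ _+_ t₂ (trans (⋆-distribˡ u₂ (swF (λ _ → a₁) b₂ (suc zero) ω y) (u₁ ⋆ (s₀ ⊞ u₀ ⋆ 𝟘)) c) (cong₂ _+_ t₁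
          (trans (⋆-congˡ (⋆-distribˡ u₁ s₀ (u₀ ⋆ 𝟘)) c) (trans (⋆-distribˡ u₂ (u₁ ⋆ s₀) (u₁ ⋆ (u₀ ⋆ 𝟘)) c) (cong₂ _+_ t₀ z))))))
          (fin _ _ _)
        where
        u₂ u₁ u₀ s₀ : Ser
        u₂ = eS (a₂ + δ ω)
        u₁ = eS (a₁ + δ ω)
        u₀ = eS (a₀ + δ ω)
        s₀ = swF (λ _ → a₀) b₁ zero ω y
        t₂ : swF (λ _ → a₂) b₃ (suc (suc zero)) ω y c ≡ swF (pre (suc (suc zero))) (post (suc (suc zero))) (suc (suc zero)) ω y c
        t₂ = cong (λ b → y (suc (suc zero)) * sw a₂ b (h-of ω (suc (suc zero))) 0 c) (q₂ (x zero) (x (suc zero)) a₂ (δ ω))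
        t₁ : (u₂ ⋆ swF (λ _ → a₁) b₂ (suc zero) ω y) c ≡ swF (pre (suc zero)) (post (suc zero)) (suc zero) ω y c
        t₁ = trans (shift (a₂ + δ ω) a₁ (b₂ ω) (y (suc zero)) (h-of ω (suc zero)) c)
               (cong₂ (λ a b → y (suc zero) * sw a b (h-of ω (suc zero)) 0 c) (r₁ (x (suc zero)) a₂ (δ ω)) (q₁ (x zero) (x (suc zero)) (δ ω)))
        t₀ : (u₂ ⋆ (u₁ ⋆ s₀)) c ≡ swF (pre zero) (post zero) zero ω y c
        t₀ = trans (sym (⋆-assoc u₂ u₁ s₀ c)) (trans (⋆-congʳ (eS-+ (a₂ + δ ω) (a₁ + δ ω)) c) (trans (shift (a₂ + δ ω + (a₁ + δ ω)) a₀ (b₁ ω) (y zero) (h-of ω zero) c)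
               (cong₂ (λ a b → y zero * sw a b (h-of ω zero) 0 c) (trans (+-assoc (a₂ + δ ω) (a₁ + δ ω) a₀) (r₀ (x zero) (x (suc zero)) a₂ (δ ω))) (q₀ (x zero) (δ ω)))))
        z : (u₂ ⋆ (u₁ ⋆ (u₀ ⋆ 𝟘))) c ≡ 0ℚ
        z = trans (⋆-congˡ (λ l → trans (⋆-congˡ (⋆-zeroʳ u₀) l) (⋆-zeroʳ u₁ l)) c) (⋆-zeroʳ u₂ c)

    gad : Fin 3 → Par → Y → Path
    gad g ω y = scale (δ ω) (gadget (cl ω g) (y g))

    end₀ end₁ end₂ path : Par → Y → Path
    end₀ ω y = (restδ ω , every) ∷ scale (δ² ω) (stairs 0 (top ω))
    end₁ ω y = (a₀ , every) ∷ gad zero ω y ++ end₀ ω y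
    end₂ ω y = (a₁ , every) ∷ gad (suc zero) ω y ++ end₁ ω y
    path ω y = (a₂ , every) ∷ gad (suc (suc zero)) ω y ++ end₂ ω y

    coef-path : ∀ ω y → coef (path ω y) ≗ total ω y
    coef-path ω y = piece a₂ (suc (suc zero)) (end₂ ω y) (piece a₁ (suc zero) (end₁ ω y) (piece a₀ zero (end₀ ω y) (⋆-cong (eJ-every (restδ ω)) (coef-scale (δ² ω) (stairs 0 (top ω))))))
      where
      piece : ∀ {F} a g P → coef P ≗ F → coef ((a , every) ∷ gad g ω y ++ P) ≗ eS a ⋆ (homogFam δ (gadgetFam g) ω y ⋆ F)
      piece a g P e = ⋆-cong (eJ-every a) (λ c → trans (coef-++ (gad g ω y) P c) (⋆-cong (coef-scale (δ ω) (gadget (cl ω g) (y g))) e c))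

    scale≥0 : ∀ {s P} → 0ℚ ≤ s → All≥0 P → All≥0 (scale s P)
    scale≥0 h [] = []
    scale≥0 h (k ∷ ks) = (h ⊛ k) ∷ scale≥0 h ks

    ++≥0 : ∀ {P P′} → All≥0 P → All≥0 P′ → All≥0 (P ++ P′)
    ++≥0 [] k = k
    ++≥0 (h ∷ hs) k = h ∷ ++≥0 hs k

    gadget≥0 : ∀ cl {y} → ∣ y ∣ ≤ ½ → All≥0 (gadget cl y)
    gadget≥0 cl {y} h = 0≤½ ∷ subst (0ℚ ≤_) (lem y) (gap (proj₂ (∣∣-elim h))) ∷ 0≤1 ∷ gap (proj₁ (∣∣-elim h)) ∷ 0≤½ ∷ []
      where
      opaque
        unfolding arith
        lem : ∀ y → ½ - (- y) ≡ ½ + y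
        lem = solve-∀ R

    path≥0 : ∀ {ω y} → Ok ω → Box y → All≥0 (path ω y)
    path≥0 {ω} {y} o b = proj₁ (unit₂ o) ∷ ++≥0 (gd (suc (suc zero))) (proj₁ (unit₁ o) ∷ ++≥0 (gd (suc zero)) (proj₁ (unit₀ o) ∷ ++≥0 (gd zero) (proj₁ (unitδ o) ∷ scale≥0 (proj₁ (0≤δ²≤1 o)) (stairs≥0 0 (top ω)))))
      where
      gd : ∀ g → All≥0 (gad g ω y)
      gd g = scale≥0 (0≤δ o) (gadget≥0 (cl ω g) (b g))

    -- This normalisation lets every column occur equally often in the words built from the path.
    mass-path : ∀ ω y c → mass (path ω y) c ≡ 1ℚ
    mass-path ω y c = trans (piece a₂ (suc (suc zero)) (end₂ ω y)) (trans (cong (λ t → a₂ + (δ ω + t)) (trans (piece a₁ (suc zero) (end₁ ω y)) (cong (λ t → a₁ + (δ ω + t)) (trans (piece a₀ zero (end₀ ω y)) (cong (λ t → a₀ + (δ ω + t))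
        (cong₂ _+_ (*-identityˡ (restδ ω)) (trans (mass-scale (δ² ω) (stairs 0 (top ω))) (trans (cong (δ² ω *_) (stairs-mass 0 (top ω) c)) (*-identityʳ _)))))))))
        (q₃ (x zero) (x (suc zero)) a₂ (δ ω)))
      where
      mass-++ : ∀ P P′ → mass (P ++ P′) c ≡ mass P c + mass P′ c
      mass-++ [] P′ = sym (+-identityˡ _)
      mass-++ ((a , J) ∷ P) P′ = trans (cong (𝟙 (J c) * a +_) (mass-++ P P′)) (sym (+-assoc _ _ _))
      mass-scale : ∀ s P → mass (scale s P) c ≡ s * mass P c
      mass-scale s [] = sym (*-zeroʳ s)
      mass-scale s ((a , J) ∷ P) = trans (cong (𝟙 (J c) * (s * a) +_) (mass-scale s P)) (lem (𝟙 (J c)) s a (mass P c))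
        where
        opaque
          unfolding arith
          lem : ∀ j s a m → j * (s * a) + s * m ≡ s * (j * a + m)
          lem = solve-∀ R
      piece : ∀ a g P → mass ((a , every) ∷ gad g ω y ++ P) c ≡ a + (δ ω + mass P c)
      piece a g P = cong₂ _+_ (*-identityˡ a) (trans (mass-++ (gad g ω y) P) (cong (_+ mass P c) (trans (mass-scale (δ ω) (gadget (cl ω g) (y g)))
        (trans (cong (δ ω *_) (trans (sym (coef-mass (gadget (cl ω g) (y g)) c)) (gadget-one (cl ω g) (y g) c))) (*-identityʳ _)))))

-- Sums over increasing tuples of columns.

module IncreasingSums where
  open import Data.Nat as ℕ using (ℕ; zero; suc; z≤n; s≤s; _∸_)
  import Data.Nat.Properties as ℕ
  open import Data.Fin using (Fin; zero; suc; toℕ)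
  open import Data.List using ([]; _∷_; map; length)
  open import Data.Vec as Vec using (Vec; []; _∷_)
  import Data.Vec.Properties as Vec
  open import Relation.Binary.PropositionalEquality hiding (_≗_)
  open import Tactic.RingSolver using (solve-∀)
  open import Defs using (subsets)
  open Rationals
  open Series

  -- inc V k o g sums g over the increasing vectors of length k with entries in [o, o + V)
  inc : (V k o : ℕ) → (Vec ℕ k → ℚ) → ℚ
  inc V zero o g = g []
  inc zero (suc k) o g = 0ℚ
  inc (suc V) (suc k) o g = inc V k (suc o) (λ v → g (o ∷ v)) + inc V (suc k) (suc o) g

  inc-cong : ∀ V k o {g h : Vec ℕ k → ℚ} → (∀ v → g v ≡ h v) → inc V k o g ≡ inc V k o h
  inc-cong V zero o e = e []
  inc-cong zero (suc k) o e = refl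
  inc-cong (suc V) (suc k) o e = cong₂ _+_ (inc-cong V k (suc o) (λ v → e (o ∷ v))) (inc-cong V (suc k) (suc o) e)

  inc-* : ∀ V k o c (g : Vec ℕ k → ℚ) → inc V k o (λ v → c * g v) ≡ c * inc V k o g
  inc-* V zero o c g = refl
  inc-* zero (suc k) o c g = sym (*-zeroʳ c)
  inc-* (suc V) (suc k) o c g = trans (cong₂ _+_ (inc-* V k (suc o) c (λ v → g (o ∷ v))) (inc-* V (suc k) (suc o) c g)) (sym (*-distribˡ-+ c _ _))

  shifted : ∀ {n k} → ℕ → Vec (Fin n) k → Vec ℕ k
  shifted o = Vec.map (λ i → o ℕ.+ toℕ i)

  shifted-suc : ∀ {n k} o (v : Vec (Fin n) k) → shifted o (Vec.map suc v) ≡ shifted (suc o) v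
  shifted-suc o [] = refl
  shifted-suc o (i ∷ v) = cong₂ _∷_ (ℕ.+-suc o (toℕ i)) (shifted-suc o v)

  ∑-subsets : ∀ V k o (g : Vec ℕ k → ℚ) → ∑ (subsets V k) (λ e → g (shifted o e)) ≡ inc V k o g
  ∑-subsets zero zero o g = +-identityʳ _
  ∑-subsets (suc V) zero o g = +-identityʳ _
  ∑-subsets zero (suc k) o g = refl
  ∑-subsets (suc V) (suc k) o g = trans (∑-++ (map (λ v → zero ∷ Vec.map suc v) (subsets V k)) _ _) (cong₂ _+_
    (trans (∑-map _ (subsets V k) _) (trans (∑-cong (subsets V k) (λ e → cong₂ (λ a b → g (a ∷ b)) (ℕ.+-identityʳ o) (shifted-suc o e))) (∑-subsets V k (suc o) (λ v → g (o ∷ v)))))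
    (trans (∑-map _ (subsets V (suc k)) _) (trans (∑-cong (subsets V (suc k)) (λ e → cong g (shifted-suc o e))) (∑-subsets V (suc k) (suc o) g))))

  ch : ℕ → ℕ → ℚ
  ch n zero = 1ℚ
  ch zero (suc k) = 0ℚ
  ch (suc n) (suc k) = ch n k + ch n (suc k)

  inc-one : ∀ V k o → inc V k o (λ _ → 1ℚ) ≡ ch V k
  inc-one zero zero o = refl
  inc-one (suc V) zero o = refl
  inc-one zero (suc k) o = refl
  inc-one (suc V) (suc k) o = cong₂ _+_ (inc-one V k (suc o)) (inc-one V (suc k) (suc o))

  -- The difference is taken in the rationals, so no bound on `k` is required; for `k` at least `n`
  -- both sides are 0.
  ch-step : ∀ n k → ι (suc k) * ch n (suc k) ≡ ch n k * (ι n - ι k)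
  ch-step zero zero = lem
    where
    opaque
      unfolding arith
      lem : (1ℚ + 0ℚ) * 0ℚ ≡ 1ℚ * (0ℚ - 0ℚ)
      lem = refl
  ch-step zero (suc k) = trans (*-zeroʳ _) (sym (*-zeroˡ _))
  ch-step (suc n) zero = trans (lem (ch n 1)) (trans (cong (1ℚ +_) (ch-step n 0)) (lem₂ (ι n)))
    where
    opaque
      unfolding arith
      lem : ∀ c → (1ℚ + 0ℚ) * (1ℚ + c) ≡ 1ℚ + (1ℚ + 0ℚ) * c
      lem = solve-∀ R
      lem₂ : ∀ n → 1ℚ + 1ℚ * (n - 0ℚ) ≡ 1ℚ * (1ℚ + n - 0ℚ)
      lem₂ = solve-∀ R
  ch-step (suc n) (suc k) = trans (lem (ι k) (ch n (suc k)) (ch n (suc (suc k)))) (trans (cong₂ (λ s t → ch n (suc k) + s + t) (ch-step n k) (ch-step n (suc k))) (lem₂ (ch n (suc k)) (ch n k) (ι n) (ι k)))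
    where
    opaque
      unfolding arith
      lem : ∀ k a b → (1ℚ + (1ℚ + k)) * (a + b) ≡ a + (1ℚ + k) * a + (1ℚ + (1ℚ + k)) * b
      lem = solve-∀ R
      lem₂ : ∀ a c n k → a + c * (n - k) + a * (n - (1ℚ + k)) ≡ (c + a) * (1ℚ + n - (1ℚ + k))
      lem₂ = solve-∀ R

  0≤ch : ∀ n k → 0ℚ ≤ ch n k
  0≤ch n zero = 0≤1
  0≤ch zero (suc k) = ≤-refl
  0≤ch (suc n) (suc k) = 0≤ch n k ⊹ 0≤ch n (suc k)

  sumTo : ℕ → (ℕ → ℚ) → ℚ
  sumTo zero f = 0ℚ
  sumTo (suc V) f = f 0 + sumTo V (λ j → f (suc j))

  sumTo-cong : ∀ V {f g : ℕ → ℚ} → (∀ j → f j ≡ g j) → sumTo V f ≡ sumTo V g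
  sumTo-cong zero e = refl
  sumTo-cong (suc V) e = cong₂ _+_ (e 0) (sumTo-cong V (λ j → e (suc j)))

  sumTo-+ : ∀ V f g → sumTo V (λ j → f j + g j) ≡ sumTo V f + sumTo V g
  sumTo-+ zero f g = sym (+-identityˡ 0ℚ)
  sumTo-+ (suc V) f g = trans (cong₂ _+_ refl (sumTo-+ V (λ j → f (suc j)) (λ j → g (suc j)))) (lem (f 0) (g 0) _ _)
    where
    opaque
      unfolding arith
      lem : ∀ a b c d → a + b + (c + d) ≡ a + c + (b + d)
      lem = solve-∀ R

  sumTo-* : ∀ V c f → sumTo V (λ j → c * f j) ≡ c * sumTo V f
  sumTo-* zero c f = sym (*-zeroʳ c)
  sumTo-* (suc V) c f = trans (cong₂ _+_ refl (sumTo-* V c (λ j → f (suc j)))) (sym (*-distribˡ-+ c _ _))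

  sumTo-∣∣ : ∀ V {f g : ℕ → ℚ} → (∀ j → j ℕ.< V → ∣ f j ∣ ≤ g j) → ∣ sumTo V f ∣ ≤ sumTo V g
  sumTo-∣∣ zero h = ∣0∣≤ ≤-refl
  sumTo-∣∣ (suc V) h = ∣+∣≤ (h 0 (s≤s z≤n)) (sumTo-∣∣ V (λ j l → h (suc j) (s≤s l)))

  after : ∀ P {k} → Vec ℕ (P ℕ.+ suc k) → Vec ℕ k
  after zero (x ∷ v) = v
  after (suc P) (x ∷ v) = after P v

  nth : ∀ P {k} → Vec ℕ (P ℕ.+ suc k) → ℕ
  nth zero (x ∷ v) = x
  nth (suc P) (x ∷ v) = nth P v

  -- Summing over the P-th entry j: the entries below j are free.
  inc-split : ∀ V P {k} o (F : ℕ → Vec ℕ k → ℚ) →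
    inc V (P ℕ.+ suc k) o (λ v → F (nth P v) (after P v)) ≡ sumTo V (λ j → ch j P * inc (V ∸ suc j) k (suc (o ℕ.+ j)) (F (o ℕ.+ j)))
  inc-split zero zero o F = refl
  inc-split zero (suc P) o F = refl
  inc-split (suc V) zero {k} o F = cong₂ _+_ (sym (trans (*-identityˡ _) (cong (λ z → inc V k (suc z) (F z)) (ℕ.+-identityʳ o))))
    (trans (inc-split V zero (suc o) F) (sumTo-cong V (λ j → cong (λ z → 1ℚ * inc (V ∸ suc j) k (suc z) (F z)) (sym (ℕ.+-suc o j)))))
  inc-split (suc V) (suc P) {k} o F = trans (cong₂ _+_ (inc-split V P (suc o) F) (inc-split V (suc P) (suc o) F))
    (trans (sym (sumTo-+ V _ _)) (trans (sumTo-cong V (λ j → trans (sym (*-distribʳ-+ _ (ch j P) (ch j (suc P)))) (cong (λ z → ch (suc j) (suc P) * inc (V ∸ suc j) k (suc z) (F z)) (sym (ℕ.+-suc o j)))))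
    (trans (sym (+-identityˡ _)) (cong (_+ sumTo V (λ j → ch (suc j) (suc P) * inc (V ∸ suc j) k (suc (o ℕ.+ suc j)) (F (o ℕ.+ suc j)))) (sym (*-zeroˡ _))))))

  -- Fixing the entries of two marked ranks leaves three free groups, before, between and after
  -- them, which become the three binomial coefficients.
  inc-marks : ∀ V P B Γ (φ ψ : ℕ → ℚ) →
    inc V (P ℕ.+ suc (B ℕ.+ suc Γ)) 0 (λ v → φ (nth P v) * ψ (nth B (after P v)))
    ≡ sumTo V (λ j → sumTo (V ∸ suc j) (λ i → φ j * ψ (suc (j ℕ.+ i)) * (ch j P * (ch i B * ch (V ∸ suc j ∸ suc i) Γ))))
  inc-marks V P B Γ φ ψ = trans (inc-split V P 0 (λ j v → φ j * ψ (nth B v))) (sumTo-cong V λ j →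
    trans (cong (ch j P *_) (trans (inc-* (V ∸ suc j) (B ℕ.+ suc Γ) (suc j) (φ j) (λ v → ψ (nth B v))) (cong (φ j *_)
      (trans (inc-split (V ∸ suc j) B (suc j) (λ i _ → ψ i)) (sumTo-cong (V ∸ suc j) λ i → cong (ch i B *_)
        (trans (inc-cong (V ∸ suc j ∸ suc i) Γ (suc (suc j ℕ.+ i)) (λ v → sym (*-identityʳ (ψ (suc j ℕ.+ i))))) (trans (inc-* (V ∸ suc j ∸ suc i) Γ (suc (suc j ℕ.+ i)) (ψ (suc j ℕ.+ i)) (λ _ → 1ℚ)) (cong (ψ (suc j ℕ.+ i) *_) (inc-one (V ∸ suc j ∸ suc i) Γ (suc (suc j ℕ.+ i)))))))))))
      (trans (sym (*-assoc _ _ _)) (trans (sym (sumTo-* (V ∸ suc j) (ch j P * φ j) _)) (sumTo-cong (V ∸ suc j) λ i → lem (ch j P) (φ j) (ch i B) (ψ (suc (j ℕ.+ i))) (ch (V ∸ suc j ∸ suc i) Γ)))))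
    where
    opaque
      unfolding arith
      lem : ∀ c f b s g → c * f * (b * (s * g)) ≡ f * s * (c * (b * g))
      lem = solve-∀ R

  module Approx (v : ℚ) (0≤v : 0ℚ ≤ v) (θ : ℚ) (v≤θ : v ≤ θ) (θ≤1 : θ ≤ 1ℚ) where

    -- The same recursion builds both sides: `ch-step` multiplies by `n v - P v` where `p`
    -- multiplies by `t`, and both divide by `P + 1`. The factors differ by at most `θ + P θ`, and
    -- after the division the error has grown by just one `θ`.
    ch≈p : ∀ n P {t} → ι n * v ≤ 1ℚ → 0ℚ ≤ t → t ≤ 1ℚ → ∣ ι n * v - t ∣ ≤ θ → ∣ pow v P * ch n P - p P t ∣ ≤ ι P * θ
    ch≈p n zero {t} nv 0≤t t≤1 h = subst₂ (λ s r → ∣ s ∣ ≤ r) (sym lem) (sym (*-zeroˡ θ)) (∣0∣≤ ≤-refl)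
      where
      opaque
        unfolding arith
        lem : 1ℚ * 1ℚ - 1ℚ ≡ 0ℚ
        lem = refl
    ch≈p n (suc P) {t} nv 0≤t t≤1 h = subst₂ (λ s r → ∣ s ∣ ≤ r) (sym eq) (cancel θ) (∣*∣≤ {rec P} (≤-reflexive (∣∣-nn (0≤rec P))) bound)
      where
      a : ℚ
      a = pow v P * ch n P
      opaque
        unfolding arith
        l₂ : ∀ v q r i k n → r * (q * i * (n * v - k * v)) ≡ r * (v * q * (i * (n - k)))
        l₂ = solve-∀ R
        l₄ : ∀ r w x → r * (w * x) ≡ w * (r * x)
        l₄ = solve-∀ R
        l₅ : ∀ r a y q t → r * (a * y) - q * (t * r) ≡ r * ((a - q) * y + q * (y - t))
        l₅ = solve-∀ R
        l₆ : ∀ n k v t → (n * v - t) + - (k * v) ≡ n * v - k * v - t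
        l₆ = solve-∀ R
        l₇ : ∀ r k th → r * (k * th * (1ℚ + k) + 1ℚ * (th + k * th)) ≡ r * (1ℚ + k) * ((1ℚ + k) * th)
        l₇ = solve-∀ R
      y : ℚ
      y = ι n * v - ι P * v
      cancelP : ∀ x → rec P * (ι (suc P) * x) ≡ x
      cancelP x = trans (sym (*-assoc (rec P) (ι (suc P)) x)) (trans (cong (_* x) (rec-ι P)) (*-identityˡ x))
      eq₀ : pow v (suc P) * ch n (suc P) ≡ rec P * (a * y)
      eq₀ = trans (cong (v * pow v P *_) (sym (cancelP (ch n (suc P))))) (trans (cong (λ z → v * pow v P * (rec P * z)) (ch-step n P)) (trans (sym (l₄ (rec P) (v * pow v P) (ch n P * (ι n - ι P)))) (sym (l₂ v (pow v P) (rec P) (ch n P) (ι P) (ι n)))))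
      eq : pow v (suc P) * ch n (suc P) - p (suc P) t ≡ rec P * ((a - p P t) * y + p P t * (y - t))
      eq = trans (cong (_- p (suc P) t) eq₀) (l₅ (rec P) a y (p P t) t)
      Pv≤ : ∣ - (ι P * v) ∣ ≤ ι P * θ
      Pv≤ = subst (_≤ ι P * θ) (sym (trans (∣-x∣ _) (∣∣-nn (0≤ι P ⊛ 0≤v)))) (*-monoˡ (ι P) (0≤ι P) v≤θ)
      y≤ : ∣ y ∣ ≤ 1ℚ + ι P
      y≤ = ∣+∣≤ (subst (_≤ 1ℚ) (sym (∣∣-nn (0≤ι n ⊛ 0≤v))) nv) (≤-trans Pv≤ (subst (ι P * θ ≤_) (*-identityʳ (ι P)) (*-monoˡ (ι P) (0≤ι P) θ≤1)))
      yt≤ : ∣ y - t ∣ ≤ θ + ι P * θ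
      yt≤ = subst (λ z → ∣ z ∣ ≤ θ + ι P * θ) (l₆ (ι n) (ι P) v t) (∣+∣≤ h Pv≤)
      bound : ∣ (a - p P t) * y + p P t * (y - t) ∣ ≤ ι P * θ * (1ℚ + ι P) + 1ℚ * (θ + ι P * θ)
      bound = ∣+∣≤ (∣*∣≤ (ch≈p n P nv 0≤t t≤1 h) y≤) (∣*∣≤ (≤-trans (≤-reflexive (∣∣-nn (0≤p P 0≤t))) (p≤1 P 0≤t t≤1)) yt≤)
      cancel : ∀ θ → rec P * (ι P * θ * (1ℚ + ι P) + 1ℚ * (θ + ι P * θ)) ≡ ι (suc P) * θ
      cancel θ = trans (l₇ (rec P) (ι P) θ) (trans (cong (_* (ι (suc P) * θ)) (rec-ι P)) (*-identityˡ _))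

  prod₃ : ∀ {a b c a′ b′ c′ α β γ} → ∣ a - a′ ∣ ≤ α → ∣ b - b′ ∣ ≤ β → ∣ c - c′ ∣ ≤ γ → ∣ a′ ∣ ≤ 1ℚ → ∣ b′ ∣ ≤ 1ℚ → ∣ c′ ∣ ≤ 1ℚ →
    ∣ a * (b * c) - a′ * (b′ * c′) ∣ ≤ α * ((1ℚ + β) * (1ℚ + γ)) + 1ℚ * (β * (1ℚ + γ) + 1ℚ * γ)
  prod₃ {a} {b} {c} {a′} {b′} {c′} {α} {β} {γ} ha hb hc a≤ b≤ c≤ = subst (λ z → ∣ z ∣ ≤ α * ((1ℚ + β) * (1ℚ + γ)) + 1ℚ * (β * (1ℚ + γ) + 1ℚ * γ)) (lem a b c a′ b′ c′)
    (∣+∣≤ (∣*∣≤ ha (∣*∣≤ (near b b′ hb b≤) (near c c′ hc c≤))) (∣*∣≤ a≤ (∣+∣≤ (∣*∣≤ hb (near c c′ hc c≤)) (∣*∣≤ b≤ hc))))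
    where
    opaque
      unfolding arith
      lem : ∀ a b c x y z → (a - x) * (b * c) + x * ((b - y) * c + y * (c - z)) ≡ a * (b * c) - x * (y * z)
      lem = solve-∀ R
      back : ∀ u v → v + (u - v) ≡ u
      back = solve-∀ R
    near : ∀ u u′ {ε} → ∣ u - u′ ∣ ≤ ε → ∣ u′ ∣ ≤ 1ℚ → ∣ u ∣ ≤ 1ℚ + ε
    near u u′ {ε} h k = subst (λ z → ∣ z ∣ ≤ 1ℚ + ε) (back u u′) (∣+∣≤ k h)

-- Counting tuples that meet two thin blocks of columns.

module ColumnCounts where
  open import Data.Nat as ℕ using (ℕ; zero; suc; z≤n; s≤s; _≤ᵇ_; _<ᵇ_; _∸_)
  import Data.Nat.Properties as ℕ
  open import Data.Bool using (Bool; true; false; _∧_; T; if_then_else_)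
  open import Data.Product using (_×_; _,_; proj₁; proj₂)
  open import Data.Empty using (⊥-elim)
  open import Data.Unit using (tt)
  open import Relation.Nullary using (¬_)
  open import Relation.Binary.PropositionalEquality hiding (_≗_)
  open import Tactic.RingSolver using (solve-∀)
  open Rationals
  open Series
  open Gadgets using (Class; first; second; other; Δ)
  open Moments using (pow-+)
  open IncreasingSums

  rng : ℕ → ℕ → ℕ → Bool
  rng a s c = (a ≤ᵇ c) ∧ (c <ᵇ a ℕ.+ s)

  cls : ℕ → ℕ → ℕ → ℕ → Class
  cls a a′ s c = if rng a s c then first else if rng a′ s c then second else other

  T-∧ : ∀ {x y} → x ∧ y ≡ true → x ≡ true × y ≡ true
  T-∧ {true} {true} e = refl , refl

  true⇒T : ∀ {b} → b ≡ true → T b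
  true⇒T refl = tt

  T⇒true : ∀ {b} → T b → b ≡ true
  T⇒true {true} _ = refl

  rng⇒ : ∀ {a s c} → rng a s c ≡ true → a ℕ.≤ c × c ℕ.< a ℕ.+ s
  rng⇒ {a} {s} {c} e = let x , y = T-∧ e in ℕ.≤ᵇ⇒≤ a c (true⇒T x) , ℕ.<ᵇ⇒< c (a ℕ.+ s) (true⇒T y)

  ⇒rng : ∀ {a s c} → a ℕ.≤ c → c ℕ.< a ℕ.+ s → rng a s c ≡ true
  ⇒rng p q = cong₂ _∧_ (T⇒true (ℕ.≤⇒≤ᵇ p)) (T⇒true (ℕ.<⇒<ᵇ q))

  ¬rng : ∀ {a s c} → ¬ (a ℕ.≤ c × c ℕ.< a ℕ.+ s) → rng a s c ≡ false
  ¬rng {a} {s} {c} n with rng a s c in e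
  ... | false = refl
  ... | true = ⊥-elim (n (rng⇒ {a} e))

  -- The first block lies wholly to the left of the second, so an increasing pair can only run from
  -- the first into the second and `Δ` is never negative.
  Δ-cls : ∀ {a a′ s c c′} → a ℕ.+ s ℕ.≤ a′ → c ℕ.< c′ → Δ (cls a a′ s c) (cls a a′ s c′) ≡ 𝟙 (rng a s c) * 𝟙 (rng a′ s c′)
  Δ-cls {a} {a′} {s} {c} {c′} h c<c′ with rng a s c in e₁ | rng a s c′ in e₂ | rng a′ s c in e₃ | rng a′ s c′ in e₄
  ... | true | true | x | true = ⊥-elim (ℕ.<-irrefl refl (ℕ.<-≤-trans (proj₂ (rng⇒ {a} e₂)) (ℕ.≤-trans h (proj₁ (rng⇒ {a′} e₄)))))
  ... | true | true | x | false = sym (*-zeroʳ 1ℚ)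
  ... | true | false | x | true = sym (*-identityˡ 1ℚ)
  ... | true | false | x | false = sym (*-zeroʳ 1ℚ)
  ... | false | true | true | y = ⊥-elim (ℕ.<-irrefl refl (ℕ.<-≤-trans (ℕ.<-trans c<c′ (proj₂ (rng⇒ {a} e₂))) (ℕ.≤-trans h (proj₁ (rng⇒ {a′} e₃)))))
  ... | false | true | false | y = sym (*-zeroˡ (𝟙 y))
  ... | false | false | true | true = sym (*-zeroˡ 1ℚ)
  ... | false | false | true | false = sym (*-zeroˡ 0ℚ)
  ... | false | false | false | true = sym (*-zeroˡ 1ℚ)
  ... | false | false | false | false = sym (*-zeroˡ 0ℚ)

  sumTo-split : ∀ m n f → sumTo (m ℕ.+ n) f ≡ sumTo m f + sumTo n (λ j → f (m ℕ.+ j))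
  sumTo-split zero n f = sym (+-identityˡ _)
  sumTo-split (suc m) n f = trans (cong (f 0 +_) (sumTo-split m n (λ j → f (suc j)))) (sym (+-assoc _ _ _))

  sumTo-0 : ∀ n {f : ℕ → ℚ} → (∀ j → j ℕ.< n → f j ≡ 0ℚ) → sumTo n f ≡ 0ℚ
  sumTo-0 zero h = refl
  sumTo-0 (suc n) h = trans (cong₂ _+_ (h 0 (s≤s z≤n)) (sumTo-0 n (λ j l → h (suc j) (s≤s l)))) (+-identityˡ 0ℚ)

  sumTo-1 : ∀ n {f : ℕ → ℚ} → (∀ j → j ℕ.< n → f j ≡ 1ℚ) → sumTo n f ≡ ι n
  sumTo-1 zero h = refl
  sumTo-1 (suc n) h = cong₂ _+_ (h 0 (s≤s z≤n)) (sumTo-1 n (λ j l → h (suc j) (s≤s l)))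

  rng-count : ∀ {a s o W} → o ℕ.≤ a → a ℕ.+ s ℕ.≤ o ℕ.+ W → sumTo W (λ i → 𝟙 (rng a s (o ℕ.+ i))) ≡ ι s
  rng-count {a} {s} {o} {W} o≤a h with ℕ.m≤n⇒∃[o]m+o≡n o≤a
  ... | d , refl with ℕ.m≤n⇒∃[o]m+o≡n (ℕ.+-cancelˡ-≤ o (d ℕ.+ s) W (subst (ℕ._≤ o ℕ.+ W) (ℕ.+-assoc o d s) h))
  ... | r , refl = trans (sumTo-split (d ℕ.+ s) r _) (trans (cong₂ _+_ (trans (sumTo-split d s _) (cong₂ _+_ z₁ z₂)) z₃) (trans (+-identityʳ _) (+-identityˡ _)))
    where
    z₁ = sumTo-0 d {λ i → 𝟙 (rng (o ℕ.+ d) s (o ℕ.+ i))} λ j l → cong 𝟙 (¬rng {o ℕ.+ d} λ (p , _) → ℕ.<-irrefl refl (ℕ.<-≤-trans l (ℕ.+-cancelˡ-≤ o d j p)))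
    z₂ = sumTo-1 s {λ i → 𝟙 (rng (o ℕ.+ d) s (o ℕ.+ (d ℕ.+ i)))} λ j l → cong 𝟙 (⇒rng (ℕ.+-monoʳ-≤ o (ℕ.m≤m+n d j)) (subst (ℕ._< o ℕ.+ d ℕ.+ s) (ℕ.+-assoc o d j) (ℕ.+-monoʳ-< (o ℕ.+ d) l)))
    z₃ = sumTo-0 r {λ i → 𝟙 (rng (o ℕ.+ d) s (o ℕ.+ (d ℕ.+ s ℕ.+ i)))} λ j l → cong 𝟙 (¬rng {o ℕ.+ d} λ (_ , q) → ℕ.<-irrefl refl (ℕ.<-≤-trans q (subst (ℕ._≤ o ℕ.+ (d ℕ.+ s ℕ.+ j)) (sym (ℕ.+-assoc o d s)) (ℕ.+-monoʳ-≤ o (ℕ.m≤m+n (d ℕ.+ s) j)))))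

  D : ℕ → ℕ → ℕ → ℚ
  D P B Γ = ι P * ((1ℚ + ι B) * (1ℚ + ι Γ)) + (ι B * (1ℚ + ι Γ) + ι Γ)

  -- `v` is the proportion of one column and `η` that of a block; `u` and `u′` are the proportions
  -- of columns left of the two blocks.
  module Marks (V : ℕ) (v : ℚ) (0≤v : 0ℚ ≤ v) (vV : v * ι V ≡ 1ℚ) (s : ℕ) (a a′ : ℕ) (aa′ : a ℕ.+ suc s ℕ.≤ a′) (a′V : a′ ℕ.+ suc s ℕ.≤ V)
    (θ≤1 : ι 3 * (ι (suc s) * v) ≤ 1ℚ) where

    η θ u u′ : ℚ
    η = ι (suc s) * v
    θ = ι 3 * η
    u = ι a * v
    u′ = ι a′ * v

    φ ψ : ℕ → ℚ
    φ j = 𝟙 (rng a (suc s) j)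
    ψ j = 𝟙 (rng a′ (suc s) j)

    private
      0≤η : 0ℚ ≤ η
      0≤η = 0≤ι (suc s) ⊛ 0≤v
      v≤η : v ≤ η
      v≤η = lin (0≤ι s ⊛ 0≤v) (lem (ι s) v)
        where
        opaque
          unfolding arith
          lem : ∀ s v → (1ℚ + s) * v ≡ v + s * v
          lem = solve-∀ R
      opaque
        unfolding arith
        tripl : ∀ η → η + η + η ≡ (1ℚ + (1ℚ + (1ℚ + 0ℚ))) * η
        tripl = solve-∀ R
      η3 : η + η + η ≡ θ
      η3 = tripl η
      η≤θ : η ≤ θ
      η≤θ = lin {t = η + η} (0≤η ⊹ 0≤η) (trans (sym η3) (+-assoc η η η))
      0≤θ : 0ℚ ≤ θ
      0≤θ = ≤-trans 0≤η η≤θ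
      open Approx v 0≤v θ (≤-trans v≤η η≤θ) θ≤1
      nv≤1 : ∀ {n} → n ℕ.≤ V → ι n * v ≤ 1ℚ
      nv≤1 {n} h = ≤-trans (*-monoʳ v 0≤v (ι-mono h)) (≤-reflexive (trans (*-comm (ι V) v) vV))
      ∣dv∣ : ∀ {d} → d ℕ.≤ suc s → ∣ ι d * v ∣ ≤ η
      ∣dv∣ {d} h = subst (_≤ η) (sym (∣∣-nn (0≤ι d ⊛ 0≤v))) (*-monoʳ v 0≤v (ι-mono h))

    module At (P B Γ : ℕ) where
      m : ℚ
      m = p P u * (p B (u′ - u) * p Γ (1ℚ - u′))

      ε : ℚ
      ε = θ * D P B Γ

      ŵ : ℕ → ℕ → ℚ
      ŵ j i = pow v P * ch j P * (pow v B * ch i B * (pow v Γ * ch (V ∸ suc j ∸ suc i) Γ))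

      private
        0≤u′-u : 0ℚ ≤ u′ - u
        0≤u′-u = gap (*-monoʳ v 0≤v (ι-mono (ℕ.≤-trans (ℕ.m≤m+n a (suc s)) aa′)))
        a′≤V : a′ ℕ.≤ V
        a′≤V = ℕ.≤-trans (ℕ.m≤m+n a′ (suc s)) a′V
        0≤u : 0ℚ ≤ u
        0≤u = 0≤ι a ⊛ 0≤v
        u′≤1 : u′ ≤ 1ℚ
        u′≤1 = nv≤1 a′≤V
        u≤1 : u ≤ 1ℚ
        u≤1 = nv≤1 (ℕ.≤-trans (ℕ.≤-trans (ℕ.m≤m+n a (suc s)) aa′) a′≤V)
        opaque
          unfolding arith
          c₁ : ∀ u u′ → u′ ≡ u′ - u + u
          c₁ = solve-∀ R
          c₂ : ∀ u′ → 1ℚ ≡ 1ℚ - u′ + u′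
          c₂ = solve-∀ R
        ∣p∣≤ : ∀ n {t} → 0ℚ ≤ t → t ≤ 1ℚ → ∣ p n t ∣ ≤ 1ℚ
        ∣p∣≤ n x y = ≤-trans (≤-reflexive (∣∣-nn (0≤p n x))) (p≤1 n x y)
        gap≤1 : u′ - u ≤ 1ℚ
        gap≤1 = ≤-trans (lin {t = u} 0≤u (c₁ u u′)) u′≤1
        0≤1-u′ : 0ℚ ≤ 1ℚ - u′
        0≤1-u′ = gap u′≤1
        1-u′≤1 : 1ℚ - u′ ≤ 1ℚ
        1-u′≤1 = lin {t = u′} (0≤ι a′ ⊛ 0≤v) (c₂ u′)

      near : ∀ j i → rng a (suc s) j ≡ true → rng a′ (suc s) (suc (j ℕ.+ i)) ≡ true → ∣ ŵ j i - m ∣ ≤ ε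
      near j i rj ri with rng⇒ {a} rj | rng⇒ {a′} ri
      ... | a≤j , j< | a′≤ , <a′ with ℕ.m≤n⇒∃[o]m+o≡n a≤j | ℕ.m≤n⇒∃[o]m+o≡n a′≤
      ... | d , refl | d′ , e = ≤-trans (prod₃ (ch≈p j P (nv≤1 j≤V) 0≤u u≤1 h₁) (ch≈p i B (nv≤1 i≤V) 0≤u′-u gap≤1 h₂) (ch≈p (V ∸ suc j ∸ suc i) Γ (nv≤1 n≤V) 0≤1-u′ 1-u′≤1 h₃)
            (∣p∣≤ P 0≤u u≤1) (∣p∣≤ B 0≤u′-u gap≤1) (∣p∣≤ Γ 0≤1-u′ 1-u′≤1))
            final
        where
        d<s : d ℕ.< suc s
        d<s = ℕ.+-cancelˡ-< a d (suc s) j<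
        d′<s : d′ ℕ.< suc s
        d′<s = ℕ.+-cancelˡ-< a′ d′ (suc s) (subst (ℕ._< a′ ℕ.+ suc s) (sym e) <a′)
        ji<V : suc (j ℕ.+ i) ℕ.< V
        ji<V = ℕ.<-≤-trans <a′ a′V
        j≤V : j ℕ.≤ V
        j≤V = ℕ.≤-trans (ℕ.m≤m+n j i) (ℕ.≤-trans (ℕ.n≤1+n _) (ℕ.<⇒≤ ji<V))
        i≤V : i ℕ.≤ V
        i≤V = ℕ.≤-trans (ℕ.m≤n+m i j) (ℕ.≤-trans (ℕ.n≤1+n _) (ℕ.<⇒≤ ji<V))
        n≤V : V ∸ suc j ∸ suc i ℕ.≤ V
        n≤V = ℕ.≤-trans (ℕ.m∸n≤m (V ∸ suc j) (suc i)) (ℕ.m∸n≤m V (suc j))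
        opaque
          unfolding arith
          f₁ : ∀ a d v → (a + d) * v - a * v ≡ d * v
          f₁ = solve-∀ R
          f₂ : ∀ a a′ d i d′ v → 1ℚ + (a + d + i) ≡ a′ + d′ → i * v - (a′ * v - a * v) ≡ d′ * v + - ((1ℚ + 0ℚ) * v) + - (d * v)
          f₂ a a′ d i d′ v e = trans (g a a′ d i v) (trans (cong (λ z → (z - a′) * v + - ((1ℚ + 0ℚ) * v) + - (d * v)) e) (g′ a′ d d′ v))
            where
            g : ∀ a a′ d i v → i * v - (a′ * v - a * v) ≡ (1ℚ + (a + d + i) - a′) * v + - ((1ℚ + 0ℚ) * v) + - (d * v)
            g = solve-∀ R
            g′ : ∀ a′ d d′ v → (a′ + d′ - a′) * v + - ((1ℚ + 0ℚ) * v) + - (d * v) ≡ d′ * v + - ((1ℚ + 0ℚ) * v) + - (d * v)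
            g′ = solve-∀ R
          f₃ : ∀ V a′ d′ v → v * V ≡ 1ℚ → (V - (1ℚ + (a′ + d′))) * v - (1ℚ - a′ * v) ≡ - ((1ℚ + d′) * v)
          f₃ V a′ d′ v e = trans (g V a′ d′ v) (trans (cong (λ z → z - 1ℚ + - ((1ℚ + d′) * v)) e) (g′ d′ v))
            where
            g : ∀ V a′ d′ v → (V - (1ℚ + (a′ + d′))) * v - (1ℚ - a′ * v) ≡ v * V - 1ℚ + - ((1ℚ + d′) * v)
            g = solve-∀ R
            g′ : ∀ d v → 1ℚ - 1ℚ + - ((1ℚ + d) * v) ≡ - ((1ℚ + d) * v)
            g′ = solve-∀ R
          fin : ∀ θ P B Γ → θ * (P * ((1ℚ + B) * (1ℚ + Γ)) + (B * (1ℚ + Γ) + Γ)) ≡ P * θ * ((1ℚ + B * θ) * (1ℚ + Γ * θ)) + 1ℚ * (B * θ * (1ℚ + Γ * θ) + 1ℚ * (Γ * θ))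
                   + (P * θ * ((B * (1ℚ - θ)) * (1ℚ + Γ * θ)) + P * θ * ((1ℚ + B) * (Γ * (1ℚ - θ))) + B * θ * (Γ * (1ℚ - θ)))
          fin = solve-∀ R
        h₁ : ∣ ι j * v - u ∣ ≤ θ
        h₁ = subst (λ z → ∣ z ∣ ≤ θ) (sym (trans (cong (λ z → z * v - u) (ι-+ a d)) (f₁ (ι a) (ι d) v))) (≤-trans (∣dv∣ (ℕ.<⇒≤ d<s)) η≤θ)
        e′ : 1ℚ + (ι a + ι d + ι i) ≡ ι a′ + ι d′
        e′ = trans (cong (1ℚ +_) (sym (trans (ι-+ (a ℕ.+ d) i) (cong (_+ ι i) (ι-+ a d))))) (trans (cong ι (sym e)) (ι-+ a′ d′))
        ∣-∣ : ∀ {x c} → ∣ x ∣ ≤ c → ∣ - x ∣ ≤ c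
        ∣-∣ {x} {c} = subst (_≤ c) (sym (∣-x∣ x))
        -- The middle gap is off by the offset of the second mark, by one column and by the offset
        -- of the first mark. Each is at most `η`, whence the factor 3 in `θ`.
        h₂ : ∣ ι i * v - (u′ - u) ∣ ≤ θ
        h₂ = subst (λ z → ∣ z ∣ ≤ θ) (sym (f₂ (ι a) (ι a′) (ι d) (ι i) (ι d′) v e′)) (subst (∣ _ ∣ ≤_) η3 (∣+∣≤ (∣+∣≤ (∣dv∣ (ℕ.<⇒≤ d′<s)) (∣-∣ (∣dv∣ {1} (s≤s z≤n)))) (∣-∣ (∣dv∣ (ℕ.<⇒≤ d<s)))))
        n≡ : ι (V ∸ suc j ∸ suc i) ≡ ι V - (1ℚ + (ι a′ + ι d′))
        n≡ = trans (cong ι (ℕ.∸-+-assoc V (suc j) (suc i))) (trans (cong (λ z → ι (V ∸ z)) (trans (ℕ.+-suc (suc j) i) (cong suc (sym e)))) (trans (ι-∸ (subst (ℕ._< V) (sym e) ji<V)) (cong (λ z → ι V - (1ℚ + z)) (ι-+ a′ d′))))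
        h₃ : ∣ ι (V ∸ suc j ∸ suc i) * v - (1ℚ - u′) ∣ ≤ θ
        h₃ = subst (λ z → ∣ z ∣ ≤ θ) (sym (trans (cong (λ z → z * v - (1ℚ - u′)) n≡) (f₃ (ι V) (ι a′) (ι d′) v vV))) (∣-∣ (≤-trans (∣dv∣ {suc d′} d′<s) η≤θ))
        final : ι P * θ * ((1ℚ + ι B * θ) * (1ℚ + ι Γ * θ)) + 1ℚ * (ι B * θ * (1ℚ + ι Γ * θ) + 1ℚ * (ι Γ * θ)) ≤ θ * (ι P * ((1ℚ + ι B) * (1ℚ + ι Γ)) + (ι B * (1ℚ + ι Γ) + ι Γ))
        final = lin (0≤ι P ⊛ 0≤θ ⊛ (0≤ι B ⊛ gap θ≤1 ⊛ (0≤1 ⊹ 0≤ι Γ ⊛ 0≤θ)) ⊹ 0≤ι P ⊛ 0≤θ ⊛ ((0≤1 ⊹ 0≤ι B) ⊛ (0≤ι Γ ⊛ gap θ≤1)) ⊹ 0≤ι B ⊛ 0≤θ ⊛ (0≤ι Γ ⊛ gap θ≤1)) (fin θ (ι P) (ι B) (ι Γ))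

      k : ℕ
      k = P ℕ.+ suc (B ℕ.+ suc Γ)

      private
        pairs : sumTo V (λ j → sumTo (V ∸ suc j) (λ i → φ j * ψ (suc (j ℕ.+ i)))) ≡ ι (suc s) * ι (suc s)
        pairs = trans (sumTo-cong V inner) (trans (sumTo-* V (ι (suc s)) φ) (cong (ι (suc s) *_) (rng-count {a} {suc s} {0} z≤n (ℕ.≤-trans aa′ (ℕ.≤-trans (ℕ.m≤m+n a′ (suc s)) a′V)))))
          where
          inner : ∀ j → sumTo (V ∸ suc j) (λ i → φ j * ψ (suc (j ℕ.+ i))) ≡ ι (suc s) * φ j
          inner j with rng a (suc s) j in r
          ... | false = trans (sumTo-* (V ∸ suc j) 0ℚ _) (trans (*-zeroˡ _) (sym (*-zeroʳ _)))
          ... | true = trans (sumTo-* (V ∸ suc j) 1ℚ _) (trans (*-identityˡ _) (trans (rng-count {a′} {suc s} {suc j} (ℕ.≤-trans (proj₂ (rng⇒ {a} r)) aa′) (subst (a′ ℕ.+ suc s ℕ.≤_) (sym (ℕ.m+[n∸m]≡n j<V)) a′V)) (sym (*-identityʳ _))))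
            where
            j<V : j ℕ.< V
            j<V = ℕ.<-≤-trans (proj₂ (rng⇒ {a} r)) (ℕ.≤-trans aa′ (ℕ.≤-trans (ℕ.m≤m+n a′ (suc s)) a′V))

        ΣΣ : (ℕ → ℕ → ℚ) → ℚ
        ΣΣ f = sumTo V (λ j → sumTo (V ∸ suc j) (f j))

        ΣΣ-* : ∀ c f → ΣΣ (λ j i → c * f j i) ≡ c * ΣΣ f
        ΣΣ-* c f = trans (sumTo-cong V (λ j → sumTo-* (V ∸ suc j) c (f j))) (sumTo-* V c _)
        ΣΣ-+ : ∀ f g → ΣΣ (λ j i → f j i + g j i) ≡ ΣΣ f + ΣΣ g
        ΣΣ-+ f g = trans (sumTo-cong V (λ j → sumTo-+ (V ∸ suc j) (f j) (g j))) (sumTo-+ V _ _)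

        opaque
          unfolding arith
          dist₁ : ∀ x y z c m → c * (x * y * z) ≡ c * (x * y) * (z - m) + (c * m) * (x * y)
          dist₁ = solve-∀ R
          sq : ∀ c m z → c * m * (z * z) ≡ c * (z * z) * m
          sq = solve-∀ R
          back : ∀ s t → s + t - t ≡ s
          back = solve-∀ R
          asm : ∀ x y v a b c x′ y′ z′ → a * (v * (b * (v * c))) * (x * y * (x′ * (y′ * z′))) ≡ v * v * (x * y * (a * x′ * (b * y′ * (c * z′))))
          asm = solve-∀ R
          η² : ∀ v s → v * v * (s * s) ≡ s * v * (s * v)
          η² = solve-∀ R

      -- There are `(s + 1)²` pairs of marked columns, and for each of them the weight of the free
      -- entries is within `ε` of its limit `m`.
      estimate : ∣ pow v k * inc V k 0 (λ e → φ (nth P e) * ψ (nth B (after P e))) - η * η * m ∣ ≤ η * η * ε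
      estimate = subst₂ (λ x y → ∣ x ∣ ≤ y) (sym eq) (trans (ΣΣ-* (v * v * ε) (λ j i → φ j * ψ (suc (j ℕ.+ i)))) (trans (cong (v * v * ε *_) pairs) (trans (sq (v * v) ε (ι (suc s))) (cong (_* ε) (η² v (ι (suc s))))))) bound
        where
        err : ℕ → ℕ → ℚ
        err j i = v * v * (φ j * ψ (suc (j ℕ.+ i))) * (ŵ j i - m)
        pk : pow v k ≡ pow v P * (v * (pow v B * (v * pow v Γ)))
        pk = trans (pow-+ v P (suc (B ℕ.+ suc Γ))) (cong (λ z → pow v P * (v * z)) (pow-+ v B (suc Γ)))
        eq₁ : pow v k * inc V k 0 (λ e → φ (nth P e) * ψ (nth B (after P e))) ≡ ΣΣ err + η * η * m
        eq₁ = trans (cong₂ _*_ pk (inc-marks V P B Γ φ ψ)) (trans (sym (ΣΣ-* (pow v P * (v * (pow v B * (v * pow v Γ)))) _))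
          (trans (sumTo-cong V (λ j → sumTo-cong (V ∸ suc j) (λ i → trans (asm (φ j) (ψ (suc (j ℕ.+ i))) v (pow v P) (pow v B) (pow v Γ) (ch j P) (ch i B) (ch (V ∸ suc j ∸ suc i) Γ)) (dist₁ (φ j) (ψ (suc (j ℕ.+ i))) (ŵ j i) (v * v) m))))
          (trans (ΣΣ-+ err (λ j i → v * v * m * (φ j * ψ (suc (j ℕ.+ i))))) (cong (ΣΣ err +_) (trans (ΣΣ-* (v * v * m) (λ j i → φ j * ψ (suc (j ℕ.+ i)))) (trans (cong (v * v * m *_) pairs) (trans (sq (v * v) m (ι (suc s))) (cong (_* m) (η² v (ι (suc s)))))))))))
        eq : pow v k * inc V k 0 (λ e → φ (nth P e) * ψ (nth B (after P e))) - η * η * m ≡ ΣΣ err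
        eq = trans (cong (_- η * η * m) eq₁) (back (ΣΣ err) (η * η * m))
        pt : ∀ j i → ∣ err j i ∣ ≤ v * v * ε * (φ j * ψ (suc (j ℕ.+ i)))
        pt j i with rng a (suc s) j in r₁ | rng a′ (suc s) (suc (j ℕ.+ i)) in r₂
        ... | false | b = subst₂ (λ x y → ∣ x ∣ ≤ y) (sym (trans (cong (λ z → v * v * z * (ŵ j i - m)) (*-zeroˡ (𝟙 b))) (trans (cong (_* (ŵ j i - m)) (*-zeroʳ _)) (*-zeroˡ _)))) (sym (trans (cong (v * v * ε *_) (*-zeroˡ (𝟙 b))) (*-zeroʳ _))) (∣0∣≤ ≤-refl)
        ... | true | false = subst₂ (λ x y → ∣ x ∣ ≤ y) (sym (trans (cong (λ z → v * v * z * (ŵ j i - m)) (*-zeroʳ 1ℚ)) (trans (cong (_* (ŵ j i - m)) (*-zeroʳ _)) (*-zeroˡ _)))) (sym (trans (cong (v * v * ε *_) (*-zeroʳ 1ℚ)) (*-zeroʳ _))) (∣0∣≤ ≤-refl)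
        ... | true | true = subst₂ (λ x y → ∣ x ∣ ≤ y) (cong (_* (ŵ j i - m)) (o₁ (v * v))) (o₂ (v * v) ε) (∣*∣≤ {v * v} (≤-reflexive (∣∣-nn (0≤v ⊛ 0≤v))) (near j i r₁ r₂))
          where
          opaque
            unfolding arith
            o₁ : ∀ c → c ≡ c * (1ℚ * 1ℚ)
            o₁ = solve-∀ R
            o₂ : ∀ c e → c * e ≡ c * e * (1ℚ * 1ℚ)
            o₂ = solve-∀ R
        bound : ∣ ΣΣ err ∣ ≤ ΣΣ (λ j i → v * v * ε * (φ j * ψ (suc (j ℕ.+ i))))
        bound = sumTo-∣∣ V (λ j _ → sumTo-∣∣ (V ∸ suc j) (λ i _ → pt j i))

-- Averaging the response over all column tuples.

module ColumnAverages where
  open import Data.Nat as ℕ using (ℕ; zero; suc; z≤n; s≤s; _<ᵇ_; _∸_; _⊓_; _⊔_)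
  import Data.Nat.Properties as ℕ
  open import Data.Bool using (true; false)
  open import Data.Fin as Fin using (Fin; zero; suc; toℕ)
  import Data.Fin.Properties as Fin
  open import Data.List using (List; []; _∷_; length)
  open import Data.Vec as Vec using (Vec; []; _∷_; toList; lookup)
  import Data.Vec.Properties as Vec
  open import Data.Vec.Relation.Unary.All as VA using ([]; _∷_)
  open import Data.Vec.Relation.Unary.AllPairs as VP using ([]; _∷_)
  open import Data.Product using (_,_)
  open import Data.Empty using (⊥-elim)
  open import Relation.Nullary using (¬_)
  open import Relation.Binary.Definitions using (Tri; tri<; tri≈; tri>)
  open import Relation.Binary.PropositionalEquality hiding (_≗_)
  open import Tactic.RingSolver using (solve-∀)
  open import Defs using (subsets)
  open Rationals
  open Series
  open Gadgets using (first; second; other; Δ)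
  open Moments using (τ; sgn; mon; lo; mid; hi)
  open Nonvanishing using (length-toList)
  open IncreasingSums
  open ColumnCounts

  -- As `e` is increasing in the applications, this spells the pattern `π` on the columns `e`.
  word : ∀ {V k n} → Vec (Fin V) k → Vec (Fin k) n → List ℕ
  word e π = toList (Vec.map (λ i → toℕ (lookup e i)) π)

  letters : ∀ {k n} → Vec (Fin k) n → List ℕ
  letters π = toList (Vec.map toℕ π)

  ∑-*+ : ∀ {A : Set} (xs : List A) c (f g : A → ℚ) → c * ∑ xs (λ x → f x + g x) ≡ c * ∑ xs f + c * ∑ xs g
  ∑-*+ xs c f g = trans (cong (c *_) (∑-+ xs f g)) (*-distribˡ-+ c _ _)

  ∣p∣≤1 : ∀ n {t} → 0ℚ ≤ t → t ≤ 1ℚ → ∣ p n t ∣ ≤ 1ℚ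
  ∣p∣≤1 n x y = ≤-trans (≤-reflexive (∣∣-nn (0≤p n x))) (p≤1 n x y)

  module _ {V k : ℕ} (c : ℚ) (q : ℚ) (h h′ : ℕ → ℕ → ℚ) (ε : ℚ) (0≤ε : 0ℚ ≤ ε)
    (close : ∀ (P Q : Fin k) → P ≢ Q → ∣ c * ∑ (subsets V k) (λ e → h (toℕ (lookup e P)) (toℕ (lookup e Q))) - q * h′ (toℕ P) (toℕ Q) ∣ ≤ ε)
    {a b : ℚ} (0≤a : 0ℚ ≤ a) (a≤1 : a ≤ 1ℚ) (0≤b : 0ℚ ≤ b) (b≤1 : b ≤ 1ℚ) where

    -- The average passes through the sum over neighbouring pairs, and each pair costs at most `ε`
    -- because its factors `p j a` and `p n b` are at most 1.
    sw-average : ∀ {n} j (π : Vec (Fin k) n) → VP.AllPairs _≢_ π →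
      ∣ c * ∑ (subsets V k) (λ e → sw a b h j (word e π)) - q * sw a b h′ j (letters π) ∣ ≤ ι n * ε
    sw-average j [] u = subst₂ (λ x y → ∣ x ∣ ≤ y) (sym (trans (cong₂ _-_ (trans (cong (c *_) (∑-zero (subsets V k) (λ _ → refl))) (*-zeroʳ c)) (*-zeroʳ q)) (+-inverseʳ 0ℚ))) (sym (*-zeroˡ ε)) (∣0∣≤ ≤-refl)
    sw-average j (P ∷ []) u = subst (λ x → ∣ x ∣ ≤ ι 1 * ε) (sym (trans (cong₂ _-_ (trans (cong (c *_) (∑-zero (subsets V k) (λ _ → refl))) (*-zeroʳ c)) (*-zeroʳ q)) (+-inverseʳ 0ℚ))) (∣0∣≤ (0≤ι 1 ⊛ 0≤ε))
    sw-average {suc (suc n)} j (P ∷ Q ∷ π) ((P≢Q ∷ _) ∷ u) = subst₂ (λ x y → ∣ x ∣ ≤ y) (sym eq) (lem₃ ε (ι (suc n))) (∣+∣≤ (∣*∣≤ (∣*∣≤ (∣p∣≤1 j 0≤a a≤1) (∣p∣≤1 n 0≤b b≤1)) (close P Q P≢Q)) (sw-average (suc j) (Q ∷ π) u))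
      where
      w : ℚ
      w = p j a * p n b
      opaque
        unfolding arith
        lem₁ : ∀ x y z → x * (y * z) ≡ x * z * y
        lem₁ = solve-∀ R
        lem₂ : ∀ c w s t q g r → c * (w * s) + c * t - q * (w * g + r) ≡ w * (c * s - q * g) + (c * t - q * r)
        lem₂ = solve-∀ R
        lem₃ : ∀ e n → 1ℚ * 1ℚ * e + n * e ≡ (1ℚ + n) * e
        lem₃ = solve-∀ R
      len : ∀ {A : Set} (f : A → ℕ) {m} (v : Vec A m) → length (toList (Vec.map f v)) ≡ m
      len f v = length-toList (Vec.map f v)
      H : Vec (Fin V) k → ℚ
      H e = h (toℕ (lookup e P)) (toℕ (lookup e Q))
      rest : Vec (Fin V) k → ℚ
      rest e = sw a b h (suc j) (word e (Q ∷ π))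
      s₁ : c * ∑ (subsets V k) (λ e → sw a b h j (word e (P ∷ Q ∷ π))) ≡ c * (w * ∑ (subsets V k) H) + c * ∑ (subsets V k) rest
      s₁ = trans (cong (c *_) (∑-cong (subsets V k) (λ e → cong (_+ rest e) (trans (cong (λ m → p j a * (H e * p m b)) (len (λ i → toℕ (lookup e i)) π)) (lem₁ (p j a) (H e) (p n b))))))
           (trans (∑-*+ (subsets V k) c (λ e → w * H e) rest) (cong (λ z → c * z + c * ∑ (subsets V k) rest) (∑-*ˡ (subsets V k) w H)))
      s₂ : sw a b h′ j (letters (P ∷ Q ∷ π)) ≡ w * h′ (toℕ P) (toℕ Q) + sw a b h′ (suc j) (letters (Q ∷ π))
      s₂ = cong (_+ sw a b h′ (suc j) (letters (Q ∷ π))) (trans (cong (λ m → p j a * (h′ (toℕ P) (toℕ Q) * p m b)) (len toℕ π)) (lem₁ (p j a) _ (p n b)))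
      eq : c * ∑ (subsets V k) (λ e → sw a b h j (word e (P ∷ Q ∷ π))) - q * sw a b h′ j (letters (P ∷ Q ∷ π))
         ≡ w * (c * ∑ (subsets V k) H - q * h′ (toℕ P) (toℕ Q)) + (c * ∑ (subsets V k) rest - q * sw a b h′ (suc j) (letters (Q ∷ π)))
      eq = trans (cong₂ (λ s t → s - q * t) s₁ s₂) (lem₂ c w (∑ (subsets V k) H) (∑ (subsets V k) rest) q (h′ (toℕ P) (toℕ Q)) _)

  p-lip : ∀ n {a b d} → 0ℚ ≤ a → a ≤ 1ℚ → 0ℚ ≤ b → b ≤ 1ℚ → ∣ a - b ∣ ≤ d → ∣ p n a - p n b ∣ ≤ ι n * d
  p-lip zero {d = d} _ _ _ _ h = subst₂ (λ x y → ∣ x ∣ ≤ y) (sym (+-inverseʳ 1ℚ)) (sym (*-zeroˡ d)) (∣0∣≤ ≤-refl)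
  p-lip (suc n) {a} {b} {d} 0≤a a≤1 0≤b b≤1 h = subst (λ x → ∣ x ∣ ≤ ι (suc n) * d) (lem (rec n) a b (p n a) (p n b))
    (≤-trans (∣*∣≤ {rec n} (≤-trans (≤-reflexive (∣∣-nn (0≤rec n))) (rec≤1 n)) (∣+∣≤ (∣*∣≤ h (∣p∣≤1 n 0≤a a≤1)) (∣*∣≤ (≤-trans (≤-reflexive (∣∣-nn 0≤b)) b≤1) (p-lip n 0≤a a≤1 0≤b b≤1 h)))) (≤-reflexive (lem₂ d (ι n))))
    where
    opaque
      unfolding arith
      lem : ∀ r a b x y → r * ((a - b) * x + b * (x - y)) ≡ x * (a * r) - y * (b * r)
      lem = solve-∀ R
      lem₂ : ∀ d n → 1ℚ * (d * 1ℚ + 1ℚ * (n * d)) ≡ (1ℚ + n) * d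
      lem₂ = solve-∀ R

  -- The two divided powers have Lipschitz constants `j` and the number of remaining letters; `N`
  -- bounds their sum at every position.
  sw-lip : ∀ {a b a′ b′ d} → 0ℚ ≤ a → a ≤ 1ℚ → 0ℚ ≤ b → b ≤ 1ℚ → 0ℚ ≤ a′ → a′ ≤ 1ℚ → 0ℚ ≤ b′ → b′ ≤ 1ℚ →
    ∣ a - a′ ∣ ≤ d → ∣ b - b′ ∣ ≤ d → ∀ h → (∀ P Q → ∣ h P Q ∣ ≤ 1ℚ) → ∀ N j c → j ℕ.+ length c ℕ.≤ N →
    ∣ sw a b h j c - sw a′ b′ h j c ∣ ≤ ι (length c) * (ι N * d)
  sw-lip {d = d} _ _ _ _ _ _ _ _ ha hb h H N j [] l = subst₂ (λ x y → ∣ x ∣ ≤ y) (sym (+-inverseʳ 0ℚ)) (sym (*-zeroˡ (ι N * d))) (∣0∣≤ ≤-refl)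
  sw-lip {d = d} _ _ _ _ _ _ _ _ ha hb h H N j (x ∷ []) l = subst (λ z → ∣ z ∣ ≤ ι 1 * (ι N * d)) (sym (+-inverseʳ 0ℚ)) (∣0∣≤ (0≤ι 1 ⊛ (0≤ι N ⊛ 0≤of∣∣ ha)))
  sw-lip {a} {b} {a′} {b′} {d} p₁ p₂ p₃ p₄ p₅ p₆ p₇ p₈ ha hb h H N j (x ∷ y ∷ c) l = subst (λ z → ∣ z ∣ ≤ ι (suc (suc (length c))) * (ι N * d)) (lem (p j a) (p j a′) (p (length c) b) (p (length c) b′) (h x y) _ _)
    (≤-trans (∣+∣≤ (∣+∣≤ (∣*∣≤ (p-lip j p₁ p₂ p₅ p₆ ha) (∣*∣≤ (H x y) (∣p∣≤1 (length c) p₃ p₄))) (∣*∣≤ (∣p∣≤1 j p₅ p₆) (∣*∣≤ (H x y) (p-lip (length c) p₃ p₄ p₇ p₈ hb))))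
      (sw-lip p₁ p₂ p₃ p₄ p₅ p₆ p₇ p₈ ha hb h H N (suc j) (y ∷ c) (subst (ℕ._≤ N) (ℕ.+-suc j (suc (length c))) l)))
      (lin (gap jm ⊛ 0≤of∣∣ ha) (lem₂ d (ι j) (ι (length c)) (ι N))))
    where
    opaque
      unfolding arith
      lem : ∀ q q′ r r′ g s s′ → (q - q′) * (g * r) + q′ * (g * (r - r′)) + (s - s′) ≡ q * (g * r) + s - (q′ * (g * r′) + s′)
      lem = solve-∀ R
      lem₂ : ∀ d j m N → (1ℚ + (1ℚ + m)) * (N * d) ≡ j * d * (1ℚ * 1ℚ) + 1ℚ * (1ℚ * (m * d)) + (1ℚ + m) * (N * d) + (N - (j + m)) * d
      lem₂ = solve-∀ R
    jm : ι j + ι (length c) ≤ ι N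
    jm = subst (_≤ ι N) (ι-+ j (length c)) (ι-mono (ℕ.≤-trans (ℕ.+-monoʳ-≤ j (ℕ.≤-trans (ℕ.n≤1+n _) (ℕ.n≤1+n _))) l))

  opaque
    unfolding τ

    τ-< : ∀ {k u v w P B Γ} → k ≡ P ℕ.+ suc (B ℕ.+ suc Γ) → τ k u v w P (P ℕ.+ suc B) ≡ p P u * (p B v * p Γ w)
    τ-< {u = u} {v} {w} {P} {B} {Γ} refl = trans (cong₂ _*_ sg (cong₂ (λ x y → p x u * y) e₁ (cong₂ (λ x y → p x v * p y w) e₂ e₃))) (*-identityˡ _)
      where
      P<Q : P ℕ.< P ℕ.+ suc B
      P<Q = ℕ.m<m+n P (s≤s z≤n)
      sg : sgn P (P ℕ.+ suc B) ≡ 1ℚ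
      sg with P <ᵇ (P ℕ.+ suc B) | T⇒true (ℕ.<⇒<ᵇ P<Q)
      ... | true | _ = refl
      e₁ : P ⊓ (P ℕ.+ suc B) ≡ P
      e₁ = ℕ.m≤n⇒m⊓n≡m (ℕ.<⇒≤ P<Q)
      m₁ : P ⊔ (P ℕ.+ suc B) ≡ P ℕ.+ suc B
      m₁ = ℕ.m≤n⇒m⊔n≡n (ℕ.<⇒≤ P<Q)
      e₂ : P ⊔ (P ℕ.+ suc B) ∸ suc (P ⊓ (P ℕ.+ suc B)) ≡ B
      e₂ = trans (cong₂ (λ x y → x ∸ suc y) (trans m₁ (ℕ.+-suc P B)) e₁) (ℕ.m+n∸m≡n P B)
      e₃ : P ℕ.+ suc (B ℕ.+ suc Γ) ∸ suc (P ⊔ (P ℕ.+ suc B)) ≡ Γ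
      e₃ = trans (cong₂ (λ x y → x ∸ suc y) (trans (cong (λ z → P ℕ.+ suc z) (ℕ.+-suc B Γ)) (trans (ℕ.+-suc P (suc B ℕ.+ Γ)) (cong suc (sym (ℕ.+-assoc P (suc B) Γ))))) m₁) (ℕ.m+n∸m≡n (P ℕ.+ suc B) Γ)

    -- `Δ` has the same antisymmetry, so the estimate for pairs in increasing order carries over to
    -- those in decreasing order.
    τ-anti : ∀ k u v w {P Q} → P ≢ Q → τ k u v w P Q ≡ - τ k u v w Q P
    τ-anti k u v w {P} {Q} n = trans (cong₂ _*_ (sg (ℕ.<-cmp P Q)) (cong₂ (λ x y → mon x (y ∸ suc x) (k ∸ suc y) u v w) (ℕ.⊓-comm P Q) (ℕ.⊔-comm P Q))) (lem (sgn Q P) _)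
      where
      opaque
        unfolding arith
        lem : ∀ s m → - s * m ≡ - (s * m)
        lem = solve-∀ R
        dn : 1ℚ ≡ - (- 1ℚ)
        dn = refl
      f⇒ : ∀ {P Q} → ¬ (P ℕ.< Q) → (P <ᵇ Q) ≡ false
      f⇒ {P} {Q} m with P <ᵇ Q in e
      ... | false = refl
      ... | true = ⊥-elim (m (ℕ.<ᵇ⇒< P Q (true⇒T e)))
      sg : Tri (P ℕ.< Q) (P ≡ Q) (Q ℕ.< P) → sgn P Q ≡ - sgn Q P
      sg (tri≈ _ e _) = ⊥-elim (n e)
      sg (tri< x _ y) with P <ᵇ Q | T⇒true (ℕ.<⇒<ᵇ x) | Q <ᵇ P | f⇒ y
      ... | true | _ | false | _ = dn
      sg (tri> y _ x) with Q <ᵇ P | T⇒true (ℕ.<⇒<ᵇ x) | P <ᵇ Q | f⇒ y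
      ... | true | _ | false | _ = refl

    ∣τ∣≤1 : ∀ k {u v w} → 0ℚ ≤ u → u ≤ 1ℚ → 0ℚ ≤ v → v ≤ 1ℚ → 0ℚ ≤ w → w ≤ 1ℚ → ∀ P Q → ∣ τ k u v w P Q ∣ ≤ 1ℚ
    ∣τ∣≤1 k a b c d e f P Q = ≤-trans (∣*∣≤ sg (∣*∣≤ (∣p∣≤1 (lo k P Q) a b) (∣*∣≤ (∣p∣≤1 (mid k P Q) c d) (∣p∣≤1 (hi k P Q) e f)))) (≤-reflexive one⁴)
      where
      opaque
        unfolding arith
        one⁴ : 1ℚ * (1ℚ * (1ℚ * 1ℚ)) ≡ 1ℚ
        one⁴ = refl
      sg : ∣ sgn P Q ∣ ≤ 1ℚ
      sg with P <ᵇ Q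
      ... | true = ≤-reflexive (∣∣-nn 0≤1)
      ... | false = ≤-reflexive (trans (∣-x∣ 1ℚ) (∣∣-nn 0≤1))

  nth-lookup : ∀ P {m n} (v : Vec ℕ n) (e : n ≡ P ℕ.+ suc m) (i : Fin n) → toℕ i ≡ P → lookup v i ≡ nth P (subst (Vec ℕ) e v)
  nth-lookup zero (x ∷ v) refl zero _ = refl
  nth-lookup (suc P) (x ∷ v) refl (suc i) h = nth-lookup P v refl i (ℕ.suc-injective h)

  after-lookup : ∀ P B {m n} (v : Vec ℕ n) (e : n ≡ P ℕ.+ suc (B ℕ.+ suc m)) (i : Fin n) → toℕ i ≡ P ℕ.+ suc B → lookup v i ≡ nth B (after P (subst (Vec ℕ) e v))
  after-lookup zero B (x ∷ v) refl (suc i) h = nth-lookup B v refl i (ℕ.suc-injective h)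
  after-lookup (suc P) B (x ∷ v) refl (suc i) h = after-lookup P B v refl i (ℕ.suc-injective h)

  -- The recursion of `inc` only ever produces increasing vectors, which is what makes `Δ-cls`
  -- applicable under the sum.
  inc-lo : ∀ V k o {g h : Vec ℕ k → ℚ} → (∀ v → VA.All (o ℕ.≤_) v → VP.AllPairs ℕ._<_ v → g v ≡ h v) → inc V k o g ≡ inc V k o h
  inc-lo V zero o e = e [] [] []
  inc-lo zero (suc k) o e = refl
  inc-lo (suc V) (suc k) o e = cong₂ _+_ (inc-lo V k (suc o) (λ v a s → e (o ∷ v) (ℕ.≤-refl ∷ VA.map (ℕ.≤-trans (ℕ.n≤1+n o)) a) (a ∷ s)))
    (inc-lo V (suc k) (suc o) (λ v a s → e v (VA.map (ℕ.≤-trans (ℕ.n≤1+n o)) a) s))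

  nth-< : ∀ P B {m} (v : Vec ℕ (P ℕ.+ suc (B ℕ.+ suc m))) → VP.AllPairs ℕ._<_ v → nth P v ℕ.< nth B (after P v)
  nth-< zero B (x ∷ v) (a ∷ _) = go B v a
    where
    go : ∀ B {m x} (v : Vec ℕ (B ℕ.+ suc m)) → VA.All (x ℕ.<_) v → x ℕ.< nth B v
    go zero (y ∷ v) (h ∷ _) = h
    go (suc B) (y ∷ v) (_ ∷ hs) = go B v hs
  nth-< (suc P) B (x ∷ v) (_ ∷ s) = nth-< P B v s

  D-mono : ∀ {P B Γ k} → P ℕ.≤ k → B ℕ.≤ k → Γ ℕ.≤ k → D P B Γ ≤ D k k k
  D-mono {P} {B} {Γ} {k} a b c = +-mono-≤ (*-mono (0≤ι P) ((0≤1 ⊹ 0≤ι k) ⊛ (0≤1 ⊹ 0≤ι k)) (ι-mono a) (*-mono (0≤1 ⊹ 0≤ι B) (0≤1 ⊹ 0≤ι k) (+-monoʳ-≤ 1ℚ (ι-mono b)) (+-monoʳ-≤ 1ℚ (ι-mono c))))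
    (+-mono-≤ (*-mono (0≤ι B) (0≤1 ⊹ 0≤ι k) (ι-mono b) (+-monoʳ-≤ 1ℚ (ι-mono c))) (ι-mono c))

  module Columns (V : ℕ) (v : ℚ) (0≤v : 0ℚ ≤ v) (vV : v * ι V ≡ 1ℚ) (s : ℕ) (a a′ : ℕ) (aa′ : a ℕ.+ suc s ℕ.≤ a′) (a′V : a′ ℕ.+ suc s ℕ.≤ V)
    (θ≤1 : ι 3 * (ι (suc s) * v) ≤ 1ℚ) (k : ℕ) where

    open Marks V v 0≤v vV s a a′ aa′ a′V θ≤1 public

    h : ℕ → ℕ → ℚ
    h c c′ = Δ (cls a a′ (suc s) c) (cls a a′ (suc s) c′)

    τ′ : ℕ → ℕ → ℚ
    τ′ = τ k u (u′ - u) (1ℚ - u′)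

    err : ℚ
    err = η * η * (θ * D k k k)

    0≤η² : 0ℚ ≤ η * η
    0≤η² = (0≤ι (suc s) ⊛ 0≤v) ⊛ (0≤ι (suc s) ⊛ 0≤v)

    0≤θ′ : 0ℚ ≤ θ
    0≤θ′ = 0≤ι 3 ⊛ (0≤ι (suc s) ⊛ 0≤v)

    0≤err : 0ℚ ≤ err
    0≤err = 0≤η² ⊛ (0≤θ′ ⊛ (0≤ι k ⊛ ((0≤1 ⊹ 0≤ι k) ⊛ (0≤1 ⊹ 0≤ι k)) ⊹ (0≤ι k ⊛ (0≤1 ⊹ 0≤ι k) ⊹ 0≤ι k)))

    avg : Fin k → Fin k → ℚ
    avg P Q = pow v k * ∑ (subsets V k) (λ e → h (toℕ (lookup e P)) (toℕ (lookup e Q)))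

    private
      avg-inc : ∀ P Q → avg P Q ≡ pow v k * inc V k 0 (λ e → h (lookup e P) (lookup e Q))
      avg-inc P Q = cong (pow v k *_) (trans (∑-cong (subsets V k) (λ e → sym (cong₂ h (Vec.lookup-map P toℕ e) (Vec.lookup-map Q toℕ e))))
        (∑-subsets V k 0 (λ e → h (lookup e P) (lookup e Q))))

      sub : ∀ {k′} (e : k ≡ k′) (g : Vec ℕ k′ → ℚ) → inc V k 0 (λ x → g (subst (Vec ℕ) e x)) ≡ inc V k′ 0 g
      sub refl g = refl

      asc : ∀ (P Q : Fin k) → toℕ P ℕ.< toℕ Q → ∣ avg P Q - η * η * τ′ (toℕ P) (toℕ Q) ∣ ≤ err
      asc P Q l with ℕ.m≤n⇒∃[o]m+o≡n l | ℕ.m≤n⇒∃[o]m+o≡n (Fin.toℕ<n Q)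
      ... | B , eB | Γ , eΓ = subst (λ z → ∣ z ∣ ≤ err) (cong₂ _-_ (sym e₁) (cong (η * η *_) (sym e₂))) (≤-trans (At.estimate (toℕ P) B Γ) (*-monoˡ (η * η) 0≤η² (*-monoˡ θ 0≤θ′ (D-mono {toℕ P} {B} {Γ} (ℕ.<⇒≤ (Fin.toℕ<n P)) B≤k Γ≤k))))
        where
        Q≡ : toℕ Q ≡ toℕ P ℕ.+ suc B
        Q≡ = trans (sym eB) (sym (ℕ.+-suc (toℕ P) B))
        k≡ : k ≡ toℕ P ℕ.+ suc (B ℕ.+ suc Γ)
        k≡ = trans (sym eΓ) (trans (cong (λ z → suc z ℕ.+ Γ) Q≡) (trans (cong suc (ℕ.+-assoc (toℕ P) (suc B) Γ)) (trans (sym (ℕ.+-suc (toℕ P) (suc B ℕ.+ Γ))) (cong (λ z → toℕ P ℕ.+ suc z) (sym (ℕ.+-suc B Γ))))))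
        B≤k : B ℕ.≤ k
        B≤k = subst (B ℕ.≤_) (sym k≡) (ℕ.≤-trans (ℕ.m≤m+n B (suc Γ)) (ℕ.≤-trans (ℕ.n≤1+n _) (ℕ.m≤n+m _ (toℕ P))))
        Γ≤k : Γ ℕ.≤ k
        Γ≤k = subst (Γ ℕ.≤_) (sym k≡) (ℕ.≤-trans (ℕ.≤-trans (ℕ.n≤1+n Γ) (ℕ.m≤n+m (suc Γ) B)) (ℕ.≤-trans (ℕ.n≤1+n _) (ℕ.m≤n+m _ (toℕ P))))
        e₁ : avg P Q ≡ pow v (toℕ P ℕ.+ suc (B ℕ.+ suc Γ)) * inc V (toℕ P ℕ.+ suc (B ℕ.+ suc Γ)) 0 (λ e → φ (nth (toℕ P) e) * ψ (nth B (after (toℕ P) e)))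
        e₁ = trans (avg-inc P Q) (trans (cong₂ _*_ (cong (pow v) k≡) (trans (inc-cong V k 0 (λ x → cong₂ h (nth-lookup (toℕ P) x k≡ P refl) (after-lookup (toℕ P) B x k≡ Q Q≡)))
               (trans (sub k≡ (λ x → h (nth (toℕ P) x) (nth B (after (toℕ P) x)))) (inc-lo V _ 0 (λ x _ s′ → Δ-cls aa′ (nth-< (toℕ P) B x s′)))))) refl)
        e₂ : τ′ (toℕ P) (toℕ Q) ≡ At.m (toℕ P) B Γ
        e₂ = trans (cong (τ′ (toℕ P)) Q≡) (τ-< k≡)

      Δ-anti : ∀ x y → Δ x y ≡ - Δ y x
      Δ-anti first first = neg0
        where
        opaque
          unfolding arith
          neg0 : 0ℚ ≡ - 0ℚ
          neg0 = refl
      Δ-anti first second = neg1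
        where
        opaque
          unfolding arith
          neg1 : 1ℚ ≡ - (- 1ℚ)
          neg1 = refl
      Δ-anti first other = Δ-anti first first
      Δ-anti second first = refl
      Δ-anti second second = Δ-anti first first
      Δ-anti second other = Δ-anti first first
      Δ-anti other first = Δ-anti first first
      Δ-anti other second = Δ-anti first first
      Δ-anti other other = Δ-anti first first

    close : ∀ P Q → P ≢ Q → ∣ avg P Q - η * η * τ′ (toℕ P) (toℕ Q) ∣ ≤ err
    close P Q n with ℕ.<-cmp (toℕ P) (toℕ Q)
    ... | tri< l _ _ = asc P Q l
    ... | tri≈ _ e _ = ⊥-elim (n (Fin.toℕ-injective e))
    ... | tri> _ _ l = subst (λ z → ∣ z ∣ ≤ err) (sym eq) (subst (_≤ err) (sym (∣-x∣ _)) (asc Q P l))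
      where
      opaque
        unfolding arith
        lem : ∀ c s q t → c * (- 1ℚ * s) - q * - t ≡ - (c * s - q * t)
        lem = solve-∀ R
        m1 : ∀ x → - x ≡ - 1ℚ * x
        m1 = solve-∀ R
      eq : avg P Q - η * η * τ′ (toℕ P) (toℕ Q) ≡ - (avg Q P - η * η * τ′ (toℕ Q) (toℕ P))
      eq = trans (cong₂ (λ s t → pow v k * s - η * η * t) (trans (∑-cong (subsets V k) (λ e → trans (Δ-anti (cls a a′ (suc s) (toℕ (lookup e P))) (cls a a′ (suc s) (toℕ (lookup e Q)))) (m1 _))) (∑-*ˡ (subsets V k) (- 1ℚ) _)) (τ-anti k u (u′ - u) (1ℚ - u′) (λ e → n (Fin.toℕ-injective e))))
             (lem (pow v k) _ (η * η) (τ′ (toℕ Q) (toℕ P)))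

-- Linear algebra and the contraction argument.

module FixedPoints where
  open import Data.Nat as ℕ using (ℕ; zero; suc; z≤n; s≤s)
  import Data.Nat.Properties as ℕ
  open import Data.Integer as ℤ using (ℤ)
  import Data.Rational as D
  import Data.Rational.Properties as D
  open import Data.Fin using (Fin; zero; suc)
  open import Data.Product using (∃; _×_; _,_; proj₁; proj₂)
  open import Relation.Binary.PropositionalEquality hiding (_≗_)
  open import Tactic.RingSolver using (solve-∀)
  open Rationals
  open Series
  open Expansions using (Y; Box; LipB; bd; lp; 0-Y)

  opaque
    unfolding arith
    archimedes : ∀ q → ∃ λ n → q ≤ ι n
    archimedes q@(D.mkℚ (ℤ.+ n) d c) = n , subst (q ≤_) (sym (ι≡/ n)) (D.toℚᵘ-cancel-≤ (ℚᵘ.≤-respʳ-≃ (ℚᵘ.≃-sym (D.toℚᵘ-fromℚᵘ (ℚᵘ.mkℚᵘ (ℤ.+ n) 0))) (ℚᵘ.*≤* le)))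
      where
      import Data.Rational.Unnormalised as ℚᵘ
      import Data.Rational.Unnormalised.Properties as ℚᵘ
      import Data.Integer.Properties as ℤ
      le : ℤ.+ n ℤ.* ℤ.1ℤ ℤ.≤ ℤ.+ n ℤ.* ℤ.+ suc d
      le = ℤ.*-monoˡ-≤-nonNeg (ℤ.+ n) (ℤ.+≤+ (s≤s z≤n))
    archimedes q@(D.mkℚ ℤ.-[1+ n ] d c) = 0 , <⇒≤ (D.negative⁻¹ q)

  small : ∀ {ε} → 0ℚ < ε → ∃ λ n → rec n ≤ ε
  small {ε} h with inverse⁺ ε h
  ... | b , 0<b , e with archimedes b
  ... | n , l = n , lin {t = rec n * ε * (ι (suc n) - b)} (0≤rec n ⊛ <⇒≤ h ⊛ gap (≤-trans l (≤+ˡ 1ℚ 0≤1))) (trans (sym (*-identityʳ ε)) (trans (cong (ε *_) (sym (rec-ι n))) (trans (lem (rec n) ε (ι (suc n)) b) (cong (λ z → rec n * z + rec n * ε * (ι (suc n) - b)) e) ■ cong (_+ rec n * ε * (ι (suc n) - b)) (*-identityʳ (rec n)))))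
    where
    _■_ = trans
    opaque
      unfolding arith
      lem : ∀ r e n b → e * (r * n) ≡ r * (b * e) + r * e * (n - b)
      lem = solve-∀ R

  rec-mono : ∀ {m n} → m ℕ.≤ n → rec n ≤ rec m
  rec-mono {m} {n} h = lin {t = rec m * rec n * (ι n - ι m)} (0≤rec m ⊛ 0≤rec n ⊛ gap (ι-mono h)) (trans (lem (rec m) (rec n) (ι m) (ι n)) (cong₂ (λ x y → rec m * (1ℚ - x) + (rec n * y + rec m * rec n * (ι n - ι m))) (rec-ι n) (rec-ι m) ■ lem₂ (rec m) (rec n) _))
    where
    _■_ = trans
    opaque
      unfolding arith
      lem : ∀ x y m n → x ≡ x * (1ℚ - y * (1ℚ + n)) + (y * (x * (1ℚ + m)) + x * y * (n - m))
      lem = solve-∀ R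
      lem₂ : ∀ x y t → x * (1ℚ - 1ℚ) + (y * 1ℚ + t) ≡ y + t
      lem₂ = solve-∀ R

  -- Measures geometric convergence on the scale of `rec`, for which `small` finds arbitrarily small
  -- members.
  half^ : ∀ n → pow ½ n ≤ rec n
  half^ zero = ≤-reflexive (trans (sym (*-identityˡ 1ℚ)) (trans (*-identityˡ 1ℚ) (trans (sym (rec-ι 0)) (lem (rec 0)))))
    where
    opaque
      unfolding arith
      lem : ∀ r → r * (1ℚ + 0ℚ) ≡ r
      lem = solve-∀ R
  half^ (suc n) = ≤-trans (*-monoˡ ½ 0≤½ (half^ n)) (lin {t = ½ * rec (suc n) * (rec n * ι n)} (0≤½ ⊛ 0≤rec (suc n) ⊛ (0≤rec n ⊛ 0≤ι n)) eq)
    where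
    opaque
      unfolding arith
      lem₁ : ∀ r → ½ * r ≡ ½ * (r * 1ℚ)
      lem₁ = solve-∀ R
      lem₂ : ∀ r s n → ½ * (r * (s * (1ℚ + (1ℚ + n)))) ≡ ½ * (s * (r * (1ℚ + n)) + s * r)
      lem₂ = solve-∀ R
      lem₄ : ∀ r s n → ½ * (s * (r * (1ℚ + n)) + s * r) + ½ * s * (r * n) ≡ ½ * s * (r * (1ℚ + n)) + ½ * s * (r * (1ℚ + n))
      lem₄ = solve-∀ R
      lem₅ : ∀ s → ½ * s * 1ℚ + ½ * s * 1ℚ ≡ s
      lem₅ = solve-∀ R
    eq : rec (suc n) ≡ ½ * rec n + ½ * rec (suc n) * (rec n * ι n)
    eq = sym (trans (cong (_+ ½ * rec (suc n) * (rec n * ι n)) (trans (lem₁ (rec n)) (trans (cong (λ z → ½ * (rec n * z)) (sym (rec-ι (suc n)))) (lem₂ (rec n) (rec (suc n)) (ι n)))))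
      (trans (lem₄ (rec n) (rec (suc n)) (ι n)) (trans (cong (λ z → ½ * rec (suc n) * z + ½ * rec (suc n) * z) (rec-ι n)) (lem₅ (rec (suc n))))))

  i₀ i₁ i₂ : Fin 3
  i₀ = zero
  i₁ = suc zero
  i₂ = suc (suc zero)

  Σ₃ : (Fin 3 → ℚ) → ℚ
  Σ₃ f = f i₀ + f i₁ + f i₂

  ∣Σ₃∣≤ : ∀ {f c} → (∀ i → ∣ f i ∣ ≤ c) → ∣ Σ₃ f ∣ ≤ c + c + c
  ∣Σ₃∣≤ h = ∣+∣≤ (∣+∣≤ (h i₀) (h i₁)) (h i₂)

  Matrix : Set
  Matrix = Fin 3 → Fin 3 → ℚ

  _∙_ : Matrix → Y → Y
  (M ∙ y) i = Σ₃ (λ g → M i g * y g)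

  det : Matrix → ℚ
  det M = M i₀ i₀ * (M i₁ i₁ * M i₂ i₂ - M i₁ i₂ * M i₂ i₁) - M i₀ i₁ * (M i₁ i₀ * M i₂ i₂ - M i₁ i₂ * M i₂ i₀) + M i₀ i₂ * (M i₁ i₀ * M i₂ i₁ - M i₁ i₁ * M i₂ i₀)

  adj : Matrix → Matrix
  adj M zero zero = M i₁ i₁ * M i₂ i₂ - M i₁ i₂ * M i₂ i₁
  adj M zero (suc zero) = M i₀ i₂ * M i₂ i₁ - M i₀ i₁ * M i₂ i₂
  adj M zero (suc (suc zero)) = M i₀ i₁ * M i₁ i₂ - M i₀ i₂ * M i₁ i₁
  adj M (suc zero) zero = M i₁ i₂ * M i₂ i₀ - M i₁ i₀ * M i₂ i₂
  adj M (suc zero) (suc zero) = M i₀ i₀ * M i₂ i₂ - M i₀ i₂ * M i₂ i₀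
  adj M (suc zero) (suc (suc zero)) = M i₀ i₂ * M i₁ i₀ - M i₀ i₀ * M i₁ i₂
  adj M (suc (suc zero)) zero = M i₁ i₀ * M i₂ i₁ - M i₁ i₁ * M i₂ i₀
  adj M (suc (suc zero)) (suc zero) = M i₀ i₁ * M i₂ i₀ - M i₀ i₀ * M i₂ i₁
  adj M (suc (suc zero)) (suc (suc zero)) = M i₀ i₀ * M i₁ i₁ - M i₀ i₁ * M i₁ i₀

  -- Cramer's rule: the adjugate divided by the determinant.
  solvable : ∀ M → det M ≢ 0ℚ → ∃ λ N → ∀ z i → (M ∙ (N ∙ z)) i ≡ z i
  solvable M n = (λ g i → c * adj M g i) , λ z → λ where
      zero → fin (z i₀) (e₀ c (M i₀ i₀) (M i₀ i₁) (M i₀ i₂) (M i₁ i₀) (M i₁ i₁) (M i₁ i₂) (M i₂ i₀) (M i₂ i₁) (M i₂ i₂) (z i₀) (z i₁) (z i₂))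
      (suc zero) → fin (z i₁) (e₁ c (M i₀ i₀) (M i₀ i₁) (M i₀ i₂) (M i₁ i₀) (M i₁ i₁) (M i₁ i₂) (M i₂ i₀) (M i₂ i₁) (M i₂ i₂) (z i₀) (z i₁) (z i₂))
      (suc (suc zero)) → fin (z i₂) (e₂ c (M i₀ i₀) (M i₀ i₁) (M i₀ i₂) (M i₁ i₀) (M i₁ i₁) (M i₁ i₂) (M i₂ i₀) (M i₂ i₁) (M i₂ i₂) (z i₀) (z i₁) (z i₂))
    where
    inv = inverse (det M) n
    c : ℚ
    c = proj₁ inv
    fin : ∀ {x} t → x ≡ c * det M * t → x ≡ t
    fin t e = trans e (trans (cong (_* t) (proj₂ inv)) (*-identityˡ t))
    opaque
      unfolding arith
      e₀ : ∀ c m n o q r s t u v x y z →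
        m * (c * (r * v - s * u) * x + c * (o * u - n * v) * y + c * (n * s - o * r) * z) + n * (c * (s * t - q * v) * x + c * (m * v - o * t) * y + c * (o * q - m * s) * z) + o * (c * (q * u - r * t) * x + c * (n * t - m * u) * y + c * (m * r - n * q) * z)
        ≡ c * (m * (r * v - s * u) - n * (q * v - s * t) + o * (q * u - r * t)) * x
      e₀ = solve-∀ R
      e₁ : ∀ c m n o q r s t u v x y z →
        q * (c * (r * v - s * u) * x + c * (o * u - n * v) * y + c * (n * s - o * r) * z) + r * (c * (s * t - q * v) * x + c * (m * v - o * t) * y + c * (o * q - m * s) * z) + s * (c * (q * u - r * t) * x + c * (n * t - m * u) * y + c * (m * r - n * q) * z)
        ≡ c * (m * (r * v - s * u) - n * (q * v - s * t) + o * (q * u - r * t)) * y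
      e₁ = solve-∀ R
      e₂ : ∀ c m n o q r s t u v x y z →
        t * (c * (r * v - s * u) * x + c * (o * u - n * v) * y + c * (n * s - o * r) * z) + u * (c * (s * t - q * v) * x + c * (m * v - o * t) * y + c * (o * q - m * s) * z) + v * (c * (q * u - r * t) * x + c * (n * t - m * u) * y + c * (m * r - n * q) * z)
        ≡ c * (m * (r * v - s * u) - n * (q * v - s * t) + o * (q * u - r * t)) * z
      e₂ = solve-∀ R

  maxNorm : ∀ (M : Matrix) → ∃ λ ν → ∀ i j → ∣ M i j ∣ ≤ ν
  maxNorm M = Σ₃ (λ i → Σ₃ (λ j → ∣ M i j ∣)) , λ i j → ≤-trans (entry (λ j → ∣ M i j ∣) (λ j → 0≤∣x∣ _) j) (entry (λ i → Σ₃ (λ j → ∣ M i j ∣)) (λ i → 0≤∣x∣ _ ⊹ 0≤∣x∣ _ ⊹ 0≤∣x∣ _) i)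
    where
    entry : ∀ f → (∀ i → 0ℚ ≤ f i) → ∀ i → f i ≤ Σ₃ f
    entry f h zero = ≤-trans (≤+ _ (h i₁)) (≤+ _ (h i₂))
    entry f h (suc zero) = ≤-trans (≤+ˡ _ (h i₀)) (≤+ _ (h i₂))
    entry f h (suc (suc zero)) = ≤+ˡ _ (h i₀ ⊹ h i₁)

  -- A zero of `M y + F y` is sought as `y = N z`, which turns the equation into the fixed point
  -- equation `z = - F (N z)`. This map has Lipschitz constant at most `9 ν ρ`, one summand for each
  -- entry of `N`, and 18 brings it down to 1/2.
  module Newton (M N : Matrix) (MN : ∀ z i → (M ∙ (N ∙ z)) i ≡ z i) (ν : ℚ) (hN : ∀ i j → ∣ N i j ∣ ≤ ν)
    (F : Fin 3 → Y → ℚ) (ρ : ℚ) (hR : ∀ i → LipB ρ (F i)) (hρ : ι 18 * (ν * ρ) ≤ 1ℚ) (ρ≤1 : ρ ≤ 1ℚ) where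

    private
      0≤ν : 0ℚ ≤ ν
      0≤ν = 0≤of∣∣ (hN i₀ i₀)
      0≤ρ : 0ℚ ≤ ρ
      0≤ρ = 0≤of∣∣ (bd (hR i₀) {0-Y} (λ g → ∣0∣≤ 0≤½))

    z : ℕ → Y
    z zero = 0-Y
    z (suc n) i = - F i (N ∙ z n)

    y : ℕ → Y
    y n = N ∙ z n

    private
      opaque
        unfolding arith
        half≡ : ½ ≡ ½ * 1ℚ
        half≡ = refl
        split : ∀ t → ½ * ((1ℚ + (1ℚ + (1ℚ + (1ℚ + (1ℚ + (1ℚ + (1ℚ + (1ℚ + (1ℚ + (1ℚ + (1ℚ + (1ℚ + (1ℚ + (1ℚ + (1ℚ + (1ℚ + (1ℚ + (1ℚ + 0ℚ)))))))))))))))))) * t)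
          ≡ t + t + t + (t + t + t + t + t + t)
        split = solve-∀ R
        nine≡ : ∀ t e → t * e + t * e + t * e + (t * e + t * e + t * e) + (t * e + t * e + t * e) ≡ (t + t + t + (t + t + t + t + t + t)) * e
        nine≡ = solve-∀ R
        n₁ : ∀ ρ ν e → ρ * (ν * e + ν * e + ν * e + (ν * e + ν * e + ν * e) + (ν * e + ν * e + ν * e)) ≡ ν * ρ * e + ν * ρ * e + ν * ρ * e + (ν * ρ * e + ν * ρ * e + ν * ρ * e) + (ν * ρ * e + ν * ρ * e + ν * ρ * e)
        n₁ = solve-∀ R
        d₁ : ∀ n₀ n₁ n₂ x y z a b c → n₀ * (x - a) + n₁ * (y - b) + n₂ * (z - c) ≡ n₀ * x + n₁ * y + n₂ * z - (n₀ * a + n₁ * b + n₂ * c)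
        d₁ = solve-∀ R
        neg₂ : ∀ a b → - (a - b) ≡ - a - - b
        neg₂ = solve-∀ R
        neg₃ : ∀ a b → a + b ≡ a - - b
        neg₃ = solve-∀ R
      νρ9 : ν * ρ + ν * ρ + ν * ρ + (ν * ρ + ν * ρ + ν * ρ + ν * ρ + ν * ρ + ν * ρ) ≤ ½
      νρ9 = subst₂ _≤_ (split (ν * ρ)) (sym half≡) (*-monoˡ ½ 0≤½ hρ)
      0≤t : 0ℚ ≤ ν * ρ
      0≤t = 0≤ν ⊛ 0≤ρ
      νρ3 : ν * ρ + ν * ρ + ν * ρ ≤ ½
      νρ3 = ≤-trans (≤+ _ (0≤t ⊹ 0≤t ⊹ 0≤t ⊹ 0≤t ⊹ 0≤t ⊹ 0≤t)) νρ9

    z-bound : ∀ n → (∀ i → ∣ z n i ∣ ≤ ρ) × Box (y n)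
    z-bound zero = (λ i → ∣0∣≤ 0≤ρ) , λ g → ≤-trans (∣Σ₃∣≤ (λ i → ∣*∣≤ (hN g i) (∣0∣≤ 0≤ρ))) νρ3
    z-bound (suc n) = zb , λ g → ≤-trans (∣Σ₃∣≤ (λ i → ∣*∣≤ (hN g i) (zb i))) νρ3
      where
      zb : ∀ i → ∣ z (suc n) i ∣ ≤ ρ
      zb i = subst (_≤ ρ) (sym (∣-x∣ (F i (y n)))) (bd (hR i) (proj₂ (z-bound n)))

    shrink : ∀ n i → ∣ z n i - z (suc n) i ∣ ≤ pow ½ n
    shrink zero i = ≤-trans (subst (λ t → ∣ t ∣ ≤ ρ) (trans (sym (+-identityˡ _)) refl) (subst (_≤ ρ) (sym (trans (∣-x∣ (- F i (y 0))) (∣-x∣ (F i (y 0))))) (bd (hR i) (proj₂ (z-bound 0))))) ρ≤1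
    shrink (suc n) i = subst (_≤ ½ * pow ½ n) (trans (sym (∣-x∣ (F i (y n) - F i (y (suc n))))) (cong ∣_∣ (neg₂ (F i (y n)) (F i (y (suc n)))))) (≤-trans (lp (hR i) (proj₂ (z-bound n)) (proj₂ (z-bound (suc n))))
      (≤-trans (*-monoˡ ρ 0≤ρ (+-mono-≤ (+-mono-≤ (co i₀) (co i₁)) (co i₂))) (≤-trans (≤-reflexive (trans (n₁ ρ ν (pow ½ n)) (nine≡ (ν * ρ) (pow ½ n)))) (*-monoʳ (pow ½ n) (0≤pow n 0≤½) νρ9))))
      where
      co : ∀ g → ∣ y n g - y (suc n) g ∣ ≤ ν * pow ½ n + ν * pow ½ n + ν * pow ½ n
      co g = subst (λ t → ∣ t ∣ ≤ ν * pow ½ n + ν * pow ½ n + ν * pow ½ n) (d₁ (N g i₀) (N g i₁) (N g i₂) _ _ _ _ _ _) (∣Σ₃∣≤ {λ i → N g i * (z n i - z (suc n) i)} (λ i → ∣*∣≤ (hN g i) (shrink n i)))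

    -- The residual at `y n` is exactly the difference of two consecutive iterates, so it suffices
    -- to stop once they are close; no limit is formed.
    approximate-root : ∀ {ε} → 0ℚ < ε → ∃ λ y → Box y × (∀ i → ∣ (M ∙ y) i + F i y ∣ ≤ ε)
    approximate-root {ε} h = let n , l = small h in y n , proj₂ (z-bound n) , λ i →
      ≤-trans (subst (λ t → ∣ t ∣ ≤ pow ½ n) (trans (sym (neg₃ (z n i) (F i (y n)))) (cong (_+ F i (y n)) (sym (MN (z n) i)))) (shrink n i)) (≤-trans (half^ n) l)

-- Discretised columns and the response matrix.

module Functionals where
  open import Data.Nat as ℕ using (ℕ; zero; suc; _∸_)
  import Data.Nat.Properties as ℕ
  open import Data.Integer as ℤ using (ℤ)
  import Data.Rational as D
  import Data.Rational.Properties as D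
  open import Data.Fin using (Fin; zero; suc; toℕ)
  open import Data.List using (List; []; _∷_; length)
  open import Data.Vec as Vec using (Vec; []; _∷_)
  import Data.Vec.Properties as Vec
  open import Data.Vec.Relation.Unary.AllPairs as VP using ([]; _∷_)
  open import Data.Product using (∃; _×_; _,_; proj₁; proj₂)
  open import Data.Empty using (⊥-elim)
  open import Relation.Nullary using (yes; no)
  open import Relation.Binary.PropositionalEquality hiding (_≗_)
  open import Tactic.RingSolver using (solve-∀)
  open import Defs using (subsets)
  open Rationals
  open Series
  open Expansions
  open TestPaths
  open Moments using (τ; T)
  open Nonvanishing using (length-toList)
  open IncreasingSums
  open ColumnCounts using (cls) renaming (D to slack)
  open ColumnAverages
  open FixedPoints

  fraction : ∀ q → 0ℚ ≤ q → ∃ λ b → ∃ λ a → q * ι (suc b) ≡ ι a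
  fraction q@(D.mkℚ (ℤ.+ n) d c) h = d , n , trans (cong (_* ι (suc d)) (sym (D.↥p/↧p≡p q))) (/-ι n d)
  fraction (D.mkℚ ℤ.-[1+ n ] d c) (D.*≤* ())

  small* : ∀ C {ε} → 0ℚ ≤ C → 0ℚ < ε → ∃ λ n → C * rec n ≤ ε
  small* C {ε} 0≤C h with inverse⁺ ε h
  ... | b , 0<b , e with archimedes (C * b)
  ... | n , l = n , lin {t = ε * rec n * (ι (suc n) - C * b)} (<⇒≤ h ⊛ 0≤rec n ⊛ gap (≤-trans l (≤+ˡ 1ℚ 0≤1))) (trans (sym (*-identityʳ ε)) (trans (cong (ε *_) (sym (rec-ι n))) (trans (lem ε (rec n) (ι (suc n)) C b) (cong (λ z → C * rec n * z + ε * rec n * (ι (suc n) - C * b)) e) ■ cong (_+ ε * rec n * (ι (suc n) - C * b)) (*-identityʳ _))))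
    where
    _■_ = trans
    opaque
      unfolding arith
      lem : ∀ e r n C b → e * (r * n) ≡ C * r * (b * e) + e * r * (n - C * b)
      lem = solve-∀ R

  -- Makes `mean` an operator of norm at most 1, with no dependence on `V`.
  ch≤ : ∀ V v k → 0ℚ ≤ v → v * ι V ≡ 1ℚ → pow v k * ch V k ≤ 1ℚ
  ch≤ V v zero 0≤v vV = ≤-reflexive (*-identityˡ 1ℚ)
  ch≤ V v (suc k) 0≤v vV = ≤-trans (lin {t = pow v k * v * (ι k * ch V (suc k)) + pow v k * v * (ch V k * ι k)} (0≤pow k 0≤v ⊛ 0≤v ⊛ (0≤ι k ⊛ 0≤ch V (suc k)) ⊹ 0≤pow k 0≤v ⊛ 0≤v ⊛ (0≤ch V k ⊛ 0≤ι k)) eq) (ch≤ V v k 0≤v vV)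
    where
    opaque
      unfolding arith
      l₁ : ∀ q c v V → q * c * (v * V) ≡ q * v * (c * V)
      l₁ = solve-∀ R
      l₂ : ∀ q v c k V → q * v * (c * V) ≡ q * v * (c * (V - k)) + q * v * (c * k)
      l₂ = solve-∀ R
      l₃ : ∀ q v c′ k u → q * v * ((1ℚ + k) * c′) + u ≡ v * q * c′ + (q * v * (k * c′) + u)
      l₃ = solve-∀ R
    eq : pow v k * ch V k ≡ v * pow v k * ch V (suc k) + (pow v k * v * (ι k * ch V (suc k)) + pow v k * v * (ch V k * ι k))
    eq = trans (sym (*-identityʳ _)) (trans (cong (pow v k * ch V k *_) (sym vV)) (trans (l₁ (pow v k) (ch V k) v (ι V)) (trans (l₂ (pow v k) v (ch V k) (ι k) (ι V))
          (trans (cong (λ z → pow v k * v * z + pow v k * v * (ch V k * ι k)) (sym (ch-step V k))) (l₃ (pow v k) v (ch V (suc k)) (ι k) _)))))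

  length-subsets : ∀ V k → ι (length (subsets V k)) ≡ ch V k
  length-subsets V k = trans (sym (trans (∑-const (subsets V k) 1ℚ) (*-identityʳ _))) (trans (∑-subsets V k 0 (λ _ → 1ℚ)) (inc-one V k 0))

  LipB-∑ : ∀ {A : Set} (xs : List A) {C} {f : A → Y → ℚ} → 0ℚ ≤ C → (∀ x → LipB C (f x)) → LipB (ι (length xs) * C) (λ y → ∑ xs (λ x → f x y))
  LipB-∑ [] {C} h k = LipB-mono (≤-reflexive (sym (*-zeroˡ C))) (LipB-const 0ℚ (∣0∣≤ ≤-refl))
  LipB-∑ (x ∷ xs) {C} h k = LipB-mono (≤-reflexive (lem C (ι (length xs)))) (LipB-+ (k x) (LipB-∑ xs h k))
    where
    opaque
      unfolding arith
      lem : ∀ C n → C + n * C ≡ (1ℚ + n) * C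
      lem = solve-∀ R

  LipB-mul : ∀ {C f} a {c} → ∣ a ∣ ≤ c → LipB C f → LipB (c * C) (λ y → a * f y)
  LipB-mul {C} {f} a {c} ha h = record
    { bd = λ b → ∣*∣≤ ha (bd h b)
    ; lp = λ {y} {z} b b′ → subst₂ (λ s t → ∣ s ∣ ≤ t) (lem a (f y) (f z)) (sym (*-assoc c C (dist y z))) (∣*∣≤ ha (lp h b b′)) }
    where
    opaque
      unfolding arith
      lem : ∀ a x y → a * (x - y) ≡ a * x - a * y
      lem = solve-∀ R

  -- `u` and `w` below 1/2 leave room between the two thin sets, and the places are ordered as
  -- `Total` requires.
  record Location : Set where
    field
      x : Fin 3 → ℚ
      0≤x₂ : 0ℚ ≤ x i₂
      x₂≤x₁ : x i₂ ≤ x i₁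
      x₁≤x₀ : x i₁ ≤ x i₀
      x₀≤ : x i₀ ≤ ½ * ½
      u w : Fin 3 → ℚ
      0<u : ∀ g → 0ℚ < u g
      u< : ∀ g → u g < ½
      0<w : ∀ g → 0ℚ < w g
      w< : ∀ g → w g < ½

  opaque
    common : ∀ (q : Fin 3 → ℚ) → (∀ g → 0ℚ ≤ q g) → ∃ λ (b : ℕ) → ∃ λ (a : Fin 3 → ℕ) → ∀ g → q g * ι (suc b) ≡ ι (a g)
    common q h with fraction (q i₀) (h i₀) | fraction (q i₁) (h i₁) | fraction (q i₂) (h i₂)
    ... | b₀ , a₀ , e₀ | b₁ , a₁ , e₁ | b₂ , a₂ , e₂ = b , a , ok
      where
      b : ℕ
      b = b₂ ℕ.+ (b₁ ℕ.+ b₀ ℕ.* suc b₁) ℕ.* suc b₂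
      a : Fin 3 → ℕ
      a zero = a₀ ℕ.* suc b₁ ℕ.* suc b₂
      a (suc zero) = a₁ ℕ.* suc b₀ ℕ.* suc b₂
      a (suc (suc zero)) = a₂ ℕ.* suc b₀ ℕ.* suc b₁
      ιι : ∀ x y z → ι (x ℕ.* y ℕ.* z) ≡ ι x * ι y * ι z
      ιι x y z = trans (ι-* (x ℕ.* y) z) (cong (_* ι z) (ι-* x y))
      opaque
        unfolding arith
        r₀ : ∀ q x y z → q * (x * y * z) ≡ q * x * y * z
        r₀ = solve-∀ R
        r₁ : ∀ q x y z → q * (x * y * z) ≡ q * y * x * z
        r₁ = solve-∀ R
        r₂ : ∀ q x y z → q * (x * y * z) ≡ q * z * x * y
        r₂ = solve-∀ R
      ok : ∀ g → q g * ι (suc b) ≡ ι (a g)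
      ok zero = trans (cong (q i₀ *_) (ιι (suc b₀) (suc b₁) (suc b₂))) (trans (r₀ (q i₀) _ _ _) (trans (cong (λ z → z * ι (suc b₁) * ι (suc b₂)) e₀) (sym (ιι a₀ (suc b₁) (suc b₂)))))
      ok (suc zero) = trans (cong (q i₁ *_) (ιι (suc b₀) (suc b₁) (suc b₂))) (trans (r₁ (q i₁) _ _ _) (trans (cong (λ z → z * ι (suc b₀) * ι (suc b₂)) e₁) (sym (ιι a₁ (suc b₀) (suc b₂)))))
      ok (suc (suc zero)) = trans (cong (q i₂ *_) (ιι (suc b₀) (suc b₁) (suc b₂))) (trans (r₂ (q i₂) _ _ _) (trans (cong (λ z → z * ι (suc b₀) * ι (suc b₁)) e₂) (sym (ιι a₂ (suc b₀) (suc b₁)))))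

  ι-reflect : ∀ {m n} → ι m < ι n → m ℕ.< n
  ι-reflect {m} {n} h with m ℕ.<? n
  ... | yes l = l
  ... | no l = ⊥-elim (<-irrefl refl (<-≤-trans h (ι-mono (ℕ.≮⇒≥ l))))

  rec-unique : ∀ {x} n → x * ι (suc n) ≡ 1ℚ → x ≡ rec n
  rec-unique {x} n e = trans (sym (*-identityʳ x)) (trans (cong (x *_) (trans (sym (rec-ι n)) (*-comm (rec n) (ι (suc n))))) (trans (sym (*-assoc x (ι (suc n)) (rec n))) (trans (cong (_* rec n) e) (*-identityˡ _))))

  module Tuning (loc : Location) (ks : Fin 3 → ℕ) (πs : ∀ i → Vec (Fin (ks i)) (ks i)) (uniq : ∀ i → VP.AllPairs _≢_ (πs i)) where
    open Location loc
    open Total x 0≤x₂ x₂≤x₁ x₁≤x₀ x₀≤ public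

    M : Matrix
    M i g = T (Vec.map toℕ (πs i)) (x g) (u g) (w g)

    private
      cu = common u (λ g → <⇒≤ (0<u g))
      cw = common w (λ g → <⇒≤ (0<w g))
      b₁ b₂ d : ℕ
      b₁ = proj₁ cu
      b₂ = proj₁ cw
      -- `suc d` is the product of `suc b₁` and `suc b₂`, a common denominator of all proportions;
      -- the positions of the thin sets then involve no rounding.
      d = b₂ ℕ.+ b₁ ℕ.* suc b₂
      A W : Fin 3 → ℕ
      A g = proj₁ (proj₂ cu) g ℕ.* suc b₂
      W g = proj₁ (proj₂ cw) g ℕ.* suc b₁
      uD : ∀ g → u g * ι (suc d) ≡ ι (A g)
      uD g = trans (cong (u g *_) (ι-* (suc b₁) (suc b₂))) (trans (sym (*-assoc (u g) _ _)) (trans (cong (_* ι (suc b₂)) (proj₂ (proj₂ cu) g)) (sym (ι-* (proj₁ (proj₂ cu) g) (suc b₂)))))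
      wD : ∀ g → w g * ι (suc d) ≡ ι (W g)
      wD g = trans (cong (w g *_) (trans (ι-* (suc b₁) (suc b₂)) (*-comm _ _))) (trans (sym (*-assoc (w g) _ _)) (trans (cong (_* ι (suc b₁)) (proj₂ (proj₂ cw) g)) (sym (ι-* (proj₁ (proj₂ cw) g) (suc b₁)))))
      opaque
        unfolding arith
        l₁ : ∀ u w D → D ≡ u * D + w * D + ((½ - u) + (½ - w)) * D
        l₁ = solve-∀ R
      AW<D : ∀ g → A g ℕ.+ W g ℕ.< suc d
      AW<D g = ι-reflect (subst (_< ι (suc d)) (sym (ι-+ (A g) (W g))) (lin< {t = ((½ - u g) + (½ - w g)) * ι (suc d)} (0<* (0<+ (gap< (u< g)) (<⇒≤ (gap< (w< g)))) (0<ι d)) (trans (l₁ (u g) (w g) (ι (suc d))) (cong₂ (λ p q → p + q + ((½ - u g) + (½ - w g)) * ι (suc d)) (uD g) (wD g)))))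
      0<W : ∀ g → 0 ℕ.< W g
      0<W g = ι-reflect {0} (subst (0ℚ <_) (wD g) (0<* (0<w g) (0<ι d)))
      W≤D : ∀ g → W g ℕ.≤ suc d
      W≤D g = ℕ.≤-trans (ℕ.m≤n+m (W g) (A g)) (ℕ.<⇒≤ (AW<D g))

    -- the column grid: H coarse columns, each consisting of suc s fine ones
    module Grid (t : ℕ) (2≤t : 2 ℕ.≤ t) where
      -- Chosen so that `suc H′` is `suc d * suc t`: a multiple of the denominator, and as large as
      -- wanted through `t`.
      H′ : ℕ
      H′ = t ℕ.+ d ℕ.* suc t

      η : ℚ
      η = rec H′

      H² : ℚ
      H² = ι (suc H′) * ι (suc H′)

      H²η² : H² * (η * η) ≡ 1ℚ
      H²η² = trans (lem (ι (suc H′)) η) (trans (cong (λ z → z * z) (rec-ι H′)) (*-identityˡ 1ℚ))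
        where
        opaque
          unfolding arith
          lem : ∀ h e → h * h * (e * e) ≡ (e * h) * (e * h)
          lem = solve-∀ R

      η≤rec-t : η ≤ rec t
      η≤rec-t = rec-mono (ℕ.m≤m+n t (d ℕ.* suc t))

      3η≤1 : ι 3 * η ≤ 1ℚ
      3η≤1 = ≤-trans (*-monoˡ (ι 3) (0≤ι 3) (≤-trans η≤rec-t (rec-mono 2≤t))) (≤-reflexive (trans (*-comm (ι 3) (rec 2)) (rec-ι 2)))

      module Fine (s : ℕ) where
        top′ : ℕ
        top′ = s ℕ.+ H′ ℕ.* suc s

        V : ℕ
        V = suc top′

        v : ℚ
        v = rec top′

        0≤v : 0ℚ ≤ v
        0≤v = 0≤rec top′

        vV : v * ι V ≡ 1ℚ
        vV = rec-ι top′

        ηs : ι (suc s) * v ≡ η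
        ηs = rec-unique H′ (trans (lem (ι (suc s)) v (ι (suc H′))) (trans (cong (v *_) (sym (ι-* (suc H′) (suc s)))) vV))
          where
          opaque
            unfolding arith
            lem : ∀ s v h → s * v * h ≡ v * (h * s)
            lem = solve-∀ R

        -- The number of fine columns in a proportion `1 / (d + 1)` of all columns.
        b : ℕ
        b = suc t ℕ.* suc s

        lo′ hi′ : Fin 3 → ℕ
        lo′ g = A g ℕ.* b
        hi′ g = (suc d ∸ W g) ℕ.* b

        s≤b : suc s ℕ.≤ b
        s≤b = ℕ.m≤m+n (suc s) (t ℕ.* suc s)

        lohi : ∀ g → lo′ g ℕ.+ suc s ℕ.≤ hi′ g
        lohi g = ℕ.≤-trans (ℕ.+-monoʳ-≤ (lo′ g) s≤b) (ℕ.≤-trans (ℕ.≤-reflexive (ℕ.+-comm (lo′ g) b)) (ℕ.*-monoˡ-≤ b (ℕ.m+n≤o⇒m≤o∸n (suc (A g)) (AW<D g))))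

        Vb : V ≡ suc d ℕ.* b
        Vb = ℕ.*-assoc (suc d) (suc t) (suc s)

        hiV : ∀ g → hi′ g ℕ.+ suc s ℕ.≤ V
        hiV g = ℕ.≤-trans (ℕ.+-monoʳ-≤ (hi′ g) s≤b) (ℕ.≤-trans (ℕ.≤-reflexive (ℕ.+-comm (hi′ g) b)) (ℕ.≤-trans (ℕ.*-monoˡ-≤ b (ℕ.∸-monoʳ-< {suc d} {W g} {0} (0<W g) (W≤D g))) (ℕ.≤-reflexive (sym Vb))))

        lo≡ : ∀ g → ι (lo′ g) * v ≡ u g
        lo≡ g = trans (cong (_* v) (trans (ι-* (A g) b) (cong (_* ι b) (sym (uD g))))) (trans (lem (u g) (ι (suc d)) (ι b) v) (trans (cong (λ z → u g * (v * z)) (trans (sym (ι-* (suc d) b)) (cong ι (sym Vb)))) (trans (cong (u g *_) vV) (*-identityʳ _))))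
          where
          opaque
            unfolding arith
            lem : ∀ u d b v → u * d * b * v ≡ u * (v * (d * b))
            lem = solve-∀ R

        hi≡ : ∀ g → ι (hi′ g) * v ≡ 1ℚ - w g
        hi≡ g = trans (cong (_* v) (trans (ι-* (suc d ∸ W g) b) (cong (_* ι b) (trans (ι-∸ (W≤D g)) (cong (λ z → ι (suc d) - z) (sym (wD g)))))))
          (trans (lem (w g) (ι (suc d)) (ι b) v) (trans (cong (λ z → (1ℚ - w g) * (v * z)) (trans (sym (ι-* (suc d) b)) (cong ι (sym Vb)))) (trans (cong ((1ℚ - w g) *_) vV) (*-identityʳ _))))
          where
          opaque
            unfolding arith
            lem : ∀ w d b v → (d - w * d) * b * v ≡ (1ℚ - w) * (v * (d * b))
            lem = solve-∀ R

        θ≤1 : ι 3 * (ι (suc s) * v) ≤ 1ℚ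
        θ≤1 = subst (λ z → ι 3 * z ≤ 1ℚ) (sym ηs) 3η≤1

        at : ℚ → Par
        at δ = par δ top′ (λ g → cls (lo′ g) (hi′ g) (suc s))

        module Col (g : Fin 3) (k : ℕ) = Columns V v 0≤v vV s (lo′ g) (hi′ g) (lohi g) (hiV g) θ≤1 k

        -- Weighted by `v ^ k` instead of the reciprocal of the number of tuples: this is the
        -- average over column tuples up to a factor close to `1 / k!`.
        mean : Fin 3 → Ser → ℚ
        mean i F = pow v (ks i) * ∑ (subsets V (ks i)) (λ e → F (word e (πs i)))

        L : Fin 3 → Fin 3 → ℚ → ℚ
        L i g δ = mean i (sw (pre g (at δ)) (post g (at δ)) (h-of (at δ) g) 0)

        -- The first summand comes from the positive width `η` of the thin sets, the second from the
        -- displacement of the gadgets by multiples of δ.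
        spread : Fin 3 → ℚ → ℚ
        spread i δ = ι (ks i) * (ι 3 * η * slack (ks i) (ks i) (ks i)) + ι (ks i) * (ι (ks i) * (δ + δ + δ))

        private
          opaque
            unfolding arith
            ¼+⅜ : ½ * ½ + (⅛ + ⅛ + ⅛) ≤ 1ℚ
            ¼+⅜ = D.≤ᵇ⇒≤ _
            q₁ : ∀ x d → x + (d + d) - x ≡ d + d
            q₁ = solve-∀ R
            q₂ : ∀ x d → x + d - x ≡ d
            q₂ = solve-∀ R
            q₃ : ∀ x → x - x ≡ 0ℚ
            q₃ = solve-∀ R
            q₄ : ∀ x d → 1ℚ - x - (d + d + d) - (1ℚ - x) ≡ - (d + d + d)
            q₄ = solve-∀ R
            q₅ : ∀ x d → 1ℚ - x - (d + d) - (1ℚ - x) ≡ - (d + d)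
            q₅ = solve-∀ R
            q₆ : ∀ x d → 1ℚ - x - d - (1ℚ - x) ≡ - d
            q₆ = solve-∀ R
            c₁ : ∀ x d → 1ℚ - x - (d + d + d) + (x + (d + d + d)) ≡ 1ℚ
            c₁ = solve-∀ R
            c₂ : ∀ x y → 1ℚ ≡ x + (1ℚ - (y + (⅛ + ⅛ + ⅛)) + (y - x) + (⅛ + ⅛ + ⅛))
            c₂ = solve-∀ R
            c₃ : ∀ x y d → 1ℚ - x - (d + d + d) ≡ (1ℚ - (y + (⅛ + ⅛ + ⅛))) + ((y - x) + ((⅛ - d) + (⅛ - d) + (⅛ - d)))
            c₃ = solve-∀ R
            c₄ : ∀ x d → 1ℚ - x - (d + d) ≡ 1ℚ - x - (d + d + d) + d
            c₄ = solve-∀ R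
            c₅ : ∀ x d → 1ℚ - x - d ≡ 1ℚ - x - (d + d + d) + (d + d)
            c₅ = solve-∀ R
            c₆ : ∀ x d → 1ℚ ≡ 1ℚ - x - (d + d) + (x + (d + d))
            c₆ = solve-∀ R
            c₇ : ∀ x d → 1ℚ ≡ 1ℚ - x - d + (x + d)
            c₇ = solve-∀ R
            c₈ : ∀ x y d → 1ℚ ≡ x + (d + d) + ((1ℚ - (y + (⅛ + ⅛ + ⅛))) + ((y - x) + ((⅛ - d) + (⅛ - d) + ⅛)))
            c₈ = solve-∀ R
            c₉ : ∀ x y d → 1ℚ ≡ x + d + ((1ℚ - (y + (⅛ + ⅛ + ⅛))) + ((y - x) + ((⅛ - d) + ⅛ + ⅛)))
            c₉ = solve-∀ R
            b₀ : ∀ x → 1ℚ ≡ 1ℚ - x + x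
            b₀ = solve-∀ R
            0≤⅛′ : 0ℚ ≤ ⅛
            0≤⅛′ = D.≤ᵇ⇒≤ _

        module _ (δ : ℚ) (0≤δ : 0ℚ ≤ δ) (δ≤⅛ : δ ≤ ⅛) where
          private
            0≤x : ∀ g → 0ℚ ≤ x g
            0≤x zero = ≤-trans 0≤x₂ (≤-trans x₂≤x₁ x₁≤x₀)
            0≤x (suc zero) = ≤-trans 0≤x₂ x₂≤x₁
            0≤x (suc (suc zero)) = 0≤x₂
            x≤ : ∀ g → x g ≤ ½ * ½
            x≤ zero = x₀≤
            x≤ (suc zero) = ≤-trans x₁≤x₀ x₀≤
            x≤ (suc (suc zero)) = ≤-trans x₂≤x₁ (≤-trans x₁≤x₀ x₀≤)
            G : ∀ g → 0ℚ ≤ ½ * ½ - x g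
            G g = gap (x≤ g)
            e : 0ℚ ≤ ⅛ - δ
            e = gap δ≤⅛
            lowest : ∀ g → 0ℚ ≤ 1ℚ - x g - (δ + δ + δ)
            lowest g = subst (0ℚ ≤_) (sym (c₃ (x g) (½ * ½) δ)) (gap ¼+⅜ ⊹ (G g ⊹ (e ⊹ e ⊹ e)))
            pre-unit : ∀ g → 0ℚ ≤ pre g (at δ) × pre g (at δ) ≤ 1ℚ
            pre-unit zero = 0≤x i₀ ⊹ (0≤δ ⊹ 0≤δ) , lin (gap ¼+⅜ ⊹ (G i₀ ⊹ (e ⊹ e ⊹ 0≤⅛′))) (c₈ (x i₀) (½ * ½) δ)
            pre-unit (suc zero) = 0≤x i₁ ⊹ 0≤δ , lin (gap ¼+⅜ ⊹ (G i₁ ⊹ (e ⊹ 0≤⅛′ ⊹ 0≤⅛′))) (c₉ (x i₁) (½ * ½) δ)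
            pre-unit (suc (suc zero)) = 0≤x i₂ , lin (gap ¼+⅜ ⊹ G i₂ ⊹ (0≤⅛′ ⊹ 0≤⅛′ ⊹ 0≤⅛′)) (c₂ (x i₂) (½ * ½))
            post-unit : ∀ g → 0ℚ ≤ post g (at δ) × post g (at δ) ≤ 1ℚ
            post-unit zero = lowest i₀ , lin (0≤x i₀ ⊹ (0≤δ ⊹ 0≤δ ⊹ 0≤δ)) (sym (c₁ (x i₀) δ))
            post-unit (suc zero) = subst (0ℚ ≤_) (sym (c₄ (x i₁) δ)) (lowest i₁ ⊹ 0≤δ) , lin (0≤x i₁ ⊹ (0≤δ ⊹ 0≤δ)) (c₆ (x i₁) δ)
            post-unit (suc (suc zero)) = subst (0ℚ ≤_) (sym (c₅ (x i₂) δ)) (lowest i₂ ⊹ (0≤δ ⊹ 0≤δ)) , lin (0≤x i₂ ⊹ 0≤δ) (c₇ (x i₂) δ)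
            d3 : ∀ {z} → 0ℚ ≤ z → z ≤ δ + δ + δ → ∣ z ∣ ≤ δ + δ + δ
            d3 h k = ≤-trans (≤-reflexive (∣∣-nn h)) k
            pre-near : ∀ g → ∣ pre g (at δ) - x g ∣ ≤ δ + δ + δ
            pre-near zero = subst (λ z → ∣ z ∣ ≤ δ + δ + δ) (sym (q₁ (x i₀) δ)) (d3 (0≤δ ⊹ 0≤δ) (≤+ δ 0≤δ))
            pre-near (suc zero) = subst (λ z → ∣ z ∣ ≤ δ + δ + δ) (sym (q₂ (x i₁) δ)) (d3 0≤δ (≤-trans (≤+ δ 0≤δ) (≤+ δ 0≤δ)))
            pre-near (suc (suc zero)) = subst (λ z → ∣ z ∣ ≤ δ + δ + δ) (sym (q₃ (x i₂))) (∣0∣≤ (0≤δ ⊹ 0≤δ ⊹ 0≤δ))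
            post-near : ∀ g → ∣ post g (at δ) - (1ℚ - x g) ∣ ≤ δ + δ + δ
            post-near zero = subst (λ z → ∣ z ∣ ≤ δ + δ + δ) (sym (q₄ (x i₀) δ)) (subst (_≤ δ + δ + δ) (sym (∣-x∣ _)) (d3 (0≤δ ⊹ 0≤δ ⊹ 0≤δ) ≤-refl))
            post-near (suc zero) = subst (λ z → ∣ z ∣ ≤ δ + δ + δ) (sym (q₅ (x i₁) δ)) (subst (_≤ δ + δ + δ) (sym (∣-x∣ _)) (d3 (0≤δ ⊹ 0≤δ) (≤+ δ 0≤δ)))
            post-near (suc (suc zero)) = subst (λ z → ∣ z ∣ ≤ δ + δ + δ) (sym (q₆ (x i₂) δ)) (subst (_≤ δ + δ + δ) (sym (∣-x∣ _)) (d3 0≤δ (≤-trans (≤+ δ 0≤δ) (≤+ δ 0≤δ))))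

          -- The columns are averaged by `sw-average`, and `sw-lip` moves `pre` and `post` to `x g`
          -- and `1 - x g`. The error keeps the factor `η * η`, so it is small even relative to the
          -- response.
          L-near : ∀ i g → ∣ L i g δ - η * η * M i g ∣ ≤ η * η * spread i δ
          L-near i g = subst₂ (λ y z → ∣ L i g δ - y ∣ ≤ z) refl (lem η (ι k) (ι 3) (slack k k k) (ι k) (δ + δ + δ)) (∣-∣-tri first second)
            where
            k : ℕ
            k = ks i
            open Col g k using (τ′; err; 0≤err; close; u′) renaming (u to u₀; η to η₀)
            opaque
              unfolding arith
              lem : ∀ η k θ D k′ d → k * (η * η * (θ * η * D)) + η * η * (k′ * (k * d)) ≡ η * η * (k * (θ * η * D) + k′ * (k * d))
              lem = solve-∀ R
              lem₂ : ∀ q x y → q * (x - y) ≡ q * x - q * y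
              lem₂ = solve-∀ R
              mid≡ : ∀ u w → 1ℚ - w - u ≡ 1ℚ - u - w
              mid≡ = solve-∀ R
              low≡ : ∀ w → 1ℚ - (1ℚ - w) ≡ w
              low≡ = solve-∀ R
              w≤ : ∀ w → 1ℚ ≡ w + ((½ - w) + ½)
              w≤ = solve-∀ R
              gap≡ : ∀ u w → 1ℚ - u - w ≡ (½ - u) + (½ - w)
              gap≡ = solve-∀ R
              gap≤ : ∀ u w → 1ℚ ≡ 1ℚ - u - w + (u + w)
              gap≤ = solve-∀ R
            τ≡ : ∀ P Q → τ′ P Q ≡ τ k (u g) (1ℚ - u g - w g) (w g) P Q
            τ≡ P Q = trans (cong₂ (λ y z → τ k y (z - y) (1ℚ - z) P Q) (lo≡ g) (hi≡ g)) (cong₂ (λ y z → τ k (u g) y z P Q) (mid≡ (u g) (w g)) (low≡ (w g)))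
            τ₀ : ℕ → ℕ → ℚ
            τ₀ = τ k (u g) (1ℚ - u g - w g) (w g)
            sw-τ : ∀ a b j c → sw a b τ′ j c ≡ sw a b τ₀ j c
            sw-τ a b j [] = refl
            sw-τ a b j (y ∷ []) = refl
            sw-τ a b j (y ∷ z ∷ c) = cong₂ (λ s t → p j a * (s * p (length c) b) + t) (τ≡ y z) (sw-τ a b (suc j) (z ∷ c))
            S₁ S₂ : ℚ
            S₁ = sw (pre g (at δ)) (post g (at δ)) τ₀ 0 (letters (πs i))
            S₂ = M i g
            first : ∣ L i g δ - η * η * S₁ ∣ ≤ ι k * (η * η * (ι 3 * η * slack k k k))
            first = subst₂ (λ q r → ∣ L i g δ - q ∣ ≤ r) (cong₂ (λ y z → y * y * z) ηs (sw-τ _ _ 0 (letters (πs i)))) (cong (λ y → ι k * (y * y * (ι 3 * y * slack k k k))) ηs)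
              (sw-average (pow v k) (η₀ * η₀) (h-of (at δ) g) τ′ err 0≤err close (proj₁ (pre-unit g)) (proj₂ (pre-unit g)) (proj₁ (post-unit g)) (proj₂ (post-unit g)) 0 (πs i) (uniq i))
            0≤ug : 0ℚ ≤ u g
            0≤ug = <⇒≤ (0<u g)
            0≤wg : 0ℚ ≤ w g
            0≤wg = <⇒≤ (0<w g)
            ½≥u : 0ℚ ≤ ½ - u g
            ½≥u = gap (<⇒≤ (u< g))
            ½≥w : 0ℚ ≤ ½ - w g
            ½≥w = gap (<⇒≤ (w< g))
            0≤1-x : 0ℚ ≤ 1ℚ - x g
            0≤1-x = ≤-trans (lowest g) (lin (0≤δ ⊹ 0≤δ ⊹ 0≤δ) (c₁′ (x g) (δ + δ + δ)))
              where
              opaque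
                unfolding arith
                c₁′ : ∀ x d → 1ℚ - x ≡ 1ℚ - x - d + d
                c₁′ = solve-∀ R
            len : length (letters (πs i)) ≡ k
            len = length-toList (Vec.map toℕ (πs i))
            second : ∣ η * η * S₁ - η * η * S₂ ∣ ≤ η * η * (ι k * (ι k * (δ + δ + δ)))
            second = subst (λ z → ∣ z ∣ ≤ η * η * (ι k * (ι k * (δ + δ + δ)))) (lem₂ (η * η) S₁ S₂) (∣*∣≤ {η * η} (≤-reflexive (∣∣-nn (0≤rec H′ ⊛ 0≤rec H′)))
              (subst (λ m → ∣ S₁ - S₂ ∣ ≤ ι m * (ι k * (δ + δ + δ))) len (sw-lip (proj₁ (pre-unit g)) (proj₂ (pre-unit g)) (proj₁ (post-unit g)) (proj₂ (post-unit g))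
                (0≤x g) (lin 0≤1-x (trans (b₀ (x g)) (+-comm _ _))) 0≤1-x (lin (0≤x g) (b₀ (x g))) (pre-near g) (post-near g) τ₀
                (∣τ∣≤1 k 0≤ug (lin (½≥u ⊹ 0≤½) (w≤ (u g))) (subst (0ℚ ≤_) (sym (gap≡ (u g) (w g))) (½≥u ⊹ ½≥w)) (lin (0≤ug ⊹ 0≤wg) (gap≤ (u g) (w g))) 0≤wg (lin (½≥w ⊹ 0≤½) (w≤ (w g))))
                k 0 (letters (πs i)) (ℕ.≤-reflexive len))))

-- Solving for the amounts moved by the gadgets.

module Solutions where
  open import Data.Nat as ℕ using (ℕ; zero; suc; z≤n; s≤s)
  import Data.Nat.Properties as ℕ
  import Data.Rational as D
  import Data.Rational.Properties as D
  open import Data.Fin using (Fin; zero; suc; toℕ)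
  open import Data.List using (List; []; _∷_; length)
  open import Data.Vec as Vec using (Vec; []; _∷_; lookup)
  import Data.Vec.Properties as Vec
  open import Data.Vec.Relation.Unary.AllPairs as VP using ([]; _∷_)
  open import Data.Product using (∃; _×_; _,_)
  open import Relation.Binary.PropositionalEquality hiding (_≗_)
  open import Tactic.RingSolver using (solve-∀)
  open import Defs using (subsets)
  open Rationals
  open Series
  open Gadgets using (Class)
  open Expansions
  open TestPaths
  open Nonvanishing using (length-toList)
  open IncreasingSums
  open ColumnCounts using () renaming (D to slack)
  open ColumnAverages
  open FixedPoints

  open Functionals

  module Setup (loc : Location) (ks : Fin 3 → ℕ) (πs : ∀ i → Vec (Fin (ks i)) (ks i)) (uniq : ∀ i → VP.AllPairs _≢_ (πs i)) (t : ℕ) (2≤t : 2 ℕ.≤ t) (s : ℕ) where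
    open Tuning loc ks πs uniq public
    open Grid t 2≤t public
    open Fine s public

    K : Fin 3 → ℚ
    K i = Bdd.K (Exp.bE expansion) (ks i)

    -- Any admissible parameter would serve: the bound at it shows that the constants `K i` are
    -- nonnegative.
    ω₀ : Par
    ω₀ = par 0ℚ 0 (λ _ _ → Class.other)

    ok₀ : Ok ω₀
    ok₀ = record { 0≤δ = ≤-refl ; δ≤⅛ = 0≤⅛ }

    module Solve (M′ : Matrix) (M≡ : ∀ i g → M i g ≡ M′ i g) (N : Matrix) (MN : ∀ z i → (M′ ∙ (N ∙ z)) i ≡ z i) (ν : ℚ) (hN : ∀ i j → ∣ N i j ∣ ≤ ν)
      (ρ : ℚ) (hρ : ι 18 * (ν * ρ) ≤ 1ℚ) (ρ≤1 : ρ ≤ 1ℚ) (δ₀ : ℚ) (0≤δ₀ : 0ℚ ≤ δ₀) (δ₀≤⅛ : δ₀ ≤ ⅛) (0≤K : ∀ i → 0ℚ ≤ K i)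
      (budget : ∀ i → spread i δ₀ * 1ℚ + spread i δ₀ * 1ℚ + spread i δ₀ * 1ℚ + δ₀ * H² * K i ≤ ρ) where
      private
        0≤H² : 0ℚ ≤ H²
        0≤H² = 0≤ι (suc H′) ⊛ 0≤ι (suc H′)
      ω : Par
      ω = at δ₀
      okω : Ok ω
      okω = record { 0≤δ = 0≤δ₀ ; δ≤⅛ = δ₀≤⅛ }
      private
        mean-+ : ∀ i F G → mean i (F ⊞ G) ≡ mean i F + mean i G
        mean-+ i F G = ∑-*+ (subsets V (ks i)) (pow v (ks i)) (λ e → F (word e (πs i))) (λ e → G (word e (πs i)))
        mean-* : ∀ i a F → mean i (a ⊡ F) ≡ a * mean i F
        mean-* i a F = trans (cong (pow v (ks i) *_) (∑-*ˡ (subsets V (ks i)) a _)) (lem (pow v (ks i)) a _)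
          where
          opaque
            unfolding arith
            lem : ∀ x a y → x * (a * y) ≡ a * (x * y)
            lem = solve-∀ R
        rest-of : Fin 3 → Y → ℚ
        rest-of i y = mean i (Exp.E expansion ω y)
        0≤powv : ∀ n → 0ℚ ≤ pow v n
        0≤powv zero = 0≤1
        0≤powv (suc n) = 0≤v ⊛ 0≤powv n
        word-length : ∀ i (e : Vec (Fin V) (ks i)) → length (word e (πs i)) ≡ ks i
        word-length i e = length-toList (Vec.map (λ j → toℕ (lookup e j)) (πs i))
        Lip-rest : ∀ i → LipB (K i) (rest-of i)
        Lip-rest i = LipB-mono le (LipB-mul (pow v k) (≤-reflexive (∣∣-nn (0≤powv k))) (LipB-∑ (subsets V k) (0≤K i) (λ e →
            subst (λ n → LipB (Bdd.K (Exp.bE expansion) n) (λ y → Exp.E expansion ω y (word e (πs i)))) (word-length i e) (Bdd.ok (Exp.bE expansion) okω (word e (πs i))))))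
          where
          k : ℕ
          k = ks i
          le : pow v k * (ι (length (subsets V k)) * K i) ≤ K i
          le = ≤-trans (≤-reflexive (trans (sym (*-assoc (pow v k) _ _)) (cong (λ z → pow v k * z * K i) (length-subsets V k)))) (subst (pow v k * ch V k * K i ≤_) (*-identityˡ _) (*-monoʳ (K i) (0≤K i) (ch≤ V v k 0≤v vV)))
        coeff : Fin 3 → Fin 3 → ℚ
        coeff i g = H² * L i g δ₀ - M′ i g
        coeff≤ : ∀ i g → ∣ coeff i g ∣ ≤ spread i δ₀
        coeff≤ i g = subst₂ (λ a b → ∣ a ∣ ≤ b) (trans (lem H² (L i g δ₀) (η * η) (M i g) H²η²) (cong (λ z → H² * L i g δ₀ - z) (M≡ i g))) (trans (sym (*-assoc H² (η * η) (spread i δ₀))) (trans (cong (_* spread i δ₀) H²η²) (*-identityˡ _))) (∣*∣≤ {H²} (≤-reflexive (∣∣-nn 0≤H²)) (L-near δ₀ 0≤δ₀ δ₀≤⅛ i g))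
          where
          opaque
            unfolding arith
            lem₀ : ∀ h l e m → h * (l - e * m) ≡ h * l - h * e * m
            lem₀ = solve-∀ R
            lem : ∀ h l e m → h * e ≡ 1ℚ → h * (l - e * m) ≡ h * l - m
            lem h l e m q = trans (lem₀ h l e m) (cong (λ z → h * l - z) (trans (cong (_* m) q) (*-identityˡ m)))
        -- All that is not the ideal linear part, divided by `δ₀² η²`. The division leaves the δ³
        -- remainder with the factor `δ₀ * H²`, small once δ is chosen after `η`.
        Rem : Fin 3 → Y → ℚ
        Rem i y = coeff i i₀ * y i₀ + coeff i i₁ * y i₁ + coeff i i₂ * y i₂ + δ₀ * H² * rest-of i y
        Lip-Rem : ∀ i → LipB ρ (Rem i)
        Lip-Rem i = LipB-mono (budget i) (LipB-+ (LipB-+ (LipB-+ (c i₀) (c i₁)) (c i₂)) (LipB-mul (δ₀ * H²) (≤-reflexive (∣∣-nn (0≤δ₀ ⊛ 0≤H²))) (Lip-rest i)))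
          where
          c : ∀ g → LipB (spread i δ₀ * 1ℚ) (λ y → coeff i g * y g)
          c g = LipB-mul (coeff i g) (coeff≤ i g) (LipB-coord g)
      discrepancy : Fin 3 → Y → ℚ
      discrepancy i y = mean i (λ c → total ω y c - p (ks i) 1ℚ)

      private
        formula : ∀ i y → discrepancy i y ≡ δ₀ * δ₀ * (η * η) * ((M′ ∙ y) i + Rem i y)
        formula i y = trans (cong (pow v (ks i) *_) (∑-cong (subsets V (ks i)) pt)) (trans (mean-+ i ((dd ⊡ (y i₀ ⊡ W₀ ⊞ y i₁ ⊡ W₁ ⊞ y i₂ ⊡ W₂))) (d₃ ⊡ Exp.E expansion ω y))
          (trans (cong₂ _+_ (trans (mean-* i dd (y i₀ ⊡ W₀ ⊞ y i₁ ⊡ W₁ ⊞ y i₂ ⊡ W₂)) (cong (dd *_) (trans (mean-+ i (y i₀ ⊡ W₀ ⊞ y i₁ ⊡ W₁) (y i₂ ⊡ W₂)) (cong₂ _+_ (trans (mean-+ i (y i₀ ⊡ W₀) (y i₁ ⊡ W₁)) (cong₂ _+_ (mean-* i (y i₀) W₀) (mean-* i (y i₁) W₁))) (mean-* i (y i₂) W₂))))) (mean-* i d₃ (Exp.E expansion ω y)))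
          (alg δ₀ (η * η) H² (y i₀) (y i₁) (y i₂) (L i i₀ δ₀) (L i i₁ δ₀) (L i i₂ δ₀) (M′ i i₀) (M′ i i₁) (M′ i i₂) (rest-of i y) H²η²)))
          where
          dd d₃ : ℚ
          dd = δ₀ * δ₀
          d₃ = δ₀ * δ₀ * δ₀
          W₀ W₁ W₂ : Ser
          W₀ = sw (pre i₀ ω) (post i₀ ω) (h-of ω i₀) 0
          W₁ = sw (pre i₁ ω) (post i₁ ω) (h-of ω i₁) 0
          W₂ = sw (pre i₂ ω) (post i₂ ω) (h-of ω i₂) 0
          opaque
            unfolding arith
            l₀ : ∀ q a b → q + a + b - q ≡ a + b
            l₀ = solve-∀ R
            alg₀ : ∀ d q H y₀ y₁ y₂ L₀ L₁ L₂ m₀ m₁ m₂ r → d * d * q * (m₀ * y₀ + m₁ * y₁ + m₂ * y₂ + ((H * L₀ - m₀) * y₀ + (H * L₁ - m₁) * y₁ + (H * L₂ - m₂) * y₂ + d * H * r))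
              ≡ (H * q) * (d * d * (y₀ * L₀ + y₁ * L₁ + y₂ * L₂) + d * d * d * r)
            alg₀ = solve-∀ R
            alg : ∀ d q H y₀ y₁ y₂ L₀ L₁ L₂ m₀ m₁ m₂ r → H * q ≡ 1ℚ → d * d * (y₀ * L₀ + y₁ * L₁ + y₂ * L₂) + d * d * d * r
              ≡ d * d * q * (m₀ * y₀ + m₁ * y₁ + m₂ * y₂ + ((H * L₀ - m₀) * y₀ + (H * L₁ - m₁) * y₁ + (H * L₂ - m₂) * y₂ + d * H * r))
            alg d q H y₀ y₁ y₂ L₀ L₁ L₂ m₀ m₁ m₂ r e = sym (trans (alg₀ d q H y₀ y₁ y₂ L₀ L₁ L₂ m₀ m₁ m₂ r) (trans (cong (_* (d * d * (y₀ * L₀ + y₁ * L₁ + y₂ * L₂) + d * d * d * r)) e) (*-identityˡ _)))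
          pt : ∀ e → total ω y (word e (πs i)) - p (ks i) 1ℚ ≡ dd * (y i₀ * W₀ (word e (πs i)) + y i₁ * W₁ (word e (πs i)) + y i₂ * W₂ (word e (πs i))) + d₃ * Exp.E expansion ω y (word e (πs i))
          pt e = trans (cong₂ _-_ (Exp.eq expansion ω y (word e (πs i))) (cong (λ n → p n 1ℚ) (sym (word-length i e)))) (l₀ (p (length (word e (πs i))) 1ℚ) _ _)
        open Newton M′ N MN ν hN Rem ρ Lip-Rem hρ ρ≤1

      solution : ∀ {ε} → 0ℚ < ε → ∃ λ y → Box y × (∀ i → ∣ discrepancy i y ∣ ≤ ε)
      solution {ε} h = let y , b , r = approximate-root h in y , b , λ i →
          subst (λ z → ∣ z ∣ ≤ ε) (sym (formula i y)) (subst (∣ δ₀ * δ₀ * (η * η) * ((M′ ∙ y) i + Rem i y) ∣ ≤_) (*-identityˡ ε) (∣*∣≤ (≤-trans (≤-reflexive (∣∣-nn (0≤δ₀ ⊛ 0≤δ₀ ⊛ (0≤rec H′ ⊛ 0≤rec H′)))) (*≤1 (0≤δ₀ ⊛ 0≤δ₀) (*≤1 0≤δ₀ (δ≤1 okω) (δ≤1 okω)) (*≤1 (0≤rec H′) (rec≤1 H′) (rec≤1 H′)))) (r i)))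

  -- η is taken small first, then δ, and only the number of fine columns is left free.
  module Tuned (loc : Location) (ks : Fin 3 → ℕ) (πs : ∀ i → Vec (Fin (ks i)) (ks i)) (uniq : ∀ i → VP.AllPairs _≢_ (πs i)) where

    private
      slackB : ℕ → ℚ
      slackB k = ι 3 * (ι k * (ι 3 * slack k k k))

      0≤slackB : ∀ k → 0ℚ ≤ slackB k
      0≤slackB k = 0≤ι 3 ⊛ (0≤ι k ⊛ (0≤ι 3 ⊛ (0≤ι k ⊛ ((0≤1 ⊹ 0≤ι k) ⊛ (0≤1 ⊹ 0≤ι k)) ⊹ (0≤ι k ⊛ (0≤1 ⊹ 0≤ι k) ⊹ 0≤ι k))))

      entry≤ : ∀ (f : Fin 3 → ℚ) → (∀ i → 0ℚ ≤ f i) → ∀ i → f i ≤ Σ₃ f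
      entry≤ f h zero = ≤-trans (≤+ _ (h i₁)) (≤+ _ (h i₂))
      entry≤ f h (suc zero) = ≤-trans (≤+ˡ _ (h i₀)) (≤+ _ (h i₂))
      entry≤ f h (suc (suc zero)) = ≤+ˡ _ (h i₀ ⊹ h i₁)

      all-small : ∀ (B : Fin 3 → ℚ) → (∀ i → 0ℚ ≤ B i) → ∀ {ε} → 0ℚ < ε → ∃ λ n → ∀ i → B i * rec n ≤ ε
      all-small B h h′ = let n , l = small* (Σ₃ B) (h i₀ ⊹ h i₁ ⊹ h i₂) h′ in n , λ i → ≤-trans (*-monoʳ (rec n) (0≤rec n) (entry≤ B h i)) l

    -- `t` and δ come before the quantifier over `s`: one coarse grid and one gadget length serve
    -- every number of fine columns, so the length of the increasing stretch does not shrink when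
    -- the columns are refined.
    Result : Set
    Result = ∃ λ t → ∃ λ (2≤t : 2 ℕ.≤ t) → ∃ λ δ₀ → (0ℚ < δ₀ × δ₀ ≤ ⅛) × (∀ s {ε} → 0ℚ < ε → let open Setup loc ks πs uniq t 2≤t s in
      ∃ λ y → Box y × (∀ i → ∣ mean i (λ c → total (at δ₀) y c - p (ks i) 1ℚ) ∣ ≤ ε))

    private
      module Pick (M′ : Matrix) (M≡ : ∀ i g → Tuning.M loc ks πs uniq i g ≡ M′ i g) (N : Matrix) (MN : ∀ z i → (M′ ∙ (N ∙ z)) i ≡ z i) (ν : ℚ) (hN : ∀ i j → ∣ N i j ∣ ≤ ν)
        (m : ℕ) (hm : ι 18 * ν ≤ ι m) where
        ρ : ℚ
        ρ = rec m
        hρ : ι 18 * (ν * ρ) ≤ 1ℚ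
        hρ = ≤-trans (≤-reflexive (sym (*-assoc (ι 18) ν ρ))) (≤-trans (*-monoʳ ρ (0≤rec m) (≤-trans hm (≤+ˡ 1ℚ 0≤1))) (≤-reflexive (trans (*-comm _ ρ) (rec-ι m))))
        0<½ρ : 0ℚ < ½ * ρ
        0<½ρ = 0<* (D.positive⁻¹ ½) (0<rec m)
        opaque
          unfolding arith
          halves : ∀ r → ½ * r + ½ * r ≡ r
          halves = solve-∀ R
          expand : ∀ k θ η D d H K → (k * (θ * η * D) + k * (k * (d + d + d))) * 1ℚ + (k * (θ * η * D) + k * (k * (d + d + d))) * 1ℚ + (k * (θ * η * D) + k * (k * (d + d + d))) * 1ℚ + d * H * K
            ≡ (1ℚ + (1ℚ + (1ℚ + 0ℚ))) * (k * (θ * D)) * η + ((1ℚ + (1ℚ + (1ℚ + (1ℚ + (1ℚ + (1ℚ + (1ℚ + (1ℚ + (1ℚ + 0ℚ))))))))) * (k * k) + H * K) * d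
          expand = solve-∀ R

        -- One half of the budget `ρ` pays for the width of the thin sets and fixes `t`. The other
        -- half pays for δ; its coefficient contains `H²`, hence it has to come second.
        pick-δ : (∃ λ n → ∀ i → slackB (ks i) * rec n ≤ ½ * ρ) → Result
        pick-δ (n₁ , h₁) = t , 2≤t , go (all-small B₂ 0≤B₂ 0<½ρ)
          where
          t : ℕ
          t = 2 ℕ.+ n₁
          2≤t : 2 ℕ.≤ t
          2≤t = s≤s (s≤s z≤n)
          -- These quantities do not involve the number of fine columns, so they are read off at
          -- `s = 0`.
          open Setup loc ks πs uniq t 2≤t 0 using (H²; H′; η; η≤rec-t; K; ω₀; ok₀)
          0≤H² : 0ℚ ≤ H²
          0≤H² = 0≤ι (suc H′) ⊛ 0≤ι (suc H′)
          word₀ : ℕ → List ℕ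
          word₀ zero = []
          word₀ (suc n) = 0 ∷ word₀ n
          len₀ : ∀ n → length (word₀ n) ≡ n
          len₀ zero = refl
          len₀ (suc n) = cong suc (len₀ n)
          0≤K : ∀ i → 0ℚ ≤ K i
          0≤K i = subst (λ n → 0ℚ ≤ Bdd.K (Exp.bE (Tuning.expansion loc ks πs uniq)) n) (len₀ (ks i)) (LipB-0≤ (Bdd.ok (Exp.bE (Tuning.expansion loc ks πs uniq)) ok₀ (word₀ (ks i))))
          B₂ : Fin 3 → ℚ
          B₂ i = ι 9 * (ι (ks i) * ι (ks i)) + H² * K i
          0≤B₂ : ∀ i → 0ℚ ≤ B₂ i
          0≤B₂ i = 0≤ι 9 ⊛ (0≤ι (ks i) ⊛ 0≤ι (ks i)) ⊹ 0≤H² ⊛ 0≤K i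
          go : (∃ λ n → ∀ i → B₂ i * rec n ≤ ½ * ρ) → ∃ λ δ₀ → (0ℚ < δ₀ × δ₀ ≤ ⅛) × (∀ s {ε} → 0ℚ < ε → let open Setup loc ks πs uniq t 2≤t s in
            ∃ λ y → Box y × (∀ i → ∣ mean i (λ c → total (at δ₀) y c - p (ks i) 1ℚ) ∣ ≤ ε))
          go (n₂ , h₂) = δ₀ , (0<δ₀ , δ₀≤⅛) , λ s {ε} → Setup.Solve.solution loc ks πs uniq t 2≤t s M′ M≡ N MN ν hN ρ hρ (rec≤1 m) δ₀ (<⇒≤ 0<δ₀) δ₀≤⅛ 0≤K (budget s)
            where
            δ₀ : ℚ
            δ₀ = ⅛ * rec n₂
            opaque
              unfolding arith
              0<⅛ : 0ℚ < ⅛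
              0<⅛ = D.positive⁻¹ ⅛
            0<δ₀ : 0ℚ < δ₀
            0<δ₀ = 0<* 0<⅛ (0<rec n₂)
            δ₀≤⅛ : δ₀ ≤ ⅛
            δ₀≤⅛ = subst (⅛ * rec n₂ ≤_) (*-identityʳ ⅛) (*-monoˡ ⅛ 0≤⅛ (rec≤1 n₂))
            δ₀≤rec : δ₀ ≤ rec n₂
            δ₀≤rec = subst (⅛ * rec n₂ ≤_) (*-identityˡ _) (*-monoʳ (rec n₂) (0≤rec n₂) ½*½≤)
            η≤ : η ≤ rec n₁
            η≤ = ≤-trans η≤rec-t (rec-mono (ℕ.m≤n+m n₁ 2))
            budget : ∀ s i → let open Setup loc ks πs uniq t 2≤t s using (spread) in spread i δ₀ * 1ℚ + spread i δ₀ * 1ℚ + spread i δ₀ * 1ℚ + δ₀ * H² * K i ≤ ρ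
            budget s i = ≤-trans (≤-reflexive (expand (ι (ks i)) (ι 3) η (slack (ks i) (ks i) (ks i)) δ₀ H² (K i))) (subst (slackB (ks i) * η + B₂ i * δ₀ ≤_) (halves ρ)
              (+-mono-≤ (≤-trans (*-monoˡ (slackB (ks i)) (0≤slackB (ks i)) η≤) (h₁ i)) (≤-trans (*-monoˡ (B₂ i) (0≤B₂ i) δ₀≤rec) (h₂ i))))

        result : Result
        result = pick-δ (all-small (λ i → slackB (ks i)) (λ i → 0≤slackB (ks i)) 0<½ρ)

    tuned : ∀ M′ → (∀ i g → Tuning.M loc ks πs uniq i g ≡ M′ i g) → det M′ ≢ 0ℚ → Result
    tuned M′ M≡ n = let N , MN = solvable M′ n
                        ν , hN = maxNorm N
                        m , hm = archimedes (ι 18 * ν)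
                    in Pick.result M′ M≡ N MN ν hN m hm

-- Choosing the places of the gadgets.

module Locations where
  open import Data.Nat using (ℕ; zero; suc)
  open import Data.Fin using (Fin; zero; suc)
  open import Data.Vec using (Vec; toList)
  open import Data.Product using (∃; _×_; _,_; proj₁; proj₂)
  open import Relation.Binary.PropositionalEquality hiding (_≗_)
  open import Tactic.RingSolver using (solve-∀)
  import Data.Rational as D
  import Data.Rational.Properties as D
  open Rationals
  open Series
  open Moments using (T)
  open Nonvanishing
  open FixedPoints
  open Functionals using (Location)

  module _ (n : Fin 3 → ℕ) (π : ∀ i → Vec ℕ (suc (suc (n i)))) (good : ∀ i → Good (π i)) (distinct : ∀ {i j} → i ≢ j → toList (π i) ≢ toList (π j)) where

    private
      01≢ : i₀ ≢ i₁
      01≢ ()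
      02≢ : i₀ ≢ i₂
      02≢ ()
      12≢ : i₁ ≢ i₂
      12≢ ()
      10≢ : i₁ ≢ i₀
      10≢ ()
      20≢ : i₂ ≢ i₀
      20≢ ()
      21≢ : i₂ ≢ i₁
      21≢ ()
      ¼ : ℚ
      ¼ = ½ * ½
      opaque
        unfolding arith
        0<¼ : 0ℚ < ½ * ½
        0<¼ = D.positive⁻¹ (½ D.* ½)
        ¼<½ : ½ * ½ < ½
        ¼<½ = lin< {t = ½ * ½} 0<¼ refl
        t₁ : ∀ a b c → 1ℚ * a + 0ℚ * b + 0ℚ * c ≡ a
        t₁ = solve-∀ R
        t₂ : ∀ a b c x y → a * y + - b * x + 0ℚ * c ≡ a * y - x * b
        t₂ = solve-∀ R
        t₃ : ∀ a b c d e f x y z → (a * e - b * d) * z + (d * (f) - e * c) * x + (- (a * f - b * c)) * y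
           ≡ a * (e * z - y * f) - b * (d * z - y * c) + x * (d * f - e * c)
        t₃ = solve-∀ R

      In : ℚ → ℚ → Set
      In ξ x = 0ℚ < x × x < ξ

      Point : ℚ → (ℚ → ℚ → ℚ → ℚ) → Set
      Point ξ f = ∃ λ x → ∃ λ y → ∃ λ z → In ξ x × In ξ y × In ξ z × f x y z ≢ 0ℚ

      Located : Set
      Located = ∃ λ loc → let open Location loc in det (λ i g → T (π i) (x g) (u g) (w g)) ≢ 0ℚ

      three : ℚ → ℚ → ℚ → Fin 3 → ℚ
      three a b c zero = a
      three a b c (suc zero) = b
      three a b c (suc (suc zero)) = c

      three-all : ∀ {P : ℚ → Set} {a b c} → P a → P b → P c → ∀ g → P (three a b c g)
      three-all p q r zero = p
      three-all p q r (suc zero) = q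
      three-all p q r (suc (suc zero)) = r

      module _ {xA uA wA} (ixA : In ¼ xA) (iuA : In ¼ uA) (iwA : In ¼ wA) where
        a d c : ℚ
        a = T (π i₀) xA uA wA
        d = T (π i₁) xA uA wA
        c = T (π i₂) xA uA wA

        module _ {xB uB wB} (ixB : In xA xB) (iuB : In xA uB) (iwB : In xA wB) where
          b e f : ℚ
          b = T (π i₀) xB uB wB
          e = T (π i₁) xB uB wB
          f = T (π i₂) xB uB wB

          -- The coefficients are the cofactors of the last column, so the combination at the new
          -- point is the determinant; the one belonging to `π i₂` is the 2 by 2 minor already made
          -- nonzero.
          stepC : Point xB (combo (π i₂) (π i₀) (π i₁) (a * e - b * d) (d * f - e * c) (- (a * f - b * c))) → Located
          stepC (xC , uC , wC , ixC , iuC , iwC , nC) = record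
            { x = three xA xB xC
            ; 0≤x₂ = <⇒≤ (proj₁ ixC) ; x₂≤x₁ = <⇒≤ (proj₂ ixC) ; x₁≤x₀ = <⇒≤ (proj₂ ixB) ; x₀≤ = <⇒≤ (proj₂ ixA)
            ; u = three uA uB uC
            ; w = three wA wB wC
            ; 0<u = three-all {0ℚ <_} (proj₁ iuA) (proj₁ iuB) (proj₁ iuC)
            ; 0<w = three-all {0ℚ <_} (proj₁ iwA) (proj₁ iwB) (proj₁ iwC)
            ; u< = three-all {_< ½} (<-trans (proj₂ iuA) ¼<½) (<-trans (proj₂ iuB) xA<½) (<-trans (proj₂ iuC) (<-trans (proj₂ ixB) xA<½))
            ; w< = three-all {_< ½} (<-trans (proj₂ iwA) ¼<½) (<-trans (proj₂ iwB) xA<½) (<-trans (proj₂ iwC) (<-trans (proj₂ ixB) xA<½)) }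
            , λ z → nC (trans (combo≡ (π i₂) (π i₀) (π i₁) (a * e - b * d) (d * f - e * c) (- (a * f - b * c)) xC uC wC)
                (trans (t₃ a b c d e f (T (π i₀) xC uC wC) (T (π i₁) xC uC wC) (T (π i₂) xC uC wC)) z))
            where
            xA<½ : xA < ½
            xA<½ = <-trans (proj₂ ixA) ¼<½

        stepB : Point xA (combo (π i₁) (π i₀) (π i₂) a (- d) 0ℚ) → Located
        stepB (xB , uB , wB , ixB , iuB , iwB , nB) = stepC ixB iuB iwB (nonvanishing (π i₂) (π i₀) (π i₁) (good i₂) (good i₀) (good i₁) (distinct 20≢) (distinct 21≢) _ _ _
          (λ z → nB (trans (combo≡ (π i₁) (π i₀) (π i₂) a (- d) 0ℚ xB uB wB) (trans (t₂ a d (T (π i₂) xB uB wB) (T (π i₀) xB uB wB) (T (π i₁) xB uB wB)) z))) xB (proj₁ ixB))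

      stepA : Point ¼ (combo (π i₀) (π i₁) (π i₂) 1ℚ 0ℚ 0ℚ) → Located
      stepA (xA , uA , wA , ixA , iuA , iwA , nA) = stepB ixA iuA iwA (nonvanishing (π i₁) (π i₀) (π i₂) (good i₁) (good i₀) (good i₂) (distinct 10≢) (distinct 12≢) _ _ 0ℚ
        (λ z → nA (trans (combo≡ (π i₀) (π i₁) (π i₂) 1ℚ 0ℚ 0ℚ xA uA wA) (trans (t₁ (T (π i₀) xA uA wA) (T (π i₁) xA uA wA) (T (π i₂) xA uA wA)) z))) xA (proj₁ ixA))

    -- The matrix is built column by column with nonzero leading minors. Each minor is a combination
    -- of responses at the newest point in which the newest pattern has the previous minor as
    -- coefficient, so `nonvanishing` applies; its box bound is the previous place, which yields the
    -- ordering.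
    locate : ∃ λ loc → let open Location loc in det (λ i g → T (π i) (x g) (u g) (w g)) ≢ 0ℚ
    locate = stepA (nonvanishing (π i₀) (π i₁) (π i₂) (good i₀) (good i₁) (good i₂) (distinct 01≢) (distinct 02≢) 1ℚ 0ℚ 0ℚ 1≢0 ¼ 0<¼)

-- Subsequence counts of words made of rows.

module Words where
  open import Data.Nat as ℕ using (ℕ; zero; suc; z≤n; s≤s; _≡ᵇ_; _<ᵇ_; _≤ᵇ_)
  import Data.Nat.Properties as ℕ
  open import Data.Bool using (Bool; true; false; _∧_; if_then_else_)
  import Data.Bool.Properties as Bool
  open import Data.List using (List; []; _∷_; _++_; length)
  open import Data.Product using (_,_; proj₁)
  open import Data.Empty using (⊥-elim)
  open import Relation.Nullary using (contradiction; yes; no)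
  open import Relation.Binary.PropositionalEquality hiding (_≗_)
  open import Tactic.RingSolver using (solve-∀)
  open Rationals
  open Series
  open Gadgets
  open ColumnCounts using (true⇒T; T⇒true)

  -- number of occurrences of c as a subsequence of w
  cntS : List ℕ → Ser
  cntS [] = one
  cntS (x ∷ w) [] = 1ℚ
  cntS (x ∷ w) (c ∷ cs) = 𝟙 (x ≡ᵇ c) * cntS w cs + cntS w (c ∷ cs)

  cntS-[] : ∀ w → cntS w [] ≡ 1ℚ
  cntS-[] [] = refl
  cntS-[] (x ∷ w) = refl

  0≤cntS : ∀ w c → 0ℚ ≤ cntS w c
  0≤cntS [] [] = 0≤1
  0≤cntS [] (c ∷ cs) = ≤-refl
  0≤cntS (x ∷ w) [] = 0≤1
  0≤cntS (x ∷ w) (c ∷ cs) = 0≤𝟙 (x ≡ᵇ c) ⊛ 0≤cntS w cs ⊹ 0≤cntS w (c ∷ cs)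

  cntS-++ : ∀ w w′ → cntS (w ++ w′) ≗ cntS w ⋆ cntS w′
  cntS-++ [] w′ c = sym (⋆-oneˡ (cntS w′) c)
  cntS-++ (x ∷ w) w′ [] = sym (trans (*-identityˡ _) (cntS-[] w′))
  cntS-++ (x ∷ w) w′ (c ∷ cs) = trans (cong₂ (λ s t → 𝟙 (x ≡ᵇ c) * s + t) (cntS-++ w w′ cs) (cntS-++ w w′ (c ∷ cs)))
    (sym (trans (cong (1ℚ * cntS w′ (c ∷ cs) +_) (trans (⋆-distribʳ (𝟙 (x ≡ᵇ c) ⊡ cntS w) (λ l → cntS w (c ∷ l)) (cntS w′) cs) (cong (_+ ((λ l → cntS w (c ∷ l)) ⋆ cntS w′) cs) (⋆-scaleˡ (𝟙 (x ≡ᵇ c)) (cntS w) (cntS w′) cs))))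
     (trans (lem (cntS w′ (c ∷ cs)) _ _) (cong (λ z → 𝟙 (x ≡ᵇ c) * (cntS w ⋆ cntS w′) cs + (z * cntS w′ (c ∷ cs) + ((λ l → cntS w (c ∷ l)) ⋆ cntS w′) cs)) (sym (cntS-[] w))))))
    where
    opaque
      unfolding arith
      lem : ∀ a s t → 1ℚ * a + (s + t) ≡ s + (1ℚ * a + t)
      lem = solve-∀ R

  -- the letters of J in [k, k + n), increasing
  sel : ℕ → ℕ → (ℕ → Bool) → List ℕ
  sel k zero J = []
  sel k (suc n) J = if J k then k ∷ sel (suc k) n J else sel (suc k) n J

  ≡ᵇ-refl : ∀ k → (k ≡ᵇ k) ≡ true
  ≡ᵇ-refl k = T⇒true (ℕ.≡⇒≡ᵇ k k refl)

  ≡ᵇ-≢ : ∀ {k c} → k ≢ c → (k ≡ᵇ c) ≡ false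
  ≡ᵇ-≢ {k} {c} n with k ≡ᵇ c in e
  ... | false = refl
  ... | true = ⊥-elim (n (ℕ.≡ᵇ⇒≡ k c (true⇒T e)))

  sel-below : ∀ k n J {c} cs → c ℕ.< k → cntS (sel k n J) (c ∷ cs) ≡ 0ℚ
  sel-below k zero J cs h = refl
  sel-below k (suc n) J {c} cs h with J k
  ... | false = sel-below (suc k) n J cs (ℕ.m<n⇒m<1+n h)
  ... | true = trans (cong₂ (λ s t → 𝟙 s * cntS (sel (suc k) n J) cs + t) (≡ᵇ-≢ (λ e → ℕ.<-irrefl (sym e) h)) (sel-below (suc k) n J cs (ℕ.m<n⇒m<1+n h))) (trans (+-identityʳ _) (*-zeroˡ _))

  -- The letters increase strictly, so at most one choice of positions spells a given word.
  sel≤1 : ∀ k n J c → cntS (sel k n J) c ≤ 1ℚ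
  sel≤1 k n J [] = ≤-reflexive (cntS-[] (sel k n J))
  sel≤1 k zero J (c ∷ cs) = 0≤1
  sel≤1 k (suc n) J (c ∷ cs) with J k
  ... | false = sel≤1 (suc k) n J (c ∷ cs)
  ... | true with k ℕ.≟ c
  ...   | yes refl = ≤-trans (≤-reflexive (trans (cong₂ (λ s t → 𝟙 s * cntS (sel (suc k) n J) cs + t) (≡ᵇ-refl k) (sel-below (suc k) n J cs ℕ.≤-refl)) (trans (+-identityʳ _) (*-identityˡ _)))) (sel≤1 (suc k) n J cs)
  ...   | no m = ≤-trans (≤-reflexive (trans (cong (λ s → 𝟙 s * cntS (sel (suc k) n J) cs + cntS (sel (suc k) n J) (c ∷ cs)) (≡ᵇ-≢ m)) (trans (cong (_+ cntS (sel (suc k) n J) (c ∷ cs)) (*-zeroˡ _)) (+-identityˡ _)))) (sel≤1 (suc k) n J (c ∷ cs))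

  within : ℕ → (ℕ → Bool) → ℕ → Bool
  within V J c = J c ∧ (c <ᵇ V)

  sel-one : ∀ k n J x → cntS (sel k n J) (x ∷ []) ≡ 𝟙 (J x ∧ ((k ≤ᵇ x) ∧ (x <ᵇ k ℕ.+ n)))
  sel-one k zero J x = cong 𝟙 (sym (trans (cong (J x ∧_) (none k x)) (Bool.∧-zeroʳ (J x))))
    where
    none : ∀ k x → (k ≤ᵇ x) ∧ (x <ᵇ k ℕ.+ 0) ≡ false
    none k x with (k ≤ᵇ x) in e₁ | (x <ᵇ k ℕ.+ 0) in e₂
    ... | false | _ = refl
    ... | true | false = refl
    ... | true | true = ⊥-elim (ℕ.<-irrefl refl (ℕ.<-≤-trans (ℕ.<ᵇ⇒< x (k ℕ.+ 0) (true⇒T e₂)) (subst (ℕ._≤ x) (sym (ℕ.+-identityʳ k)) (ℕ.≤ᵇ⇒≤ k x (true⇒T e₁)))))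
  sel-one k (suc n) J x with k ℕ.≟ x
  ... | yes refl = trans (here (J k) refl) (cong 𝟙 (sym (trans (cong₂ (λ s t → J k ∧ (s ∧ t)) (T⇒true (ℕ.≤⇒≤ᵇ (ℕ.≤-refl {k}))) (T⇒true (ℕ.<⇒<ᵇ (ℕ.m<m+n k (s≤s (z≤n {n})))))) (Bool.∧-identityʳ (J k)))))
    where
    here : ∀ b → J k ≡ b → cntS (sel k (suc n) J) (k ∷ []) ≡ 𝟙 (J k)
    here true e rewrite e = trans (cong₂ (λ s t → 𝟙 s * t + cntS (sel (suc k) n J) (k ∷ [])) (≡ᵇ-refl k) (cntS-[] (sel (suc k) n J))) (trans (cong (1ℚ * 1ℚ +_) (sel-below (suc k) n J [] ℕ.≤-refl)) (trans (+-identityʳ _) (*-identityˡ 1ℚ)))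
    here false e rewrite e = sel-below (suc k) n J [] ℕ.≤-refl
  ... | no k≢x = trans (skip (J k) refl) (trans (sel-one (suc k) n J x) (cong 𝟙 (cong (J x ∧_) (cong₂ _∧_ le (cong (x <ᵇ_) (sym (ℕ.+-suc k n)))))))
    where
    skip : ∀ b → J k ≡ b → cntS (sel k (suc n) J) (x ∷ []) ≡ cntS (sel (suc k) n J) (x ∷ [])
    skip true e rewrite e = trans (cong (λ s → 𝟙 s * cntS (sel (suc k) n J) [] + cntS (sel (suc k) n J) (x ∷ [])) (≡ᵇ-≢ k≢x)) (trans (cong (_+ cntS (sel (suc k) n J) (x ∷ [])) (*-zeroˡ _)) (+-identityˡ _))
    skip false e rewrite e = refl
    le : (suc k ≤ᵇ x) ≡ (k ≤ᵇ x)
    le with k ≤ᵇ x in e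
    ... | true = T⇒true (ℕ.≤⇒≤ᵇ (ℕ.≤∧≢⇒< (ℕ.≤ᵇ⇒≤ k x (true⇒T e)) k≢x))
    ... | false with suc k ≤ᵇ x in e′
    ...   | false = refl
    ...   | true = contradiction (trans (sym e) (T⇒true (ℕ.≤⇒≤ᵇ (ℕ.<⇒≤ (ℕ.≤ᵇ⇒≤ (suc k) x (true⇒T e′)))))) λ ()

  sel-one′ : ∀ V J x → cntS (sel 0 V J) (x ∷ []) ≡ 𝟙 (within V J x)
  sel-one′ V J x = sel-one 0 V J x

  -- The variant of `⋆-bound` for differences, which may have either sign.
  ⋆-bound₂ : ∀ {F G} (φ γ : ℕ → ℚ) (κ λ′ : ℚ) → 0ℚ ≤ κ → 0ℚ ≤ λ′ → (∀ x → 0ℚ ≤ φ x) → (∀ x → 0ℚ ≤ γ x) →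
    (∀ c → ∣ F c ∣ ≤ κ * prod φ c) → (∀ c → ∣ G c ∣ ≤ λ′ * prod γ c) → ∀ c → ∣ (F ⋆ G) c ∣ ≤ κ * λ′ * prod (λ x → φ x + γ x) c
  ⋆-bound₂ φ γ κ λ′ k l hφ hγ f g [] = ≤-trans (∣*∣≤ (f []) (g [])) (≤-reflexive (lem κ λ′))
    where
    opaque
      unfolding arith
      lem : ∀ k l → k * 1ℚ * (l * 1ℚ) ≡ k * l * 1ℚ
      lem = solve-∀ R
  ⋆-bound₂ {F} {G} φ γ κ λ′ k l hφ hγ f g (x ∷ c) = ≤-trans (∣+∣≤ (∣*∣≤ (f []) (≤-trans (g (x ∷ c)) (*-monoˡ λ′ l (*-monoˡ (γ x) (hγ x) (mono c)))))
      (⋆-bound₂ φ γ (κ * φ x) λ′ (k ⊛ hφ x) l hφ hγ (λ y → ≤-trans (f (x ∷ y)) (≤-reflexive (sym (*-assoc κ _ _)))) g c)) (≤-reflexive (lem κ λ′ (φ x) (γ x) _))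
    where
    mono : ∀ c → prod γ c ≤ prod (λ x → φ x + γ x) c
    mono [] = ≤-refl
    mono (x ∷ c) = *-mono (hγ x) (0≤prod (λ x → hφ x ⊹ hγ x) c) (≤+ˡ (φ x) (hφ x)) (mono c)
    opaque
      unfolding arith
      lem : ∀ k l a b q → k * 1ℚ * (l * (b * q)) + k * a * l * q ≡ k * l * ((a + b) * q)
      lem = solve-∀ R

  -- A row lists one set once in increasing order; many copies of the same row play the part of
  -- exp(a J) with a large integer `a`.
  rowsWord : ℕ → List (ℕ → Bool) → List ℕ
  rowsWord V [] = []
  rowsWord V (J ∷ Js) = sel 0 V J ++ rowsWord V Js

  unitPath : ℕ → List (ℕ → Bool) → Path
  unitPath V [] = []
  unitPath V (J ∷ Js) = (1ℚ , within V J) ∷ unitPath V Js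

  prod-one : ∀ c → prod (λ _ → 1ℚ) c ≡ 1ℚ
  prod-one [] = refl
  prod-one (x ∷ c) = trans (*-identityˡ _) (prod-one c)

  prod-const : ∀ a c → prod (λ _ → a) c ≡ pow a (length c)
  prod-const a [] = refl
  prod-const a (x ∷ c) = cong (a *_) (prod-const a c)

  eJ-unit≤1 : ∀ J c → ∣ eJ J 1ℚ c ∣ ≤ 1ℚ
  eJ-unit≤1 J c = ≤-trans (≤-reflexive (∣∣-nn (0≤eJ J 0≤1 c))) (*≤1 (0≤𝟙 (all J c)) (𝟙≤1 (all J c)) (p≤1 (length c) 0≤1 ≤-refl))

  -- A row and its unit block agree on words of length ≤ 1, so each replacement costs O(ν²).
  module Telescope (V N : ℕ) where
    ν : ℚ
    ν = rec N

    private
      n₁ : ℚ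
      n₁ = ι (suc N)
      1≤n₁ : 1ℚ ≤ n₁
      1≤n₁ = ≤+ (ι N) (0≤ι N)
      1≤pow : ∀ n → 1ℚ ≤ pow n₁ n
      1≤pow zero = ≤-refl
      1≤pow (suc n) = subst (_≤ n₁ * pow n₁ n) (*-identityˡ 1ℚ) (*-mono 0≤1 (≤-trans 0≤1 (1≤pow n)) 1≤n₁ (1≤pow n))

    diff : (ℕ → Bool) → Ser
    diff J c = cntS (sel 0 V J) c - eJ (within V J) 1ℚ c

    -- From two letters on, the trivial bound 1 is enough: `ν * n₁ = 1` and `n₁` is at least 1, so
    -- the right-hand side is at least 1.
    diff-small : ∀ J c → ∣ diff J c ∣ ≤ ν * ν * prod (λ _ → n₁) c
    diff-small J [] = subst (λ z → ∣ z ∣ ≤ ν * ν * 1ℚ) (sym (trans (cong₂ _-_ (cntS-[] (sel 0 V J)) (*-identityˡ 1ℚ)) (+-inverseʳ 1ℚ))) (∣0∣≤ (0≤rec N ⊛ 0≤rec N ⊛ 0≤1))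
    diff-small J (x ∷ []) = subst (λ z → ∣ z ∣ ≤ ν * ν * (n₁ * 1ℚ)) (sym (trans (cong₂ _-_ (sel-one′ V J x) (trans (cong₂ _*_ (trans (𝟙-∧ (within V J x) true) (*-identityʳ _)) (p-one 1ℚ)) (*-identityʳ _))) (+-inverseʳ _))) (∣0∣≤ (0≤rec N ⊛ 0≤rec N ⊛ (0≤ι (suc N) ⊛ 0≤1)))
    diff-small J (x ∷ y ∷ c) = ≤-trans (∣∣-intro (≤-trans (lin (0≤eJ (within V J) 0≤1 (x ∷ y ∷ c)) (lem₁ _ _)) (sel≤1 0 V J (x ∷ y ∷ c))) (≤-trans (lin (0≤cntS (sel 0 V J) (x ∷ y ∷ c)) (lem₂ _ _)) (proj₁ (∣∣-elim (eJ-unit≤1 (within V J) (x ∷ y ∷ c))))))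
      (≤-trans (1≤pow (length c)) (≤-reflexive (trans (sym (*-identityˡ _)) (trans (cong₂ _*_ (trans (sym (*-identityˡ 1ℚ)) (sym (cong₂ _*_ (rec-ι N) (rec-ι N)))) (sym (prod-const n₁ c))) (lem₃ ν n₁ (prod (λ _ → n₁) c))))))
      where
      opaque
        unfolding arith
        lem₁ : ∀ a b → a ≡ a - b + b
        lem₁ = solve-∀ R
        lem₂ : ∀ a b → b ≡ - (a - b) + a
        lem₂ = solve-∀ R
        lem₃ : ∀ v n q → v * n * (v * n) * q ≡ v * v * (n * (n * q))
        lem₃ = solve-∀ R

    words≤ : ∀ Js c → ∣ cntS (rowsWord V Js) c ∣ ≤ 1ℚ * prod (λ _ → ι (length Js)) c
    words≤ [] [] = ≤-reflexive (trans (∣∣-nn 0≤1) (sym (*-identityˡ 1ℚ)))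
    words≤ [] (x ∷ c) = ∣0∣≤ (0≤1 ⊛ (≤-refl ⊛ 0≤prod (λ _ → ≤-refl) c))
    words≤ (J ∷ Js) c = ≤-trans (≤-reflexive (cong ∣_∣ (cntS-++ (sel 0 V J) (rowsWord V Js) c)))
      (subst (λ z → ∣ (cntS (sel 0 V J) ⋆ cntS (rowsWord V Js)) c ∣ ≤ z * prod (λ _ → ι (suc (length Js))) c) (*-identityˡ 1ℚ)
        (⋆-bound₂ (λ _ → 1ℚ) (λ _ → ι (length Js)) 1ℚ 1ℚ 0≤1 0≤1 (λ _ → 0≤1) (λ _ → 0≤ι (length Js)) (λ l → ≤-trans (≤-reflexive (∣∣-nn (0≤cntS (sel 0 V J) l))) (≤-trans (sel≤1 0 V J l) (≤-reflexive (sym (trans (*-identityˡ _) (prod-one l)))))) (words≤ Js) c))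

    telescope : ∀ Js c → ∣ cntS (rowsWord V Js) c - coef (unitPath V Js) c ∣ ≤ ι (length Js) * (ν * ν) * prod (λ _ → ι (length Js) + n₁) c
    telescope [] c = subst₂ (λ x y → ∣ x ∣ ≤ y) (sym (+-inverseʳ (one c))) (sym (trans (cong (_* prod (λ _ → 0ℚ + n₁) c) (*-zeroˡ _)) (*-zeroˡ _))) (∣0∣≤ ≤-refl)
    telescope (J ∷ Js) c = subst₂ (λ x y → ∣ x ∣ ≤ y) (sym eq) fin (∣+∣≤ b₁ (≤-trans b₂ (*-monoˡ (ν * ν * 1ℚ) (0≤rec N ⊛ 0≤rec N ⊛ 0≤1) (prod-mono c))))
      where
      _■_ = trans
      m : ℕ
      m = length Js
      W C : Ser
      W = cntS (rowsWord V Js)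
      C = coef (unitPath V Js)
      e : Ser
      e = eJ (within V J) 1ℚ
      prod-cong : ∀ {f g : ℕ → ℚ} → (∀ x → f x ≡ g x) → ∀ c → prod f c ≡ prod g c
      prod-cong h [] = refl
      prod-cong h (x ∷ c) = cong₂ _*_ (h x) (prod-cong h c)
      opaque
        unfolding arith
        split : ∀ s e → s ≡ e + 1ℚ * (s - e)
        split = solve-∀ R
        split′ : ∀ w c → w ≡ c + 1ℚ * (w - c)
        split′ = solve-∀ R
        comb : ∀ a b d → a + 1ℚ * b + 1ℚ * d - a ≡ b + d
        comb = solve-∀ R
        suc-n : ∀ m n → 1ℚ + (m + n) ≡ 1ℚ + m + n
        suc-n = solve-∀ R
        fin₀ : ∀ k v q → 1ℚ * (k * v) * q + v * 1ℚ * q ≡ (1ℚ + k) * v * q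
        fin₀ = solve-∀ R
      eq : cntS (rowsWord V (J ∷ Js)) c - coef (unitPath V (J ∷ Js)) c ≡ (e ⋆ (λ l → W l - C l)) c + (diff J ⋆ W) c
      eq = trans (cong (_- (e ⋆ C) c) (trans (cntS-++ (sel 0 V J) (rowsWord V Js) c) (trans (⋆-congʳ (λ l → split (cntS (sel 0 V J) l) (e l)) c) (trans (⋆-distribʳ e (1ℚ ⊡ diff J) W c) (cong₂ _+_ (trans (⋆-congˡ (λ l → split′ (W l) (C l)) c) (trans (⋆-distribˡ e C (1ℚ ⊡ (λ l → W l - C l)) c) (cong ((e ⋆ C) c +_) (⋆-scaleʳ 1ℚ e (λ l → W l - C l) c)))) (⋆-scaleˡ 1ℚ (diff J) W c)))))) (comb _ _ _)
      b₁ : ∣ (e ⋆ (λ l → W l - C l)) c ∣ ≤ 1ℚ * (ι m * (ν * ν)) * prod (λ _ → 1ℚ + (ι m + n₁)) c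
      b₁ = ⋆-bound₂ (λ _ → 1ℚ) (λ _ → ι m + n₁) 1ℚ (ι m * (ν * ν)) 0≤1 (0≤ι m ⊛ (0≤rec N ⊛ 0≤rec N)) (λ _ → 0≤1) (λ _ → 0≤ι m ⊹ 0≤ι (suc N)) (λ l → ≤-trans (eJ-unit≤1 (within V J) l) (≤-reflexive (sym (trans (*-identityˡ _) (prod-one l))))) (telescope Js) c
      b₂ : ∣ (diff J ⋆ W) c ∣ ≤ ν * ν * 1ℚ * prod (λ _ → n₁ + ι m) c
      b₂ = ⋆-bound₂ (λ _ → n₁) (λ _ → ι m) (ν * ν) 1ℚ (0≤rec N ⊛ 0≤rec N) 0≤1 (λ _ → 0≤ι (suc N)) (λ _ → 0≤ι m) (diff-small J) (words≤ Js) c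
      prod-mono : ∀ c → prod (λ _ → n₁ + ι m) c ≤ prod (λ _ → 1ℚ + (ι m + n₁)) c
      prod-mono [] = ≤-refl
      prod-mono (x ∷ c) = *-mono (0≤ι (suc N) ⊹ 0≤ι m) (0≤prod (λ _ → 0≤1 ⊹ (0≤ι m ⊹ 0≤ι (suc N))) c) (≤-trans (≤-reflexive (+-comm n₁ (ι m))) (≤+ˡ 1ℚ 0≤1)) (prod-mono c)
      fin : 1ℚ * (ι m * (ν * ν)) * prod (λ _ → 1ℚ + (ι m + n₁)) c + ν * ν * 1ℚ * prod (λ _ → 1ℚ + (ι m + n₁)) c ≡ ι (suc m) * (ν * ν) * prod (λ _ → ι (suc m) + n₁) c
      fin = trans (fin₀ (ι m) (ν * ν) _) (cong (ι (suc m) * (ν * ν) *_) (prod-cong (λ _ → suc-n (ι m) n₁) c))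

-- Permutations read off from words.

module WordPermutations where
  open import Data.Nat as ℕ using (ℕ; zero; suc; z≤n; s≤s; _≡ᵇ_; _<ᵇ_)
  import Data.Nat.Properties as ℕ
  open import Data.Bool as Bool using (Bool; true; false; _∧_; if_then_else_)
  import Data.Bool.Properties as Bool
  open import Data.Bool.ListAction using (and)
  open import Data.Fin as Fin using (Fin; zero; suc; toℕ)
  import Data.Fin.Properties as Fin
  open import Data.List using (List; []; _∷_; length; map; allFin; filter)
  open import Data.List.Membership.Propositional using (_∈_)
  open import Data.List.Membership.Propositional.Properties using (∈-map⁺; ∈-map⁻; ∈-concatMap⁺; ∈-concatMap⁻; ∈-allFin)
  import Data.List.Relation.Unary.Any as Any
  open import Data.List.Relation.Unary.Any using (here; there)
  open import Data.Vec as Vec using (Vec; []; _∷_; toList; lookup)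
  import Data.Vec.Properties as Vec
  open import Data.Product using (∃; _,_; proj₁; proj₂)
  open import Data.Sum using (_⊎_; inj₁; inj₂)
  open import Data.Empty using (⊥-elim)
  open import Function.Definitions using (Injective)
  open import Relation.Nullary using (contradiction; ¬_; yes; no)
  open import Relation.Nullary.Decidable using (⌊_⌋)
  open import Relation.Binary.PropositionalEquality hiding (_≗_)
  open import Relation.Binary.Definitions using (tri<; tri≈; tri>)
  open import Tactic.RingSolver using (solve-∀)
  open import Defs
  open Rationals
  open Series
  open ColumnCounts using (true⇒T; T⇒true; T-∧)
  open Words using (cntS; ≡ᵇ-refl; cntS-[])

  and⇒ : ∀ {xs} → and xs ≡ true → ∀ {x} → x ∈ xs → x ≡ true
  and⇒ {y ∷ xs} e (here refl) = proj₁ (T-∧ e)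
  and⇒ {y ∷ xs} e (there m) = and⇒ (proj₂ (T-∧ {y} e)) m

  ⇒and : ∀ {xs} → (∀ {x} → x ∈ xs → x ≡ true) → and xs ≡ true
  ⇒and {[]} h = refl
  ⇒and {x ∷ xs} h = cong₂ _∧_ (h (here refl)) (⇒and (λ m → h (there m)))

  ⌊⌋⇒ : ∀ {a b} → ⌊ a Bool.≟ b ⌋ ≡ true → a ≡ b
  ⌊⌋⇒ {a} {b} e with a Bool.≟ b
  ... | yes p = p

  ⇒⌊⌋ : ∀ {a b} → a ≡ b → ⌊ a Bool.≟ b ⌋ ≡ true
  ⇒⌊⌋ {a} {b} e with a Bool.≟ b
  ... | yes p = refl
  ... | no n = ⊥-elim (n e)

  Matches : ∀ {k n} → (Fin k → Fin k) → (Fin n → Fin n) → Vec (Fin n) k → Set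
  Matches π Π a = ∀ i j → (toℕ (π i) <ᵇ toℕ (π j)) ≡ (toℕ (Π (lookup a i)) <ᵇ toℕ (Π (lookup a j)))

  module _ {k n} (π : Fin k → Fin k) (Π : Fin n → Fin n) (a : Vec (Fin n) k) where
    private
      cell : Fin k → Fin k → Bool
      cell i j = ⌊ (toℕ (π i) <ᵇ toℕ (π j)) Bool.≟ (toℕ (Π (lookup a i)) <ᵇ toℕ (Π (lookup a j))) ⌋

    induces⇒ : induces π Π a ≡ true → Matches π Π a
    induces⇒ e i j = ⌊⌋⇒ (and⇒ e (∈-concatMap⁺ (λ i → map (cell i) (allFin k)) (Any.map (λ { refl → ∈-map⁺ (cell i) (∈-allFin j) }) (∈-allFin i))))

    ⇒induces : Matches π Π a → induces π Π a ≡ true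
    ⇒induces h = ⇒and λ {x} m → case (Any.satisfied (∈-concatMap⁻ (λ i → map (cell i) (allFin k)) {xs = allFin k} m))
      where
      case : ∀ {x} → (∃ λ i → x ∈ map (cell i) (allFin k)) → x ≡ true
      case (i , m) with ∈-map⁻ (cell i) m
      ... | j , _ , refl = ⇒⌊⌋ (h i j)

  ι-filter : ∀ {A : Set} (f : A → Bool) xs → ι (length (filter (λ a → f a Bool.≟ true) xs)) ≡ ∑ xs (λ a → 𝟙 (f a))
  ι-filter f [] = refl
  ι-filter f (x ∷ xs) with f x
  ... | true = cong (1ℚ +_) (ι-filter f xs)
  ... | false = trans (ι-filter f xs) (sym (+-identityˡ _))

  countF : ∀ n → (Fin n → Bool) → ℕ
  countF zero f = 0
  countF (suc n) f = (if f zero then 1 else 0) ℕ.+ countF n (λ i → f (suc i))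

  countF-mono : ∀ n {f g} → (∀ i → f i ≡ true → g i ≡ true) → countF n f ℕ.≤ countF n g
  countF-mono zero h = z≤n
  countF-mono (suc n) {f} {g} h with f zero in e | g zero in e′
  ... | true | true = s≤s (countF-mono n (λ i → h (suc i)))
  ... | true | false = contradiction (trans (sym (h zero e)) e′) λ ()
  ... | false | true = ℕ.≤-trans (countF-mono n (λ i → h (suc i))) (ℕ.n≤1+n _)
  ... | false | false = countF-mono n (λ i → h (suc i))

  countF-strict : ∀ n {f g} → (∀ i → f i ≡ true → g i ≡ true) → ∀ i → f i ≡ false → g i ≡ true → countF n f ℕ.< countF n g
  countF-strict (suc n) {f} {g} h zero e e′ rewrite e | e′ = s≤s (countF-mono n (λ i → h (suc i)))
  countF-strict (suc n) {f} {g} h (suc i) e e′ with f zero in r | g zero in r′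
  ... | true | true = s≤s (countF-strict n (λ i → h (suc i)) i e e′)
  ... | true | false = contradiction (trans (sym (h zero r)) r′) λ ()
  ... | false | true = ℕ.≤-trans (countF-strict n (λ i → h (suc i)) i e e′) (ℕ.n≤1+n _)
  ... | false | false = countF-strict n (λ i → h (suc i)) i e e′

  all-true : ∀ n → countF n (λ _ → true) ≡ n
  all-true zero = refl
  all-true (suc n) = cong suc (all-true n)

  -- Pigeonhole: if `y` were missed, punching it out would embed `n + 1` elements into `n`.
  injective⇒surjective : ∀ {n} {f : Fin n → Fin n} → Injective _≡_ _≡_ f → ∀ y → ∃ λ x → f x ≡ y
  injective⇒surjective {suc n} {f} inj y with Fin.any? (λ x → f x Fin.≟ y)
  ... | yes p = p
  ... | no m = ⊥-elim (ℕ.1+n≰n (Fin.injective⇒≤ {f = λ x → Fin.punchOut {i = y} {j = f x} (λ e → m (x , sym e))} (λ {x} {x′} e → inj (Fin.punchOut-injective (λ e → m (x , sym e)) (λ e → m (x′ , sym e)) e))))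

  -- Positions are ranked by letter, equal letters from left to right.
  module WordPerm {n} (w : Vec ℕ n) where
    -- Letter and position in lexicographic order, encoded in one number; positions stay below `n`,
    -- so they never override a difference of letters.
    key : Fin n → ℕ
    key i = lookup w i ℕ.* n ℕ.+ toℕ i

    private
      below : Fin n → Fin n → Bool
      below i j = key j <ᵇ key i

      rank<n : ∀ i → countF n (below i) ℕ.< n
      rank<n i = subst (countF n (below i) ℕ.<_) (all-true n) (countF-strict n (λ _ _ → refl) i (f⇒ {key i} {key i} (ℕ.<-irrefl refl)) refl)
        where
        f⇒ : ∀ {x y} → ¬ (x ℕ.< y) → (x <ᵇ y) ≡ false
        f⇒ {x} {y} m with x <ᵇ y in e
        ... | false = refl
        ... | true = ⊥-elim (m (ℕ.<ᵇ⇒< x y (true⇒T e)))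

    rank : Fin n → Fin n
    rank i = Fin.fromℕ< (rank<n i)

    rank-mono : ∀ {i j} → key i ℕ.< key j → toℕ (rank i) ℕ.< toℕ (rank j)
    rank-mono {i} {j} h = subst₂ ℕ._<_ (sym (Fin.toℕ-fromℕ< (rank<n i))) (sym (Fin.toℕ-fromℕ< (rank<n j)))
      (countF-strict n (λ l e → T⇒true (ℕ.<⇒<ᵇ (ℕ.<-trans (ℕ.<ᵇ⇒< (key l) (key i) (true⇒T e)) h))) i (f⇒ {key i} {key i} (ℕ.<-irrefl refl)) (T⇒true (ℕ.<⇒<ᵇ h)))
      where
      f⇒ : ∀ {x y} → ¬ (x ℕ.< y) → (x <ᵇ y) ≡ false
      f⇒ {x} {y} m with x <ᵇ y in e
      ... | false = refl
      ... | true = ⊥-elim (m (ℕ.<ᵇ⇒< x y (true⇒T e)))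

    letter-< : ∀ {i j} → lookup w i ℕ.< lookup w j → key i ℕ.< key j
    letter-< {i} {j} h = ℕ.<-≤-trans (ℕ.+-monoʳ-< (lookup w i ℕ.* n) (Fin.toℕ<n i)) (ℕ.≤-trans (ℕ.≤-reflexive (ℕ.+-comm (lookup w i ℕ.* n) n)) (ℕ.≤-trans (ℕ.*-monoˡ-≤ n h) (ℕ.m≤m+n _ (toℕ j))))

    rank-injective : Injective _≡_ _≡_ rank
    rank-injective {i} {j} e with ℕ.<-cmp (key i) (key j)
    ... | tri< l _ _ = ⊥-elim (ℕ.<-irrefl (cong toℕ e) (rank-mono l))
    ... | tri> _ _ l = ⊥-elim (ℕ.<-irrefl (sym (cong toℕ e)) (rank-mono l))
    ... | tri≈ _ q _ with ℕ.<-cmp (lookup w i) (lookup w j)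
    ...   | tri< l _ _ = ⊥-elim (ℕ.<-irrefl q (letter-< l))
    ...   | tri> _ _ l = ⊥-elim (ℕ.<-irrefl (sym q) (letter-< l))
    ...   | tri≈ _ r _ = Fin.toℕ-injective (ℕ.+-cancelˡ-≡ (lookup w i ℕ.* n) (toℕ i) (toℕ j) (trans q (cong (λ z → z ℕ.* n ℕ.+ toℕ j) (sym r))))

    wordPerm : Perm
    wordPerm = perm n rank (rank-injective , λ y → let x , e = injective⇒surjective rank-injective y in x , λ { refl → e })

  subs : List ℕ → (k : ℕ) → (List ℕ → ℚ) → ℚ
  subs w zero g = g []
  subs [] (suc k) g = 0ℚ
  subs (x ∷ w) (suc k) g = subs w k (λ c → g (x ∷ c)) + subs w (suc k) g

  trace : ∀ {n k} → Vec ℕ n → Vec (Fin n) k → List ℕ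
  trace w a = toList (Vec.map (lookup w) a)

  trace-suc : ∀ {n k} x (w : Vec ℕ n) (a : Vec (Fin n) k) → trace (x ∷ w) (Vec.map suc a) ≡ trace w a
  trace-suc x w [] = refl
  trace-suc x w (i ∷ a) = cong (lookup w i ∷_) (trace-suc x w a)

  ∑-trace : ∀ {n} (w : Vec ℕ n) k g → ∑ (subsets n k) (λ a → g (trace w a)) ≡ subs (toList w) k g
  ∑-trace [] zero g = +-identityʳ _
  ∑-trace (x ∷ w) zero g = +-identityʳ _
  ∑-trace [] (suc k) g = refl
  ∑-trace {suc n} (x ∷ w) (suc k) g = trans (∑-++ (map (λ v → zero ∷ Vec.map suc v) (subsets n k)) _ _) (cong₂ _+_
    (trans (∑-map _ (subsets n k) _) (trans (∑-cong (subsets n k) (λ a → cong (λ l → g (x ∷ l)) (trace-suc x w a))) (∑-trace w k (λ c → g (x ∷ c)))))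
    (trans (∑-map _ (subsets n (suc k)) _) (trans (∑-cong (subsets n (suc k)) (λ a → cong g (trace-suc x w a))) (∑-trace w (suc k) g))))

  eqL : List ℕ → List ℕ → Bool
  eqL [] [] = true
  eqL (x ∷ c) (y ∷ d) = (x ≡ᵇ y) ∧ eqL c d
  eqL _ _ = false

  eqL⇒ : ∀ {c d} → eqL c d ≡ true → c ≡ d
  eqL⇒ {[]} {[]} e = refl
  eqL⇒ {x ∷ c} {y ∷ d} e = let p , q = T-∧ e in cong₂ _∷_ (ℕ.≡ᵇ⇒≡ x y (true⇒T p)) (eqL⇒ q)

  eqL-refl : ∀ c → eqL c c ≡ true
  eqL-refl [] = refl
  eqL-refl (x ∷ c) = cong₂ _∧_ (≡ᵇ-refl x) (eqL-refl c)

  subs-cong : ∀ w k {g h : List ℕ → ℚ} → (∀ c → g c ≡ h c) → subs w k g ≡ subs w k h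
  subs-cong w zero e = e []
  subs-cong [] (suc k) e = refl
  subs-cong (x ∷ w) (suc k) e = cong₂ _+_ (subs-cong w k (λ c → e (x ∷ c))) (subs-cong w (suc k) e)

  subs-* : ∀ w k a g → subs w k (λ c → a * g c) ≡ a * subs w k g
  subs-* w zero a g = refl
  subs-* [] (suc k) a g = sym (*-zeroʳ a)
  subs-* (x ∷ w) (suc k) a g = trans (cong₂ _+_ (subs-* w k a (λ c → g (x ∷ c))) (subs-* w (suc k) a g)) (sym (*-distribˡ-+ a _ _))

  subs-+ : ∀ w k g h → subs w k (λ c → g c + h c) ≡ subs w k g + subs w k h
  subs-+ w zero g h = refl
  subs-+ [] (suc k) g h = sym (+-identityˡ 0ℚ)
  subs-+ (x ∷ w) (suc k) g h = trans (cong₂ _+_ (subs-+ w k (λ c → g (x ∷ c)) (λ c → h (x ∷ c))) (subs-+ w (suc k) g h)) (lem _ _ _ _)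
    where
    opaque
      unfolding arith
      lem : ∀ a b c d → a + b + (c + d) ≡ a + c + (b + d)
      lem = solve-∀ R

  𝟙-∧′ : ∀ a b → 𝟙 (a ∧ b) ≡ 𝟙 a * 𝟙 b
  𝟙-∧′ true b = sym (*-identityˡ _)
  𝟙-∧′ false b = sym (*-zeroˡ _)

  subs-eq : ∀ w d → subs w (length d) (λ c → 𝟙 (eqL c d)) ≡ cntS w d
  subs-eq w [] = sym (cntS-[] w)
  subs-eq [] (y ∷ d) = refl
  subs-eq (x ∷ w) (y ∷ d) = cong₂ _+_ (trans (subs-cong w (length d) (λ c → 𝟙-∧′ (x ≡ᵇ y) (eqL c d))) (trans (subs-* w (length d) (𝟙 (x ≡ᵇ y)) (λ c → 𝟙 (eqL c d))) (cong (𝟙 (x ≡ᵇ y) *_) (subs-eq w d)))) (subs-eq w (y ∷ d))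

  mult : ℕ → List ℕ → ℚ
  mult x [] = 0ℚ
  mult x (y ∷ c) = 𝟙 (x ≡ᵇ y) + mult x c

  -- Counts pairs of equal letters. Only tuples of positions with such a pair can induce a pattern
  -- without their letters spelling it.
  tie : List ℕ → ℚ
  tie [] = 0ℚ
  tie (x ∷ c) = mult x c + tie c

  0≤mult : ∀ x c → 0ℚ ≤ mult x c
  0≤mult x [] = ≤-refl
  0≤mult x (y ∷ c) = 0≤𝟙 (x ≡ᵇ y) ⊹ 0≤mult x c

  0≤tie : ∀ c → 0ℚ ≤ tie c
  0≤tie [] = ≤-refl
  0≤tie (x ∷ c) = 0≤mult x c ⊹ 0≤tie c

  occ-dec : ∀ {k} x (c : Vec ℕ k) → (∀ i → x ≢ lookup c i) ⊎ 1ℚ ≤ mult x (toList c)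
  occ-dec x [] = inj₁ λ ()
  occ-dec x (y ∷ c) with x ℕ.≟ y | occ-dec x c
  ... | yes refl | _ = inj₂ (≤-trans (≤-reflexive (cong 𝟙 (sym (≡ᵇ-refl x)))) (≤+ _ (0≤mult x (toList c))))
  ... | no n | inj₂ h = inj₂ (≤-trans h (≤+ˡ _ (0≤𝟙 (x ≡ᵇ y))))
  ... | no n | inj₁ h = inj₁ λ { zero → n ; (suc i) → h i }

  tie-dec : ∀ {k} (c : Vec ℕ k) → (∀ i j → i ≢ j → lookup c i ≢ lookup c j) ⊎ 1ℚ ≤ tie (toList c)
  tie-dec [] = inj₁ λ ()
  tie-dec (x ∷ c) with occ-dec x c | tie-dec c
  ... | inj₂ h | _ = inj₂ (≤-trans h (≤+ _ (0≤tie (toList c))))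
  ... | inj₁ _ | inj₂ h = inj₂ (≤-trans h (≤+ˡ _ (0≤mult x (toList c))))
  ... | inj₁ h | inj₁ h′ = inj₁ λ where
      zero zero n → ⊥-elim (n refl)
      zero (suc j) n → h j
      (suc i) zero n e → h i (sym e)
      (suc i) (suc j) n → h′ i j (λ e → n (cong suc e))

  pow-up : ∀ m k → pow (ι m) k + pow (ι m) (suc k) ≤ pow (ι (suc m)) (suc k)
  pow-up m k = ≤-trans (≤-reflexive (lem (ι m) (pow (ι m) k))) (*-monoˡ (ι (suc m)) (0≤ι (suc m)) (mono k))
    where
    opaque
      unfolding arith
      lem : ∀ m q → q + m * q ≡ (1ℚ + m) * q
      lem = solve-∀ R
    mono : ∀ k → pow (ι m) k ≤ pow (ι (suc m)) k
    mono zero = ≤-refl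
    mono (suc k) = *-mono (0≤ι m) (≤-trans (0≤pow k (0≤ι m)) (mono k)) (≤+ˡ 1ℚ 0≤1) (mono k)

  subs-one : ∀ w k → subs w k (λ _ → 1ℚ) ≤ pow (ι (length w)) k
  subs-one w zero = ≤-refl
  subs-one [] (suc k) = ≤-reflexive (sym (*-zeroˡ _))
  subs-one (x ∷ w) (suc k) = ≤-trans (+-mono-≤ (subs-one w k) (subs-one w (suc k))) (pow-up (length w) k)

  subs-mult : ∀ w k x → subs w (suc k) (mult x) ≤ mult x w * pow (ι (length w)) k
  subs-mult [] k x = ≤-reflexive (sym (*-zeroˡ _))
  subs-mult (y ∷ w) k x = ≤-trans (+-mono-≤ (≤-reflexive (subs-+ w k (λ _ → 𝟙 (x ≡ᵇ y)) (mult x))) (subs-mult w k x))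
    (≤-trans (+-mono-≤ (+-mono-≤ (≤-reflexive (trans (subs-cong w k (λ _ → sym (*-identityʳ _))) (subs-* w k (𝟙 (x ≡ᵇ y)) (λ _ → 1ℚ)))) ≤-refl) ≤-refl) (go k))
    where
    o q : ℚ
    o = 𝟙 (x ≡ᵇ y)
    q = mult x w
    n : ℕ
    n = length w
    opaque
      unfolding arith
      l₀ : ∀ o q → o * 1ℚ + 0ℚ + q * 1ℚ ≡ (o + q) * 1ℚ
      l₀ = solve-∀ R
      l₁ : ∀ o q a b c → (o + q) * (c) ≡ o * b + q * a + q * b + ((o + q) * (c - (a + b)) + o * a)
      l₁ = solve-∀ R
    go : ∀ k → o * subs w k (λ _ → 1ℚ) + subs w k (mult x) + q * pow (ι n) k ≤ (o + q) * pow (ι (suc n)) k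
    go zero = ≤-reflexive (l₀ o q)
    go (suc k) = ≤-trans (+-mono-≤ (+-mono-≤ (*-monoˡ o (0≤𝟙 (x ≡ᵇ y)) (subs-one w (suc k))) (subs-mult w k x)) ≤-refl)
      (lin ((0≤𝟙 (x ≡ᵇ y) ⊹ 0≤mult x w) ⊛ gap (pow-up n k) ⊹ 0≤𝟙 (x ≡ᵇ y) ⊛ 0≤pow k (0≤ι n)) (l₁ o q (pow (ι n) k) (pow (ι n) (suc k)) (pow (ι (suc n)) (suc k))))

  -- A tie leaves at most `μ` candidates for the partner of a chosen position instead of the whole
  -- word, which saves one factor of the length. `pow-up` merges the cases of the first letter being
  -- chosen or skipped.
  subs-tie : ∀ w k μ → 0ℚ ≤ μ → (∀ x → mult x w ≤ μ) → subs w (suc k) tie ≤ ι k * μ * pow (ι (length w)) k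
  subs-tie [] k μ 0≤μ h = 0≤ι k ⊛ 0≤μ ⊛ 0≤pow k ≤-refl
  subs-tie (y ∷ w) zero μ 0≤μ h = ≤-trans (+-mono-≤ (≤-reflexive (+-identityˡ 0ℚ)) (subs-tie w zero μ 0≤μ (λ x → ≤-trans (≤+ˡ _ (0≤𝟙 (x ≡ᵇ y))) (h x)))) (≤-reflexive (+-identityˡ _))
  subs-tie (y ∷ w) (suc k) μ 0≤μ h = ≤-trans (+-mono-≤ (≤-trans (≤-reflexive (subs-+ w (suc k) (mult y) tie)) (+-mono-≤ (≤-trans (subs-mult w k y) (*-monoʳ _ (0≤pow k (0≤ι (length w))) (h′ y))) (subs-tie w k μ 0≤μ h′))) (subs-tie w (suc k) μ 0≤μ h′))
    (≤-trans (≤-reflexive (lem μ (ι k) (pow (ι (length w)) k) (pow (ι (length w)) (suc k)))) (*-monoˡ (ι (suc k) * μ) (0≤ι (suc k) ⊛ 0≤μ) (pow-up (length w) k)))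
    where
    h′ : ∀ x → mult x w ≤ μ
    h′ x = ≤-trans (≤+ˡ _ (0≤𝟙 (x ≡ᵇ y))) (h x)
    opaque
      unfolding arith
      lem : ∀ μ k a b → μ * a + k * μ * a + (1ℚ + k) * μ * b ≡ (1ℚ + k) * μ * (a + b)
      lem = solve-∀ R

-- Pattern counts as sums of subsequence counts.

module Counting where
  open import Data.Nat as ℕ using (ℕ; zero; suc; z≤n; s≤s; _≡ᵇ_)
  import Data.Nat.Properties as ℕ
  open import Data.Bool using (Bool; true; false; _∧_; if_then_else_)
  open import Data.Fin as Fin using (Fin; zero; suc; toℕ)
  import Data.Fin.Properties as Fin
  open import Data.List using ([]; _∷_)
  open import Data.Vec as Vec using (Vec; []; _∷_; toList; lookup)
  import Data.Vec.Properties as Vec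
  open import Data.Product using (_×_; _,_; proj₁; proj₂)
  open import Data.Sum using (inj₁; inj₂)
  open import Data.Empty using (⊥-elim)
  open import Relation.Nullary using (contradiction; yes; no)
  open import Relation.Binary.Definitions using (Tri; tri<; tri≈; tri>)
  open import Relation.Binary.PropositionalEquality hiding (_≗_)
  open import Tactic.RingSolver using (solve-∀)
  open import Defs
  open Rationals
  open Series
  open IncreasingSums
  open ColumnCounts using (true⇒T; T⇒true)
  open ColumnAverages using (word)
  open Nonvanishing using (length-toList)
  open Words using (cntS; ≡ᵇ-refl; ≡ᵇ-≢)
  open WordPermutations

  -- Tests for a strictly increasing vector with entries in `[o, o + V)`, following the recursion of
  -- `inc` so that the two can be compared step by step.
  isInc : ∀ {k} → ℕ → ℕ → Vec ℕ k → Bool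
  isInc V o [] = true
  isInc zero o (x ∷ c) = false
  isInc (suc V) o (x ∷ c) = if o ≡ᵇ x then isInc V (suc o) c else isInc V (suc o) (x ∷ c)

  inc-below : ∀ {k} V o x (c : Vec ℕ k) → x ℕ.< o → inc V (suc k) o (λ v → 𝟙 (eqL (toList (x ∷ c)) (toList v))) ≡ 0ℚ
  inc-below zero o x c h = refl
  inc-below {k} (suc V) o x c h = trans (cong₂ _+_ (trans (inc-cong V k (suc o) (λ v → trans (cong (λ z → 𝟙 (z ∧ eqL (toList c) (toList v))) (≡ᵇ-≢ {x} {o} (λ e → ℕ.<-irrefl e h))) (sym (*-zeroˡ 0ℚ)))) (trans (inc-* V k (suc o) 0ℚ (λ _ → 0ℚ)) (*-zeroˡ _))) (inc-below V (suc o) x c (ℕ.m<n⇒m<1+n h))) (+-identityˡ 0ℚ)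

  inc-eq : ∀ {k} V o (c : Vec ℕ k) → inc V k o (λ v → 𝟙 (eqL (toList c) (toList v))) ≡ 𝟙 (isInc V o c)
  inc-eq V o [] = refl
  inc-eq zero o (x ∷ c) = refl
  inc-eq {suc k} (suc V) o (x ∷ c) with o ℕ.≟ x
  ... | yes refl = trans (cong₂ _+_ (trans (inc-cong V k (suc o) (λ v → cong (λ z → 𝟙 (z ∧ eqL (toList c) (toList v))) (≡ᵇ-refl o))) (inc-eq V (suc o) c)) (inc-below V (suc o) o c ℕ.≤-refl))
     (trans (+-identityʳ _) (cong (λ z → 𝟙 (if z then isInc V (suc o) c else isInc V (suc o) (o ∷ c))) (sym (≡ᵇ-refl o))))
  ... | no n = trans (cong₂ _+_ (trans (inc-cong V k (suc o) (λ v → trans (cong (λ z → 𝟙 (z ∧ eqL (toList c) (toList v))) (≡ᵇ-≢ {x} {o} (λ e → n (sym e)))) (sym (*-zeroˡ 0ℚ)))) (trans (inc-* V k (suc o) 0ℚ (λ _ → 0ℚ)) (*-zeroˡ _))) (inc-eq V (suc o) (x ∷ c)))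
     (trans (+-identityˡ _) (cong (λ z → 𝟙 (if z then isInc V (suc o) c else isInc V (suc o) (x ∷ c))) (sym (≡ᵇ-≢ {o} {x} n))))

  Mono : ∀ {k} → Vec ℕ k → Set
  Mono c = ∀ i j → toℕ i ℕ.< toℕ j → lookup c i ℕ.< lookup c j

  isInc⇒ : ∀ {k} V o (c : Vec ℕ k) → isInc V o c ≡ true → (∀ i → o ℕ.≤ lookup c i) × Mono c
  isInc⇒ V o [] e = (λ ()) , λ ()
  isInc⇒ (suc V) o (x ∷ c) e with o ℕ.≟ x
  ... | no n = (λ i → ℕ.<⇒≤ (proj₁ r i)) , proj₂ r
    where
    r : (∀ i → suc o ℕ.≤ lookup (x ∷ c) i) × Mono (x ∷ c)
    r = isInc⇒ V (suc o) (x ∷ c) (trans (cong (λ z → if z then isInc V (suc o) c else isInc V (suc o) (x ∷ c)) (sym (≡ᵇ-≢ {o} {x} n))) e)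
  ... | yes refl = (λ { zero → ℕ.≤-refl ; (suc i) → ℕ.<⇒≤ (proj₁ r i) }) , λ { zero (suc j) h → proj₁ r j ; (suc i) (suc j) (s≤s h) → proj₂ r i j h }
    where
    r : (∀ i → suc o ℕ.≤ lookup c i) × Mono c
    r = isInc⇒ V (suc o) c (trans (cong (λ z → if z then isInc V (suc o) c else isInc V (suc o) (o ∷ c)) (sym (≡ᵇ-refl o))) e)

  ⇒isInc : ∀ {k} V o (c : Vec ℕ k) → (∀ i → o ℕ.≤ lookup c i) → (∀ i → lookup c i ℕ.< o ℕ.+ V) → Mono c → isInc V o c ≡ true
  ⇒isInc V o [] l h m = refl
  ⇒isInc zero o (x ∷ c) l h m = ⊥-elim (ℕ.<-irrefl refl (ℕ.<-≤-trans (h zero) (ℕ.≤-trans (ℕ.≤-reflexive (ℕ.+-identityʳ o)) (l zero))))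
  ⇒isInc (suc V) o (x ∷ c) l h m with o ℕ.≟ x
  ... | no n = trans (cong (λ z → if z then isInc V (suc o) c else isInc V (suc o) (x ∷ c)) (≡ᵇ-≢ {o} {x} n)) (⇒isInc V (suc o) (x ∷ c) l′ (λ i → subst (lookup (x ∷ c) i ℕ.<_) (ℕ.+-suc o V) (h i)) m)
    where
    x> : o ℕ.< x
    x> = ℕ.≤∧≢⇒< (l zero) n
    l′ : ∀ i → suc o ℕ.≤ lookup (x ∷ c) i
    l′ zero = x>
    l′ (suc i) = ℕ.<-trans x> (m zero (suc i) (s≤s z≤n))
  ... | yes refl = trans (cong (λ z → if z then isInc V (suc o) c else isInc V (suc o) (o ∷ c)) (≡ᵇ-refl o)) (⇒isInc V (suc o) c (λ i → m zero (suc i) (s≤s z≤n)) (λ i → subst (lookup c i ℕ.<_) (ℕ.+-suc o V) (h (suc i))) (λ i j p → m (suc i) (suc j) (s≤s p)))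

  toList-inj : ∀ {k} {a b : Vec ℕ k} → toList a ≡ toList b → a ≡ b
  toList-inj {a = []} {[]} e = refl
  toList-inj {a = x ∷ a} {y ∷ b} e = cong₂ _∷_ (cong (λ { [] → 0 ; (z ∷ _) → z }) e) (toList-inj (cong (λ { [] → [] ; (_ ∷ l) → l }) e))

  lookup-ext : ∀ {k} {a b : Vec ℕ k} → (∀ i → lookup a i ≡ lookup b i) → a ≡ b
  lookup-ext {a = []} {[]} e = refl
  lookup-ext {a = x ∷ a} {y ∷ b} e = cong₂ _∷_ (e zero) (lookup-ext (λ i → e (suc i)))

  eqL-lookup : ∀ {k} (a b : Vec ℕ k) → eqL (toList a) (toList b) ≡ true → ∀ i → lookup a i ≡ lookup b i
  eqL-lookup a b e i = cong (λ v → lookup v i) (toList-inj (eqL⇒ {toList a} {toList b} e))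

  ≡-iff : ∀ {a b} → (a ≡ true → b ≡ true) → (b ≡ true → a ≡ true) → a ≡ b
  ≡-iff {true} f g = sym (f refl)
  ≡-iff {false} {true} f g = g refl
  ≡-iff {false} {false} f g = refl

  module Occurrences {n V} (w : Vec ℕ n) (w<V : ∀ i → lookup w i ℕ.< V) (π : Perm) where
    open WordPerm w

    private
      k : ℕ
      k = order π
      inj : ∀ {i j} → σ π i ≡ σ π j → i ≡ j
      inj = proj₁ (bij π)
      inv : Fin k → Fin k
      inv y = proj₁ (proj₂ (bij π) y)
      σ-inv : ∀ y → σ π (inv y) ≡ y
      σ-inv y = proj₂ (proj₂ (bij π) y) refl

      module _ (a : Vec (Fin n) k) where
        c c′ : Vec ℕ k
        c = Vec.map (lookup w) a
        -- The letters in the order of the pattern's values rather than of its positions: entry `j`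
        -- is the letter at the place where the pattern takes the value `j`.
        c′ = Vec.tabulate (λ j → lookup c (inv j))

        c≡ : ∀ i → lookup c i ≡ lookup w (lookup a i)
        c≡ i = Vec.lookup-map i (lookup w) a

        c′≡ : ∀ i → lookup c′ (σ π i) ≡ lookup c i
        c′≡ i = trans (Vec.lookup∘tabulate _ (σ π i)) (cong (lookup c) (inj (σ-inv (σ π i))))

        c<V : ∀ i → lookup c′ i ℕ.< V
        c<V i = subst (ℕ._< V) (sym (trans (Vec.lookup∘tabulate _ i) (c≡ (inv i)))) (w<V (lookup a (inv i)))

        letter≡ : ∀ (e : Vec (Fin V) k) i → lookup (Vec.map (λ j → toℕ (lookup e j)) (Vec.tabulate (σ π))) i ≡ toℕ (lookup e (σ π i))
        letter≡ e i = trans (Vec.lookup-map i _ (Vec.tabulate (σ π))) (cong (λ j → toℕ (lookup e j)) (Vec.lookup∘tabulate (σ π) i))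

        same : ∀ (e : Vec (Fin V) k) → eqL (trace w a) (word e (Vec.tabulate (σ π))) ≡ eqL (toList c′) (toList (shifted 0 e))
        same e = ≡-iff
          (λ h → subst (λ l → eqL (toList c′) l ≡ true) (cong toList (lookup-ext λ j → trans (Vec.lookup∘tabulate _ j) (trans (eqL-lookup c (Vec.map (λ j → toℕ (lookup e j)) (Vec.tabulate (σ π))) h (inv j)) (trans (letter≡ e (inv j)) (trans (cong (λ z → toℕ (lookup e z)) (σ-inv j)) (sym (Vec.lookup-map j toℕ e))))))) (eqL-refl (toList c′)))
          (λ h → subst (λ l → eqL (trace w a) l ≡ true) (cong toList (lookup-ext λ i → trans (sym (c′≡ i)) (trans (eqL-lookup c′ (shifted 0 e) h (σ π i)) (trans (Vec.lookup-map (σ π i) toℕ e) (sym (letter≡ e i)))))) (eqL-refl (trace w a)))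

        total≡ : ∑ (subsets V k) (λ e → 𝟙 (eqL (trace w a) (word e (Vec.tabulate (σ π))))) ≡ 𝟙 (isInc V 0 c′)
        total≡ = trans (∑-cong (subsets V k) (λ e → cong 𝟙 (same e))) (trans (∑-subsets V k 0 (λ v → 𝟙 (eqL (toList c′) (toList v)))) (inc-eq V 0 c′))

        up : ∀ i j → lookup c i ℕ.< lookup c j → toℕ (rank (lookup a i)) ℕ.< toℕ (rank (lookup a j))
        up i j h = rank-mono (letter-< (subst₂ ℕ._<_ (c≡ i) (c≡ j) h))

        mono⇒induces : Mono c′ → induces (σ π) rank a ≡ true
        mono⇒induces m = ⇒induces (σ π) rank a λ i j → ≡-iff (λ h → T⇒true (ℕ.<⇒<ᵇ (lt i j (ℕ.<ᵇ⇒< _ _ (true⇒T h))))) (λ h → T⇒true (ℕ.<⇒<ᵇ (gt i j (ℕ.<ᵇ⇒< _ _ (true⇒T h)))))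
          where
          lt : ∀ i j → toℕ (σ π i) ℕ.< toℕ (σ π j) → toℕ (rank (lookup a i)) ℕ.< toℕ (rank (lookup a j))
          lt i j h = up i j (subst₂ ℕ._<_ (c′≡ i) (c′≡ j) (m _ _ h))
          gt : ∀ i j → toℕ (rank (lookup a i)) ℕ.< toℕ (rank (lookup a j)) → toℕ (σ π i) ℕ.< toℕ (σ π j)
          gt i j h with ℕ.<-cmp (toℕ (σ π i)) (toℕ (σ π j))
          ... | tri< l _ _ = l
          ... | tri≈ _ e _ = ⊥-elim (ℕ.<-irrefl (cong (λ z → toℕ (rank (lookup a z))) (inj (Fin.toℕ-injective e))) h)
          ... | tri> _ _ l = ⊥-elim (ℕ.<-asym h (lt j i l))

        induces⇒mono : (∀ i j → i ≢ j → lookup c i ≢ lookup c j) → induces (σ π) rank a ≡ true → Mono c′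
        induces⇒mono distinct h p q l = subst₂ ℕ._<_ (sym (Vec.lookup∘tabulate _ p)) (sym (Vec.lookup∘tabulate _ q)) (case (ℕ.<-cmp (lookup c i) (lookup c j)))
          where
          i j : Fin k
          i = inv p
          j = inv q
          σ< : toℕ (σ π i) ℕ.< toℕ (σ π j)
          σ< = subst₂ (λ x y → toℕ x ℕ.< toℕ y) (sym (σ-inv p)) (sym (σ-inv q)) l
          r< : toℕ (rank (lookup a i)) ℕ.< toℕ (rank (lookup a j))
          r< = ℕ.<ᵇ⇒< _ _ (true⇒T (trans (sym (induces⇒ (σ π) rank a h i j)) (T⇒true (ℕ.<⇒<ᵇ σ<))))
          case : Tri (lookup c i ℕ.< lookup c j) (lookup c i ≡ lookup c j) (lookup c j ℕ.< lookup c i) → lookup c i ℕ.< lookup c j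
          case (tri< x _ _) = x
          case (tri≈ _ e _) = ⊥-elim (distinct i j (λ r → ℕ.<-irrefl (cong (λ z → toℕ (σ π z)) r) σ<) e)
          case (tri> _ _ x) = ⊥-elim (ℕ.<-asym r< (up j i x))

        -- If the letters are distinct, the positions a induce π exactly when the letters, read in
        -- the order of π, increase, and then they spell word e π for a single e.
        close : ∣ 𝟙 (induces (σ π) rank a) - ∑ (subsets V k) (λ e → 𝟙 (eqL (trace w a) (word e (Vec.tabulate (σ π))))) ∣ ≤ tie (trace w a)
        close = subst (λ z → ∣ 𝟙 (induces (σ π) rank a) - z ∣ ≤ tie (trace w a)) (sym total≡) (go (isInc V 0 c′) refl)
          where
          out : ∀ b → ∣ 𝟙 b - 0ℚ ∣ ≤ 1ℚ
          out b = subst (_≤ 1ℚ) (sym (trans (cong ∣_∣ (lem (𝟙 b))) (∣∣-nn (0≤𝟙 b)))) (𝟙≤1 b)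
            where
            opaque
              unfolding arith
              lem : ∀ x → x - 0ℚ ≡ x
              lem = solve-∀ R
          go : ∀ b → isInc V 0 c′ ≡ b → ∣ 𝟙 (induces (σ π) rank a) - 𝟙 b ∣ ≤ tie (trace w a)
          go true e = subst (_≤ tie (trace w a)) (sym (trans (cong (λ z → ∣ 𝟙 z - 1ℚ ∣) (mono⇒induces (proj₂ (isInc⇒ V 0 c′ e)))) (cong ∣_∣ (+-inverseʳ 1ℚ)))) (∣0∣≤ (0≤tie (trace w a)))
          go false e with tie-dec c
          ... | inj₂ h = ≤-trans (out (induces (σ π) rank a)) h
          ... | inj₁ distinct = sub (induces (σ π) rank a) refl
            where
            sub : ∀ b → induces (σ π) rank a ≡ b → ∣ 𝟙 b - 0ℚ ∣ ≤ tie (trace w a)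
            sub false _ = subst (λ z → ∣ z ∣ ≤ tie (trace w a)) (sym (+-inverseʳ 0ℚ)) (∣0∣≤ (0≤tie (trace w a)))
            sub true h = contradiction (trans (sym e) (⇒isInc V 0 c′ (λ _ → z≤n) c<V (induces⇒mono distinct h))) λ ()

    -- `close` is summed over all tuples of positions. After exchanging the two sums, `subs-eq`
    -- recognises the inner sum over positions as a subsequence count.
    occurrences : ∣ ι (count π wordPerm) - ∑ (subsets V k) (λ e → cntS (toList w) (word e (Vec.tabulate (σ π)))) ∣ ≤ subs (toList w) k tie
    occurrences = subst₂ (λ x y → ∣ x ∣ ≤ y) eq (∑-trace w k tie) (≤-trans (∑-∣∣ (subsets n k) D) (∑-mono (subsets n k) close))
      where
      A B D : Vec (Fin n) k → ℚ
      A a = 𝟙 (induces (σ π) rank a)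
      B a = ∑ (subsets V k) (λ e → 𝟙 (eqL (trace w a) (word e (Vec.tabulate (σ π)))))
      D a = A a - B a
      opaque
        unfolding arith
        neg : ∀ x → - x ≡ - 1ℚ * x
        neg = solve-∀ R
      ΣB : ∑ (subsets n k) B ≡ ∑ (subsets V k) (λ e → cntS (toList w) (word e (Vec.tabulate (σ π))))
      ΣB = trans (∑-swap (subsets n k) (subsets V k) (λ a e → 𝟙 (eqL (trace w a) (word e (Vec.tabulate (σ π)))))) (∑-cong (subsets V k) (λ e →
        trans (∑-trace w k (λ l → 𝟙 (eqL l (word e (Vec.tabulate (σ π)))))) (trans (cong (λ m → subs (toList w) m (λ l → 𝟙 (eqL l (word e (Vec.tabulate (σ π)))))) (sym (length-toList (Vec.map (λ i → toℕ (lookup e i)) (Vec.tabulate (σ π)))))) (subs-eq (toList w) (word e (Vec.tabulate (σ π)))))))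
      eq : ∑ (subsets n k) D ≡ ι (count π wordPerm) - ∑ (subsets V k) (λ e → cntS (toList w) (word e (Vec.tabulate (σ π))))
      eq = trans (trans (∑-+ (subsets n k) A (λ a → - B a)) (cong (∑ (subsets n k) A +_) (trans (∑-cong (subsets n k) (λ a → neg (B a))) (trans (∑-*ˡ (subsets n k) (- 1ℚ) B) (sym (neg _))))))
        (cong₂ _-_ (sym (ι-filter (induces (σ π) rank) (subsets n k))) ΣB)

-- Realising a path by a finite word.

module Realisations where
  open import Data.Nat as ℕ using (ℕ; zero; suc; z≤n; s≤s; _≡ᵇ_; _<ᵇ_)
  import Data.Nat.Properties as ℕ
  open import Data.Bool using (Bool; true; false; _∧_)
  open import Data.Fin as Fin using (Fin; zero; suc; toℕ)
  import Data.Fin.Properties as Fin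
  open import Data.List as List using (List; []; _∷_; _++_; length; map; replicate)
  import Data.List.Properties as List
  open import Data.List.Relation.Unary.All as All using (All; []; _∷_)
  import Data.List.Relation.Unary.All.Properties as All
  open import Data.Vec as Vec using (Vec; []; _∷_; lookup; fromList)
  import Data.Vec.Properties as Vec
  open import Data.Product using (∃; _×_; _,_)
  open import Relation.Binary.PropositionalEquality hiding (_≗_)
  open import Tactic.RingSolver using (solve-∀)
  open import Defs
  open Rationals
  open Series
  open Gadgets
  open Functionals using (fraction; rec-unique; ι-reflect; length-subsets; ch≤)
  open IncreasingSums
  open ColumnCounts using (true⇒T; T⇒true)
  open ColumnAverages using (word)
  open Nonvanishing using (length-toList)
  open Words
  open WordPermutations
  open Counting using (≡-iff; module Occurrences)

  -- A weight that is multiplicative in the letters is unaffected by cutting the word. This yields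
  -- `eJ-+` from `eS-+` and the restriction to finitely many columns.
  ⋆-prod : ∀ φ F G → (λ c → prod φ c * F c) ⋆ (λ c → prod φ c * G c) ≗ λ c → prod φ c * (F ⋆ G) c
  ⋆-prod φ F G [] = lem (F []) (G [])
    where
    opaque
      unfolding arith
      lem : ∀ a b → 1ℚ * a * (1ℚ * b) ≡ 1ℚ * (a * b)
      lem = solve-∀ R
  ⋆-prod φ F G (x ∷ c) = trans (cong (1ℚ * F [] * (φ x * prod φ c * G (x ∷ c)) +_)
     (trans (⋆-congʳ (λ l → *-assoc (φ x) (prod φ l) (F (x ∷ l))) c) (trans (⋆-scaleˡ (φ x) (λ l → prod φ l * F (x ∷ l)) (λ l → prod φ l * G l) c) (cong (φ x *_) (⋆-prod φ (λ l → F (x ∷ l)) G c)))))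
     (lem (F []) (φ x) (prod φ c) (G (x ∷ c)) _)
    where
    opaque
      unfolding arith
      lem : ∀ f s q g u → 1ℚ * f * (s * q * g) + s * (q * u) ≡ s * q * (f * g + u)
      lem = solve-∀ R

  𝟙-all : ∀ J c → 𝟙 (all J c) ≡ prod (λ x → 𝟙 (J x)) c
  𝟙-all J [] = refl
  𝟙-all J (x ∷ c) = trans (𝟙-∧ (J x) (all J c)) (cong (𝟙 (J x) *_) (𝟙-all J c))

  eJ-prod : ∀ J a → eJ J a ≗ λ c → prod (λ x → 𝟙 (J x)) c * eS a c
  eJ-prod J a c = cong (_* p (length c) a) (𝟙-all J c)

  eJ-+ : ∀ J a b → eJ J a ⋆ eJ J b ≗ eJ J (a + b)
  eJ-+ J a b c = trans (⋆-cong (eJ-prod J a) (eJ-prod J b) c) (trans (⋆-prod (λ x → 𝟙 (J x)) (eS a) (eS b) c) (trans (cong (prod (λ x → 𝟙 (J x)) c *_) (eS-+ a b c)) (sym (eJ-prod J (a + b) c))))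

  eJ-0 : ∀ J → eJ J 0ℚ ≗ one
  eJ-0 J [] = *-identityˡ 1ℚ
  eJ-0 J (x ∷ c) = trans (cong (𝟙 (J x ∧ all J c) *_) (trans (cong (p (length c) 0ℚ *_) (*-zeroˡ _)) (*-zeroʳ _))) (*-zeroʳ _)

  restrict : ℕ → Path → Path
  restrict V = map (λ { (a , J) → a , within V J })

  inside : ℕ → List ℕ → ℚ
  inside V = prod (λ x → 𝟙 (x <ᵇ V))

  coef-restrict : ∀ V P → coef (restrict V P) ≗ λ c → inside V c * coef P c
  coef-restrict V [] [] = sym (*-identityˡ 1ℚ)
  coef-restrict V [] (x ∷ c) = sym (*-zeroʳ _)
  coef-restrict V ((a , J) ∷ P) c = trans (⋆-cong (λ l → trans (cong (_* p (length l) a) (split l)) (*-assoc _ _ _)) (coef-restrict V P) c) (⋆-prod (λ x → 𝟙 (x <ᵇ V)) (eJ J a) (coef P) c)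
    where
    opaque
      unfolding arith
      lem : ∀ a b c d → a * b * (c * d) ≡ b * c * (a * d)
      lem = solve-∀ R
    split : ∀ l → 𝟙 (all (within V J) l) ≡ inside V l * 𝟙 (all J l)
    split [] = sym (*-identityˡ 1ℚ)
    split (x ∷ l) = trans (𝟙-∧ (within V J x) (all (within V J) l)) (trans (cong₂ _*_ (𝟙-∧ (J x) (x <ᵇ V)) (split l)) (trans (lem (𝟙 (J x)) (𝟙 (x <ᵇ V)) (inside V l) (𝟙 (all J l))) (cong (𝟙 (x <ᵇ V) * inside V l *_) (sym (𝟙-∧ (J x) (all J l))))))

  -- Stretches of integral length, to be realised by repeating a row.
  Blocks : Set
  Blocks = List (ℕ × (ℕ → Bool))

  integral : Blocks → Path
  integral = map (λ { (a , J) → ι a , J })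

  times : ℕ → Blocks → Blocks
  times S = map (λ { (a , J) → a ℕ.* S , J })

  rows : Blocks → List (ℕ → Bool)
  rows [] = []
  rows ((a , J) ∷ Q) = replicate a J ++ rows Q

  coef-rows : ∀ V Q → coef (unitPath V (rows Q)) ≗ coef (restrict V (integral Q))
  coef-rows V [] c = refl
  coef-rows V ((a , J) ∷ Q) c = trans (go a c) (⋆-congˡ (coef-rows V Q) c)
    where
    X : Ser
    X = coef (unitPath V (rows Q))
    go : ∀ a → coef (unitPath V (replicate a J ++ rows Q)) ≗ eJ (within V J) (ι a) ⋆ X
    go zero c = sym (trans (⋆-congʳ (eJ-0 (within V J)) c) (⋆-oneˡ X c))
    go (suc a) c = trans (⋆-congˡ (go a) c) (trans (sym (⋆-assoc (eJ (within V J) 1ℚ) (eJ (within V J) (ι a)) X c)) (⋆-congʳ (eJ-+ (within V J) 1ℚ (ι a)) c))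

  length-rows : ∀ S Q → length (rows (times S Q)) ≡ length (rows Q) ℕ.* S
  length-rows S [] = refl
  length-rows S ((a , J) ∷ Q) = trans (List.length-++ (replicate (a ℕ.* S) J)) (trans (cong₂ ℕ._+_ (List.length-replicate (a ℕ.* S)) (length-rows S Q)) (trans (sym (ℕ.*-distribʳ-+ S a (length (rows Q)))) (cong (ℕ._* S) (trans (cong (ℕ._+ length (rows Q)) (sym (List.length-replicate a))) (sym (List.length-++ (replicate a J)))))))

  rescale : ∀ {x y} S Q → y ≡ x * ι S → scale y (integral Q) ≡ scale x (integral (times S Q))
  rescale S [] e = refl
  rescale {x} {y} S ((a , J) ∷ Q) e = cong₂ (λ s t → (s , J) ∷ t) (trans (cong (_* ι a) e) (trans (lem x (ι S) (ι a)) (cong (x *_) (sym (ι-* a S))))) (rescale {x} S Q e)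
    where
    opaque
      unfolding arith
      lem : ∀ x S a → x * S * a ≡ x * (a * S)
      lem = solve-∀ R

  scale-scale : ∀ x y P → scale x (scale y P) ≡ scale (x * y) P
  scale-scale x y [] = refl
  scale-scale x y ((a , J) ∷ P) = cong₂ (λ s t → (s , J) ∷ t) (sym (*-assoc x y a)) (scale-scale x y P)

  scale-1 : ∀ P → scale 1ℚ P ≡ P
  scale-1 [] = refl
  scale-1 ((a , J) ∷ P) = cong₂ (λ s t → (s , J) ∷ t) (*-identityˡ a) (scale-1 P)

  -- The lengths are finitely many nonnegative rationals, so they have a common denominator, here
  -- `suc b`.
  blocks : ∀ {P} → All≥0 P → ∃ λ b → ∃ λ Q → P ≡ scale (rec b) (integral Q)
  blocks [] = 0 , [] , refl
  blocks {(a , J) ∷ P} (h ∷ hs) = join (fraction a h) (blocks hs)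
    where
    opaque
      unfolding arith
      l₁ : ∀ a r x y → a * (r * (x * y)) ≡ r * (a * x * y)
      l₁ = solve-∀ R
    join : (∃ λ b → ∃ λ n → a * ι (suc b) ≡ ι n) → (∃ λ b → ∃ λ Q → P ≡ scale (rec b) (integral Q)) → ∃ λ b → ∃ λ Q → (a , J) ∷ P ≡ scale (rec b) (integral Q)
    join (b₁ , n , e) (b₂ , Q , e′) = b , (n ℕ.* suc b₂ , J) ∷ times (suc b₁) Q , cong₂ (λ s t → (s , J) ∷ t) e₁ (trans e′ (rescale (suc b₁) Q e₂))
      where
      b : ℕ
      b = b₂ ℕ.+ b₁ ℕ.* suc b₂
      full : rec b * (ι (suc b₁) * ι (suc b₂)) ≡ 1ℚ
      full = trans (cong (rec b *_) (sym (ι-* (suc b₁) (suc b₂)))) (rec-ι b)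
      e₁ : a ≡ rec b * ι (n ℕ.* suc b₂)
      e₁ = trans (sym (*-identityʳ a)) (trans (cong (a *_) (sym full)) (trans (l₁ a (rec b) (ι (suc b₁)) (ι (suc b₂))) (cong (rec b *_) (trans (cong (_* ι (suc b₂)) e) (sym (ι-* n (suc b₂)))))))
      e₂ : rec b₂ ≡ rec b * ι (suc b₁)
      e₂ = sym (rec-unique b₂ (trans (*-assoc (rec b) _ _) full))

  cntS-one : ∀ w x → cntS w (x ∷ []) ≡ mult x w
  cntS-one [] x = refl
  cntS-one (y ∷ w) x = cong₂ _+_ (trans (cong₂ (λ s t → 𝟙 s * t) (≡ᵇ-sym y x) (cntS-[] w)) (*-identityʳ _)) (cntS-one w x)
    where
    ≡ᵇ-sym : ∀ x y → (x ≡ᵇ y) ≡ (y ≡ᵇ x)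
    ≡ᵇ-sym x y = ≡-iff (λ e → trans (cong (_≡ᵇ x) (sym (ℕ.≡ᵇ⇒≡ x y (true⇒T e)))) (≡ᵇ-refl x)) (λ e → trans (cong (_≡ᵇ y) (sym (ℕ.≡ᵇ⇒≡ y x (true⇒T e)))) (≡ᵇ-refl y))

  mult-++ : ∀ x w w′ → mult x (w ++ w′) ≡ mult x w + mult x w′
  mult-++ x [] w′ = sym (+-identityˡ _)
  mult-++ x (y ∷ w) w′ = trans (cong (𝟙 (x ≡ᵇ y) +_) (mult-++ x w w′)) (sym (+-assoc _ _ _))

  mult-rows : ∀ V Js x → mult x (rowsWord V Js) ≡ mass (unitPath V Js) x
  mult-rows V [] x = refl
  mult-rows V (J ∷ Js) x = trans (mult-++ x (sel 0 V J) (rowsWord V Js)) (cong₂ _+_ (trans (sym (cntS-one (sel 0 V J) x)) (trans (sel-one′ V J x) (sym (*-identityʳ _)))) (mult-rows V Js x))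

  sel-bounded : ∀ k n J → All (ℕ._< k ℕ.+ n) (sel k n J)
  sel-bounded k zero J = []
  sel-bounded k (suc n) J with J k
  ... | true = ℕ.m<m+n k (s≤s z≤n) ∷ subst (λ z → All (ℕ._< z) (sel (suc k) n J)) (sym (ℕ.+-suc k n)) (sel-bounded (suc k) n J)
  ... | false = subst (λ z → All (ℕ._< z) (sel (suc k) n J)) (sym (ℕ.+-suc k n)) (sel-bounded (suc k) n J)

  rows-bounded : ∀ V Js → All (ℕ._< V) (rowsWord V Js)
  rows-bounded V [] = []
  rows-bounded V (J ∷ Js) = All.++⁺ (sel-bounded 0 V J) (rows-bounded V Js)

  lookup-bounded : ∀ {V} {w : List ℕ} → All (ℕ._< V) w → ∀ i → lookup (fromList w) i ℕ.< V
  lookup-bounded (h ∷ hs) zero = h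
  lookup-bounded (h ∷ hs) (suc i) = lookup-bounded hs i

  sumTo-zero : ∀ V → sumTo V (λ _ → 0ℚ) ≡ 0ℚ
  sumTo-zero zero = refl
  sumTo-zero (suc V) = trans (cong (0ℚ +_) (sumTo-zero V)) (+-identityˡ 0ℚ)

  length-mult : ∀ V {w} → All (ℕ._< V) w → ι (length w) ≡ sumTo V (λ x → mult x w)
  length-mult V [] = sym (sumTo-zero V)
  length-mult V {y ∷ w} (h ∷ hs) = trans (cong₂ _+_ (sym (single V y h)) (length-mult V hs)) (sym (sumTo-+ V (λ x → 𝟙 (x ≡ᵇ y)) (λ x → mult x w)))
    where
    single : ∀ V y → y ℕ.< V → sumTo V (λ x → 𝟙 (x ≡ᵇ y)) ≡ 1ℚ
    single (suc V) zero h = trans (cong (1ℚ +_) (sumTo-zero V)) (+-identityʳ 1ℚ)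
    single (suc V) (suc y) (s≤s h) = trans (cong (0ℚ +_) (single V y h)) (+-identityˡ 1ℚ)

  sumTo-const : ∀ V {f : ℕ → ℚ} c → (∀ x → x ℕ.< V → f x ≡ c) → sumTo V f ≡ ι V * c
  sumTo-const zero c h = sym (*-zeroˡ c)
  sumTo-const (suc V) c h = trans (cong₂ _+_ (h 0 (s≤s z≤n)) (sumTo-const V c (λ x l → h (suc x) (s≤s l)))) (lem c (ι V))
    where
    opaque
      unfolding arith
      lem : ∀ c n → c + n * c ≡ (1ℚ + n) * c
      lem = solve-∀ R

  inside-word : ∀ {V k n} (e : Vec (Fin V) k) (π : Vec (Fin k) n) → inside V (word e π) ≡ 1ℚ
  inside-word e [] = refl
  inside-word {V} e (i ∷ π) = trans (cong₂ _*_ (cong 𝟙 (T⇒true (ℕ.<⇒<ᵇ (Fin.toℕ<n (lookup e i))))) (inside-word e π)) (*-identityˡ 1ℚ)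

  pow-mul : ∀ a b k → pow (a * b) k ≡ pow a k * pow b k
  pow-mul a b zero = sym (*-identityˡ 1ℚ)
  pow-mul a b (suc k) = trans (cong (a * b *_) (pow-mul a b k)) (lem a b (pow a k) (pow b k))
    where
    opaque
      unfolding arith
      lem : ∀ a b x y → a * b * (x * y) ≡ a * x * (b * y)
      lem = solve-∀ R

  pow-inverse : ∀ {a b} k → a * b ≡ 1ℚ → pow a k * pow b k ≡ 1ℚ
  pow-inverse {a} {b} k e = trans (sym (pow-mul a b k)) (trans (cong (λ z → pow z k) e) (one^ k))
    where
    one^ : ∀ k → pow 1ℚ k ≡ 1ℚ
    one^ zero = refl
    one^ (suc k) = trans (*-identityˡ _) (one^ k)

  pow-mono : ∀ {a b} k → 0ℚ ≤ a → a ≤ b → pow a k ≤ pow b k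
  pow-mono zero h l = ≤-refl
  pow-mono (suc k) h l = *-mono h (0≤pow k (≤-trans h l)) l (pow-mono k h l)

  ∑-minus : ∀ {A : Set} (xs : List A) (f g : A → ℚ) → ∑ xs (λ x → f x - g x) ≡ ∑ xs f - ∑ xs g
  ∑-minus [] f g = sym (+-inverseʳ 0ℚ)
  ∑-minus (x ∷ xs) f g = trans (cong (f x - g x +_) (∑-minus xs f g)) (lem (f x) (g x) _ _)
    where
    opaque
      unfolding arith
      lem : ∀ a b c d → a - b + (c - d) ≡ a + c - (b + d)
      lem = solve-∀ R

  -- Each integral block is repeated `suc S` times, so every column occurs `suc N` times, where
  -- `suc N` is `suc S * suc b`. The numbers `v`, `ν` and `m` are the reciprocals of the number of
  -- columns, of this multiplicity and of the length of the word.
  module Realise (top : ℕ) (P : Path) (unit : ∀ c → mass P c ≡ 1ℚ) (b : ℕ) (Q : Blocks) (P≡ : P ≡ scale (rec b) (integral Q)) (S : ℕ) where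
    V N : ℕ
    V = suc top
    N = b ℕ.+ S ℕ.* suc b

    v ν m : ℚ
    v = rec top
    ν = rec N
    m = v * ν

    private
      Js : List (ℕ → Bool)
      Js = rows (times (suc S) Q)
      w : List ℕ
      w = rowsWord V Js
      n₁ Λ : ℚ
      n₁ = ι (suc N)
      Λ = ι (length (rows Q))

      bounded : All (ℕ._< V) w
      bounded = rows-bounded V Js

      integral≡ : integral (times (suc S) Q) ≡ scale n₁ P
      integral≡ = sym (trans (cong (scale n₁) P≡) (trans (scale-scale n₁ (rec b) (integral Q)) (trans (rescale {1ℚ} (suc S) Q e) (scale-1 _))))
        where
        opaque
          unfolding arith
          lem : ∀ s b r → s * b * r ≡ 1ℚ * (s * (r * b))
          lem = solve-∀ R
        e : n₁ * rec b ≡ 1ℚ * ι (suc S)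
        e = trans (cong (_* rec b) (ι-* (suc S) (suc b))) (trans (lem (ι (suc S)) (ι (suc b)) (rec b)) (cong (1ℚ *_) (trans (cong (ι (suc S) *_) (rec-ι b)) (*-identityʳ _))))

      coef-w : ∀ c → coef (unitPath V Js) c ≡ inside V c * (pow n₁ (length c) * coef P c)
      coef-w c = trans (coef-rows V (times (suc S) Q) c) (trans (coef-restrict V (integral (times (suc S) Q)) c) (cong (inside V c *_) (trans (cong (λ z → coef z c) integral≡) (coef-scale n₁ P c))))

      mult-w : ∀ x → mult x w ≡ 𝟙 (x <ᵇ V) * n₁
      mult-w x = trans (mult-rows V Js x) (trans (sym (coef-mass (unitPath V Js) x)) (trans (coef-w (x ∷ [])) (trans (cong (λ z → 𝟙 (x <ᵇ V) * 1ℚ * (n₁ * 1ℚ * z)) (trans (coef-mass P x) (unit x))) (lem (𝟙 (x <ᵇ V)) n₁))))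
        where
        opaque
          unfolding arith
          lem : ∀ i n → i * 1ℚ * (n * 1ℚ * 1ℚ) ≡ i * n
          lem = solve-∀ R

      mult≤ : ∀ x → mult x w ≤ n₁
      mult≤ x = ≤-trans (≤-reflexive (mult-w x)) (≤-trans (*-monoʳ n₁ (0≤ι (suc N)) (𝟙≤1 (x <ᵇ V))) (≤-reflexive (*-identityˡ n₁)))

      length-w : ι (length w) ≡ ι V * n₁
      length-w = trans (length-mult V bounded) (sumTo-const V n₁ (λ x l → trans (mult-w x) (trans (cong (λ z → 𝟙 z * n₁) (T⇒true (ℕ.<⇒<ᵇ l))) (*-identityˡ n₁))))

      νn : ν * n₁ ≡ 1ℚ
      νn = rec-ι N

    open WordPerm (fromList w) using (wordPerm) public

    n : ℕ
    n = order wordPerm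

    m-n : m * ι n ≡ 1ℚ
    m-n = trans (cong (m *_) length-w) (trans (lem v ν (ι V) n₁) (trans (cong₂ _*_ (rec-ι top) νn) (*-identityˡ 1ℚ)))
      where
      opaque
        unfolding arith
        lem : ∀ a b c d → a * b * (c * d) ≡ a * c * (b * d)
        lem = solve-∀ R

    top<n : top ℕ.< n
    top<n = ι-reflect (subst (ι top <_) (sym length-w) (<-≤-trans (lin< 0<1 (+-comm 1ℚ (ι top))) (≤-trans (≤-reflexive (sym (*-identityʳ (ι V)))) (*-monoˡ (ι V) (0≤ι V) (≤+ (ι N) (0≤ι N))))))

    0≤m : 0ℚ ≤ m
    0≤m = 0≤rec top ⊛ 0≤rec N

    -- Depends on the integral blocks but not on `S`, so the error `C k * ν` disappears as `S`
    -- grows.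
    C : ℕ → ℚ
    C k = Λ * pow (Λ + 1ℚ) k

    private
      tie-small : ∀ k → pow m k * subs w k tie ≤ ι k * v
      tie-small zero = ≤-reflexive (trans (*-zeroʳ _) (sym (*-zeroˡ v)))
      tie-small (suc j) = ≤-trans (*-monoˡ (m * pow m j) (0≤m ⊛ 0≤pow j 0≤m) (subs-tie w j n₁ (0≤ι (suc N)) mult≤))
        (≤-trans (≤-reflexive (trans (lem v ν (pow m j) (ι j) n₁ (pow (ι (length w)) j)) (trans (cong₂ (λ s t → ι j * v * (s * t)) νn (pow-inverse j m-n)) (trans (cong (ι j * v *_) (*-identityˡ 1ℚ)) (*-identityʳ _)))))
          (*-monoʳ v (0≤rec top) (≤+ˡ 1ℚ 0≤1)))
        where
        opaque
          unfolding arith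
          lem : ∀ v ν q j n u → v * ν * q * (j * n * u) ≡ j * v * (ν * n * (q * u))
          lem = solve-∀ R

      R≤ : ι (length Js) ≤ Λ * n₁
      R≤ = ≤-trans (≤-reflexive (trans (cong ι (length-rows (suc S) Q)) (ι-* (length (rows Q)) (suc S)))) (*-monoˡ Λ (0≤ι (length (rows Q))) (ι-mono (s≤s (ℕ.≤-trans (ℕ.≤-reflexive (sym (ℕ.*-identityʳ S))) (ℕ.≤-trans (ℕ.*-monoʳ-≤ S (s≤s (z≤n {b}))) (ℕ.m≤n+m _ b))))))

      words-small : ∀ c → pow ν (length c) * ∣ cntS w c - inside V c * (pow n₁ (length c) * coef P c) ∣ ≤ C (length c) * ν
      words-small c = ≤-trans (*-monoˡ (pow ν k) (0≤pow k (0≤rec N)) (≤-trans (subst (λ z → ∣ cntS w c - z ∣ ≤ ι (length Js) * (ν * ν) * prod (λ _ → ι (length Js) + n₁) c) (coef-w c) (Telescope.telescope V N Js c)) step))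
        (≤-reflexive (trans (lem (pow ν k) Λ n₁ ν (pow (Λ + 1ℚ) k) (pow n₁ k)) (trans (cong₂ (λ s t → Λ * pow (Λ + 1ℚ) k * ν * (s * t)) νn (pow-inverse k νn)) (trans (cong (Λ * pow (Λ + 1ℚ) k * ν *_) (*-identityˡ 1ℚ)) (*-identityʳ _)))))
        where
        k : ℕ
        k = length c
        0≤Λ : 0ℚ ≤ Λ
        0≤Λ = 0≤ι (length (rows Q))
        0≤n₁ : 0ℚ ≤ n₁
        0≤n₁ = 0≤ι (suc N)
        opaque
          unfolding arith
          lem : ∀ q L n ν x y → q * (L * n * (ν * ν) * (x * y)) ≡ L * x * ν * (ν * n * (q * y))
          lem = solve-∀ R
          lem′ : ∀ L n → L * n + n ≡ (L + 1ℚ) * n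
          lem′ = solve-∀ R
        step : ι (length Js) * (ν * ν) * prod (λ _ → ι (length Js) + n₁) c ≤ Λ * n₁ * (ν * ν) * (pow (Λ + 1ℚ) k * pow n₁ k)
        step = *-mono (0≤ι (length Js) ⊛ (0≤rec N ⊛ 0≤rec N)) (0≤pow k (0≤Λ ⊹ 0≤1) ⊛ 0≤pow k 0≤n₁) (*-monoʳ (ν * ν) (0≤rec N ⊛ 0≤rec N) R≤)
          (≤-trans (≤-reflexive (prod-const _ c)) (≤-trans (pow-mono k (0≤ι (length Js) ⊹ 0≤n₁) (≤-trans (+-mono-≤ R≤ ≤-refl) (≤-reflexive (lem′ Λ n₁)))) (≤-reflexive (pow-mul (Λ + 1ℚ) n₁ k))))

    module _ (π : Perm) where
      private
        k : ℕ
        k = order π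
        πv : Vec (Fin k) k
        πv = Vec.tabulate (σ π)
        Es : List (Vec (Fin V) k)
        Es = subsets V k
        X Z : Vec (Fin V) k → ℚ
        X e = cntS w (word e πv)
        Z e = coef P (word e πv)
        len : ∀ e → length (word {V} e πv) ≡ k
        len e = length-toList (Vec.map (λ i → toℕ (lookup e i)) πv)

        one-word : ∀ e → ∣ pow ν k * X e - Z e ∣ ≤ C k * ν
        one-word e = subst (λ j → ∣ pow ν j * X e - Z e ∣ ≤ C j * ν) (len e) (≤-trans (≤-reflexive eq) (words-small c))
          where
          c : List ℕ
          c = word {V} e πv
          q : ℚ
          q = pow ν (length c)
          opaque
            unfolding arith
            lem : ∀ q x n z → q * x - q * (1ℚ * (n * z)) ≡ q * x - q * n * z
            lem = solve-∀ R
            dist : ∀ q x y → q * (x - y) ≡ q * x - q * y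
            dist = solve-∀ R
          eq : ∣ q * X e - Z e ∣ ≡ q * ∣ cntS w c - inside V c * (pow n₁ (length c) * coef P c) ∣
          eq = trans (cong ∣_∣ (trans (cong (λ z → q * X e - z) (trans (sym (*-identityˡ (Z e))) (cong (_* Z e) (sym (pow-inverse (length c) νn))))) (trans (sym (lem q (X e) (pow n₁ (length c)) (Z e))) (trans (cong (λ z → q * X e - q * (z * (pow n₁ (length c) * Z e))) (sym (inside-word e πv))) (sym (dist q (X e) _))))))
            (trans (∣x*y∣ q _) (cong (_* ∣ cntS w c - inside V c * (pow n₁ (length c) * coef P c) ∣) (∣∣-nn (0≤pow (length c) (0≤rec N)))))

      -- The term `ι k * v` pays for ties, when inducing a pattern is replaced by spelling it;
      -- `C k * ν` pays for replacing rows by exponentials.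
      realised : ∣ pow m k * ι (count π wordPerm) - pow v k * ∑ Es Z ∣ ≤ ι k * v + C k * ν
      realised = subst (λ z → ∣ z ∣ ≤ ι k * v + C k * ν) eq (∣+∣≤ part₁ part₂)
        where
        cnt : ℚ
        cnt = ι (count π wordPerm)
        opaque
          unfolding arith
          lem : ∀ a b c x z → a * b * (c - x) + a * (b * x - z) ≡ a * b * c - a * z
          lem = solve-∀ R
        eq : pow m k * (cnt - ∑ Es X) + pow v k * (pow ν k * ∑ Es X - ∑ Es Z) ≡ pow m k * cnt - pow v k * ∑ Es Z
        eq = trans (cong (λ z → z * (cnt - ∑ Es X) + pow v k * (pow ν k * ∑ Es X - ∑ Es Z)) (pow-mul v ν k)) (trans (lem (pow v k) (pow ν k) cnt (∑ Es X) (∑ Es Z)) (cong (λ z → z * cnt - pow v k * ∑ Es Z) (sym (pow-mul v ν k))))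
        occ : ∣ cnt - ∑ Es X ∣ ≤ subs w k tie
        occ = subst (λ l → ∣ cnt - ∑ Es (λ e → cntS l (word {V} e πv)) ∣ ≤ subs l k tie) (Vec.toList∘fromList w) (Occurrences.occurrences (fromList w) (lookup-bounded bounded) π)
        part₁ : ∣ pow m k * (cnt - ∑ Es X) ∣ ≤ ι k * v
        part₁ = ≤-trans (∣*∣≤ (≤-reflexive (∣∣-nn (0≤pow k 0≤m))) occ) (tie-small k)
        part₂ : ∣ pow v k * (pow ν k * ∑ Es X - ∑ Es Z) ∣ ≤ C k * ν
        part₂ = ≤-trans (∣*∣≤ (≤-reflexive (∣∣-nn (0≤pow k (0≤rec top)))) (subst (λ z → ∣ z ∣ ≤ ι (length Es) * (C k * ν)) (trans (∑-minus Es (λ e → pow ν k * X e) Z) (cong (_- ∑ Es Z) (∑-*ˡ Es (pow ν k) X))) (∑-bound Es (C k * ν) one-word)))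
          (≤-trans (≤-reflexive (trans (cong (λ z → pow v k * (z * (C k * ν))) (length-subsets V k)) (sym (*-assoc _ _ _)))) (≤-trans (*-monoʳ (C k * ν) (0≤Cν) (ch≤ V v k (0≤rec top) (rec-ι top))) (≤-reflexive (*-identityˡ _))))
          where
          0≤Cν : 0ℚ ≤ C k * ν
          0≤Cν = 0≤ι (length (rows Q)) ⊛ 0≤pow k (0≤ι (length (rows Q)) ⊹ 0≤1) ⊛ 0≤rec N

-- From counts to densities.

module Densities where
  open import Data.Nat as ℕ using (ℕ; zero; suc; z≤n; s≤s; _≡ᵇ_; _!)
  import Data.Nat.Properties as ℕ
  open import Data.Nat.Combinatorics using (_C_; nCk+nC[k+1]≡[n+1]C[k+1]; k>n⇒nCk≡0)
  import Data.Integer as ℤ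
  import Data.Rational as D
  open import Data.Bool using (Bool; true; false; _∧_; if_then_else_)
  open import Data.Fin using (Fin; zero; suc; toℕ)
  open import Data.List using ([]; _∷_; _++_; length)
  open import Data.Vec as Vec using (Vec; []; _∷_; toList; lookup)
  import Data.Vec.Properties as Vec
  open import Data.Product using (_×_; _,_; proj₁; proj₂)
  open import Data.Empty using (⊥-elim)
  open import Relation.Nullary using (contradiction; yes; no)
  open import Relation.Binary.PropositionalEquality hiding (_≗_)
  open import Tactic.RingSolver using (solve-∀)
  open import Defs
  open Rationals
  open Series
  open Gadgets
  open Functionals using (length-subsets)
  open IncreasingSums
  open ColumnCounts using (T⇒true)
  open ColumnAverages using (word)
  open Words using (≡ᵇ-refl; ≡ᵇ-≢)
  open WordPermutations using (ι-filter)
  open Counting using (isInc; isInc⇒)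
  open Realisations

  *-cancel-≤ : ∀ {a b c} → 0ℚ < c → a * c ≤ b * c → a ≤ b
  *-cancel-≤ {a} {b} {c} h l = subst₂ _≤_ (back a) (back b) (*-monoʳ d (<⇒≤ 0<d) l)
    where
    d : ℚ
    d = proj₁ (inverse⁺ c h)
    0<d : 0ℚ < d
    0<d = proj₁ (proj₂ (inverse⁺ c h))
    back : ∀ x → x * c * d ≡ x
    back x = trans (*-assoc x c d) (trans (cong (x *_) (trans (*-comm c d) (proj₂ (proj₂ (inverse⁺ c h))))) (*-identityʳ x))

  C≡ch : ∀ n k → ι (n C k) ≡ ch n k
  C≡ch n zero = trans (cong ι (nC0 n)) (+-identityʳ 1ℚ)
    where
    nC0 : ∀ n → n C 0 ≡ 1
    nC0 zero = refl
    nC0 (suc n) = refl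
  C≡ch zero (suc k) = cong ι (k>n⇒nCk≡0 {0} {suc k} (s≤s z≤n))
  C≡ch (suc n) (suc k) = trans (cong ι (sym (nCk+nC[k+1]≡[n+1]C[k+1] n k))) (trans (ι-+ (n C k) (n C suc k)) (cong₂ _+_ (C≡ch n k) (C≡ch n (suc k))))

  count≤ : ∀ π Π → ι (count π Π) ≤ ch (order Π) (order π)
  count≤ π Π = ≤-trans (≤-reflexive (ι-filter (induces (σ π) (σ Π)) (subsets (order Π) (order π)))) (≤-trans (∑-mono (subsets (order Π) (order π)) (λ a → 𝟙≤1 (induces (σ π) (σ Π) a))) (≤-reflexive (trans (∑-const (subsets (order Π) (order π)) 1ℚ) (trans (*-identityʳ _) (length-subsets (order Π) (order π))))))

  -- Clears the case distinction in `density`: where the binomial coefficient is 0, the count is 0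
  -- as well.
  density-count : ∀ π Π → density π Π * ch (order Π) (order π) ≡ ι (count π Π)
  density-count π Π = trans (cong (density π Π *_) (sym (C≡ch (order Π) (order π)))) go
    where
    go : density π Π * ι (order Π C order π) ≡ ι (count π Π)
    go with order Π C order π in e
    ... | suc m = /-ι (count π Π) m
    ... | zero = trans (*-zeroʳ 0ℚ) (≤-antisym (0≤ι (count π Π)) (≤-trans (count≤ π Π) (≤-reflexive (trans (sym (C≡ch (order Π) (order π))) (cong ι e)))))

  density-bounds : ∀ π Π → 0ℚ ≤ density π Π × density π Π ≤ 1ℚ
  density-bounds π Π = go
    where
    bound : ι (count π Π) ≤ ι (order Π C order π)
    bound = subst (ι (count π Π) ≤_) (sym (C≡ch (order Π) (order π))) (count≤ π Π)
    go : 0ℚ ≤ density π Π × density π Π ≤ 1ℚ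
    go with order Π C order π | bound
    ... | zero | _ = ≤-refl , 0≤1
    ... | suc m | b = *-cancel-≤ (0<ι m) (subst₂ _≤_ (sym (*-zeroˡ _)) (sym (/-ι (count π Π) m)) (0≤ι (count π Π)))
                    , *-cancel-≤ (0<ι m) (subst₂ _≤_ (sym (/-ι (count π Π) m)) (sym (*-identityˡ _)) b)

  p-! : ∀ k → p k 1ℚ * ι (k !) ≡ 1ℚ
  p-! zero = trans (*-identityˡ _) (+-identityʳ 1ℚ)
  p-! (suc k) = trans (cong (p (suc k) 1ℚ *_) (ι-* (suc k) (k !))) (trans (lem (p k 1ℚ) (rec k) (ι (suc k)) (ι (k !))) (trans (cong₂ _*_ (p-! k) (rec-ι k)) (*-identityˡ 1ℚ)))
    where
    opaque
      unfolding arith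
      lem : ∀ q r k f → q * (1ℚ * r) * (k * f) ≡ q * f * (r * k)
      lem = solve-∀ R

  inv!≡p : ∀ k → inv! k ≡ p k 1ℚ
  inv!≡p k = go (p-! k)
    where
    opaque
      unfolding arith
      lem : ∀ q f x → x * (q * f) ≡ q * (x * f)
      lem = solve-∀ R
    go : p k 1ℚ * ι (k !) ≡ 1ℚ → inv! k ≡ p k 1ℚ
    go e with k !
    ... | zero = ⊥-elim (1≢0 (trans (sym e) (*-zeroʳ _)))
    ... | suc r = trans (sym (*-identityʳ (ℤ.+ 1 D./ suc r))) (trans (cong ((ℤ.+ 1 D./ suc r) *_) (sym e)) (trans (lem (p k 1ℚ) (ι (suc r)) (ℤ.+ 1 D./ suc r)) (trans (cong (p k 1ℚ *_) (trans (/-ι 1 r) (+-identityʳ 1ℚ))) (*-identityʳ _))))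

  idPerm : ℕ → Perm
  idPerm K = perm K (λ i → i) ((λ e → e) , λ y → y , λ e → e)

  inc-mono : ∀ V k o {g h : Vec ℕ k → ℚ} → (∀ v → isInc V o v ≡ true → g v ≤ h v) → inc V k o g ≤ inc V k o h
  inc-mono V zero o l = l [] refl
  inc-mono zero (suc k) o l = ≤-refl
  inc-mono (suc V) (suc k) o l = +-mono-≤
    (inc-mono V k (suc o) (λ v e → l (o ∷ v) (trans (cong (λ z → if z then isInc V (suc o) v else isInc V (suc o) (o ∷ v)) (≡ᵇ-refl o)) e)))
    (inc-mono V (suc k) (suc o) (λ { (x ∷ v) e → l (x ∷ v) (trans (cong (λ z → if z then isInc V (suc o) v else isInc V (suc o) (x ∷ v)) (≡ᵇ-≢ {o} {x} (λ r → ℕ.<-irrefl r (proj₁ (isInc⇒ V (suc o) (x ∷ v) e) zero)))) e) }))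

  -- One summand takes each letter from its own step with coefficient 1, and all the other summands
  -- are nonnegative.
  stairs-inc : ∀ {n} m k (c : Vec ℕ n) → isInc (suc m) k c ≡ true → 1ℚ ≤ coef (stairs k m) (toList c)
  stairs-inc m k [] e = ≤-reflexive (sym (coef-[] (stairs k m)))
  stairs-inc zero k (x ∷ c) e with k ℕ.≟ x
  ... | no n = contradiction (trans (cong (λ z → if z then isInc 0 (suc k) c else false) (sym (≡ᵇ-≢ {k} {x} n))) e) λ ()
  stairs-inc zero k (x ∷ []) e | yes refl = ≤-reflexive (sym (trans (coef-mass (stairs k 0) k) (trans (stairs-mass k 0 k) (cong 𝟙 (T⇒true (ℕ.≤⇒≤ᵇ (ℕ.≤-refl {k})))))))
  stairs-inc zero k (x ∷ y ∷ c) e | yes refl = contradiction (trans (cong (λ z → if z then false else false) (sym (≡ᵇ-refl k))) e) λ ()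
  stairs-inc (suc m) k (x ∷ c) e with k ℕ.≟ x
  ... | no n = ≤-trans (stairs-inc m (suc k) (x ∷ c) (trans (cong (λ z → if z then isInc (suc m) (suc k) c else isInc (suc m) (suc k) (x ∷ c)) (sym (≡ᵇ-≢ {k} {x} n))) e))
     (lin (0≤⋆ (λ l → 0≤eJ (k ≡ᵇ_) 0≤1 (x ∷ l)) (0≤coef (stairs≥0 (suc k) m)) (toList c)) (cong (_+ rest) (*-one (coef (stairs (suc k) m) (x ∷ toList c)))))
    where
    rest : ℚ
    rest = ((λ l → eJ (λ c → k ≡ᵇ c) 1ℚ (x ∷ l)) ⋆ coef (stairs (suc k) m)) (toList c)
    *-one : ∀ a → 1ℚ * 1ℚ * a ≡ a
    *-one a = trans (*-assoc 1ℚ 1ℚ a) (trans (*-identityˡ _) (*-identityˡ a))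
  ... | yes refl = ≤-trans (stairs-inc m (suc k) c (trans (cong (λ z → if z then isInc (suc m) (suc k) c else isInc (suc m) (suc k) (k ∷ c)) (sym (≡ᵇ-refl k))) e))
     (≤-trans (first-step (toList c)) (≤+ˡ _ (0≤1 ⊛ 0≤1 ⊛ 0≤coef (stairs≥0 (suc k) m) (k ∷ toList c))))
    where
    at : ℕ → Bool
    at c = k ≡ᵇ c
    one-letter : eJ at 1ℚ (k ∷ []) ≡ 1ℚ
    one-letter = trans (cong₂ (λ s t → 𝟙 (s ∧ true) * t) (≡ᵇ-refl k) (p-one 1ℚ)) (*-identityˡ 1ℚ)
    first-step : ∀ l → coef (stairs (suc k) m) l ≤ ((λ l → eJ at 1ℚ (k ∷ l)) ⋆ coef (stairs (suc k) m)) l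
    first-step [] = ≤-reflexive (sym (trans (cong (_* coef (stairs (suc k) m) []) one-letter) (*-identityˡ _)))
    first-step (y ∷ l) = lin (0≤⋆ (λ l′ → 0≤eJ at 0≤1 (k ∷ y ∷ l′)) (0≤coef (stairs≥0 (suc k) m)) l) (cong (_+ ((λ l′ → eJ at 1ℚ (k ∷ y ∷ l′)) ⋆ coef (stairs (suc k) m)) l) (trans (cong (_* coef (stairs (suc k) m) (y ∷ l)) one-letter) (*-identityˡ _)))

  -- The cut that leaves the empty word to `P` already contributes the coefficient of `Q`.
  tail≤ : ∀ {P Q} → All≥0 P → All≥0 Q → ∀ c → coef Q c ≤ coef (P ++ Q) c
  tail≤ {P} {Q} hP hQ c = ≤-trans (go c) (≤-reflexive (sym (coef-++ P Q c)))
    where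
    go : ∀ c → coef Q c ≤ (coef P ⋆ coef Q) c
    go [] = ≤-reflexive (sym (trans (cong (_* coef Q []) (coef-[] P)) (*-identityˡ _)))
    go (x ∷ c) = lin (0≤⋆ (λ l → 0≤coef hP (x ∷ l)) (0≤coef hQ) c) (cong (_+ ((λ l → coef P (x ∷ l)) ⋆ coef Q) c) (trans (cong (_* coef Q (x ∷ c)) (coef-[] P)) (*-identityˡ _)))

  -- Only the final stretch is kept, and there every increasing tuple has coefficient at least
  -- `d ^ K`. Comparing with the number of all tuples makes the bound uniform in the number of
  -- columns.
  stairs-identity : ∀ top {P d} → All≥0 P → 0ℚ ≤ d → All≥0 (scale d (stairs 0 top)) → ∀ K →
    pow d K * ch (suc top) K ≤ ∑ (subsets (suc top) K) (λ e → coef (P ++ scale d (stairs 0 top)) (word e (Vec.tabulate {n = K} (λ i → i))))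
  stairs-identity top {P} {d} hP 0≤d hd K = ≤-trans (≤-reflexive (trans (cong (pow d K *_) (sym (inc-one (suc top) K 0))) (trans (sym (inc-* (suc top) K 0 (pow d K) (λ _ → 1ℚ))) refl)))
    (≤-trans (inc-mono (suc top) K 0 {λ _ → pow d K * 1ℚ} {λ v → coef (P ++ scale d (stairs 0 top)) (toList v)} below)
    (≤-reflexive (trans (sym (∑-subsets (suc top) K 0 (λ v → coef (P ++ scale d (stairs 0 top)) (toList v)))) (∑-cong (subsets (suc top) K) (λ e → cong (coef (P ++ scale d (stairs 0 top))) (sym (word-id e)))))))
    where
    len : ∀ {n} (c : Vec ℕ n) → length (toList c) ≡ n
    len [] = refl
    len (x ∷ c) = cong suc (len c)
    word-id : ∀ (e : Vec (Fin (suc top)) K) → word e (Vec.tabulate {n = K} (λ i → i)) ≡ toList (shifted 0 e)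
    word-id e = cong toList (trans (sym (Vec.tabulate-∘ (λ i → toℕ (lookup e i)) (λ i → i))) (trans (Vec.tabulate-∘ toℕ (lookup e)) (cong (Vec.map toℕ) (Vec.tabulate∘lookup e))))
    below : ∀ v → isInc (suc top) 0 v ≡ true → pow d K * 1ℚ ≤ coef (P ++ scale d (stairs 0 top)) (toList v)
    below v e = ≤-trans (*-monoˡ (pow d K) (0≤pow K 0≤d) (stairs-inc top 0 v e)) (≤-trans (≤-reflexive (sym (trans (coef-scale d (stairs 0 top) (toList v)) (cong (λ z → pow d z * coef (stairs 0 top) (toList v)) (len v))))) (tail≤ hP hd (toList v)))

  module Estimates (top : ℕ) (P : Path) (unit : ∀ c → mass P c ≡ 1ℚ) (b : ℕ) (Q : Blocks) (P≡ : P ≡ scale (rec b) (integral Q)) (S : ℕ) (π : Perm) where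
    open Realise top P unit b Q P≡ S
    private
      k : ℕ
      k = order π
      q r x ρ : ℚ
      q = p k 1ℚ
      r = pow m k * ch n k
      x = density π wordPerm
      ρ = pow v k * ∑ (subsets V k) (λ e → coef P (word e (Vec.tabulate (σ π))))

      0≤q : 0ℚ ≤ q
      0≤q = 0≤p k 0≤1
      q≤1 : q ≤ 1ℚ
      q≤1 = p≤1 k 0≤1 ≤-refl

      m≤v : m ≤ v
      m≤v = subst (m ≤_) (*-identityʳ v) (*-monoˡ v (0≤rec top) (rec≤1 N))

      near : ∀ u t n → 0ℚ ≤ u → u ≤ t → t ≤ 1ℚ → u * ι n ≡ 1ℚ → ∣ pow u k * ch n k - q ∣ ≤ ι k * t
      near u t n h l t1 e = Approx.ch≈p u h t l t1 n k (≤-reflexive e′) 0≤1 ≤-refl (subst (λ z → ∣ z ∣ ≤ t) (sym (trans (cong (_- 1ℚ) e′) (+-inverseʳ 1ℚ))) (∣0∣≤ (≤-trans h l)))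
        where
        e′ : ι n * u ≡ 1ℚ
        e′ = trans (*-comm (ι n) u) e

      r≈q : ∣ r - q ∣ ≤ ι k * v
      r≈q = near m v n 0≤m m≤v (rec≤1 top) m-n

      ch≈q : ∣ pow v k * ch V k - q ∣ ≤ ι k * v
      ch≈q = near v v V (0≤rec top) ≤-refl (rec≤1 top) (rec-ι top)

      x-r : x * r ≡ pow m k * ι (count π wordPerm)
      x-r = trans (lem x (pow m k) (ch n k)) (cong (pow m k *_) (density-count π wordPerm))
        where
        opaque
          unfolding arith
          lem : ∀ x a b → x * (a * b) ≡ a * (x * b)
          lem = solve-∀ R

      ∣x∣≤1 : ∣ x ∣ ≤ 1ℚ
      ∣x∣≤1 = ≤-trans (≤-reflexive (∣∣-nn (proj₁ (density-bounds π wordPerm)))) (proj₂ (density-bounds π wordPerm))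

      xq≈ρ : ∣ x * q - ρ ∣ ≤ 1ℚ * (ι k * v) + (ι k * v + C k * ν)
      xq≈ρ = subst (λ z → ∣ z ∣ ≤ 1ℚ * (ι k * v) + (ι k * v + C k * ν)) (lem x q r ρ) (∣+∣≤ (∣*∣≤ ∣x∣≤1 (≤-trans (≤-reflexive (∣∣-sym q r)) r≈q)) (subst (λ z → ∣ z - ρ ∣ ≤ ι k * v + C k * ν) (sym x-r) (realised π)))
        where
        opaque
          unfolding arith
          lem : ∀ x q r ρ → x * (q - r) + (x * r - ρ) ≡ x * q - ρ
          lem = solve-∀ R

    -- The factor `q` stays on the left because the scaled count is the density times
    -- `m ^ k * ch n k`, which is itself only close to `q`.
    density≈ : ∀ {ε} → ∣ pow v k * ∑ (subsets V k) (λ e → coef P (word e (Vec.tabulate (σ π))) - q) ∣ ≤ ε →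
      ∣ density π wordPerm - q ∣ * q ≤ ι 3 * (ι k * v) + C k * ν + ε
    density≈ {ε} h = ≤-trans (≤-reflexive (trans (cong (∣ x - q ∣ *_) (sym (∣∣-nn 0≤q))) (sym (∣x*y∣ (x - q) q)))) (subst₂ (λ z t → ∣ z ∣ ≤ t) (lem x q ρ (pow v k * ch V k)) (lem₂ (ι k * v) (C k * ν) ε) (∣+∣≤ (∣+∣≤ xq≈ρ (subst (λ z → ∣ z ∣ ≤ ε) e h)) (∣*∣≤ (≤-trans (≤-reflexive (∣∣-nn 0≤q)) q≤1) ch≈q)))
      where
      opaque
        unfolding arith
        lem : ∀ x q ρ c → (x * q - ρ) + (ρ - q * c) + q * (c - q) ≡ (x - q) * q
        lem = solve-∀ R
        lem₂ : ∀ a b e → 1ℚ * a + (a + b) + e + 1ℚ * a ≡ (1ℚ + (1ℚ + (1ℚ + 0ℚ))) * a + b + e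
        lem₂ = solve-∀ R
        lem₃ : ∀ a s l q → a * (s - l * q) ≡ a * s - q * (a * l)
        lem₃ = solve-∀ R
      e : pow v k * ∑ (subsets V k) (λ e → coef P (word e (Vec.tabulate (σ π))) - q) ≡ ρ - q * (pow v k * ch V k)
      e = trans (cong (pow v k *_) (trans (∑-minus (subsets V k) (λ e → coef P (word e (Vec.tabulate (σ π)))) (λ _ → q)) (cong (λ z → ∑ (subsets V k) (λ e → coef P (word e (Vec.tabulate (σ π)))) - z) (trans (∑-const (subsets V k) q) (cong (_* q) (length-subsets V k)))))) (lem₃ (pow v k) _ (ch V k) q)

    density≥ : ∀ {d} → 0ℚ ≤ d → d ≤ 1ℚ → d * ch V k ≤ ∑ (subsets V k) (λ e → coef P (word e (Vec.tabulate (σ π)))) → d * q ≤ density π wordPerm * q + (ι 3 * (ι k * v) + C k * ν)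
    density≥ {d} 0≤d d≤1 h = lin (gap (proj₂ (∣∣-elim xq≈ρ)) ⊹ (gap ρ≥ ⊹ (0≤d ⊛ gap (proj₂ (∣∣-elim ch≈q)) ⊹ gap d≤1 ⊛ (0≤ι k ⊛ 0≤rec top)))) (lem d q x ρ (pow v k * ch V k) (ι k * v) (C k * ν))
      where
      opaque
        unfolding arith
        lem : ∀ d q x ρ c a b → x * q + ((1ℚ + (1ℚ + (1ℚ + 0ℚ))) * a + b) ≡ d * q + ((1ℚ * a + (a + b) - - (x * q - ρ)) + ((ρ - d * c) + (d * (a - - (c - q)) + (1ℚ - d) * a)))
        lem = solve-∀ R
        lem₂ : ∀ a d c → d * (a * c) ≡ a * (d * c)
        lem₂ = solve-∀ R
      ρ≥ : d * (pow v k * ch V k) ≤ ρ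
      ρ≥ = ≤-trans (≤-reflexive (lem₂ (pow v k) d (ch V k))) (*-monoˡ (pow v k) (0≤pow k (0≤rec top)) h)

-- Permutations with three nearly random densities and many identities.

module Approximants where
  open import Data.Nat as ℕ using (ℕ; zero; suc; z≤n; s≤s)
  import Data.Nat.Properties as ℕ
  open import Data.Fin as Fin using (Fin; zero; suc; toℕ)
  import Data.Fin.Properties as Fin
  open import Data.List using (List; []; _∷_; _++_; length)
  open import Data.Vec as Vec using (Vec; []; _∷_; toList)
  import Data.Vec.Properties as Vec
  import Data.Rational as D
  import Data.Rational.Properties as D
  open import Data.Vec.Relation.Unary.All as VA using ([]; _∷_)
  import Data.Vec.Relation.Unary.All.Properties as VA
  open import Data.Vec.Relation.Unary.AllPairs as VP using ([]; _∷_)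
  import Data.Vec.Relation.Unary.AllPairs.Properties as VP
  open import Data.Product using (∃; _×_; _,_; proj₁; proj₂)
  open import Function.Definitions using (Bijective)
  open import Relation.Binary.PropositionalEquality hiding (_≗_)
  open import Tactic.RingSolver using (solve-∀)
  open import Defs
  open Rationals
  open Series
  open Gadgets
  open Expansions
  open TestPaths
  open Moments using (T)
  open Nonvanishing using (Good; Ascending₂)
  open FixedPoints using (i₀; i₁; i₂; rec-mono; det)
  open Functionals using (small*; Location)
  open Solutions
  open ColumnAverages using (word)
  open Locations
  open Realisations
  open Densities

  -- The patterns covered by the matrix argument: order at least two, and not 21.
  record Pattern : Set where
    constructor pattern-of
    field
      n : ℕ
      f : Fin (suc (suc n)) → Fin (suc (suc n))
      bijective : Bijective _≡_ _≡_ f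

    shape : Vec (Fin (suc (suc n))) (suc (suc n))
    shape = Vec.tabulate f

    letters : Vec ℕ (suc (suc n))
    letters = Vec.map toℕ shape

    field
      asc : Ascending₂ letters

    toPerm : Perm
    toPerm = perm (suc (suc n)) f bijective

    unique : VP.AllPairs _≢_ shape
    unique = VP.tabulate⁺ λ i≢j e → i≢j (proj₁ bijective e)

    good : Good letters
    good = record
      { bounded = VA.map⁺ (VA.tabulate⁺ (λ i → Fin.toℕ<n (f i)))
      ; unique = VP.map⁺ (VP.tabulate⁺ λ i≢j e → i≢j (proj₁ bijective (Fin.toℕ-injective e)))
      ; asc = asc }

    code : List ℕ
    code = toList letters

    len : ℕ
    len = suc (suc n)

  private
    split≥0 : ∀ P {Q} → All≥0 (P ++ Q) → All≥0 P × All≥0 Q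
    split≥0 [] h = [] , h
    split≥0 (_ ∷ P) (h ∷ hs) = h ∷ proj₁ (split≥0 P hs) , proj₂ (split≥0 P hs)

  -- `d` comes before `K` and `ε`, so that `d ^ K` can be compared with `1 / K!` for a suitable `K`.
  Approximable : (Fin 3 → Pattern) → Set
  Approximable q = ∃ λ d → 0ℚ < d × (∀ K {ε} → 0ℚ < ε → ∃ λ Π → 2 ℕ.≤ order Π ×
    (∀ i → ∣ density (Pattern.toPerm (q i)) Π - p (Pattern.len (q i)) 1ℚ ∣ ≤ ε) × pow d K * p K 1ℚ ≤ density (idPerm K) Π * p K 1ℚ + ε)

  module _ (q : Fin 3 → Pattern) where
    private
      ks : Fin 3 → ℕ
      ks i = Pattern.len (q i)
      πs : ∀ i → Vec (Fin (ks i)) (ks i)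
      πs i = Pattern.shape (q i)
      uniq : ∀ i → VP.AllPairs _≢_ (πs i)
      uniq i = Pattern.unique (q i)

      module Choose (loc : Location) (t : ℕ) (2≤t : 2 ℕ.≤ t) (δ₀ : ℚ) (0<δ₀ : 0ℚ < δ₀) (δ₀≤⅛ : δ₀ ≤ ⅛) (K : ℕ) {ε : ℚ} (0<ε : 0ℚ < ε) where
        pm μ quarter : ℚ
        -- A lower bound for all three target densities, which pays for the factor `q` in
        -- `density≈`. Three quarters of `μ` go to the fineness of the columns, to the rows and to
        -- the equations.
        pm = p (ks i₀) 1ℚ * (p (ks i₁) 1ℚ * p (ks i₂) 1ℚ)
        μ = ε * pm
        quarter = ½ * ½ * μ

        0<pm : 0ℚ < pm
        0<pm = 0<* (0<p (ks i₀) 0<1) (0<* (0<p (ks i₁) 0<1) (0<p (ks i₂) 0<1))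
        0<μ : 0ℚ < μ
        0<μ = 0<* 0<ε 0<pm
        opaque
          unfolding arith
          ¾ : ∀ m → m ≡ ½ * ½ * m + ½ * ½ * m + ½ * ½ * m + ½ * ½ * m
          ¾ = solve-∀ R
        0<½ : 0ℚ < ½
        0<½ = D.positive⁻¹ ½
        0<quarter : 0ℚ < quarter
        0<quarter = 0<* (0<* 0<½ 0<½) 0<μ
        3q≤μ : quarter + quarter + quarter ≤ μ
        3q≤μ = lin (<⇒≤ 0<quarter) (¾ μ)

        pm≤ : ∀ i → pm ≤ p (ks i) 1ℚ
        pm≤ zero = ≤-trans (*-monoˡ _ (0≤p (ks i₀) 0≤1) (*≤1 (0≤p (ks i₁) 0≤1) (p≤1 (ks i₁) 0≤1 ≤-refl) (p≤1 (ks i₂) 0≤1 ≤-refl))) (≤-reflexive (*-identityʳ _))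
        pm≤ (suc zero) = ≤-trans (*-monoʳ _ (0≤p (ks i₁) 0≤1 ⊛ 0≤p (ks i₂) 0≤1) (p≤1 (ks i₀) 0≤1 ≤-refl)) (≤-trans (≤-reflexive (*-identityˡ _)) (≤-trans (*-monoˡ _ (0≤p (ks i₁) 0≤1) (p≤1 (ks i₂) 0≤1 ≤-refl)) (≤-reflexive (*-identityʳ _))))
        pm≤ (suc (suc zero)) = ≤-trans (*-monoʳ _ (0≤p (ks i₁) 0≤1 ⊛ 0≤p (ks i₂) 0≤1) (p≤1 (ks i₀) 0≤1 ≤-refl)) (≤-trans (≤-reflexive (*-identityˡ _)) (≤-trans (*-monoʳ _ (0≤p (ks i₂) 0≤1) (p≤1 (ks i₁) 0≤1 ≤-refl)) (≤-reflexive (*-identityˡ _))))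

        μ≤ε : μ ≤ ε
        μ≤ε = ≤-trans (*-monoˡ ε (<⇒≤ 0<ε) (≤-trans (pm≤ i₀) (p≤1 (ks i₀) 0≤1 ≤-refl))) (≤-reflexive (*-identityʳ ε))

        Tot : (ℕ → ℚ) → ℚ
        Tot F = F (ks i₀) + F (ks i₁) + F (ks i₂) + F K

        Tot≥0 : ∀ {F} → (∀ k → 0ℚ ≤ F k) → 0ℚ ≤ Tot F
        Tot≥0 h = h (ks i₀) ⊹ h (ks i₁) ⊹ h (ks i₂) ⊹ h K

        Tot≥ : ∀ {F} → (∀ k → 0ℚ ≤ F k) → ∀ i → F (ks i) ≤ Tot F
        Tot≥ h zero = ≤-trans (≤+ _ (h (ks i₁))) (≤-trans (≤+ _ (h (ks i₂))) (≤+ _ (h K)))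
        Tot≥ h (suc zero) = ≤-trans (≤+ˡ _ (h (ks i₀))) (≤-trans (≤+ _ (h (ks i₂))) (≤+ _ (h K)))
        Tot≥ h (suc (suc zero)) = ≤-trans (≤+ˡ _ (h (ks i₀) ⊹ h (ks i₁))) (≤+ _ (h K))

        Tot≥K : ∀ {F} → (∀ k → 0ℚ ≤ F k) → F K ≤ Tot F
        Tot≥K h = ≤+ˡ _ (h (ks i₀) ⊹ h (ks i₁) ⊹ h (ks i₂))

        fine : ℕ → ℚ
        fine k = ι 3 * ι k
        0≤fine : ∀ k → 0ℚ ≤ fine k
        0≤fine k = 0≤ι 3 ⊛ 0≤ι k

        Solves : ℕ → Y → Set
        Solves s y = ∀ i → ∣ mean i (λ c → total (at δ₀) y c - p (ks i) 1ℚ) ∣ ≤ quarter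
          where open Setup loc ks πs uniq t 2≤t s hiding (K)

        module Word (s : ℕ) (hs : Tot fine * rec s ≤ quarter) (y : Y) (box : Box y)
          (close : Solves s y) where
          open Setup loc ks πs uniq t 2≤t s hiding (K)

          P : Path
          P = path (at δ₀) y
          okδ : Ok (at δ₀)
          okδ = record { 0≤δ = <⇒≤ 0<δ₀ ; δ≤⅛ = δ₀≤⅛ }
          P≥0 : All≥0 P
          P≥0 = path≥0 okδ box

          v≤ : v ≤ rec s
          v≤ = rec-mono (ℕ.m≤m+n s (H′ ℕ.* suc s))

          fine-small : ∀ k → fine k ≤ Tot fine → ι 3 * (ι k * v) ≤ quarter
          fine-small k h = ≤-trans (≤-reflexive (sym (*-assoc (ι 3) (ι k) v))) (≤-trans (*-mono (0≤fine k) (0≤rec s) h v≤) hs)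

          -- The path without its final stretch, split off for `stairs-identity`.
          P₀ : Path
          P₀ = (a₂ , every) ∷ gad (suc (suc zero)) (at δ₀) y ++ (a₁ , every) ∷ gad (suc zero) (at δ₀) y ++ (a₀ , every) ∷ gad zero (at δ₀) y ++ (restδ (at δ₀) , every) ∷ []

          P₀≥0 : All≥0 P₀ × All≥0 (scale (δ² (at δ₀)) (stairs 0 top′))
          P₀≥0 = split≥0 P₀ P≥0

          module Rows (b : ℕ) (Q : Blocks) (P≡ : P ≡ scale (rec b) (integral Q)) where
            C : ℕ → ℚ
            C k = ι (length (rows Q)) * pow (ι (length (rows Q)) + 1ℚ) k
            0≤C : ∀ k → 0ℚ ≤ C k
            0≤C k = 0≤ι (length (rows Q)) ⊛ 0≤pow k (0≤ι (length (rows Q)) ⊹ 0≤1)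

            module Size (S : ℕ) (hS : Tot C * rec S ≤ quarter) where
              open Realise top′ P (mass-path (at δ₀) y) b Q P≡ S using (wordPerm; ν; N; top<n)

              large : 2 ℕ.≤ order wordPerm
              large = ℕ.≤-trans (ℕ.≤-trans (ℕ.≤-trans 2≤t (ℕ.≤-trans (ℕ.m≤m+n t _) (ℕ.m≤m*n H′ (suc s)))) (ℕ.m≤n+m (H′ ℕ.* suc s) s)) (ℕ.<⇒≤ top<n)

              C-small : ∀ k → C k ≤ Tot C → C k * ν ≤ quarter
              C-small k h = ≤-trans (*-mono (0≤C k) (0≤rec S) h (rec-mono (ℕ.≤-trans (ℕ.≤-reflexive (sym (ℕ.*-identityʳ S))) (ℕ.≤-trans (ℕ.*-monoʳ-≤ S (s≤s (z≤n {b}))) (ℕ.m≤n+m _ b))))) hS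

              densities : ∀ i → ∣ density (Pattern.toPerm (q i)) wordPerm - p (ks i) 1ℚ ∣ ≤ ε
              densities i = *-cancel-≤ (0<p (ks i) 0<1) (≤-trans
                (Estimates.density≈ top′ P (mass-path (at δ₀) y) b Q P≡ S (Pattern.toPerm (q i)) {quarter}
                  (subst (λ z → ∣ pow v (ks i) * z ∣ ≤ quarter) (∑-cong (subsets V (ks i)) (λ e → cong (_- p (ks i) 1ℚ) (sym (coef-path (at δ₀) y (word e (πs i)))))) (close i)))
                (≤-trans (+-mono-≤ (+-mono-≤ (fine-small (ks i) (Tot≥ {fine} 0≤fine i)) (C-small (ks i) (Tot≥ {C} 0≤C i))) ≤-refl) (≤-trans 3q≤μ (*-monoˡ ε (<⇒≤ 0<ε) (pm≤ i)))))

              identity : pow (δ₀ * δ₀) K * p K 1ℚ ≤ density (idPerm K) wordPerm * p K 1ℚ + ε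
              identity = ≤-trans (Estimates.density≥ top′ P (mass-path (at δ₀) y) b Q P≡ S (idPerm K) (0≤pow K (0≤d)) (proj₂ (pow≤1 0≤d (proj₂ (0≤δ²≤1 okδ)) K))
                  (stairs-identity top′ {P₀} {δ₀ * δ₀} (proj₁ P₀≥0) 0≤d (proj₂ P₀≥0) K))
                (+-monoʳ-≤ (density (idPerm K) wordPerm * p K 1ℚ) (≤-trans (+-mono-≤ (fine-small K (Tot≥K {fine} 0≤fine)) (C-small K (Tot≥K {C} 0≤C))) (≤-trans (≤+ quarter (<⇒≤ 0<quarter)) (≤-trans 3q≤μ μ≤ε))))
                where
                0≤d : 0ℚ ≤ δ₀ * δ₀
                0≤d = <⇒≤ 0<δ₀ ⊛ <⇒≤ 0<δ₀

      Goal : ℚ → ℕ → ℚ → Set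
      Goal d K ε = ∃ λ Π → 2 ℕ.≤ order Π × (∀ i → ∣ density (Pattern.toPerm (q i)) Π - p (Pattern.len (q i)) 1ℚ ∣ ≤ ε) × pow d K * p K 1ℚ ≤ density (idPerm K) Π * p K 1ℚ + ε

      -- The order of choices is forced: `s` first, then `y`, which depends on `s`, then the
      -- denominators of the resulting path, and `S` last, since its error constant depends on
      -- these.
      result⇒ : ∀ loc → Tuned.Result loc ks πs uniq → Approximable q
      result⇒ loc (t , 2≤t , δ₀ , (0<δ₀ , δ₀≤⅛) , solve) = δ₀ * δ₀ , 0<* 0<δ₀ 0<δ₀ , λ K 0<ε → choose K 0<ε (small* _ (Choose.Tot≥0 loc t 2≤t δ₀ 0<δ₀ δ₀≤⅛ K 0<ε {F = Choose.fine loc t 2≤t δ₀ 0<δ₀ δ₀≤⅛ K 0<ε} (Choose.0≤fine loc t 2≤t δ₀ 0<δ₀ δ₀≤⅛ K 0<ε)) (Choose.0<quarter loc t 2≤t δ₀ 0<δ₀ δ₀≤⅛ K 0<ε))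
        where
        module _ (K : ℕ) {ε : ℚ} (0<ε : 0ℚ < ε) where
          open Choose loc t 2≤t δ₀ 0<δ₀ δ₀≤⅛ K 0<ε
          choose : (∃ λ s → Tot fine * rec s ≤ quarter) → Goal (δ₀ * δ₀) K ε
          choose (s , hs) = with-y (solve s 0<quarter)
            where
            with-y : (∃ λ y → Box y × Solves s y) → Goal (δ₀ * δ₀) K ε
            with-y (y , box , close) = with-b (blocks P≥0)
              where
              open Word s hs y box close
              with-b : (∃ λ b → ∃ λ Q → P ≡ scale (rec b) (integral Q)) → Goal (δ₀ * δ₀) K ε
              with-b (b , Q , P≡) = with-S (small* (Tot C) (Tot≥0 {C} 0≤C) 0<quarter)
                where
                open Rows b Q P≡
                with-S : (∃ λ S → Tot C * rec S ≤ quarter) → Goal (δ₀ * δ₀) K ε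
                with-S (S , hS) = _ , Size.large S hS , Size.densities S hS , Size.identity S hS

    approximable : (∀ {i j} → i ≢ j → Pattern.code (q i) ≢ Pattern.code (q j)) → Approximable q
    approximable distinct = go (locate (λ i → Pattern.n (q i)) (λ i → Pattern.letters (q i)) (λ i → Pattern.good (q i)) distinct)
      where
      go : (∃ λ loc → det (λ i g → T (Pattern.letters (q i)) (Location.x loc g) (Location.u loc g) (Location.w loc g)) ≢ 0ℚ) → Approximable q
      go (loc , ne) = result⇒ loc (Tuned.tuned loc ks πs uniq _ (λ _ _ → refl) ne)

-- Reduction from arbitrary sets of at most three permutations.

module Reduction where
  open import Data.Nat as ℕ using (ℕ; zero; suc; z≤n; s≤s; _<ᵇ_; _∸_)
  import Data.Nat.Properties as ℕ
  open import Data.Nat.Combinatorics using (_C_)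
  import Data.Integer as ℤ
  import Data.Rational as D
  import Data.Rational.Properties as D
  open Polynomials using (ι-<)
  open import Data.Bool using (true; false)
  open import Data.Fin as Fin using (Fin; zero; suc; toℕ)
  import Data.Fin.Properties as Fin
  open import Data.List as List using (List; []; _∷_; length; map)
  import Data.List.Properties as List
  open import Data.List.Membership.Propositional using (_∈_; find)
  open import Data.List.Relation.Unary.Any as Any using (Any; here; there)
  open import Data.List.Relation.Unary.All as All using (All; []; _∷_)
  import Data.List.Relation.Unary.All.Properties as All
  open import Data.List.Relation.Unary.AllPairs using (AllPairs; []; _∷_)
  open import Data.Vec as Vec using (Vec; []; _∷_; lookup)
  import Data.Vec.Properties as Vec
  open import Data.Product using (∃; _×_; _,_; proj₁; proj₂)
  open import Data.Sum using (_⊎_; inj₁; inj₂)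
  open import Data.Empty using (⊥; ⊥-elim)
  open import Data.Unit using (tt)
  open import Function.Definitions using (Bijective)
  open import Relation.Nullary using (¬_; yes; no)
  open import Relation.Binary.Definitions using (tri<; tri≈; tri>)
  open import Relation.Binary.PropositionalEquality hiding (_≗_)
  open import Tactic.RingSolver using (solve-∀)
  open import Defs
  open Rationals
  open Series using (𝟙; pow; 0≤pow; p-pow; p-one)
  open Gadgets using (p-two)
  open Functionals using (length-subsets; small*)
  open IncreasingSums using (ch; 0≤ch)
  open ColumnCounts using (true⇒T; T⇒true)
  open FixedPoints using (archimedes; small; half^; rec-mono)
  open Nonvanishing using (Ascending₂; length-toList)
  open WordPermutations using (ι-filter; induces⇒; ⇒induces)
  open Counting using (≡-iff; toList-inj)
  open Realisations using (pow-inverse)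
  open Densities
  open Approximants

  ι-injective : ∀ {m n} → ι m ≡ ι n → m ≡ n
  ι-injective {m} {n} e with ℕ.<-cmp m n
  ... | tri< l _ _ = ⊥-elim (<-irrefl e (ι-< l))
  ... | tri≈ _ r _ = r
  ... | tri> _ _ l = ⊥-elim (<-irrefl (sym e) (ι-< l))

  ∑-cong-All : ∀ {A : Set} {P : A → Set} {f g : A → ℚ} {xs} → All P xs → (∀ x → P x → f x ≡ g x) → ∑ xs f ≡ ∑ xs g
  ∑-cong-All [] e = refl
  ∑-cong-All {xs = x ∷ _} (h ∷ hs) e = cong₂ _+_ (e x h) (∑-cong-All hs e)

  0<ch : ∀ n k → k ℕ.≤ n → 0ℚ < ch n k
  0<ch n zero h = 0<1
  0<ch (suc n) (suc k) (s≤s h) = 0<+ (0<ch n k h) (0≤ch n (suc k))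

  *-cancel-≡ : ∀ {a b c} → 0ℚ < c → a * c ≡ b * c → a ≡ b
  *-cancel-≡ h e = ≤-antisym (*-cancel-≤ h (≤-reflexive e)) (*-cancel-≤ h (≤-reflexive (sym e)))

  <ᵇ-irrefl : ∀ n → (n <ᵇ n) ≡ false
  <ᵇ-irrefl zero = refl
  <ᵇ-irrefl (suc n) = <ᵇ-irrefl n

  <⇒≡true : ∀ {m n} → m ℕ.< n → (m <ᵇ n) ≡ true
  <⇒≡true h = T⇒true (ℕ.<⇒<ᵇ h)

  <⇒≡false : ∀ {m n} → m ℕ.< n → (n <ᵇ m) ≡ false
  <⇒≡false {m} {n} h with n <ᵇ m in e
  ... | false = refl
  ... | true = ⊥-elim (ℕ.<-asym h (ℕ.<ᵇ⇒< n m (true⇒T e)))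

  ∑-subsets-one : ∀ n k → ∑ (subsets n k) (λ _ → 1ℚ) ≡ ch n k
  ∑-subsets-one n k = trans (∑-const (subsets n k) 1ℚ) (trans (*-identityʳ _) (length-subsets n k))

  density-cong : ∀ {k} {f g : Fin k → Fin k} {bf bg} → (∀ i → f i ≡ g i) → ∀ Π → density (perm k f bf) Π ≡ density (perm k g bg) Π
  density-cong {k} {f} {g} {bf} {bg} e Π = go
    where
    one : ∀ a → induces f (σ Π) a ≡ induces g (σ Π) a
    one a = ≡-iff (λ h → ⇒induces g (σ Π) a (λ i j → trans (cong₂ (λ x y → toℕ x <ᵇ toℕ y) (sym (e i)) (sym (e j))) (induces⇒ f (σ Π) a h i j)))
                  (λ h → ⇒induces f (σ Π) a (λ i j → trans (cong₂ (λ x y → toℕ x <ᵇ toℕ y) (e i) (e j)) (induces⇒ g (σ Π) a h i j)))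
    same : count (perm k f bf) Π ≡ count (perm k g bg) Π
    same = ι-injective (trans (ι-filter (induces f (σ Π)) (subsets (order Π) k)) (trans (∑-cong (subsets (order Π) k) (λ a → cong 𝟙 (one a))) (sym (ι-filter (induces g (σ Π)) (subsets (order Π) k)))))
    go : density (perm k f bf) Π ≡ density (perm k g bg) Π
    go with order Π C k
    ... | zero = refl
    ... | suc m = cong (λ c → ℤ.+ c D./ suc m) same

  -- Such a pattern has at most one entry, so every comparison is of an element with itself and
  -- every tuple induces it.
  density-small : ∀ π Π → order π ℕ.≤ order Π → (∀ i j → σ π i ≡ σ π j) → density π Π ≡ 1ℚ
  density-small π Π h e = *-cancel-≡ (0<ch (order Π) (order π) h) (trans (density-count π Π) (trans (ι-filter (induces (σ π) (σ Π)) (subsets (order Π) (order π)))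
    (trans (∑-cong (subsets (order Π) (order π)) (λ a → cong 𝟙 (⇒induces (σ π) (σ Π) a (same a)))) (trans (∑-subsets-one (order Π) (order π)) (sym (*-identityˡ _))))))
    where
    i≡j : ∀ i j → i ≡ j
    i≡j i j = proj₁ (bij π) (e i j)
    same : ∀ a i j → (toℕ (σ π i) <ᵇ toℕ (σ π j)) ≡ (toℕ (σ Π (lookup a i)) <ᵇ toℕ (σ Π (lookup a j)))
    same a i j with i≡j i j
    ... | refl = trans (<ᵇ-irrefl (toℕ (σ π i))) (sym (<ᵇ-irrefl (toℕ (σ Π (lookup a i)))))

  module _ (f : Fin 2 → Fin 2) {n} (Π : Fin n → Fin n) (a : Vec (Fin n) 2) where
    induces-pair : ∀ u v → u ≢ v → toℕ (f u) ℕ.< toℕ (f v) → induces f Π a ≡ (toℕ (Π (lookup a u)) <ᵇ toℕ (Π (lookup a v)))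
    induces-pair u v u≢v l = ≡-iff (λ h → trans (sym (induces⇒ f Π a h u v)) (<⇒≡true l)) (λ h → ⇒induces f Π a (cells h))
      where
      r : Fin 2 → ℕ
      r i = toℕ (Π (lookup a i))
      cases : ∀ (u v i j : Fin 2) → u ≢ v → i ≡ j ⊎ (i ≡ u × j ≡ v) ⊎ (i ≡ v × j ≡ u)
      cases u v zero zero n = inj₁ refl
      cases u v (suc zero) (suc zero) n = inj₁ refl
      cases zero zero i j n = ⊥-elim (n refl)
      cases (suc zero) (suc zero) i j n = ⊥-elim (n refl)
      cases zero (suc zero) zero (suc zero) n = inj₂ (inj₁ (refl , refl))
      cases zero (suc zero) (suc zero) zero n = inj₂ (inj₂ (refl , refl))
      cases (suc zero) zero zero (suc zero) n = inj₂ (inj₂ (refl , refl))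
      cases (suc zero) zero (suc zero) zero n = inj₂ (inj₁ (refl , refl))
      cells : (r u <ᵇ r v) ≡ true → ∀ i j → (toℕ (f i) <ᵇ toℕ (f j)) ≡ (r i <ᵇ r j)
      cells h i j with cases u v i j u≢v
      ... | inj₁ refl = trans (<ᵇ-irrefl (toℕ (f i))) (sym (<ᵇ-irrefl (r i)))
      ... | inj₂ (inj₁ (refl , refl)) = trans (<⇒≡true l) (sym h)
      ... | inj₂ (inj₂ (refl , refl)) = trans (<⇒≡false l) (sym (<⇒≡false (ℕ.<ᵇ⇒< (r u) (r v) (true⇒T h))))

  subsets-distinct : ∀ n → All (λ a → lookup a zero ≢ lookup a (suc zero)) (subsets n 2)
  subsets-distinct zero = []
  subsets-distinct (suc n) = All.++⁺ (All.map⁺ (All.universal (λ { (x ∷ []) () }) (subsets n 1)))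
    (All.map⁺ (All.map (λ { {x ∷ y ∷ []} h e → h (Fin.suc-injective e) }) (subsets-distinct n)))

  -- Each pair of positions induces exactly one of 12 and 21.
  density-swap : ∀ {f g : Fin 2 → Fin 2} {bf bg} → toℕ (f (suc zero)) ℕ.< toℕ (f zero) → toℕ (g zero) ℕ.< toℕ (g (suc zero)) →
    ∀ Π → 2 ℕ.≤ order Π → density (perm 2 f bf) Π + density (perm 2 g bg) Π ≡ 1ℚ
  density-swap {f} {g} {bf} {bg} lf lg Π h = *-cancel-≡ (0<ch n 2 h) (trans (*-distribʳ-+ (ch n 2) _ _) (trans (cong₂ _+_ (trans (density-count (perm 2 f bf) Π) (ι-filter (induces f (σ Π)) (subsets n 2))) (trans (density-count (perm 2 g bg) Π) (ι-filter (induces g (σ Π)) (subsets n 2))))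
    (trans (sym (∑-+ (subsets n 2) (λ a → 𝟙 (induces f (σ Π) a)) (λ a → 𝟙 (induces g (σ Π) a)))) (trans (∑-cong-All (subsets-distinct n) pair) (trans (∑-subsets-one n 2) (sym (*-identityˡ _)))))))
    where
    n : ℕ
    n = order Π
    01≢ : zero {1} ≢ suc zero
    01≢ ()
    10≢ : suc (zero {0}) ≢ zero
    10≢ ()
    either : ∀ {x y} → x ≢ y → 𝟙 (y <ᵇ x) + 𝟙 (x <ᵇ y) ≡ 1ℚ
    either {x} {y} ne with ℕ.<-cmp x y
    ... | tri< l _ _ = trans (cong₂ (λ s t → 𝟙 s + 𝟙 t) (<⇒≡false l) (<⇒≡true l)) (+-identityˡ 1ℚ)
    ... | tri≈ _ e _ = ⊥-elim (ne e)
    ... | tri> _ _ l = trans (cong₂ (λ s t → 𝟙 s + 𝟙 t) (<⇒≡true l) (<⇒≡false l)) (+-identityʳ 1ℚ)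
    pair : ∀ a → lookup a zero ≢ lookup a (suc zero) → 𝟙 (induces f (σ Π) a) + 𝟙 (induces g (σ Π) a) ≡ 1ℚ
    pair a ne = trans (cong₂ (λ s t → 𝟙 s + 𝟙 t) (induces-pair f (σ Π) a (suc zero) zero 10≢ lf) (induces-pair g (σ Π) a zero (suc zero) 01≢ lg)) (either (λ e → ne (proj₁ (bij Π) (Fin.toℕ-injective e))))

  idBij : ∀ {n} → Bijective {A = Fin n} _≡_ _≡_ (λ i → i)
  idBij = (λ e → e) , λ y → y , λ e → e

  idAsc : ∀ n → Ascending₂ (Vec.map toℕ (Vec.tabulate {n = suc (suc n)} (λ i → i)))
  idAsc zero = s≤s z≤n
  idAsc (suc n) = tt

  identity : ℕ → Pattern
  identity n = pattern-of n (λ i → i) idBij (idAsc n)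

  record Near (ε : ℚ) (Π π : Perm) : Set where
    constructor near
    field
      isNear : ∣ density π Π - p (order π) 1ℚ ∣ ≤ ε

  open Near

  -- The tolerance `ε` is the same on both sides, so no constants accumulate in the reduction.
  Covers : List Pattern → Perm → Set
  Covers ps π = ∀ Π {ε} → 0ℚ ≤ ε → 2 ℕ.≤ order Π → (∀ {q} → q ∈ ps → Near ε Π (Pattern.toPerm q)) → Near ε Π π

  Distinct : List Pattern → Set
  Distinct = AllPairs (λ a b → Pattern.code a ≢ Pattern.code b)

  code-length : ∀ q → length (Pattern.code q) ≡ Pattern.len q
  code-length q = length-toList (Pattern.letters q)

  code-near : ∀ {q r ε Π} → Pattern.code q ≡ Pattern.code r → Near ε Π (Pattern.toPerm q) → Near ε Π (Pattern.toPerm r)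
  code-near {q} {r} {ε} {Π} e = go q r e (ℕ.suc-injective (ℕ.suc-injective (trans (sym (code-length q)) (trans (cong length e) (code-length r)))))
    where
    go : ∀ q r → Pattern.code q ≡ Pattern.code r → Pattern.n q ≡ Pattern.n r → Near ε Π (Pattern.toPerm q) → Near ε Π (Pattern.toPerm r)
    go (pattern-of n f bf _) (pattern-of .n g bg _) e refl (near h) = near (subst (λ z → ∣ z - p (suc (suc n)) 1ℚ ∣ ≤ ε) (density-cong {f = f} {g} {bf} {bg} pointwise Π) h)
      where
      letter : ∀ (h : Fin (suc (suc n)) → Fin (suc (suc n))) i → lookup (Vec.map toℕ (Vec.tabulate h)) i ≡ toℕ (h i)
      letter h i = trans (Vec.lookup-map i toℕ (Vec.tabulate h)) (cong toℕ (Vec.lookup∘tabulate h i))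
      pointwise : ∀ i → f i ≡ g i
      pointwise i = Fin.toℕ-injective (trans (sym (letter f i)) (trans (cong (λ v → lookup v i) (toList-inj {a = Vec.map toℕ (Vec.tabulate f)} {Vec.map toℕ (Vec.tabulate g)} e)) (letter g i)))

  -- Orders at most one are settled by density 1; 21 is represented by 12, whose density deviates
  -- from 1/2 by the opposite amount.
  representative : ∀ π → Covers [] π ⊎ ∃ λ q → Covers (q ∷ []) π
  representative π@(perm zero f b) = inj₁ λ Π {ε} 0≤ε h _ → near (subst (λ z → ∣ z ∣ ≤ ε) (sym (trans (cong (_- 1ℚ) (density-small π Π z≤n λ ())) (+-inverseʳ 1ℚ))) (∣0∣≤ 0≤ε))
  representative π@(perm (suc zero) f b) = inj₁ λ Π {ε} 0≤ε h _ → near (subst (λ z → ∣ z ∣ ≤ ε) (sym (trans (cong₂ _-_ (density-small π Π (ℕ.≤-trans (s≤s z≤n) h) (λ { zero zero → refl })) (p-one 1ℚ)) (+-inverseʳ 1ℚ))) (∣0∣≤ 0≤ε))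
  representative (perm (suc (suc (suc n))) f b) = inj₂ (pattern-of (suc n) f b tt , λ Π _ _ h → h (here refl))
  representative (perm (suc (suc zero)) f b) with ℕ.<-cmp (toℕ (f zero)) (toℕ (f (suc zero)))
  ... | tri< l _ _ = inj₂ (pattern-of zero f b l , λ Π _ _ h → h (here refl))
  ... | tri≈ _ e _ = ⊥-elim (01≢ (proj₁ b (Fin.toℕ-injective e)))
    where
    01≢ : zero {1} ≢ suc zero
    01≢ ()
  ... | tri> _ _ l = inj₂ (identity zero , λ Π {ε} _ 2≤ h → near (subst (_≤ ε) (flip Π 2≤) (isNear (h (here refl)))))
    where
    opaque
      unfolding arith
      half : 1ℚ - ½ * (1ℚ * 1ℚ) ≡ ½ * (1ℚ * 1ℚ)
      half = refl
      lem : ∀ x y q → y - q ≡ - (x - (x + y - q))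
      lem = solve-∀ R
    flip : ∀ Π → 2 ℕ.≤ order Π → ∣ density (Pattern.toPerm (identity zero)) Π - p 2 1ℚ ∣ ≡ ∣ density (perm 2 f b) Π - p 2 1ℚ ∣
    flip Π 2≤ = trans (cong ∣_∣ (trans (lem (density (perm 2 f b) Π) _ (p 2 1ℚ)) (cong (λ z → - (density (perm 2 f b) Π - z)) (trans (cong (_- p 2 1ℚ) (density-swap l (s≤s z≤n) Π 2≤)) (trans (cong (λ z → 1ℚ - z) (p-two 1ℚ)) (trans half (sym (p-two 1ℚ)))))))) (∣-x∣ _)

  covers-mono : ∀ {ps ps′ π} → (∀ {q} → q ∈ ps → q ∈ ps′) → Covers ps π → Covers ps′ π
  covers-mono s c Π h 2≤ k = c Π h 2≤ (λ m → k (s m))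

  cover : ∀ (L : List Perm) → ∃ λ ps → Distinct ps × length ps ℕ.≤ length L × (∀ {π} → π ∈ L → Covers ps π)
  cover [] = [] , [] , z≤n , λ ()
  cover (π ∷ L) with cover L
  ... | ps , d , l , c with representative π
  ...   | inj₁ trivial = ps , d , ℕ.m≤n⇒m≤1+n l , λ { (here refl) → covers-mono (λ ()) trivial ; (there m) → c m }
  ...   | inj₂ (q , h) with Any.any? (λ r → List.≡-dec ℕ._≟_ (Pattern.code r) (Pattern.code q)) ps
  ...     | yes found = ps , d , ℕ.m≤n⇒m≤1+n l , λ { (here refl) → covered (find found) ; (there m) → c m }
    where
    covered : (∃ λ r → r ∈ ps × Pattern.code r ≡ Pattern.code q) → Covers ps π
    covered (r , m , e) Π 0≤ε 2≤ k = h Π 0≤ε 2≤ (λ { (here refl) → code-near {r} {q} e (k m) })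
  ...     | no new = (q ∷ ps) , (All.map (λ n e → n (sym e)) (All.¬Any⇒All¬ ps new) ∷ d) , s≤s l , λ { (here refl) → covers-mono (λ { (here refl) → here refl }) h ; (there m) → covers-mono there (c m) }

  bound : List Pattern → ℕ
  bound [] = 0
  bound (q ∷ ps) = Pattern.n q ℕ.+ bound ps

  ≤bound : ∀ ps → All (λ q → Pattern.n q ℕ.≤ bound ps) ps
  ≤bound [] = []
  ≤bound (q ∷ ps) = ℕ.m≤m+n _ _ ∷ All.map (λ h → ℕ.≤-trans h (ℕ.m≤n+m _ (Pattern.n q))) (≤bound ps)

  -- An identity longer than all patterns present is certainly new.
  pad : ∀ j ps → Distinct ps → ∃ λ ps′ → Distinct ps′ × length ps′ ≡ j ℕ.+ length ps × (∀ {q} → q ∈ ps → q ∈ ps′)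
  pad zero ps d = ps , d , refl , λ m → m
  pad (suc j) ps d with pad j ps d
  ... | ps′ , d′ , l , s = identity (suc (bound ps′)) ∷ ps′ , (All.map (λ {q} → fresh q) (≤bound ps′) ∷ d′) , cong suc l , λ m → there (s m)
    where
    fresh : ∀ q → Pattern.n q ℕ.≤ bound ps′ → Pattern.code (identity (suc (bound ps′))) ≢ Pattern.code q
    fresh q h e = ℕ.1+n≰n (ℕ.≤-trans (ℕ.≤-reflexive (ℕ.suc-injective (ℕ.suc-injective (trans (sym (code-length (identity (suc (bound ps′))))) (trans (cong length e) (code-length q)))))) h)

  three-patterns : ∀ (L : List Perm) → length L ℕ.≤ 3 → ∃ λ (q : Fin 3 → Pattern) → (∀ {i j} → i ≢ j → Pattern.code (q i) ≢ Pattern.code (q j)) ×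
    (∀ {π} → π ∈ L → ∀ Π {ε} → 0ℚ ≤ ε → 2 ℕ.≤ order Π → (∀ i → Near ε Π (Pattern.toPerm (q i))) → Near ε Π π)
  three-patterns L l with cover L
  ... | ps , d , l′ , c with pad (3 ∸ length ps) ps d
  ...   | ps′ , d′ , e , s = split ps′ d′ (trans e (ℕ.m∸n+n≡m (ℕ.≤-trans l′ l))) (λ m → covers-mono s (c m))
    where
    split : ∀ ps → Distinct ps → length ps ≡ 3 → (∀ {π} → π ∈ L → Covers ps π) → ∃ λ (q : Fin 3 → Pattern) → (∀ {i j} → i ≢ j → Pattern.code (q i) ≢ Pattern.code (q j)) ×
      (∀ {π} → π ∈ L → ∀ Π {ε} → 0ℚ ≤ ε → 2 ℕ.≤ order Π → (∀ i → Near ε Π (Pattern.toPerm (q i))) → Near ε Π π)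
    split (a ∷ b ∷ c ∷ []) ((ab ∷ ac ∷ []) ∷ (bc ∷ []) ∷ [] ∷ []) refl cov = q , dist , λ m Π 0≤ε 2≤ h → cov m Π 0≤ε 2≤ (λ { (here refl) → h zero ; (there (here refl)) → h (suc zero) ; (there (there (here refl))) → h (suc (suc zero)) })
      where
      q : Fin 3 → Pattern
      q zero = a
      q (suc zero) = b
      q (suc (suc zero)) = c
      dist : ∀ {i j} → i ≢ j → Pattern.code (q i) ≢ Pattern.code (q j)
      dist {zero} {zero} n = ⊥-elim (n refl)
      dist {zero} {suc zero} n = ab
      dist {zero} {suc (suc zero)} n = ac
      dist {suc zero} {zero} n e = ab (sym e)
      dist {suc zero} {suc zero} n = ⊥-elim (n refl)
      dist {suc zero} {suc (suc zero)} n = bc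
      dist {suc (suc zero)} {zero} n e = ac (sym e)
      dist {suc (suc zero)} {suc zero} n e = bc (sym e)
      dist {suc (suc zero)} {suc (suc zero)} n = ⊥-elim (n refl)

  -- With `c = 1 / d`, the step from `n` to `n + 1` multiplies `c ^ n / n!` by `c / (n + 1)`, which
  -- is at most 1/2 from `n = M` on. After `j` such steps the factor `½ ^ j` outweighs the value at
  -- `M`.
  factorial-small : ∀ {d} → 0ℚ < d → ∃ λ K → p K 1ℚ ≤ ½ * pow d K
  factorial-small {d} 0<d = go (inverse⁺ d 0<d)
    where
    go : (∃ λ c → 0ℚ < c × c * d ≡ 1ℚ) → ∃ λ K → p K 1ℚ ≤ ½ * pow d K
    go (c , 0<c , cd) = from-M (archimedes (c + c))
      where
      opaque
        unfolding arith
        lem : ∀ c r n → c * r + (½ * (r * (n - (c + c)))) ≡ ½ * (r * n)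
        lem = solve-∀ R
      from-M : (∃ λ M → c + c ≤ ι M) → ∃ λ K → p K 1ℚ ≤ ½ * pow d K
      from-M (M , hM) = from-j (small* (p M c) (0≤p M (<⇒≤ 0<c)) (D.positive⁻¹ ½))
        where
        step : ∀ n → M ℕ.≤ n → c * rec n ≤ ½
        step n h = lin (0≤½ ⊛ (0≤rec n ⊛ gap (≤-trans hM (ι-mono (ℕ.m≤n⇒m≤1+n h))))) (trans (sym (trans (cong (½ *_) (rec-ι n)) (*-identityʳ ½))) (sym (lem c (rec n) (ι (suc n)))))
        decay : ∀ j → p (j ℕ.+ M) c ≤ p M c * pow ½ j
        decay zero = ≤-reflexive (sym (*-identityʳ _))
        decay (suc j) = ≤-trans (*-mono (0≤p (j ℕ.+ M) (<⇒≤ 0<c)) 0≤½ (decay j) (step (j ℕ.+ M) (ℕ.m≤n+m M j))) (≤-reflexive (trans (*-assoc _ _ _) (cong (p M c *_) (*-comm (pow ½ j) ½))))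
        from-j : (∃ λ j → p M c * rec j ≤ ½) → ∃ λ K → p K 1ℚ ≤ ½ * pow d K
        from-j (j , hj) = K , subst₂ _≤_ (trans (sym (*-assoc _ _ _)) (trans (cong (_* p K 1ℚ) (pow-inverse K (trans (*-comm d c) cd))) (*-identityˡ _))) (*-comm _ ½)
          (*-monoˡ (pow d K) (0≤pow K (<⇒≤ 0<d)) (≤-trans (≤-reflexive (trans (sym (p-pow K c 1ℚ)) (cong (p K) (*-identityʳ c)))) (≤-trans (decay j) (≤-trans (*-monoˡ (p M c) (0≤p M (<⇒≤ 0<c)) (half^ j)) hj))))
          where
          K : ℕ
          K = j ℕ.+ M

  opaque
    unfolding arith ∣_∣
    converges : ∀ {Πs : ℕ → Perm} {π} → (∀ i → Near (rec i) (Πs i) π) → ConvergesTo (λ i → density π (Πs i)) (inv! (order π))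
    -- `Near` is a weak inequality and convergence a strict one, hence half of `ε`.
    converges {Πs} {π} h ε 0<ε = go (small (0<* (D.positive⁻¹ ½) 0<ε))
      where
      lem : ∀ e → e ≡ ½ * e + ½ * e
      lem = solve-∀ R
      go : (∃ λ N → rec N ≤ ½ * ε) → ∃ λ N → ∀ i → N ℕ.≤ i → D.∣ density π (Πs i) D.- inv! (order π) ∣ < ε
      go (N , hN) = N , λ i l → subst (λ z → ∣ density π (Πs i) - z ∣ < ε) (sym (inv!≡p (order π))) (≤-<-trans (≤-trans (isNear (h i)) (≤-trans (rec-mono l) hN)) (lin< (0<* (D.positive⁻¹ ½) 0<ε) (lem ε)))

    near-limit : ∀ {Πs : ℕ → Perm} {π} → ConvergesTo (λ i → density π (Πs i)) (inv! (order π)) → ∀ {ε} → 0ℚ < ε → ∃ λ N → ∀ i → N ℕ.≤ i → Near ε (Πs i) π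
    near-limit {Πs} {π} h {ε} 0<ε = go (h ε 0<ε)
      where
      go : (∃ λ N → ∀ i → N ℕ.≤ i → D.∣ density π (Πs i) D.- inv! (order π) ∣ < ε) → ∃ λ N → ∀ i → N ℕ.≤ i → Near ε (Πs i) π
      go (N , hN) = N , λ i l → near (subst (λ z → ∣ density π (Πs i) - z ∣ ≤ ε) (inv!≡p (order π)) (<⇒≤ (hN i l)))

  -- Forcing would drive the density of the identity of order `K` to `1 / K!`, at most half of
  -- `d ^ K`, whereas along the sequence it stays above `d ^ K` up to a vanishing error.
  no-small-forcing : (L : List Perm) → length L ℕ.≤ 3 → ¬ Forcing (λ π → π ∈ L)
  no-small-forcing L l forcing = reduce (three-patterns L l)
    where
    reduce : (∃ λ (q : Fin 3 → Pattern) → (∀ {i j} → i ≢ j → Pattern.code (q i) ≢ Pattern.code (q j)) ×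
      (∀ {π} → π ∈ L → ∀ Π {ε} → 0ℚ ≤ ε → 2 ℕ.≤ order Π → (∀ i → Near ε Π (Pattern.toPerm (q i))) → Near ε Π π)) → ⊥
    reduce (q , distinct , covered) = contradict (approximable q distinct)
      where
      contradict : Approximable q → ⊥
      contradict (d , 0<d , approx) = at-K (factorial-small 0<d)
        where
        at-K : (∃ λ K → p K 1ℚ ≤ ½ * pow d K) → ⊥
        at-K (K , hK) = at-N (near-limit {Πs} {idPerm K} (forcing Πs (λ π m → converges {Πs} {π} (λ i → covered m (Πs i) (0≤rec i) (proj₁ (proj₂ (seq i))) (λ j → near (proj₁ (proj₂ (proj₂ (seq i))) j))) ) (idPerm K)) (0<* 0<½ 0<pK))
          where
          pK : ℚ
          pK = p K 1ℚ
          0<pK : 0ℚ < pK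
          0<pK = 0<p K 0<1
          0<½ : 0ℚ < ½
          0<½ = D.positive⁻¹ ½
          seq : ∀ i → _
          seq i = approx K (0<rec i)
          Πs : ℕ → Perm
          Πs i = proj₁ (seq i)
          opaque
            unfolding arith
            -- Here `q` is `1 / K!`, `d` the power `d ^ K`, `x` the density and `r` the error. The
            -- estimates `x ≤ 3 q / 2`, `d q ≤ x q + r`, `r ≤ q² / 4` and `2 q ≤ d` make the four
            -- slacks nonnegative, yet together with the positive `q² / 4` they add up to 0.
            final : ∀ q x d r → ½ * (½ * (q * q)) + ((½ * q - (x - q)) * q + (x * q + r - d * q) + ((½ * (½ * (q * q))) - r) + (½ * d - q) * (q + q)) ≡ 0ℚ
            final = solve-∀ R
          at-N : (∃ λ N → ∀ i → N ℕ.≤ i → Near (½ * pK) (Πs i) (idPerm K)) → ⊥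
          at-N (N , hN) = at-M (small (0<* 0<½ (0<* 0<½ (0<* 0<pK 0<pK))))
            where
            at-M : (∃ λ M → rec M ≤ ½ * (½ * (pK * pK))) → ⊥
            at-M (M , hM) = <-irrefl refl (subst (0ℚ <_) (final pK x (pow d K) (rec i))
              (0<+ (0<* 0<½ (0<* 0<½ (0<* 0<pK 0<pK)))
                (gap (proj₁ (∣∣-elim (isNear (hN i (ℕ.m≤m+n N M))))) ⊛ <⇒≤ 0<pK ⊹ gap (proj₂ (proj₂ (proj₂ (seq i)))) ⊹ gap (≤-trans (rec-mono (ℕ.m≤n+m M N)) hM) ⊹ gap hK ⊛ (<⇒≤ 0<pK ⊹ <⇒≤ 0<pK))))
              where
              i : ℕ
              i = N ℕ.+ M
              x : ℚ
              x = density (idPerm K) (Πs i)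

open import Defs
open import Data.Nat using (_≤_)
open import Data.List using (List; length)
open import Data.List.Membership.Propositional using (_∈_)
open import Relation.Nullary using (¬_)

theorem1 : (L : List Perm) → length L ≤ 3 → ¬ Forcing (λ π → π ∈ L)
theorem1 = Reduction.no-small-forcing
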